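{- Let $n\in\mathbb{N}$. Then \begin{align*} N(1,1,1,5;n)= &\sigma_{\chi_0,\chi_1}(n) -2\sigma_{\chi_0,\chi_1}(n/2) -4 \sigma_{\chi_0,\chi_1}(n/4) + 5\sigma_{\chi_1,\chi_0}(n)+10\sigma_{\chi_1,\chi_0}(n/2)- 20\sigma_{\chi_1,\chi_0}(n/4),\\ N(1,1,2,10;n) = & -\tfrac{1}{2}\sigma_{\chi_0,\chi_1}(n) +\tfrac{1}{2} \sigma_{\chi_0,\chi_1}(n/2) - \sigma_{\chi_0,\chi_1}(n/4) -4 \sigma_{\chi_0,\chi_1}(n/8) +\tfrac{5}{2}\sigma_{\chi_1,\chi_0}(n)+\tfrac{5}{2}\sigma_{\chi_1,\chi_0}(n/2)+ 5\sigma_{\chi_1,\chi_0}(n/4)\\ &-20\sigma_{\chi_1,\chi_0}(n/8) + 2b_2(n),\\ N(1,2,2,5;n)= &\tfrac{1}{2}\sigma_{\chi_0,\chi_1}(n) -\tfrac{1}{2} \sigma_{\chi_0,\chi_1}(n/2) - \sigma_{\chi_0,\chi_1}(n/4) -4 \sigma_{\chi_0,\chi_1}(n/8) +\tfrac{5}{2}\sigma_{\chi_1,\chi_0}(n)+\tfrac{5}{2}\sigma_{\chi_1,\chi_0}(n/2)- 5\sigma_{\chi_1,\chi_0}(n/4)\\ &+20\sigma_{\chi_1,\chi_0}(n/8) +5 b_1(n) - b_2(n),\\ N(1,5,5,5;n)= &\sigma_{\chi_0,\chi_1}(n) -2\sigma_{\chi_0,\chi_1}(n/2) -4 \sigma_{\chi_0,\chi_1}(n/4)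 + \sigma_{\chi_1,\chi_0}(n)+2\sigma_{\chi_1,\chi_0}(n/2)- 4\sigma_{\chi_1,\chi_0}(n/4),\\ N(1,5,10,10;n)= &\tfrac{1}{2}\sigma_{\chi_0,\chi_1}(n) -\tfrac{1}{2} \sigma_{\chi_0,\chi_1}(n/2) - \sigma_{\chi_0,\chi_1}(n/4) -4\sigma_{\chi_0,\chi_1}(n/8) +\tfrac{1}{2}\sigma_{\chi_1,\chi_0}(n)+\tfrac{1}{2}\sigma_{\chi_1,\chi_0}(n/2)- \sigma_{\chi_1,\chi_0}(n/4)\\ &+4\sigma_{\chi_1,\chi_0}(n/8) - b_1(n) +b_2(n),\\ N(2,5,5,10;n)=&-\tfrac{1}{2}\sigma_{\chi_0,\chi_1}(n) +\tfrac{1}{2} \sigma_{\chi_0,\chi_1}(n/2) - \sigma_{\chi_0,\chi_1}(n/4) -4\sigma_{\chi_0,\chi_1}(n/8) +\tfrac{1}{2}\sigma_{\chi_1,\chi_0}(n)+\tfrac{1}{2}\sigma_{\chi_1,\chi_0}(n/2)+ \sigma_{\chi_1,\chi_0}(n/4)\\ & -4\sigma_{\chi_1,\chi_0}(n/8) -2 b_1(n). \end{align*}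
   Context: For $a_1,a_2,a_3,a_4\in\mathbb{N}$ and $n\in\mathbb{N}_0$, $N(a_1,a_2,a_3,a_4;n)$ denotes the number of $(x_1,x_2,x_3,x_4)\in\mathbb{Z}^4$ with $n=a_1x_1^2+a_2x_2^2+a_3x_3^2+a_4x_4^2$. Let $\chi_0$ be the trivial character ($\chi_0(m)=1$ for all $m\in\mathbb{Z}$) and $\chi_1(m)=\left(\frac{5}{m}\right)$ (Kronecker symbol). For Dirichlet characters $\chi,\psi$ and $x\in\mathbb{N}$, $\sigma_{\chi,\psi}(x)=\sum_{m\mid x}\psi(m)\chi(x/m)\,m$ (sum over positive divisors $m$); if $x\notin\mathbb{N}$, $\sigma_{\chi,\psi}(x)=0$. Let $q=e^{2\pi i z}$ with $\mathrm{Im}(z)>0$ and $\eta(z)=q^{1/24}\prod_{m\ge1}(1-q^m)$. The integers $b_k(n)$ are defined by $\sum_{n\ge1}b_1(n)q^n=\dfrac{\eta(2z)\eta^4(20z)}{\eta(10z)}$ and $\sum_{n\ge1}b_2(n)q^n=\dfrac{\eta^4(4z)\eta(10z)}{\eta(2z)}$. -}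

module Defs where

open import Data.Nat as ℕ using (ℕ; zero; suc; NonZero)
open import Data.Nat.DivMod using (_/_; _%_)
open import Data.Nat.Divisibility using (_∣?_)
open import Data.Integer as ℤ using (ℤ; +_; -[1+_])
open import Data.List using (List; []; _∷_; map; upTo; concatMap; foldr)
open import Data.Bool using (Bool; true; false; if_then_else_)
open import Relation.Nullary.Decidable using (⌊_⌋)
open import Data.Rational as ℚ using (ℚ)

sumℤ : List ℤ → ℤ
sumℤ = foldr ℤ._+_ (+ 0)

-- N(a₁,a₂,a₃,a₄;n): number of (x₁,x₂,x₃,x₄) ∈ ℤ⁴ with
-- n = a₁x₁² + a₂x₂² + a₃x₃² + a₄x₄².
-- Since every aᵢ ≥ 1, any solution has |xᵢ| ≤ n, so the count is
-- taken over the box [-n, n]⁴ (this is the full set of solutions).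

box : ℕ → List ℤ
box n = map (λ i → + i ℤ.- + n) (upTo (suc (n ℕ.+ n)))

isSol : ℕ → ℕ → ℕ → ℕ → ℕ → ℤ → ℤ → ℤ → ℤ → ℕ
isSol a₁ a₂ a₃ a₄ n x₁ x₂ x₃ x₄ =
  if ⌊ (+ a₁ ℤ.* (x₁ ℤ.* x₁) ℤ.+ + a₂ ℤ.* (x₂ ℤ.* x₂)
        ℤ.+ + a₃ ℤ.* (x₃ ℤ.* x₃) ℤ.+ + a₄ ℤ.* (x₄ ℤ.* x₄)) ℤ.≟ + n ⌋
  then 1 else 0

sumℕ : List ℕ → ℕ
sumℕ = foldr ℕ._+_ 0

N : ℕ → ℕ → ℕ → ℕ → ℕ → ℕ
N a₁ a₂ a₃ a₄ n =
  sumℕ (map (λ x₁ → sumℕ (map (λ x₂ → sumℕ (map (λ x₃ → sumℕ (map (λ x₄ →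
    isSol a₁ a₂ a₃ a₄ n x₁ x₂ x₃ x₄) (box n))) (box n))) (box n))) (box n))

χ₀ : ℕ → ℤ
χ₀ _ = + 1

-- χ₁(m) = (5/m), the Kronecker symbol.  Since 5 ≡ 1 (mod 4) (and
-- (5/2) = -1 = (2/5)), for m ≥ 0 this equals the Legendre symbol (m/5),
-- determined by m mod 5: 0 ↦ 0, 1 ↦ 1, 2 ↦ -1, 3 ↦ -1, 4 ↦ 1.
χ₁ : ℕ → ℤ
χ₁ m with m % 5
... | 0 = + 0
... | 1 = + 1
... | 4 = + 1
... | _ = -[1+ 0 ]

σ : (ℕ → ℤ) → (ℕ → ℤ) → ℕ → ℤ
σ χ ψ x = sumℤ (map term (upTo x))
  where
    term : ℕ → ℤ
    term k = if ⌊ suc k ∣? x ⌋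
             then ψ (suc k) ℤ.* χ (x / suc k) ℤ.* + (suc k)
             else + 0

σ/ : (ℕ → ℤ) → (ℕ → ℤ) → ℕ → (d : ℕ) → .{{NonZero d}} → ℤ
σ/ χ ψ n d = if ⌊ d ∣? n ⌋ then σ χ ψ (n / d) else + 0

-- Formal power series in q with integer coefficients:
-- a series is its coefficient function k ↦ [q^k].

Series : Set
Series = ℕ → ℤ

oneS : Series
oneS zero    = + 1
oneS (suc _) = + 0

_⊛_ : Series → Series → Series
(f ⊛ g) k = sumℤ (map (λ i → f i ℤ.* g (k ℕ.∸ i)) (upTo (suc k)))

infixl 7 _⊛_

1-q^ : (a : ℕ) → .{{NonZero a}} → Series
1-q^ a zero = + 1
1-q^ a (suc k) = if ⌊ suc k ℕ.≟ a ⌋ then -[1+ 0 ] else + 0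

1/1-q^ : (a : ℕ) → .{{NonZero a}} → Series
1/1-q^ a k = if ⌊ a ∣? k ⌋ then + 1 else + 0

_^S_ : Series → ℕ → Series
f ^S zero  = oneS
f ^S suc e = f ⊛ (f ^S e)

prodS : (ℕ → Series) → ℕ → Series
prodS F zero    = oneS
prodS F (suc M) = F (suc M) ⊛ prodS F M

-- Factors F(m) of the infinite products (m ≥ 1); each is 1 + O(q^m),
-- so the coefficient of q^k in ∏_{m ≥ 1} F(m) equals that in
-- ∏_{m=1}^{M} F(m) for any M ≥ k.

-- η(2z)η⁴(20z)/η(10z) = q³ ∏_{m≥1} (1-q^{2m})(1-q^{20m})⁴/(1-q^{10m})
F₁ : ℕ → Series
F₁ zero = oneS
F₁ (suc j) = 1-q^ (2 ℕ.* suc j) ⊛ (1-q^ (20 ℕ.* suc j) ^S 4) ⊛ 1/1-q^ (10 ℕ.* suc j)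

-- η⁴(4z)η(10z)/η(2z) = q ∏_{m≥1} (1-q^{4m})⁴(1-q^{10m})/(1-q^{2m})
F₂ : ℕ → Series
F₂ zero = oneS
F₂ (suc j) = (1-q^ (4 ℕ.* suc j) ^S 4) ⊛ 1-q^ (10 ℕ.* suc j) ⊛ 1/1-q^ (2 ℕ.* suc j)

-- b₁(n) = [q^n] q³ ∏ F₁(m) ;  b₂(n) = [q^n] q ∏ F₂(m)
b₁ : ℕ → ℤ
b₁ n = if ⌊ 3 ℕ.≤? n ⌋ then prodS F₁ n (n ℕ.∸ 3) else + 0

b₂ : ℕ → ℤ
b₂ n = if ⌊ 1 ℕ.≤? n ⌋ then prodS F₂ n (n ℕ.∸ 1) else + 0

⟦_⟧ : ℤ → ℚ
⟦ z ⟧ = z ℚ./ 1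

⟦_⟧ₙ : ℕ → ℚ
⟦ n ⟧ₙ = ⟦ + n ⟧

{-# OPTIONS --safe #-}
module Submission where

-- Write φ for the theta series of x², Ψ = 2ψ for that of x(x+1)/2, and e_k = ∏ (1 - q^(k m)).  The Jacobi
-- triple product expresses φ, Ψ and their dilations as eta quotients.  Splitting ℤ² = ℤ[i] into cosets of
-- (2 + i) gives φ(q)² - φ(q⁵)² = 4q f(q³,q⁷) f(q,q⁹) and Ψ(q)² - q Ψ(q⁵)² = 4 f(q,q⁴) f(q²,q³).
--
-- Let E and F be the generating series of σ_{χ₀,χ₁} and σ_{χ₁,χ₀}.  The difference of the second logarithmic
-- derivatives of the triple products for f(q,q⁴) and f(q²,q³) is the Lambert series F(q) - 4F(q²); computing it
-- instead on the lattice x ≡ y (mod 2) gives F(q) - 4F(q²) = q e₁³ e₅ e₁₀² / e₂², that is, after q ↦ -q, a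
-- formula for φ(q) φ(q⁵) (φ(q)² - φ(q⁵)²) in terms of F.  The companion formula for
-- φ(q) φ(q⁵) (5φ(q⁵)² - φ(q)²) in terms of E follows from it: in the 5-dissection of the two theta products,
-- the twist by χ₁ exchanges them away from the multiples of 5, and at the multiples of 5 the second one
-- reproduces itself.  The first and fourth identities are linear combinations of these two formulas.
--
-- For the remaining four, the theta series G of 2x² + 2xy + 3y² satisfies analogous formulas with
-- φ(q) φ(q⁵) replaced by G; their odd parts, together with eta quotient identities which reduce to the
-- relations above, isolate b₁ and b₂.

-- No convergence, modularity or dimension count enters: all series are formal with integer
-- coefficients, an infinite product is read coefficientwise from its finite truncations, and an eta
-- quotient is cancelled as a unit. Three choices shape the proof. The ring has the single variable
-- q, so the auxiliary variable u of the triple product cannot be differentiated; u^j is replaced by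
-- an arbitrary weight w(j), and the weights 1, (-1)^j, j, j² and (-1)^j j give the product at u = 1
-- and u = -1 together with its derivatives there. `Ψ` is summed over all of ℤ, hence twice
-- Ramanujan's ψ, so that bijections of lattices apply without boundary terms. Finally, once a few
-- lattice identities are known, everything else is polynomial algebra: each further identity is an
-- explicit combination of known ones, checked by the ring solver, and eta quotients are compared
-- through their exponent vectors.

open import Defs
open import Data.Bool using (if_then_else_)
open import Data.Fin using (Fin; toℕ; fromℕ<)
open import Data.Fin.Patterns using (0F; 1F)
open import Data.Integer as ℤ using (ℤ; +_; -[1+_])
import Data.Integer.Properties as ℤₚ
open import Data.Integer.Solver using (module +-*-Solver)
open import Data.List using (List; []; _∷_; allFin)
open import Data.Nat as ℕ using (ℕ; zero; suc; z≤n; s≤s; NonZero)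
open import Data.Nat.DivMod using (m*n/n≡m; _%_; m%n<n)
open import Data.Nat.Divisibility using (_∣_; _∣?_; divides; ∣m+n∣m⇒∣n; ∣m∣n⇒∣m+n; ∣-refl; >⇒∤; m%n≡0⇒n∣m; n∣m⇒m%n≡0)
open import Data.Nat.Primality using (euclidsLemma; prime?)
import Data.Nat.Properties as ℕₚ
open import Data.Nat.Solver using () renaming (module +-*-Solver to ℕ-Solver)
open import Data.Product using (_,_; _×_; proj₁; proj₂; ∃)
open import Data.Sum using (inj₁; inj₂)
open import Data.Vec using (Vec; []; _∷_)
open import Function using (_∘_; id)
open import Relation.Binary.PropositionalEquality hiding ([_])
open import Relation.Nullary using (yes; no; ¬_; contradiction)
open import Relation.Nullary.Decidable using (⌊_⌋; from-yes)

-- Formal power series over ℤ: ring structure and solver.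

module SeriesRing where

  import Algebra.Solver.Ring
  open import Data.Integer using (_+_; _*_; -_; _-_)
  open import Data.List using (map; applyUpTo)
  open import Data.Maybe using (Maybe; just; nothing)
  open import Algebra.Bundles using (CommutativeRing)
  open import Algebra.Solver.Ring.AlmostCommutativeRing using (fromCommutativeRing; _-Raw-AlmostCommutative⟶_)
  open import Level using (0ℓ)

  Σ< : ℕ → (ℕ → ℤ) → ℤ
  Σ< zero    f = + 0
  Σ< (suc n) f = f 0 + Σ< n (f ∘ suc)

  sumℤ-applyUpTo : ∀ (f : ℕ → ℤ) (g : ℕ → ℕ) n → sumℤ (map f (applyUpTo g n)) ≡ Σ< n (f ∘ g)
  sumℤ-applyUpTo f g zero    = refl
  sumℤ-applyUpTo f g (suc n) = cong (λ z → f (g 0) + z) (sumℤ-applyUpTo f (g ∘ suc) n)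

  Σ<-cong : ∀ n {f g : ℕ → ℤ} → (∀ i → i ℕ.< n → f i ≡ g i) → Σ< n f ≡ Σ< n g
  Σ<-cong zero    h = refl
  Σ<-cong (suc n) h = cong₂ _+_ (h 0 (s≤s z≤n)) (Σ<-cong n (λ i i<n → h (suc i) (s≤s i<n)))

  interchange : ∀ a b c d → (a + b) + (c + d) ≡ (a + c) + (b + d)
  interchange = solve 4 (λ a b c d → (a :+ b) :+ (c :+ d) := (a :+ c) :+ (b :+ d)) refl
    where open +-*-Solver

  Σ<-+ : ∀ n (f g : ℕ → ℤ) → Σ< n (λ i → f i + g i) ≡ Σ< n f + Σ< n g
  Σ<-+ zero    f g = refl
  Σ<-+ (suc n) f g = trans (cong (λ z → f 0 + g 0 + z) (Σ<-+ n (f ∘ suc) (g ∘ suc))) (interchange (f 0) (g 0) _ _)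

  Σ<-0 : ∀ n {f : ℕ → ℤ} → (∀ i → i ℕ.< n → f i ≡ + 0) → Σ< n f ≡ + 0
  Σ<-0 zero    h = refl
  Σ<-0 (suc n) h = cong₂ _+_ (h 0 (s≤s z≤n)) (Σ<-0 n (λ i i<n → h (suc i) (s≤s i<n)))

  Σ<-*ˡ : ∀ n c (f : ℕ → ℤ) → Σ< n (λ i → c * f i) ≡ c * Σ< n f
  Σ<-*ˡ zero    c f = sym (ℤₚ.*-zeroʳ c)
  Σ<-*ˡ (suc n) c f = trans (cong (λ z → c * f 0 + z) (Σ<-*ˡ n c (f ∘ suc))) (sym (ℤₚ.*-distribˡ-+ c (f 0) _))

  Σ<-last : ∀ n (f : ℕ → ℤ) → Σ< (suc n) f ≡ Σ< n f + f n
  Σ<-last zero    f = trans (ℤₚ.+-identityʳ (f 0)) (sym (ℤₚ.+-identityˡ (f 0)))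
  Σ<-last (suc n) f = trans (cong (λ z → f 0 + z) (Σ<-last n (f ∘ suc))) (sym (ℤₚ.+-assoc (f 0) _ _))

  Σ<-extend : ∀ m n {f : ℕ → ℤ} → m ℕ.≤ n → (∀ i → m ℕ.≤ i → f i ≡ + 0) → Σ< n f ≡ Σ< m f
  Σ<-extend zero    n       _         h = Σ<-0 n (λ i _ → h i z≤n)
  Σ<-extend (suc m) (suc n) {f} (s≤s m≤n) h = cong (λ z → f 0 + z) (Σ<-extend m n m≤n (λ i m≤i → h (suc i) (s≤s m≤i)))

  Σ<-swap : ∀ m n (f : ℕ → ℕ → ℤ) → Σ< m (λ i → Σ< n (f i)) ≡ Σ< n (λ j → Σ< m (λ i → f i j))
  Σ<-swap zero    n f = sym (Σ<-0 n (λ _ _ → refl))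
  Σ<-swap (suc m) n f = trans (cong (λ z → Σ< n (f 0) + z) (Σ<-swap m n (f ∘ suc))) (sym (Σ<-+ n (f 0) _))

  ⊛-sum : ∀ f g k → (f ⊛ g) k ≡ Σ< (suc k) (λ i → f i * g (k ℕ.∸ i))
  ⊛-sum f g k = sumℤ-applyUpTo (λ i → f i * g (k ℕ.∸ i)) id (suc k)

  ⊛-zero : ∀ f g → (f ⊛ g) 0 ≡ f 0 * g 0
  ⊛-zero f g = ℤₚ.+-identityʳ (f 0 * g 0)

  ⊛-suc : ∀ f g k → (f ⊛ g) (suc k) ≡ f 0 * g (suc k) + ((f ∘ suc) ⊛ g) k
  ⊛-suc f g k = trans (⊛-sum f g (suc k)) (cong (λ z → f 0 * g (suc k) + z) (sym (⊛-sum (f ∘ suc) g k)))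

  ⊛-cong-at : ∀ k {f f′ g g′ : Series} → (∀ i → i ℕ.≤ k → f i ≡ f′ i) → (∀ i → i ℕ.≤ k → g i ≡ g′ i) →
              (f ⊛ g) k ≡ (f′ ⊛ g′) k
  ⊛-cong-at k {f} {f′} {g} {g′} p r =
    trans (⊛-sum f g k) (trans
      (Σ<-cong (suc k) (λ { i (s≤s i≤k) → cong₂ _*_ (p i i≤k) (r (k ℕ.∸ i) (ℕₚ.m∸n≤m k i)) }))
      (sym (⊛-sum f′ g′ k)))

  ⊛-distribʳ-at : ∀ k (f g h : Series) → ((λ i → f i + g i) ⊛ h) k ≡ (f ⊛ h) k + (g ⊛ h) k
  ⊛-distribʳ-at k f g h = begin
    ((λ i → f i + g i) ⊛ h) k                              ≡⟨ ⊛-sum (λ i → f i + g i) h k ⟩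
    Σ< (suc k) (λ i → (f i + g i) * h (k ℕ.∸ i))           ≡⟨ Σ<-cong (suc k) (λ i _ → ℤₚ.*-distribʳ-+ (h (k ℕ.∸ i)) (f i) (g i)) ⟩
    Σ< (suc k) (λ i → f i * h (k ℕ.∸ i) + g i * h (k ℕ.∸ i)) ≡⟨ Σ<-+ (suc k) (λ i → f i * h (k ℕ.∸ i)) (λ i → g i * h (k ℕ.∸ i)) ⟩
    Σ< (suc k) (λ i → f i * h (k ℕ.∸ i)) + Σ< (suc k) (λ i → g i * h (k ℕ.∸ i))
      ≡⟨ cong₂ _+_ (⊛-sum f h k) (⊛-sum g h k) ⟨
    (f ⊛ h) k + (g ⊛ h) k                                  ∎
    where open ≡-Reasoning

  ⊛-scaleˡ-at : ∀ k c f g → ((λ i → c * f i) ⊛ g) k ≡ c * (f ⊛ g) k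
  ⊛-scaleˡ-at k c f g = begin
    ((λ i → c * f i) ⊛ g) k                       ≡⟨ ⊛-sum (λ i → c * f i) g k ⟩
    Σ< (suc k) (λ i → c * f i * g (k ℕ.∸ i))      ≡⟨ Σ<-cong (suc k) (λ i _ → ℤₚ.*-assoc c (f i) (g (k ℕ.∸ i))) ⟩
    Σ< (suc k) (λ i → c * (f i * g (k ℕ.∸ i)))    ≡⟨ Σ<-*ˡ (suc k) c (λ i → f i * g (k ℕ.∸ i)) ⟩
    c * Σ< (suc k) (λ i → f i * g (k ℕ.∸ i))      ≡⟨ cong (c *_) (⊛-sum f g k) ⟨
    c * (f ⊛ g) k                                 ∎
    where open ≡-Reasoning

  ⊛-sucʳ : ∀ f g k → (f ⊛ g) (suc k) ≡ (f ⊛ (g ∘ suc)) k + f (suc k) * g 0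
  ⊛-sucʳ f g zero    = trans (⊛-suc f g 0) (cong₂ _+_ (sym (⊛-zero f (g ∘ suc))) (⊛-zero (f ∘ suc) g))
  ⊛-sucʳ f g (suc k) = begin
    (f ⊛ g) (suc (suc k))                                                         ≡⟨ ⊛-suc f g (suc k) ⟩
    f 0 * g (suc (suc k)) + ((f ∘ suc) ⊛ g) (suc k)
        ≡⟨ cong (λ z → f 0 * g (suc (suc k)) + z) (⊛-sucʳ (f ∘ suc) g k) ⟩
    f 0 * g (suc (suc k)) + (((f ∘ suc) ⊛ (g ∘ suc)) k + f (suc (suc k)) * g 0)   ≡⟨ ℤₚ.+-assoc (f 0 * g (suc (suc k))) _ _ ⟨
    f 0 * g (suc (suc k)) + ((f ∘ suc) ⊛ (g ∘ suc)) k + f (suc (suc k)) * g 0     ≡⟨ cong (_+ f (suc (suc k)) * g 0) (⊛-suc f (g ∘ suc) k) ⟨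
    (f ⊛ (g ∘ suc)) (suc k) + f (suc (suc k)) * g 0                               ∎
    where open ≡-Reasoning

  -- Peeling `f ⊛ g` on the left and `g ⊛ f` on the right removes the same term, so induction on the
  -- coefficient works without reversing a sum.
  ⊛-comm-at : ∀ k f g → (f ⊛ g) k ≡ (g ⊛ f) k
  ⊛-comm-at zero    f g = trans (⊛-zero f g) (trans (ℤₚ.*-comm (f 0) (g 0)) (sym (⊛-zero g f)))
  ⊛-comm-at (suc k) f g = begin
    (f ⊛ g) (suc k)                          ≡⟨ ⊛-suc f g k ⟩
    f 0 * g (suc k) + ((f ∘ suc) ⊛ g) k      ≡⟨ cong₂ _+_ (ℤₚ.*-comm (f 0) (g (suc k))) (⊛-comm-at k (f ∘ suc) g) ⟩
    g (suc k) * f 0 + (g ⊛ (f ∘ suc)) k      ≡⟨ ℤₚ.+-comm (g (suc k) * f 0) _ ⟩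
    (g ⊛ (f ∘ suc)) k + g (suc k) * f 0      ≡⟨ ⊛-sucʳ g f k ⟨
    (g ⊛ f) (suc k)                          ∎
    where open ≡-Reasoning

  -- The tail of `f ⊛ g` is a multiple of the tail of `g` plus the tail of `f` times `g`. With `f`
  -- and `g` generalized, this gives an induction on the coefficient in place of an interchange of
  -- double sums.
  ⊛-assoc-at : ∀ k f g h → ((f ⊛ g) ⊛ h) k ≡ (f ⊛ (g ⊛ h)) k
  ⊛-assoc-at zero f g h = begin
    ((f ⊛ g) ⊛ h) 0      ≡⟨ trans (⊛-zero (f ⊛ g) h) (cong (_* h 0) (⊛-zero f g)) ⟩
    f 0 * g 0 * h 0      ≡⟨ ℤₚ.*-assoc (f 0) (g 0) (h 0) ⟩
    f 0 * (g 0 * h 0)    ≡⟨ trans (⊛-zero f (g ⊛ h)) (cong (f 0 *_) (⊛-zero g h)) ⟨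
    (f ⊛ (g ⊛ h)) 0      ∎
    where open ≡-Reasoning
  ⊛-assoc-at (suc k) f g h = begin
    ((f ⊛ g) ⊛ h) (suc k)
      ≡⟨ ⊛-suc (f ⊛ g) h k ⟩
    (f ⊛ g) 0 * h (suc k) + (((f ⊛ g) ∘ suc) ⊛ h) k
      ≡⟨ cong₂ _+_ (cong (_* h (suc k)) (⊛-zero f g)) (⊛-cong-at k {g = h} (λ i _ → ⊛-suc f g i) (λ _ _ → refl)) ⟩
    f 0 * g 0 * h (suc k) + ((λ i → f 0 * g (suc i) + ((f ∘ suc) ⊛ g) i) ⊛ h) k
      ≡⟨ cong (λ z → f 0 * g 0 * h (suc k) + z) (⊛-distribʳ-at k (λ i → f 0 * g (suc i)) ((f ∘ suc) ⊛ g) h) ⟩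
    f 0 * g 0 * h (suc k) + (((λ i → f 0 * g (suc i)) ⊛ h) k + (((f ∘ suc) ⊛ g) ⊛ h) k)
      ≡⟨ cong₂ (λ y z → f 0 * g 0 * h (suc k) + (y + z)) (⊛-scaleˡ-at k (f 0) (g ∘ suc) h) (⊛-assoc-at k (f ∘ suc) g h) ⟩
    f 0 * g 0 * h (suc k) + (f 0 * ((g ∘ suc) ⊛ h) k + ((f ∘ suc) ⊛ (g ⊛ h)) k)
      ≡⟨ regroup (f 0) (g 0) (h (suc k)) _ _ ⟩
    f 0 * (g 0 * h (suc k) + ((g ∘ suc) ⊛ h) k) + ((f ∘ suc) ⊛ (g ⊛ h)) k
      ≡⟨ cong (λ z → f 0 * z + ((f ∘ suc) ⊛ (g ⊛ h)) k) (⊛-suc g h k) ⟨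
    f 0 * (g ⊛ h) (suc k) + ((f ∘ suc) ⊛ (g ⊛ h)) k
      ≡⟨ ⊛-suc f (g ⊛ h) k ⟨
    (f ⊛ (g ⊛ h)) (suc k) ∎
    where
      open ≡-Reasoning
      regroup : ∀ a b c x y → a * b * c + (a * x + y) ≡ a * (b * c + x) + y
      regroup = solve 5 (λ a b c x y → a :* b :* c :+ (a :* x :+ y) := a :* (b :* c :+ x) :+ y) refl
        where open +-*-Solver

  ⊛-zeroˡ-at : ∀ k {f} g → (∀ i → i ℕ.≤ k → f i ≡ + 0) → (f ⊛ g) k ≡ + 0
  ⊛-zeroˡ-at k {f} g h = trans (⊛-sum f g k)
    (Σ<-0 (suc k) (λ { i (s≤s i≤k) → trans (cong (_* g (k ℕ.∸ i)) (h i i≤k)) (ℤₚ.*-zeroˡ (g (k ℕ.∸ i))) }))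

  -- A wrapper without η: unification then never unfolds the ring operations.
  record PS : Set where
    no-eta-equality
    constructor ⟪_⟫
    field coe : ℕ → ℤ

  infixl 9 _!_
  _!_ : PS → ℕ → ℤ
  f ! k = PS.coe f k

  infix 4 _≈_
  -- A record rather than a function type, so that both series can be recovered by unification from
  -- the type of a proof.
  record _≈_ (f g : PS) : Set where
    constructor pointwise
    field at : ∀ k → f ! k ≡ g ! k
  open _≈_ public

  infixl 6 _⊕_ _⊖_
  infixl 7 _·_
  infix  8 ~_

  _⊕_ : PS → PS → PS
  PS.coe (f ⊕ g) k = f ! k + g ! k

  ~_ : PS → PS
  PS.coe (~ f) k = - f ! k

  _⊖_ : PS → PS → PS
  f ⊖ g = f ⊕ (~ g)

  _·_ : PS → PS → PS
  PS.coe (f · g) = PS.coe f ⊛ PS.coe g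

  0ₛ : PS
  PS.coe 0ₛ _ = + 0

  1ₛ : PS
  PS.coe 1ₛ = oneS

  -- The image of ℤ in the ring, through which the solver reads numerals. `κ (+ 1)` and `1ₛ` agree
  -- only coefficient by coefficient, so `1ₛ` is an atom for the solver and is converted by hand
  -- where its value matters.
  κ : ℤ → PS
  PS.coe (κ c) zero    = c
  PS.coe (κ c) (suc _) = + 0

  tl : PS → PS
  PS.coe (tl f) k = f ! suc k

  ·-zero : ∀ f g → (f · g) ! 0 ≡ f ! 0 * g ! 0
  ·-zero f g = ⊛-zero (PS.coe f) (PS.coe g)

  ·-suc : ∀ f g k → (f · g) ! suc k ≡ f ! 0 * g ! suc k + (tl f · g) ! k
  ·-suc f g k = ⊛-suc (PS.coe f) (PS.coe g) k

  κ-·-at : ∀ c f k → (κ c · f) ! k ≡ c * f ! k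
  κ-·-at c f zero    = ·-zero (κ c) f
  κ-·-at c f (suc k) = trans (·-suc (κ c) f k)
    (trans (cong (λ z → c * f ! suc k + z) (⊛-zeroˡ-at k (PS.coe f) (λ _ _ → refl))) (ℤₚ.+-identityʳ _))

  oneS≗κ : ∀ k → oneS k ≡ κ (+ 1) ! k
  oneS≗κ zero    = refl
  oneS≗κ (suc _) = refl

  ≈-refl : ∀ {f} → f ≈ f
  ≈-refl = pointwise (λ _ → refl)

  ≈-sym : ∀ {f g} → f ≈ g → g ≈ f
  ≈-sym p = pointwise (λ k → sym (at p k))

  ≈-trans : ∀ {f g h} → f ≈ g → g ≈ h → f ≈ h
  ≈-trans p r = pointwise (λ k → trans (at p k) (at r k))

  ⊕-cong : ∀ {f f′ g g′} → f ≈ f′ → g ≈ g′ → f ⊕ g ≈ f′ ⊕ g′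
  ⊕-cong p r = pointwise (λ k → cong₂ _+_ (at p k) (at r k))

  ·-cong : ∀ {f f′ g g′} → f ≈ f′ → g ≈ g′ → f · g ≈ f′ · g′
  ·-cong p r = pointwise (λ k → ⊛-cong-at k (λ i _ → at p i) (λ i _ → at r i))

  ~-cong : ∀ {f g} → f ≈ g → ~ f ≈ ~ g
  ~-cong p = pointwise (λ k → cong -_ (at p k))

  ⊖-cong : ∀ {f f′ g g′} → f ≈ f′ → g ≈ g′ → f ⊖ g ≈ f′ ⊖ g′
  ⊖-cong p r = ⊕-cong p (~-cong r)

  ·-comm : ∀ f g → f · g ≈ g · f
  ·-comm f g = pointwise (λ k → ⊛-comm-at k (PS.coe f) (PS.coe g))

  ·-identityˡ : ∀ f → 1ₛ · f ≈ f
  ·-identityˡ f = pointwise (λ k → trans (⊛-cong-at k {g = PS.coe f} (λ i _ → oneS≗κ i) (λ _ _ → refl))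
    (trans (κ-·-at (+ 1) f k) (ℤₚ.*-identityˡ (f ! k))))

  ·-distribʳ : ∀ h f g → (f ⊕ g) · h ≈ f · h ⊕ g · h
  ·-distribʳ h f g = pointwise (λ k → ⊛-distribʳ-at k (PS.coe f) (PS.coe g) (PS.coe h))

  seriesRing : CommutativeRing 0ℓ 0ℓ
  seriesRing = record
    { Carrier = PS ; _≈_ = _≈_ ; _+_ = _⊕_ ; _*_ = _·_ ; -_ = ~_ ; 0# = 0ₛ ; 1# = 1ₛ
    ; isCommutativeRing = record
      { isRing = record
        { +-isAbelianGroup = record
          { isGroup = record
            { isMonoid = record
              { isSemigroup = record
                { isMagma = record
                  { isEquivalence = record { refl = ≈-refl ; sym = ≈-sym ; trans = ≈-trans }
                  ; ∙-cong = ⊕-cong }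
                ; assoc = λ f g h → pointwise (λ k → ℤₚ.+-assoc (f ! k) (g ! k) (h ! k)) }
              ; identity = (λ f → pointwise (λ k → ℤₚ.+-identityˡ (f ! k))) , (λ f → pointwise (λ k → ℤₚ.+-identityʳ (f ! k))) }
            ; inverse = (λ f → pointwise (λ k → ℤₚ.+-inverseˡ (f ! k))) , (λ f → pointwise (λ k → ℤₚ.+-inverseʳ (f ! k)))
            ; ⁻¹-cong = ~-cong }
          ; comm = λ f g → pointwise (λ k → ℤₚ.+-comm (f ! k) (g ! k)) }
        ; *-cong = ·-cong
        ; *-assoc = λ f g h → pointwise (λ k → ⊛-assoc-at k (PS.coe f) (PS.coe g) (PS.coe h))
        ; *-identity = ·-identityˡ , (λ f → ≈-trans (·-comm f 1ₛ) (·-identityˡ f))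
        ; distrib = (λ h f g → ≈-trans (·-comm h (f ⊕ g)) (≈-trans (·-distribʳ h f g) (⊕-cong (·-comm f h) (·-comm g h)))) , ·-distribʳ }
      ; *-comm = ·-comm } }

  κ-dec : ∀ a b → Maybe (κ a ≈ κ b)
  κ-dec a b with a ℤ.≟ b
  ... | yes refl = just ≈-refl
  ... | no  _    = nothing

  κκ : ∀ a b → κ (a * b) ≈ κ a · κ b
  κκ a b = pointwise λ { zero → sym (κ-·-at a (κ b) 0) ; (suc k) → sym (trans (κ-·-at a (κ b) (suc k)) (ℤₚ.*-zeroʳ a)) }

  κ-morphism : ℤ.+-*-rawRing -Raw-AlmostCommutative⟶ fromCommutativeRing seriesRing
  κ-morphism = record
    { ⟦_⟧    = κ
    ; +-homo = λ a b → pointwise λ { zero → refl ; (suc k) → refl }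
    ; *-homo = κκ
    ; -‿homo = λ a → pointwise λ { zero → refl ; (suc k) → refl }
    ; 0-homo = pointwise λ { zero → refl ; (suc k) → refl }
    ; 1-homo = pointwise (λ k → sym (oneS≗κ k)) }

  module CR = CommutativeRing seriesRing

  module SeriesSolver = Algebra.Solver.Ring ℤ.+-*-rawRing (fromCommutativeRing seriesRing) κ-morphism κ-dec

open SeriesRing

-- Congruences modulo q^N, monomials, cancellation, and the substitutions q ↦ -q and q ↦ q^k.

module Substitution where

  import Relation.Binary.Reasoning.Setoid as SetoidReasoning
  open import Data.Integer using (_+_; _*_; -_; _-_)
  open import Data.Nat.Divisibility using (n∣m*n; m*n∣⇒m∣; *-cancelˡ-∣)
  open import Data.Nat.DivMod using (_/_; +-distrib-/-∣ˡ; n/n≡1; m/n≤m)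

  module ≈-Reasoning = SetoidReasoning CR.setoid

  infix 4 _≈[_]_
  -- Congruence modulo q^N. It plays the role of a limit: an infinite identity is obtained from its
  -- truncations by `≈[]-all`.
  record _≈[_]_ (f : PS) (N : ℕ) (g : PS) : Set where
    constructor modulo
    field at< : ∀ k → k ℕ.< N → f ! k ≡ g ! k
  open _≈[_]_ public

  ≈⇒≈[] : ∀ {f g} N → f ≈ g → f ≈[ N ] g
  ≈⇒≈[] N p = modulo (λ k _ → at p k)

  ≈[]-all : ∀ {f g} → (∀ N → f ≈[ N ] g) → f ≈ g
  ≈[]-all p = pointwise (λ k → at< (p (suc k)) k ℕₚ.≤-refl)

  ≈[]-refl : ∀ {f N} → f ≈[ N ] f
  ≈[]-refl = modulo (λ _ _ → refl)

  ≈[]-sym : ∀ {f g N} → f ≈[ N ] g → g ≈[ N ] f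
  ≈[]-sym p = modulo (λ k k<N → sym (at< p k k<N))

  ≈[]-trans : ∀ {f g h N} → f ≈[ N ] g → g ≈[ N ] h → f ≈[ N ] h
  ≈[]-trans p r = modulo (λ k k<N → trans (at< p k k<N) (at< r k k<N))

  ≈[]-weaken : ∀ {f g M N} → M ℕ.≤ N → f ≈[ N ] g → f ≈[ M ] g
  ≈[]-weaken M≤N p = modulo (λ k k<M → at< p k (ℕₚ.<-≤-trans k<M M≤N))

  ⊕-cong[] : ∀ {f f′ g g′ N} → f ≈[ N ] f′ → g ≈[ N ] g′ → f ⊕ g ≈[ N ] f′ ⊕ g′
  ⊕-cong[] p r = modulo (λ k k<N → cong₂ _+_ (at< p k k<N) (at< r k k<N))

  ~-cong[] : ∀ {f g N} → f ≈[ N ] g → ~ f ≈[ N ] ~ g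
  ~-cong[] p = modulo (λ k k<N → cong -_ (at< p k k<N))

  ·-cong[] : ∀ {f f′ g g′ N} → f ≈[ N ] f′ → g ≈[ N ] g′ → f · g ≈[ N ] f′ · g′
  ·-cong[] p r = modulo (λ k k<N → ⊛-cong-at k (λ i i≤k → at< p i (ℕₚ.≤-<-trans i≤k k<N)) (λ i i≤k → at< r i (ℕₚ.≤-<-trans i≤k k<N)))

  monoᶜ : ℕ → ℕ → ℤ
  monoᶜ zero            = oneS
  monoᶜ (suc k) zero    = + 0
  monoᶜ (suc k) (suc n) = monoᶜ k n

  mono : ℕ → PS
  PS.coe (mono k) = monoᶜ k

  mono-0 : mono 0 ≈ 1ₛ
  mono-0 = pointwise (λ _ → refl)

  mono-·-+ : ∀ k f n → (mono k · f) ! (k ℕ.+ n) ≡ f ! n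
  mono-·-+ zero    f n = at (≈-trans (·-cong mono-0 (≈-refl {f})) (·-identityˡ f)) n
  mono-·-+ (suc k) f n = trans (·-suc (mono (suc k)) f (k ℕ.+ n))
    (trans (cong₂ _+_ (ℤₚ.*-zeroˡ (f ! suc (k ℕ.+ n))) (mono-·-+ k f n)) (ℤₚ.+-identityˡ (f ! n)))

  mono-·-< : ∀ k f n → n ℕ.< k → (mono k · f) ! n ≡ + 0
  mono-·-< (suc k) f zero    _         = trans (·-zero (mono (suc k)) f) (ℤₚ.*-zeroˡ (f ! 0))
  mono-·-< (suc k) f (suc n) (s≤s n<k) = trans (·-suc (mono (suc k)) f n)
    (cong₂ _+_ (ℤₚ.*-zeroˡ (f ! suc n)) (mono-·-< k f n n<k))

  mono-self : ∀ k → mono k ! k ≡ + 1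
  mono-self zero    = refl
  mono-self (suc k) = mono-self k

  mono-other : ∀ k n → ¬ n ≡ k → mono k ! n ≡ + 0
  mono-other zero    zero    n≢k = contradiction refl n≢k
  mono-other zero    (suc n) n≢k = refl
  mono-other (suc k) zero    n≢k = refl
  mono-other (suc k) (suc n) n≢k = mono-other k n (n≢k ∘ cong suc)

  ≈-by-cases : ∀ k {f g : PS} → (∀ n → n ℕ.< k → f ! n ≡ g ! n) → (∀ n → f ! (k ℕ.+ n) ≡ g ! (k ℕ.+ n)) → f ≈ g
  ≈-by-cases k {f} {g} lo hi = pointwise go
    where
      go : ∀ n → f ! n ≡ g ! n
      go n with n ℕₚ.<? k
      ... | yes n<k = lo n n<k
      ... | no  n≮k = subst (λ m → f ! m ≡ g ! m) (ℕₚ.m+[n∸m]≡n (ℕₚ.≮⇒≥ n≮k)) (hi (n ℕ.∸ k))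

  mono-+ : ∀ a b → mono (a ℕ.+ b) ≈ mono a · mono b
  mono-+ a b = ≈-by-cases a
    (λ n n<a → trans (mono-other (a ℕ.+ b) n (λ n≡ → ℕₚ.<⇒≱ n<a (subst (a ℕ.≤_) (sym n≡) (ℕₚ.m≤m+n a b))))
        (sym (mono-·-< a (mono b) n n<a)))
    (λ n → trans (shifted a n) (sym (mono-·-+ a (mono b) n)))
    where
      shifted : ∀ a n → mono (a ℕ.+ b) ! (a ℕ.+ n) ≡ mono b ! n
      shifted zero    n = refl
      shifted (suc a) n = shifted a n

  mono-≡ : ∀ {a b} → a ≡ b → mono a ≈ mono b
  mono-≡ refl = ≈-refl

  mono-·-mono : ∀ {a b c} → a ℕ.+ b ≡ c → mono a · mono b ≈ mono c
  mono-·-mono {a} {b} refl = ≈-sym (mono-+ a b)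

  -- Multiplying by q^k gains k powers of precision. This gain drives the multiplicativity of `dil`
  -- and the convergence of the finite triple product.
  mono-·-cong[] : ∀ k {f g N} → f ≈[ N ] g → mono k · f ≈[ k ℕ.+ N ] mono k · g
  mono-·-cong[] k {f} {g} {N} p = modulo go
    where
      go : ∀ n → n ℕ.< k ℕ.+ N → (mono k · f) ! n ≡ (mono k · g) ! n
      go n n<k+N with n ℕₚ.<? k
      ... | yes n<k = trans (mono-·-< k f n n<k) (sym (mono-·-< k g n n<k))
      ... | no  n≮k = subst (λ m → (mono k · f) ! m ≡ (mono k · g) ! m) k+d≡n
              (trans (mono-·-+ k f d) (trans (at< p d (ℕₚ.+-cancelˡ-< k d N (subst (ℕ._< k ℕ.+ N) (sym k+d≡n) n<k+N)))
                  (sym (mono-·-+ k g d))))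
        where
          d = n ℕ.∸ k
          k+d≡n : k ℕ.+ d ≡ n
          k+d≡n = ℕₚ.m+[n∸m]≡n (ℕₚ.≮⇒≥ n≮k)

  mono-·-small : ∀ k f → mono k · f ≈[ k ] 0ₛ
  mono-·-small k f = modulo (mono-·-< k f)

  mono-small : ∀ {N k} → N ℕ.≤ k → mono k ≈[ N ] 0ₛ
  mono-small {N} {k} N≤k = modulo (λ n n<N → mono-other k n (λ { refl → ℕₚ.<⇒≱ n<N N≤k }))

  -- ℤ has no zero divisors, so the constant term of `d` vanishes. Then `d` is q times its tail, and
  -- the tail is annihilated by `f` up to one degree less.
  ·-cancelʳ-at : ∀ (f d : PS) → ¬ f ! 0 ≡ + 0 → ∀ k → (∀ j → j ℕ.≤ k → (d · f) ! j ≡ + 0) → d ! k ≡ + 0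
  ·-cancelʳ-at f d f₀≢0 k h with ℤₚ.i*j≡0⇒i≡0∨j≡0 (d ! 0) (trans (sym (·-zero d f)) (h 0 z≤n))
  ... | inj₂ f₀≡0 = contradiction f₀≡0 f₀≢0
  ... | inj₁ d₀≡0 = go k h
    where
      go : ∀ k → (∀ j → j ℕ.≤ k → (d · f) ! j ≡ + 0) → d ! k ≡ + 0
      go zero    _ = d₀≡0
      go (suc k) h = ·-cancelʳ-at f (tl d) f₀≢0 k (λ j j≤k → begin
        (tl d · f) ! j                    ≡⟨ ℤₚ.+-identityˡ _ ⟨
        + 0 + (tl d · f) ! j              ≡⟨ cong (λ z → z + (tl d · f) ! j) (trans (cong (_* f ! suc j) d₀≡0) (ℤₚ.*-zeroˡ (f ! suc j))) ⟨
        d ! 0 * f ! suc j + (tl d · f) ! j  ≡⟨ ·-suc d f j ⟨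
        (d · f) ! suc j                      ≡⟨ h (suc j) (s≤s j≤k) ⟩
        + 0                                  ∎)
        where open ≡-Reasoning

  ⊖≈0⇒≈ : ∀ {f g} → f ⊖ g ≈ 0ₛ → f ≈ g
  ⊖≈0⇒≈ {f} {g} p = pointwise (λ k → ℤₚ.i-j≡0⇒i≡j (f ! k) (g ! k) (at p k))

  ≈⇒⊖≈0 : ∀ {f g} → f ≈ g → f ⊖ g ≈ 0ₛ
  ≈⇒⊖≈0 {f} {g} p = pointwise (λ k → ℤₚ.i≡j⇒i-j≡0 {f ! k} {g ! k} (at p k))

  ·-cancelʳ : ∀ f {g h} → ¬ f ! 0 ≡ + 0 → g · f ≈ h · f → g ≈ h
  ·-cancelʳ f {g} {h} f₀≢0 p = ⊖≈0⇒≈ (pointwise (λ k → ·-cancelʳ-at f (g ⊖ h) f₀≢0 k (λ j _ → at zero-product j)))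
    where
      zero-product : (g ⊖ h) · f ≈ 0ₛ
      zero-product = ≈-trans (solve 3 (λ f g h → (g :- h) :* f := g :* f :- h :* f) ≈-refl f g h) (≈⇒⊖≈0 p)
        where open SeriesSolver

  mono-cancelˡ : ∀ k {f g} → mono k · f ≈ mono k · g → f ≈ g
  mono-cancelˡ k {f} {g} p = pointwise (λ n → trans (sym (mono-·-+ k f n)) (trans (at p (k ℕ.+ n)) (mono-·-+ k g n)))

  κ-cancelˡ : ∀ c {f g} → ¬ c ≡ + 0 → κ c · f ≈ κ c · g → f ≈ g
  κ-cancelˡ c {f} {g} c≢0 p = ·-cancelʳ (κ c) c≢0 (≈-trans (·-comm f (κ c)) (≈-trans p (·-comm (κ c) g)))

  sgn : ℕ → ℤ
  sgn zero    = + 1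
  sgn (suc n) = - sgn n

  -- The substitution q ↦ -q.
  alt : PS → PS
  PS.coe (alt f) n = sgn n * f ! n

  sgn² : ∀ n → sgn n * sgn n ≡ + 1
  sgn² zero    = refl
  sgn² (suc n) = trans (solve 1 (λ s → (:- s) :* (:- s) := s :* s) refl (sgn n)) (sgn² n)
    where open +-*-Solver

  alt-cong : ∀ {f g} → f ≈ g → alt f ≈ alt g
  alt-cong p = pointwise (λ k → cong (sgn k *_) (at p k))

  alt-⊕ : ∀ f g → alt (f ⊕ g) ≈ alt f ⊕ alt g
  alt-⊕ f g = pointwise (λ k → ℤₚ.*-distribˡ-+ (sgn k) (f ! k) (g ! k))

  alt-~ : ∀ f → alt (~ f) ≈ ~ alt f
  alt-~ f = pointwise (λ k → sym (ℤₚ.neg-distribʳ-* (sgn k) (f ! k)))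

  alt-⊖ : ∀ f g → alt (f ⊖ g) ≈ alt f ⊖ alt g
  alt-⊖ f g = ≈-trans (alt-⊕ f (~ g)) (⊕-cong ≈-refl (alt-~ g))

  alt-alt : ∀ f → alt (alt f) ≈ f
  alt-alt f = pointwise (λ k → trans (sym (ℤₚ.*-assoc (sgn k) (sgn k) (f ! k))) (trans (cong (_* f ! k) (sgn² k)) (ℤₚ.*-identityˡ (f ! k))))

  alt-·-at : ∀ k f g → sgn k * (f · g) ! k ≡ (alt f · alt g) ! k
  alt-·-at zero    f g = trans (cong (+ 1 *_) (·-zero f g)) (trans
      (solve 2 (λ a b → con (+ 1) :* (a :* b) := con (+ 1) :* a :* (con (+ 1) :* b)) refl (f ! 0) (g ! 0)) (sym (·-zero (alt f) (alt g))))
    where open +-*-Solver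
  alt-·-at (suc k) f g = begin
    - sgn k * (f · g) ! suc k
      ≡⟨ cong (- sgn k *_) (·-suc f g k) ⟩
    - sgn k * (f ! 0 * g ! suc k + (tl f · g) ! k)
      ≡⟨ solve 4 (λ s a b c → :- s :* (a :* b :+ c) := con (+ 1) :* a :* (:- s :* b) :+ con -[1+ 0 ] :* (s :* c)) refl (sgn k) (f ! 0)
          (g ! suc k) _ ⟩
    alt f ! 0 * alt g ! suc k + -[1+ 0 ] * (sgn k * (tl f · g) ! k)
      ≡⟨ cong (λ z → alt f ! 0 * alt g ! suc k + -[1+ 0 ] * z) (alt-·-at k (tl f) g) ⟩
    alt f ! 0 * alt g ! suc k + -[1+ 0 ] * (alt (tl f) · alt g) ! k
      ≡⟨ cong (λ z → alt f ! 0 * alt g ! suc k + z) (⊛-scaleˡ-at k -[1+ 0 ] (PS.coe (alt (tl f))) (PS.coe (alt g))) ⟨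
    alt f ! 0 * alt g ! suc k + ((λ i → -[1+ 0 ] * alt (tl f) ! i) ⊛ PS.coe (alt g)) k
      ≡⟨ cong (λ z → alt f ! 0 * alt g ! suc k + z) (⊛-cong-at k {g = PS.coe (alt g)}
          (λ i _ → solve 2 (λ s a → con -[1+ 0 ] :* (s :* a) := (:- s) :* a) refl (sgn i) (f ! suc i)) (λ _ _ → refl)) ⟩
    alt f ! 0 * alt g ! suc k + (tl (alt f) · alt g) ! k
      ≡⟨ ·-suc (alt f) (alt g) k ⟨
    (alt f · alt g) ! suc k ∎
    where
      open ≡-Reasoning
      open +-*-Solver

  alt-· : ∀ f g → alt (f · g) ≈ alt f · alt g
  alt-· f g = pointwise (λ k → alt-·-at k f g)

  alt-κ : ∀ c → alt (κ c) ≈ κ c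
  alt-κ c = pointwise λ { zero → ℤₚ.*-identityˡ c ; (suc k) → ℤₚ.*-zeroʳ (- sgn k) }

  alt-mono : ∀ k → alt (mono k) ≈ κ (sgn k) · mono k
  alt-mono k = pointwise go
    where
      go : ∀ n → sgn n * mono k ! n ≡ (κ (sgn k) · mono k) ! n
      go n with n ℕ.≟ k
      ... | yes refl = sym (κ-·-at (sgn k) (mono k) n)
      ... | no  n≢k  = trans (trans (cong (sgn n *_) (mono-other k n n≢k)) (ℤₚ.*-zeroʳ (sgn n)))
                         (sym (trans (κ-·-at (sgn k) (mono k) n) (trans (cong (sgn k *_) (mono-other k n n≢k)) (ℤₚ.*-zeroʳ (sgn k)))))

  -- The substitution q ↦ q^k. The body has the shape of `σ/`, so the coefficients of a dilated
  -- divisor-sum series are values of `σ/` by computation.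
  dil : (k : ℕ) → .{{NonZero k}} → PS → PS
  PS.coe (dil k f) n = if ⌊ k ∣? n ⌋ then f ! (n / k) else + 0

  module _ (k : ℕ) .{{_ : NonZero k}} where

    dil-∣ : ∀ f {n} → k ∣ n → dil k f ! n ≡ f ! (n / k)
    dil-∣ f {n} k∣n with k ∣? n
    ... | yes _   = refl
    ... | no  k∤n = contradiction k∣n k∤n

    dil-∤ : ∀ f {n} → ¬ k ∣ n → dil k f ! n ≡ + 0
    dil-∤ f {n} k∤n with k ∣? n
    ... | yes k∣n = contradiction k∣n k∤n
    ... | no  _   = refl

    dil-* : ∀ f n → dil k f ! (n ℕ.* k) ≡ f ! n
    dil-* f n = trans (dil-∣ f (n∣m*n n)) (cong (f !_) (m*n/n≡m n k))

    dil-cong : ∀ {f g} → f ≈ g → dil k f ≈ dil k g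
    dil-cong {f} {g} p = pointwise go
      where
        go : ∀ n → dil k f ! n ≡ dil k g ! n
        go n with k ∣? n
        ... | yes _ = at p (n / k)
        ... | no  _ = refl

    dil-cong[] : ∀ {f g N} → f ≈[ N ] g → dil k f ≈[ N ] dil k g
    dil-cong[] {f} {g} {N} p = modulo go
      where
        go : ∀ n → n ℕ.< N → dil k f ! n ≡ dil k g ! n
        go n n<N with k ∣? n
        ... | yes _ = at< p (n / k) (ℕₚ.≤-<-trans (m/n≤m n k) n<N)
        ... | no  _ = refl

    dil-injective : ∀ {f g} → dil k f ≈ dil k g → f ≈ g
    dil-injective {f} {g} p = pointwise (λ n → trans (sym (dil-* f n)) (trans (at p (n ℕ.* k)) (dil-* g n)))

    dil-⊕ : ∀ f g → dil k (f ⊕ g) ≈ dil k f ⊕ dil k g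
    dil-⊕ f g = pointwise go
      where
        go : ∀ n → dil k (f ⊕ g) ! n ≡ dil k f ! n + dil k g ! n
        go n with k ∣? n
        ... | yes _ = refl
        ... | no  _ = refl

    dil-~ : ∀ f → dil k (~ f) ≈ ~ dil k f
    dil-~ f = pointwise go
      where
        go : ∀ n → dil k (~ f) ! n ≡ - dil k f ! n
        go n with k ∣? n
        ... | yes _ = refl
        ... | no  _ = refl

    dil-⊖ : ∀ f g → dil k (f ⊖ g) ≈ dil k f ⊖ dil k g
    dil-⊖ f g = ≈-trans (dil-⊕ f (~ g)) (⊕-cong ≈-refl (dil-~ g))

    dil-at-0 : ∀ f → dil k f ! 0 ≡ f ! 0
    dil-at-0 f = dil-* f 0

    0<k : 0 ℕ.< k
    0<k = ℕₚ.n≢0⇒n>0 (ℕ.≢-nonZero⁻¹ k)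

    dil-small : ∀ f n → 0 ℕ.< n → n ℕ.< k → dil k f ! n ≡ + 0
    dil-small f (suc n) _ n<k = dil-∤ f (>⇒∤ n<k)

    dil-step : ∀ f n → dil k f ! (k ℕ.+ n) ≡ dil k (tl f) ! n
    dil-step f n with k ∣? n
    ... | yes k∣n = trans (dil-∣ f (∣m∣n⇒∣m+n ∣-refl k∣n))
            (cong (f !_) (trans (+-distrib-/-∣ˡ n ∣-refl) (cong (ℕ._+ n / k) (n/n≡1 k))))
    ... | no  k∤n = dil-∤ f (λ k∣k+n → k∤n (∣m+n∣m⇒∣n k∣k+n ∣-refl))

    dil-unfold : ∀ f → dil k f ≈ κ (f ! 0) ⊕ mono k · dil k (tl f)
    dil-unfold f = ≈-by-cases k lo hi
      where
        lo : ∀ n → n ℕ.< k → dil k f ! n ≡ κ (f ! 0) ! n + (mono k · dil k (tl f)) ! n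
        lo zero    n<k = trans (dil-at-0 f) (sym (trans (cong (λ z → f ! 0 + z) (mono-·-< k (dil k (tl f)) 0 n<k))
            (ℤₚ.+-identityʳ (f ! 0))))
        lo (suc n) n<k = trans (dil-small f (suc n) (s≤s z≤n) n<k) (sym (trans (ℤₚ.+-identityˡ _) (mono-·-< k (dil k (tl f)) (suc n) n<k)))
        κ-pos : ∀ {m} → 0 ℕ.< m → κ (f ! 0) ! m ≡ + 0
        κ-pos {suc m} _ = refl
        hi : ∀ n → dil k f ! (k ℕ.+ n) ≡ κ (f ! 0) ! (k ℕ.+ n) + (mono k · dil k (tl f)) ! (k ℕ.+ n)
        hi n = trans (dil-step f n) (sym (trans (cong₂ _+_ (κ-pos (ℕₚ.<-≤-trans 0<k (ℕₚ.m≤m+n k n))) (mono-·-+ k (dil k (tl f)) n))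
            (ℤₚ.+-identityˡ _)))

    ∣-cases : ∀ {P : Set} n → (k ∣ n → P) → (¬ k ∣ n → P) → P
    ∣-cases n p r with k ∣? n
    ... | yes k∣n = p k∣n
    ... | no  k∤n = r k∤n

    dil-κ-· : ∀ c f → dil k (κ c · f) ≈ κ c · dil k f
    dil-κ-· c f = pointwise λ n → ∣-cases n
      (λ k∣n → trans (dil-∣ (κ c · f) k∣n) (trans (κ-·-at c f (n / k))
          (trans (cong (c *_) (sym (dil-∣ f k∣n))) (sym (κ-·-at c (dil k f) n)))))
      (λ k∤n → trans (dil-∤ (κ c · f) k∤n) (sym (trans (κ-·-at c (dil k f) n) (trans (cong (c *_) (dil-∤ f k∤n)) (ℤₚ.*-zeroʳ c)))))

    dil-κ : ∀ c → dil k (κ c) ≈ κ c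
    dil-κ c = ≈-trans (dil-unfold (κ c)) (≈-trans (⊕-cong ≈-refl (·-cong ≈-refl zero-tail))
      (solve 2 (λ c m → c :+ m :* con (+ 0) := c) ≈-refl (κ c) (mono k)))
      where
        open SeriesSolver
        zero-tail : dil k (tl (κ c)) ≈ κ (+ 0)
        zero-tail = pointwise λ n → ∣-cases n
          (λ k∣n → trans (dil-∣ (tl (κ c)) k∣n) (κ0 n)) (λ k∤n → trans (dil-∤ (tl (κ c)) k∤n) (κ0 n))
          where
            κ0 : ∀ n → + 0 ≡ κ (+ 0) ! n
            κ0 zero    = refl
            κ0 (suc _) = refl

    ·-unfold : ∀ f g → tl (f · g) ≈ κ (f ! 0) · (tl g) ⊕ (tl f) · g
    ·-unfold f g = pointwise (λ n → trans (·-suc f g n) (cong (λ z → z + (tl f · g) ! n) (sym (κ-·-at (f ! 0) (tl g) n))))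

    -- Both sides unfold to a constant plus q^k times the same expression in the tails. As k ≥ 1,
    -- every unfolding gains at least one power of q, which makes induction on N possible.
    dil-·-mod : ∀ N f g → dil k (f · g) ≈[ N ] dil k f · dil k g
    dil-·-mod zero    f g = modulo (λ _ ())
    dil-·-mod (suc N) f g =
      ≈[]-trans (≈⇒≈[] (suc N) lhs) (≈[]-trans
        (⊕-cong[] ≈[]-refl (≈[]-weaken (ℕₚ.+-monoˡ-≤ N 0<k) (mono-·-cong[] k (⊕-cong[] ≈[]-refl (dil-·-mod N (tl f) g)))))
        (≈⇒≈[] (suc N) rhs))
      where
        open SeriesSolver
        open ≈-Reasoning
        g₀ = κ (g ! 0)
        f₀ = κ (f ! 0)
        f′ = dil k (tl f)
        g′ = dil k (tl g)
        lhs : dil k (f · g) ≈ κ (f ! 0) · κ (g ! 0) ⊕ mono k · (f₀ · g′ ⊕ dil k ((tl f) · g))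
        lhs = begin
          dil k (f · g)                                        ≈⟨ dil-unfold (f · g) ⟩
          κ ((f · g) ! 0) ⊕ mono k · dil k (tl (f · g))       ≈⟨ ⊕-cong κ-eq (·-cong ≈-refl (dil-cong (·-unfold f g))) ⟩
          f₀ · g₀ ⊕ mono k · dil k (f₀ · (tl g) ⊕ (tl f) · g)
            ≈⟨ ⊕-cong ≈-refl (·-cong ≈-refl (≈-trans (dil-⊕ (f₀ · (tl g)) ((tl f) · g)) (⊕-cong (dil-κ-· (f ! 0) (tl g)) ≈-refl))) ⟩
          f₀ · g₀ ⊕ mono k · (f₀ · g′ ⊕ dil k ((tl f) · g)) ∎
          where
            κ-eq : κ ((f · g) ! 0) ≈ f₀ · g₀
            κ-eq = pointwise λ { zero → trans (·-zero f g) (sym (·-zero f₀ g₀))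
                               ; (suc n) → sym (trans (κ-·-at (f ! 0) g₀ (suc n)) (ℤₚ.*-zeroʳ (f ! 0))) }
        rhs : f₀ · g₀ ⊕ mono k · (f₀ · g′ ⊕ f′ · dil k g) ≈ dil k f · dil k g
        rhs = begin
          f₀ · g₀ ⊕ mono k · (f₀ · g′ ⊕ f′ · dil k g)
            ≈⟨ solve 6 (λ a b m c d e → a :* b :+ m :* (a :* c :+ d :* e) := a :* (b :+ m :* c) :+ m :* d :* e) ≈-refl f₀ g₀ (mono k) g′ f′
                (dil k g) ⟩
          f₀ · (g₀ ⊕ mono k · g′) ⊕ mono k · f′ · dil k g
            ≈⟨ ⊕-cong (·-cong ≈-refl (≈-sym (dil-unfold g))) ≈-refl ⟩
          f₀ · dil k g ⊕ mono k · f′ · dil k g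
            ≈⟨ solve 4 (λ a m d e → a :* e :+ m :* d :* e := (a :+ m :* d) :* e) ≈-refl f₀ (mono k) f′ (dil k g) ⟩
          (f₀ ⊕ mono k · f′) · dil k g
            ≈⟨ ·-cong (≈-sym (dil-unfold f)) ≈-refl ⟩
          dil k f · dil k g ∎

    dil-· : ∀ f g → dil k (f · g) ≈ dil k f · dil k g
    dil-· f g = ≈[]-all (λ N → dil-·-mod N f g)

    dil-mono : ∀ m → dil k (mono m) ≈ mono (m ℕ.* k)
    dil-mono m = pointwise go
      where
        go : ∀ n → dil k (mono m) ! n ≡ mono (m ℕ.* k) ! n
        go n with n ℕ.≟ m ℕ.* k
        ... | yes refl = trans (dil-* (mono m) m) (trans (mono-self m) (sym (mono-self (m ℕ.* k))))
        ... | no n≢mk with k ∣? n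
        ...   | no  _                 = sym (mono-other (m ℕ.* k) n n≢mk)
        ...   | yes (divides j refl) = trans (cong (mono m !_) (m*n/n≡m j k))
            (trans (mono-other m j (λ { refl → n≢mk refl })) (sym (mono-other (m ℕ.* k) (j ℕ.* k) n≢mk)))

  dil-dil : ∀ j k l .{{_ : NonZero j}} .{{_ : NonZero k}} .{{_ : NonZero l}} → j ℕ.* k ≡ l → ∀ f → dil j (dil k f) ≈ dil l f
  dil-dil j k _ refl f = pointwise λ n → ∣-cases j n
    (λ { (divides m refl) → trans (dil-* j (dil k f) m) (∣-cases k m
        (λ { (divides l refl) → trans (dil-* k f l)
            (sym (trans (cong (dil (j ℕ.* k) f !_) (trans (ℕₚ.*-assoc l k j) (cong (l ℕ.*_) (ℕₚ.*-comm k j)))) (dil-* (j ℕ.* k) f l))) })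
        (λ k∤m → trans (dil-∤ k f k∤m)
            (sym (dil-∤ (j ℕ.* k) f (λ jk∣mj → k∤m (*-cancelˡ-∣ j (subst (j ℕ.* k ∣_) (ℕₚ.*-comm m j) jk∣mj))))))) })
    (λ j∤n → trans (dil-∤ j (dil k f) j∤n) (sym (dil-∤ (j ℕ.* k) f (λ jk∣n → j∤n (m*n∣⇒m∣ j k jk∣n)))))

  sgn-even : ∀ n → sgn (n ℕ.* 2) ≡ + 1
  sgn-even zero    = refl
  sgn-even (suc n) = trans (ℤₚ.neg-involutive (sgn (n ℕ.* 2))) (sgn-even n)

  alt-dil2 : ∀ f → alt (dil 2 f) ≈ dil 2 f
  alt-dil2 f = pointwise go
    where
      go : ∀ n → sgn n * dil 2 f ! n ≡ dil 2 f ! n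
      go n with 2 ∣? n
      ... | yes (divides m refl) = trans (cong (_* f ! (m ℕ.* 2 / 2)) (sgn-even m)) (ℤₚ.*-identityˡ _)
      ... | no  _                = ℤₚ.*-zeroʳ (sgn n)

open Substitution

-- Infinite products, theta exponents and Gaussian binomials.

module FiniteTripleProduct where

  open import Data.Integer using (_+_; _*_; -_; _-_)

  ∏< : ℕ → (ℕ → PS) → PS
  ∏< zero    h = 1ₛ
  ∏< (suc n) h = ∏< n h · h n

  -- The coefficient of q^n of ∏ h k when h k = 1 + O(q^(k+1)).
  ∏∞ : (ℕ → PS) → PS
  PS.coe (∏∞ h) n = ∏< n h ! n

  Tame : (ℕ → PS) → Set
  Tame h = ∀ k → h k ≈[ suc k ] 1ₛ

  ∏<-cong : ∀ n {h g : ℕ → PS} → (∀ k → h k ≈ g k) → ∏< n h ≈ ∏< n g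
  ∏<-cong zero    p = ≈-refl
  ∏<-cong (suc n) p = ·-cong (∏<-cong n p) (p n)

  ∏<-· : ∀ n (h g : ℕ → PS) → ∏< n (λ k → h k · g k) ≈ ∏< n h · ∏< n g
  ∏<-· zero    h g = ≈-sym (·-identityˡ 1ₛ)
  ∏<-· (suc n) h g = ≈-trans (·-cong (∏<-· n h g) ≈-refl)
    (solve 4 (λ a b c d → a :* b :* (c :* d) := a :* c :* (b :* d)) ≈-refl (∏< n h) (∏< n g) (h n) (g n))
    where open SeriesSolver

  ∏<-first : ∀ n (h : ℕ → PS) → ∏< (suc n) h ≈ h 0 · ∏< n (h ∘ suc)
  ∏<-first zero    h = ·-comm 1ₛ (h 0)
  ∏<-first (suc n) h = ≈-trans (·-cong (∏<-first n h) ≈-refl)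
    (solve 3 (λ a b c → a :* b :* c := a :* (b :* c)) ≈-refl (h 0) (∏< n (h ∘ suc)) (h (suc n)))
    where open SeriesSolver

  ·-identityʳ : ∀ f → f · 1ₛ ≈ f
  ·-identityʳ f = ≈-trans (·-comm f 1ₛ) (·-identityˡ f)

  ∏<-stable : ∀ {h} → Tame h → ∀ {n m} → n ℕ.≤′ m → ∏< m h ≈[ suc n ] ∏< n h
  ∏<-stable tame (ℕ.≤′-reflexive refl) = ≈[]-refl
  ∏<-stable {h} tame {n} {suc m} (ℕ.≤′-step n≤m) =
    ≈[]-trans (⊛-step (≈[]-weaken (s≤s (ℕₚ.≤′⇒≤ n≤m)) (tame m))) (∏<-stable tame n≤m)
    where
      ⊛-step : h m ≈[ suc n ] 1ₛ → ∏< m h · h m ≈[ suc n ] ∏< m h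
      ⊛-step p = ≈[]-trans (·-cong[] ≈[]-refl p) (≈⇒≈[] (suc n) (·-identityʳ (∏< m h)))

  ∏∞-trunc : ∀ {h} → Tame h → ∀ M → ∏∞ h ≈[ suc M ] ∏< M h
  ∏∞-trunc tame M = modulo (λ { n (s≤s n≤M) → sym (at< (∏<-stable tame (ℕₚ.≤⇒≤′ n≤M)) n ℕₚ.≤-refl) })

  ∏∞-cong : ∀ {h g : ℕ → PS} → (∀ k → h k ≈ g k) → ∏∞ h ≈ ∏∞ g
  ∏∞-cong p = pointwise (λ n → at (∏<-cong n p) n)

  ∏∞-· : ∀ {h g} → Tame h → Tame g → ∏∞ (λ k → h k · g k) ≈ ∏∞ h · ∏∞ g
  ∏∞-· {h} {g} th tg = pointwise (λ n → trans (at (∏<-· n h g) n)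
    (sym (at< (·-cong[] (∏∞-trunc th n) (∏∞-trunc tg n)) n ℕₚ.≤-refl)))

  alt-1 : alt 1ₛ ≈ 1ₛ
  alt-1 = pointwise λ { zero → refl ; (suc k) → ℤₚ.*-zeroʳ (- sgn k) }

  alt-∏< : ∀ n h → alt (∏< n h) ≈ ∏< n (alt ∘ h)
  alt-∏< zero    h = alt-1
  alt-∏< (suc n) h = ≈-trans (alt-· (∏< n h) (h n)) (·-cong (alt-∏< n h) ≈-refl)

  alt-∏∞ : ∀ h → alt (∏∞ h) ≈ ∏∞ (alt ∘ h)
  alt-∏∞ h = pointwise (λ n → at (alt-∏< n h) n)

  dil-1 : ∀ k .{{_ : NonZero k}} → dil k 1ₛ ≈ 1ₛ
  dil-1 k = ≈-trans (dil-cong k (pointwise oneS≗κ)) (≈-trans (dil-κ k (+ 1)) (pointwise (sym ∘ oneS≗κ)))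

  dil-∏< : ∀ k .{{_ : NonZero k}} n h → dil k (∏< n h) ≈ ∏< n (λ j → dil k (h j))
  dil-∏< k zero    h = dil-1 k
  dil-∏< k (suc n) h = ≈-trans (dil-· k (∏< n h) (h n)) (·-cong (dil-∏< k n h) ≈-refl)

  dil-∏∞ : ∀ k .{{_ : NonZero k}} {h} → Tame h → dil k (∏∞ h) ≈ ∏∞ (λ j → dil k (h j))
  dil-∏∞ k {h} tame = pointwise (λ n → trans (at< (dil-cong[] k (∏∞-trunc tame n)) n ℕₚ.≤-refl) (at (dil-∏< k n h) n))

  ∏<-split2 : ∀ n (h : ℕ → PS) → ∏< (n ℕ.* 2) h ≈ ∏< n (λ k → h (k ℕ.* 2)) · ∏< n (λ k → h (1 ℕ.+ k ℕ.* 2))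
  ∏<-split2 zero    h = ≈-sym (·-identityˡ 1ₛ)
  ∏<-split2 (suc n) h = ≈-trans (·-cong (·-cong (∏<-split2 n h) ≈-refl) ≈-refl)
    (solve 4 (λ a b c d → a :* b :* c :* d := a :* c :* (b :* d)) ≈-refl _ _ (h (n ℕ.* 2)) (h (1 ℕ.+ n ℕ.* 2)))
    where open SeriesSolver

  ∏<-split5 : ∀ n (h : ℕ → PS) → ∏< (n ℕ.* 5) h ≈ ∏< n (λ k → h (k ℕ.* 5)) · ∏< n (λ k → h (1 ℕ.+ k ℕ.* 5)) · ∏< n (λ k → h (2 ℕ.+ k ℕ.* 5))
                                               · ∏< n (λ k → h (3 ℕ.+ k ℕ.* 5)) · ∏< n (λ k → h (4 ℕ.+ k ℕ.* 5))
  ∏<-split5 zero    h = solve 0 (con (+ 1) := con (+ 1) :* con (+ 1) :* con (+ 1) :* con (+ 1) :* con (+ 1)) ≈-refl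
    ⟨≈⟩ 1s
    where
      open SeriesSolver
      infixr 4 _⟨≈⟩_
      _⟨≈⟩_ : ∀ {x y : PS} → κ (+ 1) ≈ x → x ≈ y → 1ₛ ≈ y
      p ⟨≈⟩ r = ≈-trans (pointwise oneS≗κ) (≈-trans p r)
      o : κ (+ 1) ≈ 1ₛ
      o = pointwise (sym ∘ oneS≗κ)
      1s = ·-cong (·-cong (·-cong (·-cong o o) o) o) o
  ∏<-split5 (suc n) h = ≈-trans (·-cong (·-cong (·-cong (·-cong (·-cong (∏<-split5 n h) ≈-refl) ≈-refl) ≈-refl) ≈-refl) ≈-refl)
    (solve 10 (λ a b c d e a′ b′ c′ d′ e′ → a :* b :* c :* d :* e :* a′ :* b′ :* c′ :* d′ :* e′ := a :* a′ :* (b :* b′) :* (c :* c′) :*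
        (d :* d′) :* (e :* e′)) ≈-refl _ _ _ _ _
      (h (n ℕ.* 5)) (h (1 ℕ.+ n ℕ.* 5)) (h (2 ℕ.+ n ℕ.* 5)) (h (3 ℕ.+ n ℕ.* 5)) (h (4 ℕ.+ n ℕ.* 5)))
    where open SeriesSolver

  Tame-∘ : ∀ {h} → Tame h → (i m : ℕ) .{{_ : NonZero m}} → Tame (λ k → h (i ℕ.+ k ℕ.* m))
  Tame-∘ tame i m k = ≈[]-weaken (s≤s (ℕₚ.≤-trans (ℕₚ.m≤m*n k m) (ℕₚ.m≤n+m (k ℕ.* m) i))) (tame (i ℕ.+ k ℕ.* m))

  ∏∞-split2 : ∀ {h} → Tame h → ∏∞ h ≈ ∏∞ (λ k → h (k ℕ.* 2)) · ∏∞ (λ k → h (1 ℕ.+ k ℕ.* 2))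
  ∏∞-split2 {h} tame = pointwise (λ n → trans
    (at< (≈[]-weaken (s≤s (ℕₚ.m≤m*n n 2)) (∏∞-trunc tame (n ℕ.* 2))) n ℕₚ.≤-refl) (trans (at (∏<-split2 n h) n)
    (sym (at< (·-cong[] (∏∞-trunc (Tame-∘ tame 0 2) n) (∏∞-trunc (Tame-∘ tame 1 2) n)) n ℕₚ.≤-refl))))

  ∏∞-split5 : ∀ {h} → Tame h → ∏∞ h ≈ ∏∞ (λ k → h (k ℕ.* 5)) · ∏∞ (λ k → h (1 ℕ.+ k ℕ.* 5)) · ∏∞ (λ k → h (2 ℕ.+ k ℕ.* 5))
                                    · ∏∞ (λ k → h (3 ℕ.+ k ℕ.* 5)) · ∏∞ (λ k → h (4 ℕ.+ k ℕ.* 5))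
  ∏∞-split5 {h} tame = pointwise (λ n → trans
    (at< (≈[]-weaken (s≤s (ℕₚ.m≤m*n n 5)) (∏∞-trunc tame (n ℕ.* 5))) n ℕₚ.≤-refl) (trans (at (∏<-split5 n h) n)
    (sym (at< (·-cong[] (·-cong[] (·-cong[] (·-cong[] (∏∞-trunc (Tame-∘ tame 0 5) n) (∏∞-trunc (Tame-∘ tame 1 5) n))
       (∏∞-trunc (Tame-∘ tame 2 5) n)) (∏∞-trunc (Tame-∘ tame 3 5) n)) (∏∞-trunc (Tame-∘ tame 4 5) n)) n ℕₚ.≤-refl))))

  ΣS : ℕ → (ℕ → PS) → PS
  ΣS zero    h = 0ₛ
  ΣS (suc n) h = h 0 ⊕ ΣS n (h ∘ suc)

  ΣS-cong : ∀ n {h g : ℕ → PS} → (∀ i → i ℕ.< n → h i ≈ g i) → ΣS n h ≈ ΣS n g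
  ΣS-cong zero    p = ≈-refl
  ΣS-cong (suc n) p = ⊕-cong (p 0 (s≤s z≤n)) (ΣS-cong n (λ i i<n → p (suc i) (s≤s i<n)))

  ΣS-⊕ : ∀ n (h g : ℕ → PS) → ΣS n (λ i → h i ⊕ g i) ≈ ΣS n h ⊕ ΣS n g
  ΣS-⊕ zero    h g = pointwise (λ _ → refl)
  ΣS-⊕ (suc n) h g = ≈-trans (⊕-cong ≈-refl (ΣS-⊕ n (h ∘ suc) (g ∘ suc)))
    (solve 4 (λ a b c d → a :+ b :+ (c :+ d) := a :+ c :+ (b :+ d)) ≈-refl (h 0) (g 0) _ _)
    where open SeriesSolver

  ΣS-·ˡ : ∀ n c (h : ℕ → PS) → ΣS n (λ i → c · h i) ≈ c · ΣS n h
  ΣS-·ˡ zero    c h = ≈-sym (CR.zeroʳ c)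
  ΣS-·ˡ (suc n) c h = ≈-trans (⊕-cong ≈-refl (ΣS-·ˡ n c (h ∘ suc)))
    (solve 3 (λ c a b → c :* a :+ c :* b := c :* (a :+ b)) ≈-refl c (h 0) _)
    where open SeriesSolver

  ΣS-last : ∀ n (h : ℕ → PS) → ΣS (suc n) h ≈ ΣS n h ⊕ h n
  ΣS-last zero    h = CR.+-comm (h 0) 0ₛ
  ΣS-last (suc n) h = ≈-trans (⊕-cong ≈-refl (ΣS-last n (h ∘ suc)))
    (solve 3 (λ a b c → a :+ (b :+ c) := a :+ b :+ c) ≈-refl (h 0) _ (h (suc n)))
    where open SeriesSolver

  ΣS-at : ∀ n (h : ℕ → PS) k → ΣS n h ! k ≡ Σ< n (λ i → h i ! k)
  ΣS-at zero    h k = refl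
  ΣS-at (suc n) h k = cong (λ z → h 0 ! k + z) (ΣS-at n (h ∘ suc) k)

  ⊕-identityʳ : ∀ f → f ⊕ 0ₛ ≈ f
  ⊕-identityʳ f = pointwise (λ k → ℤₚ.+-identityʳ (f ! k))

  ·-zeroʳ : ∀ f → f · 0ₛ ≈ 0ₛ
  ·-zeroʳ = CR.zeroʳ

  tri : ℕ → ℕ
  tri zero    = 0
  tri (suc n) = tri n ℕ.+ n

  tri-spec : ∀ n → + 2 * + tri n ≡ + n * (+ n - + 1)
  tri-spec zero    = refl
  tri-spec (suc n) = begin
    + 2 * (+ tri n + + n)        ≡⟨ ℤₚ.*-distribˡ-+ (+ 2) (+ tri n) (+ n) ⟩
    + 2 * + tri n + + 2 * + n    ≡⟨ cong (λ z → z + + 2 * + n) (tri-spec n) ⟩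
    + n * (+ n - + 1) + + 2 * + n ≡⟨ solve 1 (λ n → n :* (n :- con (+ 1)) :+ con (+ 2) :* n := (con (+ 1) :+ n) :*
        (con (+ 1) :+ n :- con (+ 1))) refl (+ n) ⟩
    (+ 1 + + n) * (+ 1 + + n - + 1) ∎
    where
      open ≡-Reasoning
      open +-*-Solver

  -- ex a b j = (a+b) j (j-1) / 2 + a j, the exponent of q in Ramanujan's f(q^a, q^b).
  ex : ℕ → ℕ → ℤ → ℕ
  ex a b (+ n)      = (a ℕ.+ b) ℕ.* tri n ℕ.+ a ℕ.* n
  ex a b (-[1+ n ]) = (a ℕ.+ b) ℕ.* tri (suc n) ℕ.+ b ℕ.* suc n

  -- Twice the exponent is one polynomial in j for both signs. All comparisons of exponents are
  -- therefore made on doubled values, where the ring solver applies, and undone by `halve`.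
  ex-spec : ∀ a b j → + 2 * + ex a b j ≡ (+ a + + b) * (j * (j - + 1)) + + 2 * (+ a * j)
  ex-spec a b (+ n) = begin
    + 2 * + ((a ℕ.+ b) ℕ.* tri n ℕ.+ a ℕ.* n)          ≡⟨ cong (+ 2 *_)
        (trans (ℤₚ.pos-+ _ (a ℕ.* n)) (cong₂ _+_ (trans (ℤₚ.pos-* (a ℕ.+ b) (tri n)) (cong (_* + tri n) (ℤₚ.pos-+ a b))) (ℤₚ.pos-* a n))) ⟩
    + 2 * ((+ a + + b) * + tri n + + a * + n)          ≡⟨ solve 4 (λ a b t n → con (+ 2) :* ((a :+ b) :* t :+ a :* n) := (a :+ b) :*
        (con (+ 2) :* t) :+ con (+ 2) :* (a :* n)) refl (+ a) (+ b) (+ tri n) (+ n) ⟩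
    (+ a + + b) * (+ 2 * + tri n) + + 2 * (+ a * + n)  ≡⟨ cong (λ z → (+ a + + b) * z + + 2 * (+ a * + n)) (tri-spec n) ⟩
    (+ a + + b) * (+ n * (+ n - + 1)) + + 2 * (+ a * + n) ∎
    where
      open ≡-Reasoning
      open +-*-Solver
  ex-spec a b -[1+ n ] = begin
    + 2 * + ((a ℕ.+ b) ℕ.* tri (suc n) ℕ.+ b ℕ.* suc n)   ≡⟨ cong (+ 2 *_)
        (trans (ℤₚ.pos-+ _ (b ℕ.* suc n)) (cong₂ _+_ (trans (ℤₚ.pos-* (a ℕ.+ b) (tri (suc n))) (cong (_* + tri (suc n)) (ℤₚ.pos-+ a b)))
        (ℤₚ.pos-* b (suc n)))) ⟩
    + 2 * ((+ a + + b) * + tri (suc n) + + b * + suc n)    ≡⟨ solve 4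
        (λ a b t n → con (+ 2) :* ((a :+ b) :* t :+ b :* n) := (a :+ b) :* (con (+ 2) :* t) :+ con (+ 2) :* (b :* n)) refl (+ a) (+ b)
        (+ tri (suc n)) (+ suc n) ⟩
    (+ a + + b) * (+ 2 * + tri (suc n)) + + 2 * (+ b * + suc n)  ≡⟨ cong (λ z → (+ a + + b) * z + + 2 * (+ b * + suc n)) (tri-spec (suc n))
        ⟩
    (+ a + + b) * (+ suc n * (+ suc n - + 1)) + + 2 * (+ b * + suc n)
      ≡⟨ solve 3 (λ a b n → (a :+ b) :* (n :* (n :- con (+ 1))) :+ con (+ 2) :* (b :* n) := (a :+ b) :* (:- n :* (:- n :- con (+ 1))) :+
          con (+ 2) :* (a :* :- n)) refl (+ a) (+ b) (+ suc n) ⟩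
    (+ a + + b) * (- + suc n * (- + suc n - + 1)) + + 2 * (+ a * - + suc n) ∎
    where
      open ≡-Reasoning
      open +-*-Solver

  halve : ∀ {m n} → + 2 * + m ≡ + 2 * + n → m ≡ n
  halve {m} {n} p = ℤₚ.+-injective (ℤₚ.*-cancelˡ-≡ (+ 2) (+ m) (+ n) p)

  n≤1+tri : ∀ n → n ℕ.≤ suc (tri n)
  n≤1+tri zero    = z≤n
  n≤1+tri (suc n) = s≤s (ℕₚ.m≤n+m n (tri n))

  -- Bounds the indices that can reach a given power of q. The extra 1 is needed when a = 0, where j
  -- = 0 and j = 1 both have exponent 0.
  ex-proper : ∀ a b → 1 ℕ.≤ a ℕ.+ b → ∀ j → ℤ.∣ j ∣ ℕ.≤ suc (ex a b j)
  ex-proper a b 1≤d (+ n)    = ℕₚ.≤-trans (n≤1+tri n) (s≤s (ℕₚ.≤-trans (ℕₚ.m≤n*m (tri n) (a ℕ.+ b) {{ℕ.>-nonZero 1≤d}}) (ℕₚ.m≤m+n _ _)))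
  ex-proper a b 1≤d -[1+ n ] = ℕₚ.≤-trans (n≤1+tri (suc n)) (s≤s (ℕₚ.≤-trans (ℕₚ.m≤n*m (tri (suc n)) (a ℕ.+ b) {{ℕ.>-nonZero 1≤d}})
      (ℕₚ.m≤m+n _ _)))

  module Gauss (d : ℕ) where

    -- The Gaussian binomial coefficient in q^d, defined by one of its two Pascal rules.
    gb : ℕ → ℕ → PS
    gb N       zero    = 1ₛ
    gb zero    (suc i) = 0ₛ
    gb (suc N) (suc i) = gb N i ⊕ mono (d ℕ.* suc i) · gb N (suc i)

    gb-above : ∀ N i → N ℕ.< i → gb N i ≈ 0ₛ
    gb-above zero    (suc i) _         = ≈-refl
    gb-above (suc N) (suc i) (s≤s N<i) = ≈-trans
      (⊕-cong (gb-above N i N<i) (≈-trans (·-cong ≈-refl (gb-above N (suc i) (ℕₚ.m<n⇒m<1+n N<i))) (·-zeroʳ _))) (⊕-identityʳ 0ₛ)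

    mono-split : ∀ {a b c} → a ℕ.+ b ≡ c → mono c ≈ mono a · mono b
    mono-split p = ≈-sym (mono-⊛-mono′ p)
      where
        mono-⊛-mono′ : ∀ {a b c} → a ℕ.+ b ≡ c → mono a · mono b ≈ mono c
        mono-⊛-mono′ {a} {b} refl = ≈-sym (mono-+ a b)

    -- The other q-Pascal rule. In the generic case it is applied to both terms of the defining
    -- rule, and the pieces regroup because d(i + 2) + dr = d(r + 1) + d(i + 1).
    pascal : ∀ N r i → r ℕ.+ i ≡ N → gb (suc N) (suc i) ≈ gb N (suc i) ⊕ mono (d ℕ.* r) · gb N i
    pascal zero zero zero refl = ≈-trans (⊕-cong ≈-refl (·-zeroʳ _)) (≈-trans
      (≈-trans (⊕-identityʳ 1ₛ) (≈-sym (≈-trans (·-identityʳ _) (≈-trans (mono-≡ (ℕₚ.*-zeroʳ d)) mono-0))))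
      (≈-sym (≈-trans (CR.+-identityˡ _) ≈-refl)))
    pascal (suc N) (suc r) zero eq = begin
      1ₛ ⊕ mono (d ℕ.* 1) · gb (suc N) 1
        ≈⟨ ⊕-cong ≈-refl (·-cong ≈-refl (pascal N N 0 (ℕₚ.+-identityʳ N))) ⟩
      1ₛ ⊕ mono (d ℕ.* 1) · (gb N 1 ⊕ mono (d ℕ.* N) · 1ₛ)
        ≈⟨ solve 4 (λ o q g m → o :+ q :* (g :+ m :* o) := o :+ q :* g :+ q :* m :* o) ≈-refl 1ₛ (mono (d ℕ.* 1)) (gb N 1) (mono (d ℕ.* N))
            ⟩
      1ₛ ⊕ mono (d ℕ.* 1) · gb N 1 ⊕ mono (d ℕ.* 1) · mono (d ℕ.* N) · 1ₛ
        ≈⟨ ⊕-cong ≈-refl (·-cong (≈-sym (mono-split exponent)) ≈-refl) ⟩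
      1ₛ ⊕ mono (d ℕ.* 1) · gb N 1 ⊕ mono (d ℕ.* suc r) · 1ₛ ∎
      where
        open ≈-Reasoning
        open SeriesSolver
        exponent : d ℕ.* 1 ℕ.+ d ℕ.* N ≡ d ℕ.* suc r
        exponent = trans (sym (ℕₚ.*-distribˡ-+ d 1 N)) (cong (d ℕ.*_) (sym (trans (sym (ℕₚ.+-identityʳ (suc r))) eq)))
    pascal (suc N) zero (suc i) refl = begin
      gb (suc N) (suc i) ⊕ mono (d ℕ.* suc (suc i)) · gb (suc i) (suc (suc i))
        ≈⟨ ⊕-cong ≈-refl (≈-trans (·-cong ≈-refl (gb-above (suc i) (suc (suc i)) ℕₚ.≤-refl)) (·-zeroʳ _)) ⟩
      gb (suc N) (suc i) ⊕ 0ₛ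
        ≈⟨ CR.+-comm _ _ ⟩
      0ₛ ⊕ gb (suc N) (suc i)
        ≈⟨ ⊕-cong (≈-sym (gb-above (suc i) (suc (suc i)) ℕₚ.≤-refl))
            (≈-sym (≈-trans (·-cong (≈-trans (mono-≡ (ℕₚ.*-zeroʳ d)) mono-0) ≈-refl) (·-identityˡ _))) ⟩
      gb (suc N) (suc (suc i)) ⊕ mono (d ℕ.* 0) · gb (suc N) (suc i) ∎
      where
        open ≈-Reasoning
    pascal (suc N) (suc r) (suc i) eq = begin
      gb (suc N) (suc i) ⊕ Q₂ · gb (suc N) (suc (suc i))
        ≈⟨ ⊕-cong (pascal N (suc r) i (trans (sym (ℕₚ.+-suc r i)) eq′)) (·-cong ≈-refl (pascal N r (suc i) eq′)) ⟩
      gb N (suc i) ⊕ mono (d ℕ.* suc r) · gb N i ⊕ Q₂ · (gb N (suc (suc i)) ⊕ mono (d ℕ.* r) · gb N (suc i))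
        ≈⟨ solve 6 (λ g₁ m g₀ q g₂ m′ → g₁ :+ m :* g₀ :+ q :* (g₂ :+ m′ :* g₁) := g₁ :+ q :* g₂ :+ (m :* g₀ :+ q :* m′ :* g₁)) ≈-refl
            (gb N (suc i)) (mono (d ℕ.* suc r)) (gb N i) Q₂ (gb N (suc (suc i))) (mono (d ℕ.* r)) ⟩
      gb N (suc i) ⊕ Q₂ · gb N (suc (suc i)) ⊕ (mono (d ℕ.* suc r) · gb N i ⊕ Q₂ · mono (d ℕ.* r) · gb N (suc i))
        ≈⟨ ⊕-cong ≈-refl (⊕-cong ≈-refl (·-cong (≈-trans (≈-sym (mono-split {c = d ℕ.* suc r ℕ.+ d ℕ.* suc i} exponent)) (mono-split refl))
            ≈-refl)) ⟩
      gb N (suc i) ⊕ Q₂ · gb N (suc (suc i)) ⊕ (mono (d ℕ.* suc r) · gb N i ⊕ mono (d ℕ.* suc r) · mono (d ℕ.* suc i) · gb N (suc i))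
        ≈⟨ solve 5 (λ x m g₀ q g₁ → x :+ (m :* g₀ :+ m :* q :* g₁) := x :+ m :* (g₀ :+ q :* g₁)) ≈-refl (gb (suc N) (suc (suc i)))
            (mono (d ℕ.* suc r)) (gb N i) (mono (d ℕ.* suc i)) (gb N (suc i)) ⟩
      gb (suc N) (suc (suc i)) ⊕ mono (d ℕ.* suc r) · gb (suc N) (suc i) ∎
      where
        open ≈-Reasoning
        open SeriesSolver
        Q₂ = mono (d ℕ.* suc (suc i))
        eq′ : r ℕ.+ suc i ≡ N
        eq′ = ℕₚ.suc-injective eq
        exponent : d ℕ.* suc (suc i) ℕ.+ d ℕ.* r ≡ d ℕ.* suc r ℕ.+ d ℕ.* suc i
        exponent = ℕ-Solver.solve 3 (λ d i r → d ℕ-Solver.:* (ℕ-Solver.con 2 ℕ-Solver.:+ i) ℕ-Solver.:+ d ℕ-Solver.:* r ℕ-Solver.:= d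
            ℕ-Solver.:* (ℕ-Solver.con 1 ℕ-Solver.:+ r) ℕ-Solver.:+ d ℕ-Solver.:* (ℕ-Solver.con 1 ℕ-Solver.:+ i)) refl d i r

    factor : ℕ → PS
    factor k = 1ₛ ⊖ mono (d ℕ.* suc k)

    -- Eliminating `gb (r + i) (suc i)` between the two Pascal rules gives the ratio of consecutive
    -- Gaussian binomials. It stands in for their formula as a quotient of q-factorials.
    gb-recurrence : ∀ r i → factor i · gb (suc (r ℕ.+ i)) (suc i) ≈ gb (r ℕ.+ i) i ⊖ mono (d ℕ.* suc i) · mono (d ℕ.* r) · gb (r ℕ.+ i) i
    gb-recurrence r i = begin
      (1ₛ ⊖ Q) · X         ≈⟨ ≈-trans (CR.distribʳ X 1ₛ (~ Q)) (⊕-cong (·-identityˡ X) ≈-refl) ⟩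
      X ⊕ ~ Q · X          ≈⟨ ⊕-cong ≈-refl (·-cong ≈-refl (pascal (r ℕ.+ i) r i refl)) ⟩
      A ⊕ Q · B ⊕ ~ Q · (B ⊕ R · A)  ≈⟨ solve 4 (λ a b q r → a :+ q :* b :+ :- q :* (b :+ r :* a) := a :- q :* r :* a) ≈-refl A B Q R ⟩
      A ⊖ Q · R · A ∎
      where
        open ≈-Reasoning
        open SeriesSolver
        A = gb (r ℕ.+ i) i
        B = gb (r ℕ.+ i) (suc i)
        X = gb (suc (r ℕ.+ i)) (suc i)
        Q = mono (d ℕ.* suc i)
        R = mono (d ℕ.* r)

    module _ (1≤d : 1 ℕ.≤ d) where

      private instance
        nz : NonZero d
        nz = ℕ.>-nonZero 1≤d

      factor-tame : Tame factor
      factor-tame k = ≈[]-trans (⊕-cong[] ≈[]-refl (~-cong[] (mono-small (ℕₚ.m≤n*m (suc k) d))))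
          (≈⇒≈[] (suc k) (pointwise (λ n → ℤₚ.+-identityʳ (1ₛ ! n))))

      -- By `gb-recurrence` each new factor lowers the binomial by one step with relative error
      -- q^(d(r + i + 1)), which vanishes to the required order.
      gb-limit : ∀ r i → ∏< i factor · gb (r ℕ.+ i) i ≈[ suc r ] 1ₛ
      gb-limit r zero    = ≈⇒≈[] (suc r) (·-identityˡ 1ₛ)
      gb-limit r (suc i) rewrite ℕₚ.+-suc r i =
        ≈[]-trans (≈⇒≈[] (suc r) (solve 3 (λ a b c → a :* b :* c := a :* (b :* c)) ≈-refl (∏< i factor) (factor i)
            (gb (suc (r ℕ.+ i)) (suc i))))
          (≈[]-trans (·-cong[] ≈[]-refl step) (gb-limit r i))
        where
          open SeriesSolver
          step : factor i · gb (suc (r ℕ.+ i)) (suc i) ≈[ suc r ] gb (r ℕ.+ i) i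
          step = ≈[]-trans (≈⇒≈[] (suc r) (gb-recurrence r i)) (≈[]-trans
            (⊕-cong[] ≈[]-refl (~-cong[] (≈[]-trans (·-cong[] (≈⇒≈[] (suc r) (≈-sym (mono-+ _ _))) ≈[]-refl)
               (≈[]-weaken (subst (suc r ℕ.≤_) (ℕₚ.*-distribˡ-+ d (suc i) r) (ℕₚ.≤-trans (s≤s (ℕₚ.m≤n+m r i)) (ℕₚ.m≤n*m (suc i ℕ.+ r) d)))
                   (mono-·-small _ _)))))
            (≈⇒≈[] (suc r) (pointwise (λ n → ℤₚ.+-identityʳ _))))

      gb-limit∞ : ∀ p r i → p ℕ.≤ r → p ℕ.≤ i → ∏∞ factor · gb (r ℕ.+ i) i ≈[ suc p ] 1ₛ
      gb-limit∞ p r i p≤r p≤i = ≈[]-trans (·-cong[] (≈[]-weaken (s≤s p≤i) (∏∞-trunc factor-tame i)) ≈[]-refl)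
          (≈[]-weaken (s≤s p≤r) (gb-limit r i))

open FiniteTripleProduct

-- The Jacobi triple product with arbitrary weights in place of u^j.

module TripleProduct where

  open import Data.Integer using (_+_; _*_; -_; _-_)

  Σbox : ℕ → (ℤ → ℤ) → ℤ
  Σbox n F = Σ< (suc (n ℕ.+ n)) (λ i → F (+ i - + n))

  shift-index : ∀ i n → + suc i - + suc n ≡ + i - + n
  shift-index i n = solve 2 (λ i n → con (+ 1) :+ i :- (con (+ 1) :+ n) := i :- n) refl (+ i) (+ n)
    where open +-*-Solver

  pred-index : ∀ i n → + i - + suc n ≡ + i - + n - + 1
  pred-index i n = solve 2 (λ i n → i :- (con (+ 1) :+ n) := i :- n :- con (+ 1)) refl (+ i) (+ n)
    where open +-*-Solver

  suc-index : ∀ i n → + suc i - + n ≡ + i - + n + + 1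
  suc-index i n = solve 2 (λ i n → con (+ 1) :+ i :- n := i :- n :+ con (+ 1)) refl (+ i) (+ n)
    where open +-*-Solver

  Σbox-suc : ∀ n F → Σbox (suc n) F ≡ F (-[1+ n ]) + (Σbox n F + F (+ suc n))
  Σbox-suc n F = cong (λ z → F -[1+ n ] + z) (begin
    Σ< (suc n ℕ.+ suc n) (λ i → F (+ suc i - + suc n))
      ≡⟨ cong (λ m → Σ< m (λ i → F (+ suc i - + suc n))) (ℕₚ.+-suc (suc n) n) ⟩
    Σ< (suc (suc (n ℕ.+ n))) (λ i → F (+ suc i - + suc n))
      ≡⟨ Σ<-cong (suc (suc (n ℕ.+ n))) (λ i _ → cong F (shift-index i n)) ⟩
    Σ< (suc (suc (n ℕ.+ n))) (λ i → F (+ i - + n))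
      ≡⟨ Σ<-last (suc (n ℕ.+ n)) (λ i → F (+ i - + n)) ⟩
    Σbox n F + F (+ suc (n ℕ.+ n) - + n)
      ≡⟨ cong (λ j → Σbox n F + F j) (solve 1 (λ n → con (+ 1) :+ (n :+ n) :- n := con (+ 1) :+ n) refl (+ n)) ⟩
    Σbox n F + F (+ suc n) ∎)
    where
      open ≡-Reasoning
      open +-*-Solver

  Σbox-extend′ : ∀ {M N} F → M ℕ.≤′ N → (∀ j → M ℕ.< ℤ.∣ j ∣ → F j ≡ + 0) → Σbox N F ≡ Σbox M F
  Σbox-extend′ F (ℕ.≤′-reflexive refl) h = refl
  Σbox-extend′ {M} {suc N} F (ℕ.≤′-step M≤N) h = begin
    Σbox (suc N) F                          ≡⟨ Σbox-suc N F ⟩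
    F -[1+ N ] + (Σbox N F + F (+ suc N))   ≡⟨ cong₂ (λ x y → x + (Σbox N F + y)) (h -[1+ N ] (s≤s (ℕₚ.≤′⇒≤ M≤N)))
        (h (+ suc N) (s≤s (ℕₚ.≤′⇒≤ M≤N))) ⟩
    + 0 + (Σbox N F + + 0)                  ≡⟨ trans (ℤₚ.+-identityˡ _) (ℤₚ.+-identityʳ _) ⟩
    Σbox N F                                ≡⟨ Σbox-extend′ F M≤N h ⟩
    Σbox M F                                ∎
    where open ≡-Reasoning

  Σbox-extend : ∀ {M N} F → M ℕ.≤ N → (∀ j → M ℕ.< ℤ.∣ j ∣ → F j ≡ + 0) → Σbox N F ≡ Σbox M F
  Σbox-extend F M≤N = Σbox-extend′ F (ℕₚ.≤⇒≤′ M≤N)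

  -- Σ_j w(j) q^(ex a b j): only |j| ≤ k + 1 can contribute to the coefficient of q^k.
  th : (a b : ℕ) → (ℤ → ℤ) → PS
  PS.coe (th a b w) k = Σbox (suc k) (λ j → w j * monoᶜ (ex a b j) k)

  th-outside : ∀ a b → 1 ℕ.≤ a ℕ.+ b → ∀ (w : ℤ → ℤ) k j → suc k ℕ.< ℤ.∣ j ∣ → w j * monoᶜ (ex a b j) k ≡ + 0
  th-outside a b 1≤d w k j k<j = trans
    (cong (w j *_) (mono-other (ex a b j) k (λ { refl → ℕₚ.<⇒≱ k<j (ex-proper a b 1≤d j) }))) (ℤₚ.*-zeroʳ (w j))

  th-at : ∀ a b → 1 ℕ.≤ a ℕ.+ b → ∀ w {k n} → k ℕ.< n → th a b w ! k ≡ Σbox n (λ j → w j * monoᶜ (ex a b j) k)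
  th-at a b 1≤d w {k} k<n = sym (Σbox-extend (λ j → w j * monoᶜ (ex a b j) k) k<n (th-outside a b 1≤d w k))

  th-cong : ∀ a b {w v : ℤ → ℤ} → (∀ j → w j ≡ v j) → th a b w ≈ th a b v
  th-cong a b p = pointwise (λ k → Σ<-cong (suc (suc k ℕ.+ suc k)) (λ i _ → cong (_* monoᶜ (ex a b (+ i - + suc k)) k) (p (+ i - + suc k))))

  ΣS-cong[] : ∀ n {h g : ℕ → PS} {N} → (∀ i → i ℕ.< n → h i ≈[ N ] g i) → ΣS n h ≈[ N ] ΣS n g
  ΣS-cong[] zero    p = ≈[]-refl
  ΣS-cong[] (suc n) p = ⊕-cong[] (p 0 (s≤s z≤n)) (ΣS-cong[] n (λ i i<n → p (suc i) (s≤s i<n)))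

  κ-≡ : ∀ {a b} → a ≡ b → κ a ≈ κ b
  κ-≡ refl = ≈-refl

  module JTP (a b : ℕ) (1≤d : 1 ℕ.≤ a ℕ.+ b) where

    d : ℕ
    d = a ℕ.+ b

    open Gauss d

    term : (ℤ → ℤ) → ℕ → ℕ → ℕ → PS
    term w N n i = κ (w (+ i - + n)) · (gb N i · mono (ex a b (+ i - + n)))

    M : (ℤ → ℤ) → ℕ → ℕ → PS
    M w N n = ΣS (suc N) (term w N n)

    exponent-pred : ∀ i n → d ℕ.* i ℕ.+ ex a b (+ i - + n - + 1) ≡ b ℕ.+ d ℕ.* n ℕ.+ ex a b (+ i - + n)
    exponent-pred i n = halve (begin
      + 2 * + (d ℕ.* i ℕ.+ ex a b (j - + 1))
        ≡⟨ cong (λ z → + 2 * (z + + ex a b (j - + 1))) (ℤₚ.pos-* d i) ⟩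
      + 2 * ((+ a + + b) * + i + + ex a b (j - + 1))
        ≡⟨ ℤₚ.*-distribˡ-+ (+ 2) ((+ a + + b) * + i) (+ ex a b (j - + 1)) ⟩
      + 2 * ((+ a + + b) * + i) + + 2 * + ex a b (j - + 1)
        ≡⟨ cong (λ z → + 2 * ((+ a + + b) * + i) + z) (ex-spec a b (j - + 1)) ⟩
      + 2 * ((+ a + + b) * + i) + ((+ a + + b) * ((j - + 1) * (j - + 1 - + 1)) + + 2 * (+ a * (j - + 1)))
        ≡⟨ solve 4 (λ a b i n → let j = i :- n in
             con (+ 2) :* ((a :+ b) :* i) :+ ((a :+ b) :* ((j :- con (+ 1)) :* (j :- con (+ 1) :- con (+ 1))) :+ con (+ 2) :*
                 (a :* (j :- con (+ 1))))
             := con (+ 2) :* (b :+ (a :+ b) :* n) :+ ((a :+ b) :* (j :* (j :- con (+ 1))) :+ con (+ 2) :* (a :* j))) refl (+ a) (+ b) (+ i)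
                 (+ n) ⟩
      + 2 * (+ b + (+ a + + b) * + n) + ((+ a + + b) * (j * (j - + 1)) + + 2 * (+ a * j))
        ≡⟨ cong (λ z → + 2 * (+ b + (+ a + + b) * + n) + z) (ex-spec a b j) ⟨
      + 2 * (+ b + (+ a + + b) * + n) + + 2 * + ex a b j
        ≡⟨ ℤₚ.*-distribˡ-+ (+ 2) (+ b + (+ a + + b) * + n) (+ ex a b j) ⟨
      + 2 * (+ b + (+ a + + b) * + n + + ex a b j)
        ≡⟨ cong (λ z → + 2 * (+ b + z + + ex a b j)) (ℤₚ.pos-* d n) ⟨
      + 2 * + (b ℕ.+ d ℕ.* n ℕ.+ ex a b j) ∎)
      where
        open ≡-Reasoning
        open +-*-Solver
        j = + i - + n

    exponent-suc : ∀ r m i n → r ℕ.+ i ≡ m ℕ.+ n → d ℕ.* r ℕ.+ ex a b (+ i - + n + + 1) ≡ a ℕ.+ d ℕ.* m ℕ.+ ex a b (+ i - + n)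
    exponent-suc r m i n eq = halve (begin
      + 2 * + (d ℕ.* r ℕ.+ ex a b (j + + 1))
        ≡⟨ cong (λ z → + 2 * (z + + ex a b (j + + 1))) (ℤₚ.pos-* d r) ⟩
      + 2 * ((+ a + + b) * + r + + ex a b (j + + 1))
        ≡⟨ ℤₚ.*-distribˡ-+ (+ 2) ((+ a + + b) * + r) (+ ex a b (j + + 1)) ⟩
      + 2 * ((+ a + + b) * + r) + + 2 * + ex a b (j + + 1)
        ≡⟨ cong₂ (λ y z → + 2 * ((+ a + + b) * y) + z) r≡ (ex-spec a b (j + + 1)) ⟩
      + 2 * ((+ a + + b) * (+ m + + n - + i)) + ((+ a + + b) * ((j + + 1) * (j + + 1 - + 1)) + + 2 * (+ a * (j + + 1)))
        ≡⟨ solve 5 (λ a b i n m → let j = i :- n in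
             con (+ 2) :* ((a :+ b) :* (m :+ n :- i)) :+ ((a :+ b) :* ((j :+ con (+ 1)) :* (j :+ con (+ 1) :- con (+ 1))) :+ con (+ 2) :*
                 (a :* (j :+ con (+ 1))))
             := con (+ 2) :* (a :+ (a :+ b) :* m) :+ ((a :+ b) :* (j :* (j :- con (+ 1))) :+ con (+ 2) :* (a :* j))) refl (+ a) (+ b) (+ i)
                 (+ n) (+ m) ⟩
      + 2 * (+ a + (+ a + + b) * + m) + ((+ a + + b) * (j * (j - + 1)) + + 2 * (+ a * j))
        ≡⟨ cong (λ z → + 2 * (+ a + (+ a + + b) * + m) + z) (ex-spec a b j) ⟨
      + 2 * (+ a + (+ a + + b) * + m) + + 2 * + ex a b j
        ≡⟨ ℤₚ.*-distribˡ-+ (+ 2) (+ a + (+ a + + b) * + m) (+ ex a b j) ⟨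
      + 2 * (+ a + (+ a + + b) * + m + + ex a b j)
        ≡⟨ cong (λ z → + 2 * (+ a + z + + ex a b j)) (ℤₚ.pos-* d m) ⟨
      + 2 * + (a ℕ.+ d ℕ.* m ℕ.+ ex a b j) ∎)
      where
        open ≡-Reasoning
        open +-*-Solver
        j = + i - + n
        r≡ : + r ≡ + m + + n - + i
        r≡ = trans (solve 2 (λ r i → r := r :+ i :- i) refl (+ r) (+ i)) (cong (λ z → + z - + i) eq)

    -- This adjoins the factor 1 + u⁻¹ q^(b + dn). The defining Pascal rule yields the old sum, and
    -- its second term is the same sum with u shifted down, by `exponent-pred`.
    M-predecessor : ∀ w N n → M w (suc N) (suc n) ≈ M w N n ⊕ mono (b ℕ.+ d ℕ.* n) · M (λ j → w (j - + 1)) N n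
    M-predecessor w N n = begin
      term w (suc N) (suc n) 0 ⊕ ΣS (suc N) (λ i → term w (suc N) (suc n) (suc i))
        ≈⟨ ⊕-cong first (≈-trans (ΣS-cong (suc N) (λ i _ → split i)) (ΣS-⊕ (suc N) (term w N n) (u ∘ suc))) ⟩
      u 0 ⊕ (M w N n ⊕ ΣS (suc N) (u ∘ suc))
        ≈⟨ solve 3 (λ x y z → x :+ (y :+ z) := y :+ (x :+ z)) ≈-refl (u 0) (M w N n) (ΣS (suc N) (u ∘ suc)) ⟩
      M w N n ⊕ ΣS (suc (suc N)) u
        ≈⟨ ⊕-cong ≈-refl (≈-trans (ΣS-last (suc N) u) (≈-trans (⊕-cong ≈-refl last) (⊕-identityʳ (ΣS (suc N) u)))) ⟩
      M w N n ⊕ ΣS (suc N) u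
        ≈⟨ ⊕-cong ≈-refl (≈-trans (ΣS-cong (suc N) (λ i _ → collect i))
            (ΣS-·ˡ (suc N) (mono (b ℕ.+ d ℕ.* n)) (term (λ j → w (j - + 1)) N n))) ⟩
      M w N n ⊕ mono (b ℕ.+ d ℕ.* n) · M (λ j → w (j - + 1)) N n ∎
      where
        open ≈-Reasoning
        open SeriesSolver
        u : ℕ → PS
        u i = κ (w (+ i - + suc n)) · (mono (d ℕ.* i) · gb N i · mono (ex a b (+ i - + suc n)))
        first : term w (suc N) (suc n) 0 ≈ u 0
        first = ·-cong ≈-refl (·-cong (≈-sym (≈-trans (·-cong (≈-trans (mono-≡ (ℕₚ.*-zeroʳ d)) mono-0) ≈-refl) (·-identityˡ 1ₛ))) ≈-refl)
        split : ∀ i → term w (suc N) (suc n) (suc i) ≈ term w N n i ⊕ u (suc i)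
        split i = ≈-trans
          (solve 5 (λ k g q h m → k :* ((g :+ q :* h) :* m) := k :* (g :* m) :+ k :* (q :* h :* m)) ≈-refl (κ (w (+ suc i - + suc n)))
              (gb N i) (mono (d ℕ.* suc i)) (gb N (suc i)) (mono (ex a b (+ suc i - + suc n))))
          (⊕-cong (·-cong (κ-≡ (cong w (shift-index i n))) (·-cong ≈-refl (mono-≡ (cong (ex a b) (shift-index i n))))) ≈-refl)
        last : u (suc N) ≈ 0ₛ
        last = ≈-trans (solve 4 (λ k q g m → k :* (q :* g :* m) := k :* q :* m :* g) ≈-refl (κ (w (+ suc N - + suc n)))
            (mono (d ℕ.* suc N)) (gb N (suc N)) (mono (ex a b (+ suc N - + suc n))))
                 (≈-trans (·-cong ≈-refl (gb-above N (suc N) ℕₚ.≤-refl)) (·-zeroʳ _))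
        index : ∀ i → + i - + suc n ≡ + i - + n - + 1
        index i = pred-index i n
        collect : ∀ i → u i ≈ mono (b ℕ.+ d ℕ.* n) · term (λ j → w (j - + 1)) N n i
        collect i = begin
          κ (w (+ i - + suc n)) · (mono (d ℕ.* i) · gb N i · mono (ex a b (+ i - + suc n)))
            ≈⟨ ·-cong (κ-≡ (cong w (index i))) (·-cong ≈-refl (mono-≡ (cong (ex a b) (index i)))) ⟩
          κ w′ · (mono (d ℕ.* i) · gb N i · mono (ex a b (+ i - + n - + 1)))
            ≈⟨ solve 4 (λ k q g m → k :* (q :* g :* m) := (q :* m) :* (k :* g)) ≈-refl (κ w′) (mono (d ℕ.* i)) (gb N i)
                (mono (ex a b (+ i - + n - + 1))) ⟩
          mono (d ℕ.* i) · mono (ex a b (+ i - + n - + 1)) · (κ w′ · gb N i)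
            ≈⟨ ·-cong (≈-trans (mono-·-mono (exponent-pred i n)) (mono-+ _ _)) ≈-refl ⟩
          mono (b ℕ.+ d ℕ.* n) · mono (ex a b (+ i - + n)) · (κ w′ · gb N i)
            ≈⟨ solve 4 (λ q m k g → q :* m :* (k :* g) := q :* (k :* (g :* m))) ≈-refl (mono (b ℕ.+ d ℕ.* n)) (mono (ex a b (+ i - + n)))
                (κ w′) (gb N i) ⟩
          mono (b ℕ.+ d ℕ.* n) · (κ w′ · (gb N i · mono (ex a b (+ i - + n)))) ∎
          where w′ = w (+ i - + n - + 1)

    -- This adjoins the factor 1 + u q^(a + dm). The shift of u is now upward, so the second Pascal
    -- rule is the suitable one: its power d(N - i) combines with the exponent through
    -- `exponent-suc`.
    M-successor : ∀ w N m n → N ≡ m ℕ.+ n → M w (suc N) n ≈ M w N n ⊕ mono (a ℕ.+ d ℕ.* m) · M (λ j → w (j + + 1)) N n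
    M-successor w N m n N≡m+n = begin
      term w N n 0 ⊕ ΣS (suc N) (λ i → term w (suc N) n (suc i))
        ≈⟨ ⊕-cong ≈-refl (≈-trans (ΣS-cong (suc N) (λ { i (s≤s i≤N) → split i i≤N }))
            (ΣS-⊕ (suc N) (term w N n ∘ suc) (λ i → q · term w′ N n i))) ⟩
      term w N n 0 ⊕ (ΣS (suc N) (term w N n ∘ suc) ⊕ ΣS (suc N) (λ i → q · term w′ N n i))
        ≈⟨ solve 3 (λ x y z → x :+ (y :+ z) := x :+ y :+ z) ≈-refl (term w N n 0) (ΣS (suc N) (term w N n ∘ suc))
            (ΣS (suc N) (λ i → q · term w′ N n i)) ⟩
      ΣS (suc (suc N)) (term w N n) ⊕ ΣS (suc N) (λ i → q · term w′ N n i)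
        ≈⟨ ⊕-cong (≈-trans (ΣS-last (suc N) (term w N n)) (≈-trans (⊕-cong ≈-refl last) (⊕-identityʳ (M w N n))))
            (ΣS-·ˡ (suc N) q (term w′ N n)) ⟩
      M w N n ⊕ q · M w′ N n ∎
      where
        open ≈-Reasoning
        open SeriesSolver
        q = mono (a ℕ.+ d ℕ.* m)
        w′ : ℤ → ℤ
        w′ j = w (j + + 1)
        last : term w N n (suc N) ≈ 0ₛ
        last = ≈-trans (solve 3 (λ k g m → k :* (g :* m) := k :* m :* g) ≈-refl (κ (w (+ suc N - + n))) (gb N (suc N))
            (mono (ex a b (+ suc N - + n))))
                 (≈-trans (·-cong ≈-refl (gb-above N (suc N) ℕₚ.≤-refl)) (·-zeroʳ _))
        index : ∀ i → + suc i - + n ≡ + i - + n + + 1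
        index i = suc-index i n
        split : ∀ i → i ℕ.≤ N → term w (suc N) n (suc i) ≈ term w N n (suc i) ⊕ q · term w′ N n i
        split i i≤N = begin
          κ (w (+ suc i - + n)) · (gb (suc N) (suc i) · mono (ex a b (+ suc i - + n)))
            ≈⟨ ·-cong ≈-refl (·-cong (pascal N r i r+i≡N) ≈-refl) ⟩
          κ (w (+ suc i - + n)) · ((gb N (suc i) ⊕ mono (d ℕ.* r) · gb N i) · mono (ex a b (+ suc i - + n)))
            ≈⟨ solve 5 (λ k g q h m → k :* ((g :+ q :* h) :* m) := k :* (g :* m) :+ q :* m :* (k :* h)) ≈-refl (κ (w (+ suc i - + n)))
                (gb N (suc i)) (mono (d ℕ.* r)) (gb N i) (mono (ex a b (+ suc i - + n))) ⟩
          term w N n (suc i) ⊕ mono (d ℕ.* r) · mono (ex a b (+ suc i - + n)) · (κ (w (+ suc i - + n)) · gb N i)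
            ≈⟨ ⊕-cong ≈-refl (·-cong (·-cong ≈-refl (mono-≡ (cong (ex a b) (index i)))) (·-cong (κ-≡ (cong w (index i))) ≈-refl)) ⟩
          term w N n (suc i) ⊕ mono (d ℕ.* r) · mono (ex a b (+ i - + n + + 1)) · (κ (w′ (+ i - + n)) · gb N i)
            ≈⟨ ⊕-cong ≈-refl (·-cong (≈-trans (mono-·-mono (exponent-suc r m i n (trans r+i≡N N≡m+n))) (mono-+ _ _)) ≈-refl) ⟩
          term w N n (suc i) ⊕ q · mono (ex a b (+ i - + n)) · (κ (w′ (+ i - + n)) · gb N i)
            ≈⟨ ⊕-cong ≈-refl (solve 4 (λ q m k g → q :* m :* (k :* g) := q :* (k :* (g :* m))) ≈-refl q (mono (ex a b (+ i - + n)))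
                (κ (w′ (+ i - + n))) (gb N i)) ⟩
          term w N n (suc i) ⊕ q · term w′ N n i ∎
          where
            r = N ℕ.∸ i
            r+i≡N : r ℕ.+ i ≡ N
            r+i≡N = ℕₚ.m∸n+n≡m i≤N

    -- The weighted expansion of ∏_{k<m} (1 + u q^(a+dk)) ∏_{k<n} (1 + u⁻¹ q^(b+dk)), with u^j replaced by w j.
    MM : (ℤ → ℤ) → ℕ → ℕ → PS
    MM w m n = M w (m ℕ.+ n) n

    MM-sucˡ : ∀ w m n → MM w (suc m) n ≈ MM w m n ⊕ mono (a ℕ.+ d ℕ.* m) · MM (λ j → w (j + + 1)) m n
    MM-sucˡ w m n = M-successor w (m ℕ.+ n) m n refl

    MM-sucʳ : ∀ w m n → MM w m (suc n) ≈ MM w m n ⊕ mono (b ℕ.+ d ℕ.* n) · MM (λ j → w (j - + 1)) m n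
    MM-sucʳ w m n rewrite ℕₚ.+-suc m n = M-predecessor w (m ℕ.+ n) n

    MM-0 : ∀ w → MM w 0 0 ≈ κ (w (+ 0))
    MM-0 w = ≈-trans (⊕-identityʳ _) (≈-trans (·-cong ≈-refl (≈-trans (·-identityˡ _)
        (≈-trans (mono-≡ (cong₂ ℕ._+_ (ℕₚ.*-zeroʳ d) (ℕₚ.*-zeroʳ a))) mono-0))) (·-identityʳ _))

    MM-linear : ∀ x y w v {u : ℤ → ℤ} → (∀ j → u j ≡ x * w j + y * v j) → ∀ m n → MM u m n ≈ κ x · MM w m n ⊕ κ y · MM v m n
    MM-linear x y w v {u} p m n = ≈-trans (ΣS-cong (suc L) (λ i _ → step i))
      (≈-trans (ΣS-⊕ (suc L) (λ i → κ x · term w L n i) (λ i → κ y · term v L n i))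
          (⊕-cong (ΣS-·ˡ (suc L) (κ x) (term w L n)) (ΣS-·ˡ (suc L) (κ y) (term v L n))))
      where
        open SeriesSolver
        L = m ℕ.+ n
        κ-lin : ∀ j → κ (u j) ≈ κ x · κ (w j) ⊕ κ y · κ (v j)
        κ-lin j = ≈-trans (κ-≡ (p j)) (pointwise λ
          { zero → sym (cong₂ _+_ (κ-·-at x (κ (w j)) 0) (κ-·-at y (κ (v j)) 0))
          ; (suc k) → sym (cong₂ _+_ (trans (κ-·-at x (κ (w j)) (suc k)) (ℤₚ.*-zeroʳ x))
              (trans (κ-·-at y (κ (v j)) (suc k)) (ℤₚ.*-zeroʳ y))) })
        step : ∀ i → term u L n i ≈ κ x · term w L n i ⊕ κ y · term v L n i
        step i = ≈-trans (·-cong (κ-lin (+ i - + n)) ≈-refl)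
          (solve 5 (λ x w y v t → (x :* w :+ y :* v) :* t := x :* (w :* t) :+ y :* (v :* t)) ≈-refl (κ x) (κ (w (+ i - + n))) (κ y)
              (κ (v (+ i - + n))) (gb L i · mono (ex a b (+ i - + n))))

    distance : ∀ i n → i ℕ.≤ n ℕ.+ n → n ℕ.≤ ℤ.∣ + i - + n ∣ ℕ.+ (n ℕ.+ n ℕ.∸ i) × n ℕ.≤ ℤ.∣ + i - + n ∣ ℕ.+ i
    distance i n i≤2n =
        ℕₚ.≤-trans (ℕₚ.≤-reflexive (sym (cong ℤ.∣_∣ (trans (cong (λ z → + i - + n + z) (r≡))
            (solve 2 (λ i n → i :- n :+ (n :+ n :- i) := n) refl (+ i) (+ n)))))) (ℤₚ.∣i+j∣≤∣i∣+∣j∣ (+ i - + n) (+ (n ℕ.+ n ℕ.∸ i)))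
      , ℕₚ.≤-trans (ℕₚ.≤-reflexive (sym (cong ℤ.∣_∣ (solve 2 (λ i n → i :- (i :- n) := n) refl (+ i) (+ n)))))
          (ℕₚ.≤-trans (ℤₚ.∣i-j∣≤∣i∣+∣j∣ (+ i) (+ i - + n)) (ℕₚ.≤-reflexive (ℕₚ.+-comm i _)))
      where
        open +-*-Solver
        r≡ : + (n ℕ.+ n ℕ.∸ i) ≡ + n + + n - + i
        r≡ = trans (solve 2 (λ r i → r := r :+ i :- i) refl (+ (n ℕ.+ n ℕ.∸ i)) (+ i)) (cong (λ z → + z - + i) (ℕₚ.m∸n+n≡m i≤2n))

    E : PS
    E = ∏∞ factor

    -- Term i carries a monomial of order at least |j| - 1 with j = i - n, while `E` times its
    -- Gaussian binomial is 1 + O(q^(p + 1)) with p = min(2n - i, i). Since |j| + p ≥ n by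
    -- `distance`, each term is exact modulo q^n, whatever the weight.
    E·MM : ∀ w n → E · MM w n n ≈[ n ] th a b w
    E·MM w n = ≈[]-trans (≈⇒≈[] n (≈-sym (ΣS-·ˡ (suc (n ℕ.+ n)) E (term w (n ℕ.+ n) n))))
      (≈[]-trans (ΣS-cong[] (suc (n ℕ.+ n)) (λ { i (s≤s i≤2n) → step i i≤2n })) (modulo coefficients))
      where
        open SeriesSolver
        t : ℕ → PS
        t i = κ (w (+ i - + n)) · mono (ex a b (+ i - + n))
        step : ∀ i → i ℕ.≤ n ℕ.+ n → E · term w (n ℕ.+ n) n i ≈[ n ] t i
        step i i≤2n = ≈[]-trans
          (≈⇒≈[] n (solve 4 (λ e k g m → e :* (k :* (g :* m)) := k :* (m :* (e :* g))) ≈-refl E (κ (w j)) (gb (n ℕ.+ n) i)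
              (mono (ex a b j))))
          (·-cong[] ≈[]-refl (≈[]-trans (≈[]-weaken precise (mono-·-cong[] (ex a b j) limit)) (≈⇒≈[] n (·-identityʳ _))))
          where
            j = + i - + n
            r = n ℕ.+ n ℕ.∸ i
            p = r ℕ.⊓ i
            limit : E · gb (n ℕ.+ n) i ≈[ suc p ] 1ₛ
            limit = subst (λ N → E · gb N i ≈[ suc p ] 1ₛ) (ℕₚ.m∸n+n≡m i≤2n) (gb-limit∞ 1≤d p r i (ℕₚ.m⊓n≤m r i) (ℕₚ.m⊓n≤n r i))
            -- The 1 lost in `ex-proper` is regained from `suc p`, the precision of the binomial
            -- limit.
            precise : n ℕ.≤ ex a b j ℕ.+ suc p
            precise = ℕₚ.≤-trans near (ℕₚ.≤-trans (ℕₚ.+-monoˡ-≤ p (ex-proper a b 1≤d j)) (ℕₚ.≤-reflexive (sym (ℕₚ.+-suc (ex a b j) p))))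
              where
                near : n ℕ.≤ ℤ.∣ j ∣ ℕ.+ p
                near with ℕₚ.⊓-sel r i
                ... | inj₁ p≡r = subst (λ z → n ℕ.≤ ℤ.∣ j ∣ ℕ.+ z) (sym p≡r) (proj₁ (distance i n i≤2n))
                ... | inj₂ p≡i = subst (λ z → n ℕ.≤ ℤ.∣ j ∣ ℕ.+ z) (sym p≡i) (proj₂ (distance i n i≤2n))
        coefficients : ∀ k → k ℕ.< n → ΣS (suc (n ℕ.+ n)) t ! k ≡ th a b w ! k
        coefficients k k<n = trans (ΣS-at (suc (n ℕ.+ n)) t k)
          (trans (Σ<-cong (suc (n ℕ.+ n)) (λ i _ → κ-·-at (w (+ i - + n)) (mono (ex a b (+ i - + n))) k))
          (sym (th-at a b 1≤d w k<n)))

    module _ (c : ℤ) (w : ℤ → ℤ) (w-0 : w (+ 0) ≡ + 1) (w-suc : ∀ j → w (j + + 1) ≡ c * w j) (w-pred : ∀ j → w (j - + 1) ≡ c * w j) where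

      up down : ℕ → PS
      up   k = 1ₛ ⊕ κ c · mono (a ℕ.+ d ℕ.* k)
      down k = 1ₛ ⊕ κ c · mono (b ℕ.+ d ℕ.* k)

      MM-scale : ∀ {v : ℤ → ℤ} → (∀ j → v j ≡ c * w j) → ∀ m n → MM v m n ≈ κ c · MM w m n
      MM-scale {v} p m n = ≈-trans (MM-linear c (+ 0) w w {v} (λ j → trans (p j)
          (sym (trans (cong (λ z → c * w j + z) (ℤₚ.*-zeroˡ (w j))) (ℤₚ.+-identityʳ _)))) m n)
        (solve 2 (λ x y → x :* y :+ con (+ 0) :* y := x :* y) ≈-refl (κ c) (MM w m n))
        where open SeriesSolver

      -- A weight that both shifts multiply by the same c, with w 0 = 1, is u^j at u = u⁻¹ = c. Each
      -- recurrence then multiplies by one factor. The cases used are c = 1 and c = -1.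
      MM-product : ∀ m n → MM w m n ≈ ∏< m up · ∏< n down
      MM-product zero zero = ≈-trans (MM-0 w) (≈-trans (κ-≡ w-0) (≈-trans (pointwise (λ k → sym (oneS≗κ k))) (≈-sym (·-identityˡ 1ₛ))))
      MM-product (suc m) n = ≈-trans (MM-sucˡ w m n) (≈-trans (⊕-cong ≈-refl (·-cong ≈-refl (MM-scale w-suc m n)))
        (≈-trans (⊕-cong (≈-sym (·-identityˡ _)) ≈-refl) (≈-trans (solve 4 (λ o q x y → o :* y :+ q :* (x :* y) := (o :+ x :* q) :* y)
            ≈-refl 1ₛ (mono (a ℕ.+ d ℕ.* m)) (κ c) (MM w m n))
        (≈-trans (·-cong ≈-refl (MM-product m n)) (solve 3 (λ u p r → u :* (p :* r) := p :* u :* r) ≈-refl (up m) (∏< m up) (∏< n down))))))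
        where open SeriesSolver
      MM-product zero (suc n) = ≈-trans (MM-sucʳ w 0 n) (≈-trans (⊕-cong ≈-refl (·-cong ≈-refl (MM-scale w-pred 0 n)))
        (≈-trans (⊕-cong (≈-sym (·-identityˡ _)) ≈-refl) (≈-trans (solve 4 (λ o q x y → o :* y :+ q :* (x :* y) := (o :+ x :* q) :* y)
            ≈-refl 1ₛ (mono (b ℕ.+ d ℕ.* n)) (κ c) (MM w 0 n))
        (≈-trans (·-cong ≈-refl (MM-product 0 n)) (solve 3 (λ u p r → u :* (p :* r) := p :* (r :* u)) ≈-refl (down n) 1ₛ (∏< n down))))))
        where open SeriesSolver

      tame-shape : ∀ e → 1 ℕ.≤ e → Tame (λ k → 1ₛ ⊕ κ c · mono (e ℕ.+ d ℕ.* k))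
      tame-shape e 1≤e k = ≈[]-trans (⊕-cong[] ≈[]-refl (≈[]-trans (·-cong[] ≈[]-refl
          (mono-small (ℕₚ.+-mono-≤ 1≤e (ℕₚ.m≤n*m k d {{ℕ.>-nonZero 1≤d}})))) (≈⇒≈[] (suc k) (·-zeroʳ _)))) (≈⇒≈[] (suc k) (⊕-identityʳ 1ₛ))

      triple-product : 1 ℕ.≤ a → 1 ℕ.≤ b → th a b w ≈ E · (∏∞ up · ∏∞ down)
      triple-product 1≤a 1≤b = ≈[]-all (λ N → ≈[]-sym (≈[]-trans
        (·-cong[] ≈[]-refl (≈[]-trans (≈[]-weaken (ℕₚ.n≤1+n N) (·-cong[] (∏∞-trunc (tame-shape a 1≤a) N) (∏∞-trunc (tame-shape b 1≤b) N)))
            (≈⇒≈[] N (≈-sym (MM-product N N)))))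
        (E·MM w N)))

open TripleProduct

-- The degenerate triple product, Jacobi's cube identity and second logarithmic derivatives.

module LogDerivative where

  open import Data.Integer using (_+_; _*_; -_; _-_)

  one-w : ℤ → ℤ
  one-w _ = + 1

  sgnℤ : ℤ → ℤ
  sgnℤ j = sgn ℤ.∣ j ∣

  sgnℤ-suc : ∀ j → sgnℤ (j + + 1) ≡ -[1+ 0 ] * sgnℤ j
  sgnℤ-suc (+ n) = trans (cong sgn (ℕₚ.+-comm n 1)) (sym (ℤₚ.-1*i≡-i (sgn n)))
  sgnℤ-suc -[1+ zero ] = refl
  sgnℤ-suc -[1+ suc n ] = sym (trans (ℤₚ.-1*i≡-i (- sgn (suc n))) (ℤₚ.neg-involutive (sgn (suc n))))

  sgnℤ-pred : ∀ j → sgnℤ (j - + 1) ≡ -[1+ 0 ] * sgnℤ j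
  sgnℤ-pred j = begin
    sgnℤ (j - + 1)                              ≡⟨ solve 1 (λ x → x := con -[1+ 0 ] :* (con -[1+ 0 ] :* x)) refl (sgnℤ (j - + 1)) ⟩
    -[1+ 0 ] * (-[1+ 0 ] * sgnℤ (j - + 1))      ≡⟨ cong (-[1+ 0 ] *_) (sgnℤ-suc (j - + 1)) ⟨
    -[1+ 0 ] * sgnℤ (j - + 1 + + 1)             ≡⟨ cong (λ z → -[1+ 0 ] * sgnℤ z) (solve 1 (λ j → j :- con (+ 1) :+ con (+ 1) := j) refl j)
        ⟩
    -[1+ 0 ] * sgnℤ j                           ∎
    where
      open ≡-Reasoning
      open +-*-Solver

  1ₛ≈κ : 1ₛ ≈ κ (+ 1)
  1ₛ≈κ = pointwise oneS≗κ

  module ZeroJTP (D : ℕ) (1≤D : 1 ℕ.≤ D) where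
    open JTP 0 D 1≤D public

    tame-down : ∀ c → Tame (λ k → 1ₛ ⊕ κ c · mono (D ℕ.+ D ℕ.* k))
    tame-down c k = ≈[]-trans (⊕-cong[] ≈[]-refl (≈[]-trans (·-cong[] ≈[]-refl
        (mono-small (ℕₚ.+-mono-≤ 1≤D (ℕₚ.m≤n*m k D {{ℕ.>-nonZero 1≤D}})))) (≈⇒≈[] (suc k) (·-zeroʳ _)))) (≈⇒≈[] (suc k) (⊕-identityʳ 1ₛ))

    -- For a = 0 the first upper factor is the constant 1 + c, which is not 1 + O(q). It is split
    -- off: it becomes the 2 in `triple-product-0`, and the zero in `signed` when c = -1.
    upper : ∀ c n → ∏< (suc n) (λ k → 1ₛ ⊕ κ c · mono (D ℕ.* k)) ≈ (1ₛ ⊕ κ c) · ∏< n (λ k → 1ₛ ⊕ κ c · mono (D ℕ.+ D ℕ.* k))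
    upper c n = ≈-trans (∏<-first n _) (·-cong (⊕-cong ≈-refl (≈-trans (·-cong ≈-refl (≈-trans (mono-≡ (ℕₚ.*-zeroʳ D)) mono-0))
        (·-identityʳ (κ c))))
      (∏<-cong n (λ k → ⊕-cong ≈-refl (·-cong ≈-refl (mono-≡ (ℕₚ.*-suc D k))))))

    triple-product-0 : th 0 D one-w ≈ κ (+ 2) · (E · (∏∞ (λ k → 1ₛ ⊕ κ (+ 1) · mono (D ℕ.+ D ℕ.* k)) · ∏∞
        (λ k → 1ₛ ⊕ κ (+ 1) · mono (D ℕ.+ D ℕ.* k))))
    triple-product-0 = ≈[]-all (λ L → ≈[]-sym (≈[]-trans (body L) (≈[]-weaken (ℕₚ.n≤1+n L) (E·MM one-w (suc L)))))
      where
        open SeriesSolver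
        h : ℕ → PS
        h k = 1ₛ ⊕ κ (+ 1) · mono (D ℕ.+ D ℕ.* k)
        finite : ∀ L → MM one-w (suc L) (suc L) ≈ (1ₛ ⊕ κ (+ 1)) · ∏< L h · ∏< (suc L) h
        finite L = ≈-trans (MM-product (+ 1) one-w refl (λ _ → refl) (λ _ → refl) (suc L) (suc L)) (·-cong (upper (+ 1) L) ≈-refl)
        body : ∀ L → κ (+ 2) · (E · (∏∞ h · ∏∞ h)) ≈[ L ] E · MM one-w (suc L) (suc L)
        body L = ≈[]-trans (·-cong[] ≈[]-refl (·-cong[] ≈[]-refl (·-cong[] (≈[]-weaken (ℕₚ.n≤1+n L) (∏∞-trunc (tame-down (+ 1)) L))
            (≈[]-weaken (ℕₚ.m≤n⇒m≤1+n (ℕₚ.n≤1+n L)) (∏∞-trunc (tame-down (+ 1)) (suc L))))))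
          (≈⇒≈[] L (≈-trans (solve 3 (λ e x y → con (+ 2) :* (e :* (x :* y)) := e :* ((con (+ 1) :+ con (+ 1)) :* x :* y)) ≈-refl E
              (∏< L h) (∏< (suc L) h))
            (≈-sym (·-cong ≈-refl (≈-trans (finite L) (·-cong (·-cong (⊕-cong 1ₛ≈κ ≈-refl) ≈-refl) ≈-refl))))))

    -- The weight that represents u d/du at u = -1.
    w₁ : ℤ → ℤ
    w₁ j = sgnℤ j * j

    signed : ∀ m n → MM sgnℤ (suc m) n ≈ 0ₛ
    signed m n = ≈-trans (MM-product -[1+ 0 ] sgnℤ refl sgnℤ-suc sgnℤ-pred (suc m) n)
      (≈-trans (·-cong (≈-trans (upper -[1+ 0 ] m) (·-cong zero-factor ≈-refl)) ≈-refl)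
        (solve 2 (λ x y → con (+ 0) :* x :* y := con (+ 0)) ≈-refl _ _ ⟨≈⟩ pointwise (λ { zero → refl ; (suc k) → refl })))
      where
        open SeriesSolver
        infixl 4 _⟨≈⟩_
        _⟨≈⟩_ = ≈-trans
        zero-factor : 1ₛ ⊕ κ -[1+ 0 ] ≈ κ (+ 0)
        zero-factor = pointwise λ { zero → refl ; (suc k) → refl }

    w₁-suc : ∀ j → w₁ (j + + 1) ≡ -[1+ 0 ] * w₁ j + -[1+ 0 ] * sgnℤ j
    w₁-suc j = trans (cong (_* (j + + 1)) (sgnℤ-suc j)) (solve 2 (λ s j → con -[1+ 0 ] :* s :* (j :+ con (+ 1)) := con -[1+ 0 ] :* (s :* j)
        :+ con -[1+ 0 ] :* s) refl (sgnℤ j) j)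
      where open +-*-Solver

    w₁-pred : ∀ j → w₁ (j - + 1) ≡ -[1+ 0 ] * w₁ j + + 1 * sgnℤ j
    w₁-pred j = trans (cong (_* (j - + 1)) (sgnℤ-pred j)) (solve 2
        (λ s j → con -[1+ 0 ] :* s :* (j :- con (+ 1)) := con -[1+ 0 ] :* (s :* j) :+ con (+ 1) :* s) refl (sgnℤ j) j)
      where open +-*-Solver

    minus : ℕ → PS
    minus k = 1ₛ ⊕ κ -[1+ 0 ] · mono (D ℕ.+ D ℕ.* k)

    -- The product has the form (1 + u) P(u), so at u = -1 only the derivative of 1 + u survives,
    -- and u d/du contributes the sign. In the recurrences the undifferentiated terms drop out by
    -- `signed`.
    signed-moment : ∀ m n → MM w₁ (suc m) n ≈ ~ (∏< m minus · ∏< n minus)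
    signed-moment zero zero = ≈-trans (MM-sucˡ w₁ 0 0) (≈-trans
      (⊕-cong (MM-0 w₁) (·-cong (≈-trans (mono-≡ (ℕₚ.*-zeroʳ D)) mono-0) (MM-0 (λ j → w₁ (j + + 1)))))
      (≈-trans (⊕-cong ≈-refl (·-cong 1ₛ≈κ ≈-refl)) (≈-trans (solve 0
          (con (+ 0) :+ con (+ 1) :* con -[1+ 0 ] := :- (con (+ 1) :* con (+ 1))) ≈-refl)
        (~-cong (·-cong (≈-sym 1ₛ≈κ) (≈-sym 1ₛ≈κ))))))
      where open SeriesSolver
    signed-moment (suc m) n = begin
      MM w₁ (suc (suc m)) n
        ≈⟨ MM-sucˡ w₁ (suc m) n ⟩
      MM w₁ (suc m) n ⊕ mono (D ℕ.* suc m) · MM (λ j → w₁ (j + + 1)) (suc m) n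
        ≈⟨ ⊕-cong ≈-refl (·-cong (mono-≡ (ℕₚ.*-suc D m)) (MM-linear -[1+ 0 ] -[1+ 0 ] w₁ sgnℤ w₁-suc (suc m) n)) ⟩
      MM w₁ (suc m) n ⊕ x · (κ -[1+ 0 ] · MM w₁ (suc m) n ⊕ κ -[1+ 0 ] · MM sgnℤ (suc m) n)
        ≈⟨ ⊕-cong (signed-moment m n) (·-cong ≈-refl (⊕-cong (·-cong ≈-refl (signed-moment m n))
            (·-cong ≈-refl (≈-trans (signed m n) 0ₛ≈κ)))) ⟩
      ~ (p · r) ⊕ x · (κ -[1+ 0 ] · ~ (p · r) ⊕ κ -[1+ 0 ] · κ (+ 0))
        ≈⟨ solve 3 (λ p r x → :- (p :* r) :+ x :* (con -[1+ 0 ] :* :- (p :* r) :+ con -[1+ 0 ] :* con (+ 0)) := :-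
            (p :* (con (+ 1) :+ con -[1+ 0 ] :* x) :* r)) ≈-refl p r x ⟩
      ~ (p · (κ (+ 1) ⊕ κ -[1+ 0 ] · x) · r)
        ≈⟨ ~-cong (·-cong (·-cong ≈-refl (⊕-cong (≈-sym 1ₛ≈κ) ≈-refl)) ≈-refl) ⟩
      ~ (∏< (suc m) minus · ∏< n minus) ∎
      where
        open ≈-Reasoning
        open SeriesSolver
        x = mono (D ℕ.+ D ℕ.* m)
        p = ∏< m minus
        r = ∏< n minus
        0ₛ≈κ : 0ₛ ≈ κ (+ 0)
        0ₛ≈κ = pointwise λ { zero → refl ; (suc k) → refl }
    signed-moment zero (suc n) = begin
      MM w₁ 1 (suc n)
        ≈⟨ MM-sucʳ w₁ 1 n ⟩
      MM w₁ 1 n ⊕ x · MM (λ j → w₁ (j - + 1)) 1 n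
        ≈⟨ ⊕-cong ≈-refl (·-cong ≈-refl (MM-linear -[1+ 0 ] (+ 1) w₁ sgnℤ w₁-pred 1 n)) ⟩
      MM w₁ 1 n ⊕ x · (κ -[1+ 0 ] · MM w₁ 1 n ⊕ κ (+ 1) · MM sgnℤ 1 n)
        ≈⟨ ⊕-cong (signed-moment 0 n) (·-cong ≈-refl (⊕-cong (·-cong ≈-refl (signed-moment 0 n))
            (·-cong ≈-refl (≈-trans (signed 0 n) 0ₛ≈κ)))) ⟩
      ~ (1ₛ · r) ⊕ x · (κ -[1+ 0 ] · ~ (1ₛ · r) ⊕ κ (+ 1) · κ (+ 0))
        ≈⟨ solve 3 (λ p r x → :- (p :* r) :+ x :* (con -[1+ 0 ] :* :- (p :* r) :+ con (+ 1) :* con (+ 0)) := :-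
            (p :* (r :* (con (+ 1) :+ con -[1+ 0 ] :* x)))) ≈-refl 1ₛ r x ⟩
      ~ (1ₛ · (r · (κ (+ 1) ⊕ κ -[1+ 0 ] · x)))
        ≈⟨ ~-cong (·-cong ≈-refl (·-cong ≈-refl (⊕-cong (≈-sym 1ₛ≈κ) ≈-refl))) ⟩
      ~ (1ₛ · ∏< (suc n) minus) ∎
      where
        open ≈-Reasoning
        open SeriesSolver
        x = mono (D ℕ.+ D ℕ.* n)
        r = ∏< n minus
        0ₛ≈κ : 0ₛ ≈ κ (+ 0)
        0ₛ≈κ = pointwise λ { zero → refl ; (suc k) → refl }

    jacobi-cube : th 0 D w₁ ≈ ~ (E · (∏∞ minus · ∏∞ minus))
    jacobi-cube = ≈[]-all (λ L → ≈[]-sym (≈[]-trans (body L) (≈[]-weaken (ℕₚ.n≤1+n L) (E·MM w₁ (suc L)))))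
      where
        open SeriesSolver
        body : ∀ L → ~ (E · (∏∞ minus · ∏∞ minus)) ≈[ L ] E · MM w₁ (suc L) (suc L)
        body L = ≈[]-trans (~-cong[] (·-cong[] ≈[]-refl (·-cong[] (≈[]-weaken (ℕₚ.n≤1+n L) (∏∞-trunc (tame-down -[1+ 0 ]) L))
            (≈[]-weaken (ℕₚ.m≤n⇒m≤1+n (ℕₚ.n≤1+n L)) (∏∞-trunc (tame-down -[1+ 0 ]) (suc L))))))
          (≈⇒≈[] L (≈-trans (solve 2 (λ e p → :- (e :* p) := e :* :- p) ≈-refl E (∏< L minus · ∏< (suc L) minus))
              (·-cong ≈-refl (≈-sym (signed-moment L (suc L))))))

    signed-zero : th 0 D sgnℤ ≈ 0ₛ
    signed-zero = ≈[]-all (λ L → ≈[]-trans (≈[]-weaken (ℕₚ.n≤1+n L) (≈[]-sym (E·MM sgnℤ (suc L))))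
        (≈⇒≈[] L (≈-trans (·-cong ≈-refl (signed L (suc L))) (·-zeroʳ E))))

  -- s e = q^e / (1 + q^e)² is the second logarithmic derivative (u d/du)² log (1 + u q^e) at u = 1.
  s₁ : PS
  PS.coe s₁ n = - sgn n * + n

  s : ℕ → PS
  s zero    = 0ₛ
  s (suc e) = dil (suc e) s₁

  s₁-spec : s₁ · ((1ₛ ⊕ mono 1) · (1ₛ ⊕ mono 1)) ≈ mono 1
  s₁-spec = ≈-trans (solve 2 (λ s p → s :* (p :* p) := s :* p :* p) ≈-refl s₁ (1ₛ ⊕ mono 1))
    (≈-trans (·-cong half ≈-refl) (≈-trans (solve 3 (λ q g p → q :* g :* p := q :* (g :* p)) ≈-refl (mono 1) g (1ₛ ⊕ mono 1))
    (≈-trans (·-cong ≈-refl geometric) (·-identityʳ (mono 1)))))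
    where
      open SeriesSolver
      g : PS
      PS.coe g n = sgn n
      times : ∀ f → f · (1ₛ ⊕ mono 1) ≈ f ⊕ mono 1 · f
      times f = ≈-trans (CR.distribˡ f 1ₛ (mono 1)) (⊕-cong (·-identityʳ f) (·-comm f (mono 1)))
      half : s₁ · (1ₛ ⊕ mono 1) ≈ mono 1 · g
      half = ≈-trans (times s₁) (pointwise λ
        { zero → trans (cong (λ z → s₁ ! 0 + z) (mono-·-< 1 s₁ 0 (s≤s z≤n))) (sym (mono-·-< 1 g 0 (s≤s z≤n)))
        ; (suc n) → trans (cong (λ z → s₁ ! suc n + z) (mono-·-+ 1 s₁ n)) (trans
            (Z.solve 2 (λ s n → Z.:- (Z.:- s) Z.:* (Z.con (+ 1) Z.:+ n) Z.:+ Z.:- s Z.:* n Z.:= s) refl (sgn n) (+ n))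
                (sym (mono-·-+ 1 g n))) })
        where module Z = +-*-Solver
      geometric : g · (1ₛ ⊕ mono 1) ≈ 1ₛ
      geometric = ≈-trans (times g) (pointwise λ
        { zero → cong (λ z → + 1 + z) (mono-·-< 1 g 0 (s≤s z≤n))
        ; (suc n) → trans (cong (λ z → - sgn n + z) (mono-·-+ 1 g n)) (ℤₚ.+-inverseˡ (sgn n)) })

  s-spec : ∀ e → 1 ℕ.≤ e → s e · ((1ₛ ⊕ mono e) · (1ₛ ⊕ mono e)) ≈ mono e
  s-spec (suc e) _ = ≈-trans (·-cong ≈-refl (·-cong factor≈ factor≈)) (≈-trans (·-cong ≈-refl (≈-sym (dil-· k p p)))
    (≈-trans (≈-sym (dil-· k s₁ (p · p))) (≈-trans (dil-cong k s₁-spec) (≈-trans (dil-mono k 1) (mono-≡ (ℕₚ.*-identityˡ k))))))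
    where
      k = suc e
      p = 1ₛ ⊕ mono 1
      factor≈ : 1ₛ ⊕ mono k ≈ dil k p
      factor≈ = ≈-sym (≈-trans (dil-⊕ k 1ₛ (mono 1)) (⊕-cong (dil-1 k) (≈-trans (dil-mono k 1) (mono-≡ (ℕₚ.*-identityˡ k)))))

  module Moments (a b : ℕ) (1≤a : 1 ℕ.≤ a) (1≤b : 1 ℕ.≤ b) where
    open JTP a b (ℕₚ.≤-trans 1≤a (ℕₚ.m≤m+n a b)) public

    sq : ℤ → ℤ
    sq j = j * j

    S : ℕ → ℕ → PS
    S m n = ΣS m (λ k → s (a ℕ.+ d ℕ.* k)) ⊕ ΣS n (λ k → s (b ℕ.+ d ℕ.* k))

    -- Additivity of the second logarithmic derivative, free of division: (M₂M₀ - M₁²)/M₀² increases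
    -- by σ = x/(1 + x)² when the product gains a factor 1 + u^ε x, where ε² = 1.
    algebra : ∀ ε (M₀ M₁ M₂ x σ Σ : PS) → ε · ε ≈ κ (+ 1) → M₂ · M₀ ⊖ M₁ · M₁ ≈ Σ · (M₀ · M₀) → σ · ((1ₛ ⊕ x) · (1ₛ ⊕ x)) ≈ x →
      (M₂ ⊕ x · (M₂ ⊕ κ (+ 2) · ε · M₁ ⊕ M₀)) · (M₀ ⊕ x · M₀) ⊖ (M₁ ⊕ x · (M₁ ⊕ ε · M₀)) · (M₁ ⊕ x · (M₁ ⊕ ε · M₀))
        ≈ (Σ ⊕ σ) · ((M₀ ⊕ x · M₀) · (M₀ ⊕ x · M₀))
    algebra ε M₀ M₁ M₂ x σ Σ ε² ih σ-spec = begin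
      (M₂ ⊕ x · (M₂ ⊕ κ (+ 2) · ε · M₁ ⊕ M₀)) · (M₀ ⊕ x · M₀) ⊖ (M₁ ⊕ x · (M₁ ⊕ ε · M₀)) · (M₁ ⊕ x · (M₁ ⊕ ε · M₀))
        ≈⟨ solve 5 (λ e m₀ m₁ m₂ x →
             (m₂ :+ x :* (m₂ :+ con (+ 2) :* e :* m₁ :+ m₀)) :* (m₀ :+ x :* m₀) :- (m₁ :+ x :* (m₁ :+ e :* m₀)) :*
                 (m₁ :+ x :* (m₁ :+ e :* m₀))
             := (con (+ 1) :+ x) :* (con (+ 1) :+ x) :* (m₂ :* m₀ :- m₁ :* m₁) :+ x :* m₀ :* m₀ :+ x :* x :* m₀ :* m₀ :- e :* e :*
                 (x :* x :* m₀ :* m₀)) ≈-refl ε M₀ M₁ M₂ x ⟩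
      (κ (+ 1) ⊕ x) · (κ (+ 1) ⊕ x) · (M₂ · M₀ ⊖ M₁ · M₁) ⊕ x · M₀ · M₀ ⊕ x · x · M₀ · M₀ ⊖ ε · ε · (x · x · M₀ · M₀)
        ≈⟨ ⊖-cong (⊕-cong (⊕-cong (·-cong ≈-refl ih) (·-cong (·-cong (≈-sym σ-spec′) ≈-refl) ≈-refl)) ≈-refl) (·-cong ε² ≈-refl) ⟩
      (κ (+ 1) ⊕ x) · (κ (+ 1) ⊕ x) · (Σ · (M₀ · M₀)) ⊕ σ · ((κ (+ 1) ⊕ x) · (κ (+ 1) ⊕ x)) · M₀ · M₀ ⊕ x · x · M₀ · M₀ ⊖ κ (+ 1) ·
          (x · x · M₀ · M₀)
        ≈⟨ solve 4 (λ m₀ x σ Σ → (con (+ 1) :+ x) :* (con (+ 1) :+ x) :* (Σ :* (m₀ :* m₀)) :+ σ :* ((con (+ 1) :+ x) :* (con (+ 1) :+ x))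
            :* m₀ :* m₀ :+ x :* x :* m₀ :* m₀ :- con (+ 1) :* (x :* x :* m₀ :* m₀)
             := (Σ :+ σ) :* ((m₀ :+ x :* m₀) :* (m₀ :+ x :* m₀))) ≈-refl M₀ x σ Σ ⟩
      (Σ ⊕ σ) · ((M₀ ⊕ x · M₀) · (M₀ ⊕ x · M₀)) ∎
      where
        open ≈-Reasoning
        open SeriesSolver
        σ-spec′ : σ · ((κ (+ 1) ⊕ x) · (κ (+ 1) ⊕ x)) ≈ x
        σ-spec′ = ≈-trans (·-cong ≈-refl (·-cong (⊕-cong (≈-sym 1ₛ≈κ) ≈-refl) (⊕-cong (≈-sym 1ₛ≈κ) ≈-refl))) σ-spec

    m₀ m₁ m₂ : ℕ → ℕ → PS
    m₀ = MM one-w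
    m₁ = MM id
    m₂ = MM sq

    shift₁ : ∀ ε {u : ℤ → ℤ} → (∀ j → u j ≡ j + ε) → ∀ m n → MM u m n ≈ m₁ m n ⊕ κ ε · m₀ m n
    shift₁ ε p m n = ≈-trans (MM-linear (+ 1) ε id one-w (λ j → trans (p j) (sym (cong₂ _+_ (ℤₚ.*-identityˡ j) (ℤₚ.*-identityʳ ε)))) m n)
      (⊕-cong (≈-trans (·-cong (≈-sym 1ₛ≈κ) ≈-refl) (·-identityˡ _)) ≈-refl)

    shift₂ : ∀ ε → ε * ε ≡ + 1 → {u : ℤ → ℤ} → (∀ j → u j ≡ (j + ε) * (j + ε)) → ∀ m n → MM u m n ≈ m₂ m n ⊕ κ (+ 2) · κ ε · m₁ m n ⊕ m₀ m n
    shift₂ ε ε² p m n = ≈-trans (MM-linear (+ 1) (+ 1) sq (λ j → + 2 * ε * j + + 1 * + 1) (λ j → trans (p j) (expand j)) m n)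
      (≈-trans (⊕-cong ≈-refl (·-cong ≈-refl (MM-linear (+ 2 * ε) (+ 1) id one-w (λ j → refl) m n)))
      (≈-trans (⊕-cong ≈-refl (·-cong ≈-refl (⊕-cong (·-cong (pointwise λ
          { zero → sym (κ-·-at (+ 2) (κ ε) 0) ; (suc k) → sym (trans (κ-·-at (+ 2) (κ ε) (suc k)) (ℤₚ.*-zeroʳ (+ 2))) }) ≈-refl) ≈-refl)))
      (solve 4 (λ a b c e → con (+ 1) :* a :+ con (+ 1) :* (con (+ 2) :* e :* b :+ con (+ 1) :* c) := a :+ con (+ 2) :* e :* b :+ c) ≈-refl
          (m₂ m n) (m₁ m n) (m₀ m n) (κ ε))))
      where
        open SeriesSolver
        expand : ∀ j → (j + ε) * (j + ε) ≡ + 1 * sq j + + 1 * (+ 2 * ε * j + + 1 * + 1)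
        expand j = trans (Z.solve 2 (λ j e → (j Z.:+ e) Z.:* (j Z.:+ e) Z.:= Z.con (+ 1) Z.:* (j Z.:* j) Z.:+ Z.con (+ 1) Z.:*
            (Z.con (+ 2) Z.:* e Z.:* j Z.:+ Z.con (+ 1) Z.:* (e Z.:* e))) refl j ε)
          (cong (λ z → + 1 * (j * j) + + 1 * (+ 2 * ε * j + + 1 * z)) ε²)
          where module Z = +-*-Solver

    curvature : ∀ m n → m₂ m n · m₀ m n ⊖ m₁ m n · m₁ m n ≈ S m n · (m₀ m n · m₀ m n)
    curvature zero zero = ≈-trans (⊖-cong (·-cong (MM-0 sq) ≈-refl) (·-cong (MM-0 id) ≈-refl))
      (≈-trans (solve 2 (λ x y → con (+ 0) :* x :- con (+ 0) :* y := (con (+ 0) :+ con (+ 0)) :* (x :* x)) ≈-refl (m₀ 0 0) (m₁ 0 0))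
        (·-cong (⊕-cong κ0≈ κ0≈) ≈-refl))
      where
        open SeriesSolver
        κ0≈ : κ (+ 0) ≈ 0ₛ
        κ0≈ = pointwise λ { zero → refl ; (suc k) → refl }
    curvature (suc m) n = ≈-trans
      (⊖-cong (·-cong (≈-trans (MM-sucˡ sq m n) (⊕-cong ≈-refl (·-cong ≈-refl (shift₂ (+ 1) refl (λ j → refl) m n)))) M₀≈) (·-cong M₁≈ M₁≈))
      (≈-trans (algebra (κ (+ 1)) (m₀ m n) (m₁ m n) (m₂ m n) x (s (a ℕ.+ d ℕ.* m)) (S m n)
          (pointwise λ { zero → refl ; (suc k) → κ-·-at (+ 1) (κ (+ 1)) (suc k) }) (curvature m n)
              (s-spec (a ℕ.+ d ℕ.* m) (ℕₚ.≤-trans 1≤a (ℕₚ.m≤m+n a _))))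
        (·-cong (≈-trans (solve 3 (λ a b c → a :+ b :+ c := a :+ c :+ b) ≈-refl _ _ _) (⊕-cong (≈-sym (ΣS-last m _)) ≈-refl))
            (·-cong (≈-sym M₀≈) (≈-sym M₀≈))))
      where
        open SeriesSolver
        x = mono (a ℕ.+ d ℕ.* m)
        M₀≈ = MM-sucˡ one-w m n
        M₁≈ = ≈-trans (MM-sucˡ id m n) (⊕-cong ≈-refl (·-cong ≈-refl (shift₁ (+ 1) (λ j → refl) m n)))
    curvature zero (suc n) = ≈-trans
      (⊖-cong (·-cong (≈-trans (MM-sucʳ sq 0 n) (⊕-cong ≈-refl (·-cong ≈-refl (shift₂ -[1+ 0 ] refl (λ j → refl) 0 n)))) M₀≈)
          (·-cong M₁≈ M₁≈))
      (≈-trans (algebra (κ -[1+ 0 ]) (m₀ 0 n) (m₁ 0 n) (m₂ 0 n) x (s (b ℕ.+ d ℕ.* n)) (S 0 n)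
          (pointwise λ { zero → refl ; (suc k) → κ-·-at -[1+ 0 ] (κ -[1+ 0 ]) (suc k) }) (curvature 0 n)
              (s-spec (b ℕ.+ d ℕ.* n) (ℕₚ.≤-trans 1≤b (ℕₚ.m≤m+n b _))))
        (·-cong (≈-trans (solve 3 (λ a b c → a :+ b :+ c := a :+ (b :+ c)) ≈-refl _ _ _) (⊕-cong ≈-refl (≈-sym (ΣS-last n _))))
            (·-cong (≈-sym M₀≈) (≈-sym M₀≈))))
      where
        open SeriesSolver
        x = mono (b ℕ.+ d ℕ.* n)
        M₀≈ = MM-sucʳ one-w 0 n
        M₁≈ = ≈-trans (MM-sucʳ id 0 n) (⊕-cong ≈-refl (·-cong ≈-refl (shift₁ -[1+ 0 ] (λ j → refl) 0 n)))

    -- `E` does not depend on u, so multiplying the finite identity by E² replaces all three moments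
    -- by weighted theta series and leaves the sum of the `s` untouched.
    th-curvature : ∀ n → th a b sq · th a b one-w ⊖ th a b id · th a b id ≈[ n ] S n n · (th a b one-w · th a b one-w)
    th-curvature n = ≈[]-trans
      (⊕-cong[] (·-cong[] (≈[]-sym (E·MM sq n)) (≈[]-sym (E·MM one-w n))) (~-cong[] (·-cong[] (≈[]-sym (E·MM id n)) (≈[]-sym (E·MM id n)))))
      (≈[]-trans (≈⇒≈[] n (≈-trans
          (solve 4 (λ e x y z → e :* x :* (e :* y) :- e :* z :* (e :* z) := e :* e :* (x :* y :- z :* z)) ≈-refl E (m₂ n n) (m₀ n n)
              (m₁ n n))
          (≈-trans (·-cong ≈-refl (curvature n n)) (solve 3 (λ e t x → e :* e :* (t :* (x :* x)) := t :* (e :* x :* (e :* x))) ≈-refl E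
              (S n n) (m₀ n n)))))
        (·-cong[] ≈[]-refl (·-cong[] (E·MM one-w n) (E·MM one-w n))))
      where open SeriesSolver

open LogDerivative

-- Theta sums over ℤ and ℤ² and their reindexing along bijections.

module LatticeSums where

  import Data.Fin.Properties as Finₚ
  import Data.List.Relation.Unary.Unique.Propositional.Properties as Unique
  open import Data.Integer using (_+_; _*_; -_; _-_)
  open import Data.List using (map; upTo; filter; _++_; cartesianProduct)
  open import Relation.Nullary using (Dec; ¬?)
  open import Data.Integer.DivMod using (_/ℕ_; _%ℕ_; n%ℕd<d; a≡a%ℕn+[a/ℕn]*n)
  open import Data.List.Properties using (map-∘; map-cong)
  open import Data.List.Membership.Propositional using (_∈_)
  open import Data.List.Membership.Propositional.Properties using (∈-map⁺; ∈-map⁻; ∈-filter⁺; ∈-filter⁻; ∈-upTo⁺; ∈-allFin; ∈-cartesianProduct⁺)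
  open import Data.List.Membership.Propositional.Properties.WithK using (unique∧set⇒bag)
  open import Data.List.Relation.Binary.BagAndSetEquality using (∼bag⇒↭)
  open import Data.List.Relation.Binary.Permutation.Propositional using (_↭_; prep; swap) renaming (refl to ↭refl; trans to ↭trans)
  open import Data.List.Relation.Unary.Unique.Propositional using (Unique)
  open import Function.Bundles using (mk⇔)

  +-cancelʳ : ∀ c {a b : ℤ} → a + c ≡ b + c → a ≡ b
  +-cancelʳ c {a} {b} p = trans (solve 2 (λ a c → a := a :+ c :- c) refl a c)
      (trans (cong (_- c) p) (solve 2 (λ b c → b :+ c :- c := b) refl b c))
    where open +-*-Solver

  +-cancelˡ : ∀ c {a b : ℤ} → c + a ≡ c + b → a ≡ b
  +-cancelˡ c {a} {b} p = +-cancelʳ c (trans (ℤₚ.+-comm a c) (trans p (ℤₚ.+-comm c b)))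

  sumL : {I : Set} → List I → (I → ℤ) → ℤ
  sumL xs F = sumℤ (map F xs)

  sumL-cong : {I : Set} (xs : List I) {F G : I → ℤ} → (∀ x → F x ≡ G x) → sumL xs F ≡ sumL xs G
  sumL-cong xs p = cong sumℤ (map-cong p xs)

  sumL-++ : {I : Set} (xs ys : List I) (F : I → ℤ) → sumL (xs ++ ys) F ≡ sumL xs F + sumL ys F
  sumL-++ []       ys F = sym (ℤₚ.+-identityˡ _)
  sumL-++ (x ∷ xs) ys F = trans (cong (λ z → F x + z) (sumL-++ xs ys F)) (sym (ℤₚ.+-assoc (F x) _ _))

  sumL-map : {I J : Set} (xs : List I) (g : I → J) (F : J → ℤ) → sumL (map g xs) F ≡ sumL xs (F ∘ g)
  sumL-map xs g F = cong sumℤ (sym (map-∘ xs))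

  sumL-× : {I J : Set} (xs : List I) (ys : List J) (F : I × J → ℤ) → sumL (cartesianProduct xs ys) F ≡ sumL xs
      (λ x → sumL ys (λ y → F (x , y)))
  sumL-× []       ys F = refl
  sumL-× (x ∷ xs) ys F = trans (sumL-++ (map (x ,_) ys) (cartesianProduct xs ys) F) (cong₂ _+_ (sumL-map ys (x ,_) F) (sumL-× xs ys F))

  sumL-↭ : {I : Set} {xs ys : List I} (F : I → ℤ) → xs ↭ ys → sumL xs F ≡ sumL ys F
  sumL-↭ F ↭refl          = refl
  sumL-↭ F (prep x p)     = cong (λ z → F x + z) (sumL-↭ F p)
  sumL-↭ {xs = _ ∷ _ ∷ xs} F (swap x y p) = trans (solve 3 (λ a b c → a :+ (b :+ c) := b :+ (a :+ c)) refl (F x) (F y) (sumL xs F))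
      (cong (λ z → F y + (F x + z)) (sumL-↭ F p))
    where open +-*-Solver
  sumL-↭ F (↭trans p r) = trans (sumL-↭ F p) (sumL-↭ F r)

  module _ {J : Set} (F : J → ℤ) where

    nonzero? : (y : J) → Dec (¬ F y ≡ + 0)
    nonzero? y = ¬? (F y ℤ.≟ + 0)

    sumL-filter : ∀ ys → sumL ys F ≡ sumL (filter nonzero? ys) F
    sumL-filter []       = refl
    sumL-filter (y ∷ ys) with F y ℤ.≟ + 0
    ... | yes p = trans (cong₂ _+_ p (sumL-filter ys)) (ℤₚ.+-identityˡ _)
    ... | no  _ = cong (λ z → F y + z) (sumL-filter ys)

  -- Only nonzero summands need to correspond. After zeros are filtered out, the two lists are
  -- duplicate free with the same members, hence permutations of each other.
  reindex : {I J : Set} (xs : List I) (ys : List J) (g : I → J) (F : J → ℤ) → Unique xs → Unique ys →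
            (∀ {x x′} → g x ≡ g x′ → x ≡ x′) → (∀ x → ¬ F (g x) ≡ + 0 → g x ∈ ys) →
            (∀ y → ¬ F y ≡ + 0 → ∃ λ x → x ∈ xs × y ≡ g x) → sumL ys F ≡ sumL xs (F ∘ g)
  reindex xs ys g F uxs uys inj into onto = begin
    sumL ys F                              ≡⟨ sumL-filter F ys ⟩
    sumL (filter (nonzero? F) ys) F        ≡⟨ sumL-↭ F (∼bag⇒↭ (unique∧set⇒bag (Unique.filter⁺ (nonzero? F) uys)
        (Unique.filter⁺ (nonzero? F) (Unique.map⁺ inj uxs)) (λ {z} → mk⇔ to from))) ⟩
    sumL (filter (nonzero? F) (map g xs)) F ≡⟨ sumL-filter F (map g xs) ⟨
    sumL (map g xs) F                      ≡⟨ sumL-map xs g F ⟩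
    sumL xs (F ∘ g)                        ∎
    where
      open ≡-Reasoning
      to : ∀ {z} → z ∈ filter (nonzero? F) ys → z ∈ filter (nonzero? F) (map g xs)
      to {z} z∈ with ∈-filter⁻ (nonzero? F) {xs = ys} z∈
      ... | _ , Fz≢0 with onto z Fz≢0
      ...   | x , x∈xs , refl = ∈-filter⁺ (nonzero? F) (∈-map⁺ g x∈xs) Fz≢0
      from : ∀ {z} → z ∈ filter (nonzero? F) (map g xs) → z ∈ filter (nonzero? F) ys
      from {z} z∈ with ∈-filter⁻ (nonzero? F) {xs = map g xs} z∈
      ... | z∈map , Fz≢0 with ∈-map⁻ g z∈map
      ...   | x , _ , refl = ∈-filter⁺ (nonzero? F) (into x Fz≢0) Fz≢0

  -- The line and the plane behind one interface, with duplicate-free boxes that exhaust the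
  -- lattice, so that splitting and shifting are proved once.
  record Index : Set₁ where
    field
      I     : Set
      size  : I → ℕ
      boxes : ℕ → List I
      boxes-unique : ∀ n → Unique (boxes n)
      ∈-boxes : ∀ n x → size x ℕ.≤ n → x ∈ boxes n

  line : Index
  line = record
    { I = ℤ ; size = ℤ.∣_∣ ; boxes = box
    ; boxes-unique = λ n → Unique.map⁺ (λ {i} {j} p → ℤₚ.+-injective (+-cancelʳ (- + n) p)) (Unique.upTo⁺ (suc (n ℕ.+ n)))
    ; ∈-boxes = member }
    where
      open +-*-Solver
      member : ∀ n x → ℤ.∣ x ∣ ℕ.≤ n → x ∈ box n
      member n (+ m) m≤n = subst (_∈ box n) (solve 2 (λ m n → m :+ n :- n := m) refl (+ m) (+ n))
        (∈-map⁺ (λ i → + i - + n) (∈-upTo⁺ (s≤s (ℕₚ.+-monoˡ-≤ n m≤n))))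
      member n -[1+ m ] m<n = subst (_∈ box n) eq (∈-map⁺ (λ i → + i - + n)
          (∈-upTo⁺ (s≤s (ℕₚ.≤-trans (ℕₚ.m∸n≤m n (suc m)) (ℕₚ.m≤m+n n n)))))
        where
          eq : + (n ℕ.∸ suc m) - + n ≡ -[1+ m ]
          eq = trans (cong (λ z → + (n ℕ.∸ suc m) - + z) (sym (ℕₚ.m∸n+n≡m m<n)))
              (solve 2 (λ r m → r :- (r :+ m) := :- m) refl (+ (n ℕ.∸ suc m)) (+ suc m))

  plane : Index
  plane = record
    { I = ℤ × ℤ ; size = λ (x , y) → ℤ.∣ x ∣ ℕ.⊔ ℤ.∣ y ∣ ; boxes = λ n → cartesianProduct (box n) (box n)
    ; boxes-unique = λ n → Unique.cartesianProduct⁺ (boxes-unique line n) (boxes-unique line n)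
    ; ∈-boxes = λ n (x , y) p → ∈-cartesianProduct⁺ (∈-boxes line n x (ℕₚ.≤-trans (ℕₚ.m≤m⊔n ℤ.∣ x ∣ ℤ.∣ y ∣) p))
        (∈-boxes line n y (ℕₚ.≤-trans (ℕₚ.m≤n⊔m ℤ.∣ x ∣ ℤ.∣ y ∣) p)) }
    where open Index

  module Theta (X : Index) where
    open Index X

    Θ : (I → ℕ) → (I → ℤ) → PS
    PS.coe (Θ e w) k = sumL (boxes (suc k)) (λ x → w x * monoᶜ (e x) k)

    Proper : (I → ℕ) → Set
    Proper e = ∀ x → size x ℕ.≤ suc (e x)

    support : ∀ (e : I → ℕ) (w : I → ℤ) k x → ¬ w x * monoᶜ (e x) k ≡ + 0 → k ≡ e x
    support e w k x ≢0 with k ℕ.≟ e x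
    ... | yes p = p
    ... | no  p = contradiction (trans (cong (w x *_) (mono-other (e x) k p)) (ℤₚ.*-zeroʳ (w x))) ≢0

    inside : ∀ {e} → Proper e → ∀ (w : I → ℤ) {k n} → k ℕ.< n → ∀ x → ¬ w x * monoᶜ (e x) k ≡ + 0 → x ∈ boxes n
    inside {e} proper w {k} k<n x ≢0 = ∈-boxes _ x (ℕₚ.≤-trans (proper x) (subst (λ z → suc z ℕ.≤ _) (support e w k x ≢0) k<n))

    Θ-at : ∀ {e} → Proper e → ∀ w {k n} → k ℕ.< n → Θ e w ! k ≡ sumL (boxes n) (λ x → w x * monoᶜ (e x) k)
    Θ-at {e} proper w {k} {n} k<n = reindex (boxes n) (boxes (suc k)) id (λ x → w x * monoᶜ (e x) k) (boxes-unique n)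
        (boxes-unique (suc k)) id
      (inside proper w ℕₚ.≤-refl) (λ y ≢0 → y , inside proper w k<n y ≢0 , refl)

    Θ-cong : ∀ {e e′ w w′} → (∀ x → e x ≡ e′ x) → (∀ x → w x ≡ w′ x) → Θ e w ≈ Θ e′ w′
    Θ-cong p r = pointwise (λ k → sumL-cong (boxes (suc k)) (λ x → cong₂ _*_ (r x) (cong (λ z → monoᶜ z k) (p x))))

    Θ-shift : ∀ o {e} → Proper e → ∀ w → Θ (λ x → o ℕ.+ e x) w ≈ mono o · Θ e w
    Θ-shift o {e} proper w = ≈-by-cases o
      (λ n n<o → trans (zeros (boxes (suc n)) (λ x → trans (cong (w x *_)
          (mono-other (o ℕ.+ e x) n (λ n≡ → ℕₚ.<⇒≱ n<o (subst (o ℕ.≤_) (sym n≡) (ℕₚ.m≤m+n o (e x)))))) (ℤₚ.*-zeroʳ (w x))))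
          (sym (mono-·-< o (Θ e w) n n<o)))
      (λ n → trans (sumL-cong (boxes (suc (o ℕ.+ n))) (λ x → cong (w x *_)
          (trans (at (mono-+ o (e x)) (o ℕ.+ n)) (mono-·-+ o (mono (e x)) n))))
        (trans (sym (Θ-at proper w (s≤s (ℕₚ.m≤n+m n o)))) (sym (mono-·-+ o (Θ e w) n))))
      where
        zeros : ∀ xs {F : I → ℤ} → (∀ x → F x ≡ + 0) → sumL xs F ≡ + 0
        zeros []       p = refl
        zeros (x ∷ xs) p = cong₂ _+_ (p x) (zeros xs p)

    Θ-linear : ∀ {e} x y w v {u : I → ℤ} → (∀ p → u p ≡ x * w p + y * v p) → Θ e u ≈ κ x · Θ e w ⊕ κ y · Θ e v
    Θ-linear {e} x y w v {u} p = pointwise (λ k → trans (go (boxes (suc k)) k) (sym (cong₂ _+_ (κ-·-at x (Θ e w) k) (κ-·-at y (Θ e v) k))))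
      where
        open +-*-Solver
        go : ∀ xs k → sumL xs (λ i → u i * monoᶜ (e i) k) ≡ x * sumL xs (λ i → w i * monoᶜ (e i) k) + y * sumL xs
            (λ i → v i * monoᶜ (e i) k)
        go []       k = solve 2 (λ x y → con (+ 0) := x :* con (+ 0) :+ y :* con (+ 0)) refl x y
        go (i ∷ xs) k = trans (cong₂ (λ s t → s * monoᶜ (e i) k + t) (p i) (go xs k))
          (solve 7 (λ x y w v m s t → (x :* w :+ y :* v) :* m :+ (x :* s :+ y :* t) := x :* (w :* m :+ s) :+ y :* (v :* m :+ t)) refl x y
              (w i) (v i) (monoᶜ (e i) k) (sumL xs (λ i → w i * monoᶜ (e i) k)) (sumL xs (λ i → v i * monoᶜ (e i) k)))

    module _ {m : ℕ} (g : Fin m × I → I) (inj : ∀ {p p′} → g p ≡ g p′ → p ≡ p′) (surj : ∀ y → ∃ λ p → y ≡ g p) where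

      -- A bijection need not map boxes to boxes. Properness of the exponent, before and after
      -- pulling back along `g`, ensures that all nonzero summands lie in the boxes on both sides.
      Θ-split-at : ∀ {e} w → Proper e → (∀ r → Proper (λ x → e (g (r , x)))) →
                   ∀ k → Θ e w ! k ≡ sumL (allFin m) (λ r → Θ (λ x → e (g (r , x))) (λ x → w (g (r , x))) ! k)
      Θ-split-at {e} w proper properg k = trans
        (reindex (cartesianProduct (allFin m) (boxes (suc k))) (boxes (suc k)) g F
          (Unique.cartesianProduct⁺ (Unique.allFin⁺ m) (boxes-unique (suc k))) (boxes-unique (suc k)) inj
          (λ p → inside proper w ℕₚ.≤-refl (g p)) onto)
        (sumL-× (allFin m) (boxes (suc k)) (F ∘ g))
        where
          F : I → ℤ
          F x = w x * monoᶜ (e x) k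
          onto : ∀ y → ¬ F y ≡ + 0 → ∃ λ p → p ∈ cartesianProduct (allFin m) (boxes (suc k)) × y ≡ g p
          onto y ≢0 with surj y
          ... | (r , x) , refl = (r , x) , ∈-cartesianProduct⁺ (∈-allFin r) (inside (properg r) (λ x → w (g (r , x))) ℕₚ.≤-refl x ≢0) , refl

  open Theta line  using () renaming (Θ to Θ₁; Proper to Proper₁; Θ-at to Θ₁-at; Θ-cong to Θ₁-cong) public
  open Theta plane using () renaming (Θ to Θ₂; Proper to Proper₂; Θ-linear to Θ₂-linear) public

  Σbox-sumL : ∀ n (F : ℤ → ℤ) → Σbox n F ≡ sumL (box n) F
  Σbox-sumL n F = sym (trans (sumL-map (upTo (suc (n ℕ.+ n))) (λ i → + i - + n) F)
      (sumℤ-applyUpTo (λ i → F (+ i - + n)) id (suc (n ℕ.+ n))))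

  th≈Θ₁ : ∀ a b w → th a b w ≈ Θ₁ (ex a b) w
  th≈Θ₁ a b w = pointwise (λ k → Σbox-sumL (suc k) (λ j → w j * monoᶜ (ex a b j) k))

  ΣL : {I : Set} → List I → (I → PS) → PS
  ΣL []       h = 0ₛ
  ΣL (x ∷ xs) h = h x ⊕ ΣL xs h

  ΣL-at : {I : Set} (xs : List I) (h : I → PS) → ∀ k → ΣL xs h ! k ≡ sumL xs (λ x → h x ! k)
  ΣL-at []       h k = refl
  ΣL-at (x ∷ xs) h k = cong (λ z → h x ! k + z) (ΣL-at xs h k)

  ΣL-·ˡ : {I : Set} (xs : List I) (c : PS) (h : I → PS) → c · ΣL xs h ≈ ΣL xs (λ x → c · h x)
  ΣL-·ˡ []       c h = ·-zeroʳ c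
  ΣL-·ˡ (x ∷ xs) c h = ≈-trans (solve 3 (λ c a b → c :* (a :+ b) := c :* a :+ c :* b) ≈-refl c (h x) (ΣL xs h))
      (⊕-cong ≈-refl (ΣL-·ˡ xs c h))
    where open SeriesSolver

  ΣL-·ʳ : {I : Set} (xs : List I) (h : I → PS) (c : PS) → ΣL xs h · c ≈ ΣL xs (λ x → h x · c)
  ΣL-·ʳ []       h c = ≈-trans (·-comm 0ₛ c) (·-zeroʳ c)
  ΣL-·ʳ (x ∷ xs) h c = ≈-trans (solve 3 (λ c a b → (a :+ b) :* c := a :* c :+ b :* c) ≈-refl c (h x) (ΣL xs h))
      (⊕-cong ≈-refl (ΣL-·ʳ xs h c))
    where open SeriesSolver

  poly : ℕ → (ℤ → ℕ) → (ℤ → ℤ) → PS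
  poly n e w = ΣL (box n) (λ x → κ (w x) · mono (e x))

  Θ₁-poly : ∀ {e} → Proper₁ e → ∀ w n → Θ₁ e w ≈[ n ] poly n e w
  Θ₁-poly {e} proper w n = modulo (λ k k<n → trans (Θ₁-at proper w k<n)
    (sym (trans (ΣL-at (box n) (λ x → κ (w x) · mono (e x)) k) (sumL-cong (box n) (λ x → κ-·-at (w x) (mono (e x)) k)))))

  -- Modulo q^(k + 1) each factor is a finite sum of monomials over `box (suc k)`, and the product
  -- of two boxes is the box of the plane.
  Θ₁-· : ∀ {e e′} → Proper₁ e → Proper₁ e′ → ∀ w w′ → Θ₁ e w · Θ₁ e′ w′ ≈ Θ₂ (λ (x , y) → e x ℕ.+ e′ y) (λ (x , y) → w x * w′ y)
  Θ₁-· {e} {e′} proper proper′ w w′ = pointwise (λ k → begin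
    (Θ₁ e w · Θ₁ e′ w′) ! k
      ≡⟨ at< (·-cong[] (Θ₁-poly proper w (suc k)) (Θ₁-poly proper′ w′ (suc k))) k ℕₚ.≤-refl ⟩
    (poly (suc k) e w · poly (suc k) e′ w′) ! k
      ≡⟨ at (ΣL-·ʳ (box (suc k)) (λ x → κ (w x) · mono (e x)) (poly (suc k) e′ w′)) k ⟩
    ΣL (box (suc k)) (λ x → κ (w x) · mono (e x) · poly (suc k) e′ w′) ! k
      ≡⟨ ΣL-at (box (suc k)) (λ x → κ (w x) · mono (e x) · poly (suc k) e′ w′) k ⟩
    sumL (box (suc k)) (λ x → (κ (w x) · mono (e x) · poly (suc k) e′ w′) ! k)
      ≡⟨ sumL-cong (box (suc k)) (λ x → trans (at (ΣL-·ˡ (box (suc k)) (κ (w x) · mono (e x)) (λ y → κ (w′ y) · mono (e′ y))) k)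
           (trans (ΣL-at (box (suc k)) (λ y → κ (w x) · mono (e x) · (κ (w′ y) · mono (e′ y))) k)
             (sumL-cong (box (suc k)) (λ y → term x y k)))) ⟩
    sumL (box (suc k)) (λ x → sumL (box (suc k)) (λ y → w x * w′ y * monoᶜ (e x ℕ.+ e′ y) k))
      ≡⟨ sumL-× (box (suc k)) (box (suc k)) (λ (x , y) → w x * w′ y * monoᶜ (e x ℕ.+ e′ y) k) ⟨
    Θ₂ (λ (x , y) → e x ℕ.+ e′ y) (λ (x , y) → w x * w′ y) ! k ∎)
    where
      open ≡-Reasoning
      term : ∀ x y k → (κ (w x) · mono (e x) · (κ (w′ y) · mono (e′ y))) ! k ≡ w x * w′ y * monoᶜ (e x ℕ.+ e′ y) k
      term x y k = begin
        (κ (w x) · mono (e x) · (κ (w′ y) · mono (e′ y))) ! k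
          ≡⟨ at (solve 4 (λ a b c d → a :* b :* (c :* d) := a :* (c :* (b :* d))) ≈-refl (κ (w x)) (mono (e x)) (κ (w′ y)) (mono (e′ y))) k
              ⟩
        (κ (w x) · (κ (w′ y) · (mono (e x) · mono (e′ y)))) ! k
          ≡⟨ trans (κ-·-at (w x) (κ (w′ y) · (mono (e x) · mono (e′ y))) k) (cong (w x *_) (κ-·-at (w′ y) (mono (e x) · mono (e′ y)) k)) ⟩
        w x * (w′ y * (mono (e x) · mono (e′ y)) ! k)
          ≡⟨ cong (λ z → w x * (w′ y * z)) (at (mono-+ (e x) (e′ y)) k) ⟨
        w x * (w′ y * monoᶜ (e x ℕ.+ e′ y) k)
          ≡⟨ ℤₚ.*-assoc (w x) (w′ y) _ ⟨
        w x * w′ y * monoᶜ (e x ℕ.+ e′ y) k ∎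
        where open SeriesSolver

  th-· : ∀ a b c d → 1 ℕ.≤ a ℕ.+ b → 1 ℕ.≤ c ℕ.+ d → ∀ w v → th a b w · th c d v ≈ Θ₂ (λ (x , y) → ex a b x ℕ.+ ex c d y)
      (λ (x , y) → w x * v y)
  th-· a b c d 1≤ab 1≤cd w v = ≈-trans (·-cong (th≈Θ₁ a b w) (th≈Θ₁ c d v)) (Θ₁-· (ex-proper a b 1≤ab) (ex-proper c d 1≤cd) w v)

  -- The difference of two residues is a multiple of m of absolute value less than m, hence zero.
  quotRem-unique : ∀ m (a a′ : ℤ) (r r′ : Fin m) → + m * a + + toℕ r ≡ + m * a′ + + toℕ r′ → r ≡ r′ × a ≡ a′
  quotRem-unique m a a′ r r′ eq = Finₚ.toℕ-injective (ℤₚ.+-injective r≡r′) , a≡a′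
    where
      open +-*-Solver
      difference : + m * (a - a′) ≡ + toℕ r′ - + toℕ r
      difference = trans (solve 4 (λ m a a′ r → m :* (a :- a′) := m :* a :+ r :- r :- m :* a′) refl (+ m) a a′ (+ toℕ r))
        (trans (cong (λ z → z - + toℕ r - + m * a′) eq) (solve 4 (λ m a′ r r′ → m :* a′ :+ r′ :- r :- m :* a′ := r′ :- r) refl (+ m) a′
            (+ toℕ r) (+ toℕ r′)))
      small : m ℕ.* ℤ.∣ a - a′ ∣ ℕ.< m
      small = ℕₚ.≤-<-trans (ℕₚ.≤-reflexive (trans (sym (ℤₚ.abs-* (+ m) (a - a′)))
          (trans (cong ℤ.∣_∣ difference) (cong ℤ.∣_∣ (ℤₚ.m-n≡m⊖n (toℕ r′) (toℕ r))))))
        (ℕₚ.≤-<-trans (ℤₚ.∣m⊝n∣≤m⊔n (toℕ r′) (toℕ r)) (ℕₚ.⊔-lub (Finₚ.toℕ<n r′) (Finₚ.toℕ<n r)))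
      vanish : ∀ n → m ℕ.* n ℕ.< m → n ≡ 0
      vanish zero    _  = refl
      vanish (suc n) lt = contradiction (ℕₚ.≤-trans (ℕₚ.m≤m+n m (m ℕ.* n)) (ℕₚ.≤-reflexive (sym (ℕₚ.*-suc m n)))) (ℕₚ.<⇒≱ lt)
      a≡a′ : a ≡ a′
      a≡a′ = ℤₚ.i-j≡0⇒i≡j a a′ (ℤₚ.∣i∣≡0⇒i≡0 (vanish ℤ.∣ a - a′ ∣ small))
      r≡r′ : + toℕ r ≡ + toℕ r′
      r≡r′ = +-cancelˡ (+ m * a) (trans eq (cong (λ z → + m * z + + toℕ r′) (sym a≡a′)))

  quotRem : ∀ m .{{_ : NonZero m}} t → ∃ λ (r : Fin m) → ∃ λ a → t ≡ + m * a + + toℕ r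
  quotRem m t = fromℕ< (n%ℕd<d t m) , t /ℕ m , trans (a≡a%ℕn+[a/ℕn]*n t m)
    (trans (ℤₚ.+-comm (+ (t %ℕ m)) (t /ℕ m * + m)) (cong₂ _+_ (ℤₚ.*-comm (t /ℕ m) (+ m)) (cong +_ (sym (Finₚ.toℕ-fromℕ< (n%ℕd<d t m))))))

open LatticeSums

-- Dissections of theta series by residue classes and by cosets in ℤ[i].

module ResidueClasses where

  open import Data.Integer using (_+_; _*_; -_; _-_)
  open import Data.Fin.Patterns using (2F; 3F; 4F)

  module Split (X : Index) where
    open Index X using (I)
    open Theta X

    Θ-split : ∀ {m} (g : Fin m × I → I) → (∀ {p p′} → g p ≡ g p′ → p ≡ p′) → (∀ y → ∃ λ p → y ≡ g p) →
              ∀ {e w} → Proper e → (o : Fin m → ℕ) (e′ : Fin m → I → ℕ) (w′ : Fin m → I → ℤ) → (∀ r → Proper (e′ r)) →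
              (∀ r x → e (g (r , x)) ≡ o r ℕ.+ e′ r x) → (∀ r x → w (g (r , x)) ≡ w′ r x) →
              Θ e w ≈ ΣL (allFin m) (λ r → mono (o r) · Θ (e′ r) (w′ r))
    Θ-split {m} g inj surj {e} {w} proper o e′ w′ proper′ e-eq w-eq = pointwise (λ k → trans
      (Θ-split-at g inj surj w proper (λ r x → subst (λ z → Index.size X x ℕ.≤ suc z) (sym (e-eq r x))
          (ℕₚ.≤-trans (proper′ r x) (s≤s (ℕₚ.m≤n+m (e′ r x) (o r))))) k)
      (sym (trans (ΣL-at (allFin m) _ k) (sumL-cong (allFin m) (λ r → sym
          (at (≈-trans (Θ-cong (e-eq r) (w-eq r)) (Θ-shift (o r) (proper′ r) (w′ r))) k))))))

  quad : ℕ → ℕ → ℤ → ℤ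
  quad a b j = (+ a + + b) * (j * (j - + 1)) + + 2 * (+ a * j)

  module QuadPoly where
    open +-*-Solver public

    :quad : ∀ {n} → ℕ → ℕ → Polynomial n → Polynomial n
    :quad a b j = (con (+ a) :+ con (+ b)) :* (j :* (j :- con (+ 1))) :+ con (+ 2) :* (con (+ a) :* j)

  ex-eq₁ : ∀ a b A B o X x → quad a b X ≡ + 2 * + o + quad A B x → ex a b X ≡ o ℕ.+ ex A B x
  ex-eq₁ a b A B o X x p = halve (trans (ex-spec a b X) (trans p (trans (cong (λ z → + 2 * + o + z) (sym (ex-spec A B x)))
      (sym (ℤₚ.*-distribˡ-+ (+ 2) (+ o) (+ ex A B x))))))

  -- Reduces a change of lattice coordinates to a polynomial identity between doubled exponents.
  -- Only the sum of the two exponents has to match, as a rotation mixes them.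
  ex-eq₂ : ∀ a b c d A B C D o X Y x y → quad a b X + quad c d Y ≡ + 2 * + o + (quad A B x + quad C D y) →
           ex a b X ℕ.+ ex c d Y ≡ o ℕ.+ (ex A B x ℕ.+ ex C D y)
  ex-eq₂ a b c d A B C D o X Y x y p = halve (trans (ℤₚ.*-distribˡ-+ (+ 2) (+ ex a b X) (+ ex c d Y))
    (trans (cong₂ _+_ (ex-spec a b X) (ex-spec c d Y)) (trans p (trans
        (cong₂ (λ s t → + 2 * + o + (s + t)) (sym (ex-spec A B x)) (sym (ex-spec C D y)))
    (solve 3 (λ o s t → con (+ 2) :* o :+ (con (+ 2) :* s :+ con (+ 2) :* t) := con (+ 2) :* (o :+ (s :+ t))) refl (+ o) (+ ex A B x)
        (+ ex C D y))))))
    where open +-*-Solver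

  ϑ : ℕ → ℕ → PS
  ϑ a b = th a b one-w

  module _ {m : ℕ} (g : Fin m × ℤ → ℤ) (inj : ∀ {p p′} → g p ≡ g p′ → p ≡ p′) (surj : ∀ y → ∃ λ p → y ≡ g p) where

    ϑ-split : ∀ a b → 1 ℕ.≤ a ℕ.+ b → (o A B : Fin m → ℕ) → (∀ r → 1 ℕ.≤ A r ℕ.+ B r) →
              (∀ r x → quad a b (g (r , x)) ≡ + 2 * + o r + quad (A r) (B r) x) →
              ϑ a b ≈ ΣL (allFin m) (λ r → mono (o r) · Θ₁ (ex (A r) (B r)) one-w)
    ϑ-split a b 1≤ab o A B 1≤AB p = ≈-trans (th≈Θ₁ a b one-w) (Split.Θ-split line g inj surj (ex-proper a b 1≤ab) o (λ r → ex (A r) (B r))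
        (λ _ → one-w) (λ r → ex-proper (A r) (B r) (1≤AB r))
      (λ r x → ex-eq₁ a b (A r) (B r) (o r) (g (r , x)) x (p r x)) (λ _ _ → refl))

  module _ {m : ℕ} (g : Fin m × (ℤ × ℤ) → ℤ × ℤ) (inj : ∀ {p p′} → g p ≡ g p′ → p ≡ p′) (surj : ∀ y → ∃ λ p → y ≡ g p) where

    ϑ₂-split : ∀ a b c d → 1 ℕ.≤ a ℕ.+ b → 1 ℕ.≤ c ℕ.+ d → (W : ℤ × ℤ → ℤ) (o A B C D : Fin m → ℕ) (w v : Fin m → ℤ → ℤ) →
               (∀ r → 1 ℕ.≤ A r ℕ.+ B r) → (∀ r → 1 ℕ.≤ C r ℕ.+ D r) →
               (∀ r x y → quad a b (proj₁ (g (r , x , y))) + quad c d (proj₂ (g (r , x , y))) ≡ + 2 * + o r +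
                   (quad (A r) (B r) x + quad (C r) (D r) y)) →
               (∀ r x y → W (g (r , x , y)) ≡ w r x * v r y) →
               Θ₂ (λ (x , y) → ex a b x ℕ.+ ex c d y) W ≈ ΣL (allFin m) (λ r → mono (o r) · (th (A r) (B r) (w r) · th (C r) (D r) (v r)))
    ϑ₂-split a b c d 1≤ab 1≤cd W o A B C D w v 1≤AB 1≤CD p W-eq = ≈-trans
      (Split.Θ-split plane g inj surj (proper a b c d 1≤ab 1≤cd) o (λ r (x , y) → ex (A r) (B r) x ℕ.+ ex (C r) (D r) y)
          (λ r (x , y) → w r x * v r y)
        (λ r → proper (A r) (B r) (C r) (D r) (1≤AB r) (1≤CD r))
        (λ r (x , y) → ex-eq₂ a b c d (A r) (B r) (C r) (D r) (o r) (proj₁ (g (r , x , y))) (proj₂ (g (r , x , y))) x y (p r x y))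
        (λ r (x , y) → W-eq r x y))
      (ΣL-cong (allFin m) (λ r → ·-cong ≈-refl (≈-sym (th-· (A r) (B r) (C r) (D r) (1≤AB r) (1≤CD r) (w r) (v r)))))
      where
        proper : ∀ a b c d → 1 ℕ.≤ a ℕ.+ b → 1 ℕ.≤ c ℕ.+ d → Proper₂ (λ (x , y) → ex a b x ℕ.+ ex c d y)
        proper a b c d 1≤ab 1≤cd (x , y) = ℕₚ.⊔-lub
          (ℕₚ.≤-trans (ex-proper a b 1≤ab x) (s≤s (ℕₚ.m≤m+n _ _))) (ℕₚ.≤-trans (ex-proper c d 1≤cd y) (s≤s (ℕₚ.m≤n+m _ (ex a b x))))
        ΣL-cong : {I : Set} (xs : List I) {h h′ : I → PS} → (∀ x → h x ≈ h′ x) → ΣL xs h ≈ ΣL xs h′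
        ΣL-cong []       p = ≈-refl
        ΣL-cong (x ∷ xs) p = ⊕-cong (p x) (ΣL-cong xs p)

  th-dil : ∀ k .{{_ : NonZero k}} a b → 1 ℕ.≤ a ℕ.+ b → ∀ w → dil k (th a b w) ≈ th (a ℕ.* k) (b ℕ.* k) w
  th-dil k a b 1≤ab w = pointwise λ n → ∣-cases k n
    (λ { (divides j refl) → begin
      dil k (th a b w) ! (j ℕ.* k)                       ≡⟨ dil-* k (th a b w) j ⟩
      th a b w ! j                                       ≡⟨ th-at a b 1≤ab w (s≤s (ℕₚ.m≤m*n j k)) ⟩
      Σbox (suc (j ℕ.* k)) (λ x → w x * monoᶜ (ex a b x) j)
        ≡⟨ Σ<-cong (suc (suc (j ℕ.* k) ℕ.+ suc (j ℕ.* k))) (λ i _ → let x = + i - + suc (j ℕ.* k) in cong (w x *_)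
             (trans (sym (dil-* k (mono (ex a b x)) j)) (trans (at (dil-mono k (ex a b x)) (j ℕ.* k))
                 (cong (λ z → monoᶜ z (j ℕ.* k)) (sym (scale x)))))) ⟩
      Σbox (suc (j ℕ.* k)) (λ x → w x * monoᶜ (ex (a ℕ.* k) (b ℕ.* k) x) (j ℕ.* k)) ∎ })
    (λ k∤n → trans (dil-∤ k (th a b w) k∤n) (sym (Σ<-0 (suc (suc n ℕ.+ suc n)) (λ i _ → let x = + i - + suc n in
       trans (cong (w x *_) (mono-other _ n (λ n≡ → k∤n (divides (ex a b x) (trans n≡ (scale x)))))) (ℤₚ.*-zeroʳ (w x))))))
    where
      open ≡-Reasoning
      scale : ∀ x → ex (a ℕ.* k) (b ℕ.* k) x ≡ ex a b x ℕ.* k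
      scale (+ n) = solve 5 (λ a b t n k → (a :* k :+ b :* k) :* t :+ a :* k :* n := ((a :+ b) :* t :+ a :* n) :* k) refl a b (tri n) n k
        where open ℕ-Solver
      scale -[1+ n ] = solve 5 (λ a b t n k → (a :* k :+ b :* k) :* t :+ b :* k :* n := ((a :+ b) :* t :+ b :* n) :* k) refl a b
          (tri (suc n)) (suc n) k
        where open ℕ-Solver

  th-reflect : ∀ a b → 1 ℕ.≤ a ℕ.+ b → ∀ w → th a b w ≈ th b a (w ∘ -_)
  th-reflect a b 1≤ab w = ≈-trans (th≈Θ₁ a b w) (≈-trans
    (Split.Θ-split line {1} (λ (_ , x) → - x) inj (λ y → (0F , - y) , sym (ℤₚ.neg-involutive y)) (ex-proper a b 1≤ab) (λ _ → 0)
        (λ _ → ex b a) (λ _ → w ∘ -_)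
      (λ _ → ex-proper b a (subst (1 ℕ.≤_) (ℕₚ.+-comm a b) 1≤ab))
      (λ _ x → ex-eq₁ a b b a 0 (- x) x (solve 3 (λ a b x → (a :+ b) :* (:- x :* (:- x :- con (+ 1))) :+ con (+ 2) :* (a :* :- x) := con
          (+ 2) :* con (+ 0) :+ ((b :+ a) :* (x :* (x :- con (+ 1))) :+ con (+ 2) :* (b :* x))) refl (+ a) (+ b) x))
      (λ _ _ → refl))
    (≈-trans (⊕-identityʳ _) (≈-trans (·-cong mono-0 ≈-refl) (≈-trans (·-identityˡ _) (≈-sym (th≈Θ₁ b a (w ∘ -_)))))))
    where
      open +-*-Solver
      inj : ∀ {p p′ : Fin 1 × ℤ} → - proj₂ p ≡ - proj₂ p′ → p ≡ p′
      inj {0F , x} {0F , y} eq = cong (0F ,_) (ℤₚ.neg-injective eq)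

  ϑ-reflect : ∀ a b → 1 ℕ.≤ a ℕ.+ b → ϑ a b ≈ ϑ b a
  ϑ-reflect a b 1≤ab = th-reflect a b 1≤ab one-w

  -- x = m y + t r, where t r ≡ r (mod m)
  module Residues (m : ℕ) .{{_ : NonZero m}} (t α : Fin m → ℤ) (t≡ : ∀ r → t r ≡ + m * α r + + toℕ r) where

    open +-*-Solver

    g : Fin m × ℤ → ℤ
    g (r , y) = + m * y + t r

    reduce : ∀ r y → g (r , y) ≡ + m * (y + α r) + + toℕ r
    reduce r y = trans (cong (λ z → + m * y + z) (t≡ r)) (solve 4 (λ m y a r → m :* y :+ (m :* a :+ r) := m :* (y :+ a) :+ r) refl (+ m) y
        (α r) (+ toℕ r))

    g-injective : ∀ {p p′} → g p ≡ g p′ → p ≡ p′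
    g-injective {r , y} {r′ , y′} eq with quotRem-unique m (y + α r) (y′ + α r′) r r′ (trans (sym (reduce r y)) (trans eq (reduce r′ y′)))
    ... | refl , y≡ = cong (r ,_) (+-cancelʳ (α r) {y} {y′} y≡)

    g-surjective : ∀ x → ∃ λ p → x ≡ g p
    g-surjective x with quotRem m x
    ... | r , a , eq = (r , a - α r) , trans eq (sym (trans (reduce r (a - α r))
        (cong (λ z → + m * z + + toℕ r) (solve 2 (λ a b → a :- b :+ b := a) refl a (α r)))))

  mod2-offsets : (r : Fin 2) → + toℕ r ≡ + 2 * + 0 + + toℕ r
  mod2-offsets 0F = refl
  mod2-offsets 1F = refl

  module Mod2 = Residues 2 (λ r → + toℕ r) (λ _ → + 0) mod2-offsets

  -- Ψ is twice Ramanujan's ψ.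
  φ Ψ : PS
  φ = ϑ 1 1
  Ψ = ϑ 0 1

  1≤ : ∀ {n} → 1 ℕ.≤ suc n
  1≤ = s≤s z≤n

  -- Even squares are 4x², and odd squares are 1 plus 8 times a triangular number.
  φ-dissection₂ : φ ≈ dil 4 φ ⊕ mono 1 · dil 8 Ψ
  φ-dissection₂ = ≈-trans (ϑ-split Mod2.g Mod2.g-injective Mod2.g-surjective 1 1 1≤ o A B (λ { 0F → 1≤ ; 1F → 1≤ }) (λ
      { 0F x → solve 1 (λ x → :quad 1 1 (con (+ 2) :* x :+ con (+ 0)) := con (+ 0) :+ :quad 4 4 x) refl x
      ; 1F x → solve 1 (λ x → :quad 1 1 (con (+ 2) :* x :+ con (+ 1)) := con (+ 2) :+ :quad 8 0 x) refl x }))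
    (⊕-cong (≈-trans (·-cong mono-0 ≈-refl) (≈-trans (·-identityˡ _) (≈-trans (≈-sym (th≈Θ₁ 4 4 one-w)) (≈-sym (th-dil 4 1 1 1≤ one-w)))))
      (≈-trans (⊕-identityʳ _) (·-cong ≈-refl (≈-trans (≈-sym (th≈Θ₁ 8 0 one-w))
          (≈-trans (ϑ-reflect 8 0 1≤) (≈-sym (th-dil 8 0 1 1≤ one-w)))))))
    where
      open QuadPoly
      o A B : Fin 2 → ℕ
      o 0F = 0
      o 1F = 1
      A 0F = 4
      A 1F = 8
      B 0F = 4
      B 1F = 0

  table5 : {S : Set} → S → S → S → S → S → Fin 5 → S
  table5 a b c d e 0F = a
  table5 a b c d e 1F = b
  table5 a b c d e 2F = c
  table5 a b c d e 3F = d
  table5 a b c d e 4F = e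

  -- Balanced representatives 0, ±1, ±2: the classes r and -r then have exponents that are
  -- reflections of each other.
  mod5-reps mod5-carry : Fin 5 → ℤ
  mod5-reps  = table5 (+ 0) (+ 1) (+ 2) -[1+ 1 ] -[1+ 0 ]
  mod5-carry = table5 (+ 0) (+ 0) (+ 0) -[1+ 0 ] -[1+ 0 ]

  mod5-offsets : ∀ r → mod5-reps r ≡ + 5 * mod5-carry r + + toℕ r
  mod5-offsets = λ { 0F → refl ; 1F → refl ; 2F → refl ; 3F → refl ; 4F → refl }

  module Mod5 = Residues 5 mod5-reps mod5-carry mod5-offsets

  β₁ β₂ : PS
  β₁ = ϑ 7 3
  β₂ = ϑ 9 1

  -- The classes ±1 contribute equally, as do ±2, since x ↦ -x exchanges them. This is the source of
  -- the factors 2.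
  φ-dissection₅ : φ ≈ dil 25 φ ⊕ κ (+ 2) · mono 1 · dil 5 β₁ ⊕ κ (+ 2) · mono 4 · dil 5 β₂
  φ-dissection₅ = ≈-trans (ϑ-split Mod5.g Mod5.g-injective Mod5.g-surjective 1 1 1≤ (table5 0 1 4 4 1) (table5 25 35 45 5 15)
      (table5 25 15 5 45 35)
      (λ { 0F → 1≤ ; 1F → 1≤ ; 2F → 1≤ ; 3F → 1≤ ; 4F → 1≤ }) (λ
      { 0F x → solve 1 (λ x → :quad 1 1 (con (+ 5) :* x :+ con (+ 0)) := con (+ 0) :+ :quad 25 25 x) refl x
      ; 1F x → solve 1 (λ x → :quad 1 1 (con (+ 5) :* x :+ con (+ 1)) := con (+ 2) :+ :quad 35 15 x) refl x
      ; 2F x → solve 1 (λ x → :quad 1 1 (con (+ 5) :* x :+ con (+ 2)) := con (+ 8) :+ :quad 45 5 x) refl x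
      ; 3F x → solve 1 (λ x → :quad 1 1 (con (+ 5) :* x :+ con -[1+ 1 ]) := con (+ 8) :+ :quad 5 45 x) refl x
      ; 4F x → solve 1 (λ x → :quad 1 1 (con (+ 5) :* x :+ con -[1+ 0 ]) := con (+ 2) :+ :quad 15 35 x) refl x }))
    (≈-trans (⊕-cong (≈-trans (·-cong mono-0 ≈-refl) (≈-trans (·-identityˡ _)
        (≈-trans (≈-sym (th≈Θ₁ 25 25 one-w)) (≈-sym (th-dil 25 1 1 1≤ one-w)))))
      (⊕-cong (·-cong ≈-refl b₁≈) (⊕-cong (·-cong ≈-refl b₂≈) (⊕-cong
          (·-cong ≈-refl (≈-trans (≈-sym (th≈Θ₁ 5 45 one-w)) (≈-trans (ϑ-reflect 5 45 1≤) (≈-sym (th-dil 5 9 1 1≤ one-w)))))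
        (≈-trans (⊕-identityʳ _) (·-cong ≈-refl (≈-trans (≈-sym (th≈Θ₁ 15 35 one-w))
            (≈-trans (ϑ-reflect 15 35 1≤) (≈-sym (th-dil 5 7 3 1≤ one-w))))))))))
      (S.solve 5 (λ a q r x y → a S.:+ (q S.:* x S.:+ (r S.:* y S.:+ (r S.:* y S.:+ q S.:* x))) S.:= a S.:+ S.con (+ 2) S.:* q S.:* x S.:+
          S.con (+ 2) S.:* r S.:* y) ≈-refl (dil 25 φ) (mono 1) (mono 4) (dil 5 β₁) (dil 5 β₂)))
    where
      open QuadPoly
      module S = SeriesSolver
      b₁≈ = ≈-trans (≈-sym (th≈Θ₁ 35 15 one-w)) (≈-sym (th-dil 5 7 3 1≤ one-w))
      b₂≈ = ≈-trans (≈-sym (th≈Θ₁ 45 5 one-w)) (≈-sym (th-dil 5 9 1 1≤ one-w))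

  -- ℤ[i] modulo 2 + i: (x , y) = (2 + i)(a + b i) + t r
  module Gaussian5 (tx ty α : Fin 5 → ℤ) (t≡ : ∀ r → + 2 * tx r + ty r ≡ + 5 * α r + + toℕ r) where

    open +-*-Solver

    g : Fin 5 × (ℤ × ℤ) → ℤ × ℤ
    g (r , a , b) = + 2 * a - b + tx r , a + + 2 * b + ty r

    -- Modulo 5 the form 2x + y kills the multiples of 2 + i, so it identifies ℤ[i]/(2 + i) with
    -- ℤ/5. Its residue recovers r and its quotient recovers a.
    functional : ∀ r a b → + 2 * proj₁ (g (r , a , b)) + proj₂ (g (r , a , b)) ≡ + 5 * (a + α r) + + toℕ r
    functional r a b = trans (solve 4 (λ a b x y → con (+ 2) :* (con (+ 2) :* a :- b :+ x) :+ (a :+ con (+ 2) :* b :+ y) := con (+ 5) :* a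
        :+ (con (+ 2) :* x :+ y)) refl a b (tx r) (ty r))
      (trans (cong (λ z → + 5 * a + z) (t≡ r)) (solve 3 (λ a c r → con (+ 5) :* a :+ (con (+ 5) :* c :+ r) := con (+ 5) :* (a :+ c) :+ r)
          refl a (α r) (+ toℕ r)))

    g-injective : ∀ {p p′} → g p ≡ g p′ → p ≡ p′
    g-injective {r , a , b} {r′ , a′ , b′} eq
      with quotRem-unique 5 (a + α r) (a′ + α r′) r r′ (trans (sym (functional r a b))
          (trans (cong (λ p → + 2 * proj₁ p + proj₂ p) eq) (functional r′ a′ b′)))
    ... | refl , a≡ with +-cancelʳ (α r) {a} {a′} a≡
    ...   | refl = cong (λ z → r , a , z) (ℤₚ.neg-injective {b} {b′}
        (+-cancelˡ (+ 2 * a) { - b} { - b′} (+-cancelʳ (tx r) {+ 2 * a - b} {+ 2 * a - b′} (cong proj₁ eq))))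

    g-surjective : ∀ z → ∃ λ p → z ≡ g p
    g-surjective (x , y) with quotRem 5 (+ 2 * x + y)
    ... | r , c , eq = (r , a , b) , cong₂ _,_
        (solve 3 (λ a x t → x := con (+ 2) :* a :- (con (+ 2) :* a :+ t :- x) :+ t) refl a x (tx r))
        (trans (solve 2 (λ x y → y := con (+ 2) :* x :+ y :- con (+ 2) :* x) refl x y) (trans (cong (_- + 2 * x) eq)
          (trans (solve 4 (λ c α r x → con (+ 5) :* c :+ r :- con (+ 2) :* x := con (+ 5) :* (c :- α) :+ (con (+ 5) :* α :+ r) :- con (+ 2)
              :* x) refl c (α r) (+ toℕ r) x)
          (trans (cong (λ z → + 5 * a + z - + 2 * x) (sym (t≡ r)))
            (solve 4 (λ a t u x → con (+ 5) :* a :+ (con (+ 2) :* t :+ u) :- con (+ 2) :* x := a :+ con (+ 2) :* (con (+ 2) :* a :+ t :- x)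
                :+ u) refl a (tx r) (ty r) x)))))
      where
        a = c - α r
        b = + 2 * a + tx r - x

  -- Entry r is a representative with 2x + y ≡ r modulo 5. For squares these are 0 and the units of
  -- ℤ[i]. Triangular exponents are symmetric about (1/2, 1/2), so the second table takes the four
  -- corners of the unit square around that point and (0, -1), which has exponent 1.
  g₁x g₁y g₁c g₂x g₂y g₂c : Fin 5 → ℤ
  g₁x = table5 (+ 0) (+ 0) (+ 1) -[1+ 0 ] (+ 0)
  g₁y = table5 (+ 0) (+ 1) (+ 0) (+ 0) -[1+ 0 ]
  g₁c = table5 (+ 0) (+ 0) (+ 0) -[1+ 0 ] -[1+ 0 ]
  g₂x = table5 (+ 0) (+ 0) (+ 1) (+ 1) (+ 0)
  g₂y = table5 (+ 0) (+ 1) (+ 0) (+ 1) -[1+ 0 ]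
  g₂c = table5 (+ 0) (+ 0) (+ 0) (+ 0) -[1+ 0 ]

  g₁-offsets : ∀ r → + 2 * g₁x r + g₁y r ≡ + 5 * g₁c r + + toℕ r
  g₁-offsets = λ { 0F → refl ; 1F → refl ; 2F → refl ; 3F → refl ; 4F → refl }

  g₂-offsets : ∀ r → + 2 * g₂x r + g₂y r ≡ + 5 * g₂c r + + toℕ r
  g₂-offsets = λ { 0F → refl ; 1F → refl ; 2F → refl ; 3F → refl ; 4F → refl }

  module G₁ = Gaussian5 g₁x g₁y g₁c g₁-offsets
  module G₂ = Gaussian5 g₂x g₂y g₂c g₂-offsets

  -- The norm x² + y² is multiplicative and 2 + i has norm 5, so the zero coset reproduces the
  -- square at q⁵. Multiplication by i permutes the other four cosets, which therefore contribute
  -- equally.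
  φ² : φ · φ ≈ dil 5 φ · dil 5 φ ⊕ κ (+ 4) · mono 1 · (β₁ · β₂)
  φ² = ≈-trans (th-· 1 1 1 1 1≤ 1≤ one-w one-w) (≈-trans
    (ϑ₂-split G₁.g G₁.g-injective G₁.g-surjective 1 1 1 1 1≤ 1≤ (λ _ → + 1) (table5 0 1 1 1 1) (table5 5 7 9 1 3) (table5 5 3 1 9 7)
        (table5 5 9 3 7 1) (table5 5 1 7 3 9) (λ _ → one-w) (λ _ → one-w)
      (λ { 0F → 1≤ ; 1F → 1≤ ; 2F → 1≤ ; 3F → 1≤ ; 4F → 1≤ }) (λ { 0F → 1≤ ; 1F → 1≤ ; 2F → 1≤ ; 3F → 1≤ ; 4F → 1≤ })
      (λ { 0F x y → solve 2 (λ a b → :quad 1 1 (con (+ 2) :* a :- b :+ con (+ 0)) :+ :quad 1 1 (a :+ con (+ 2) :* b :+ con (+ 0)) := con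
          (+ 0) :+ (:quad 5 5 a :+ :quad 5 5 b)) refl x y
         ; 1F x y → solve 2 (λ a b → :quad 1 1 (con (+ 2) :* a :- b :+ con (+ 0)) :+ :quad 1 1 (a :+ con (+ 2) :* b :+ con (+ 1)) := con
             (+ 2) :+ (:quad 7 3 a :+ :quad 9 1 b)) refl x y
         ; 2F x y → solve 2 (λ a b → :quad 1 1 (con (+ 2) :* a :- b :+ con (+ 1)) :+ :quad 1 1 (a :+ con (+ 2) :* b :+ con (+ 0)) := con
             (+ 2) :+ (:quad 9 1 a :+ :quad 3 7 b)) refl x y
         ; 3F x y → solve 2 (λ a b → :quad 1 1 (con (+ 2) :* a :- b :+ con -[1+ 0 ]) :+ :quad 1 1 (a :+ con (+ 2) :* b :+ con (+ 0)) := con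
             (+ 2) :+ (:quad 1 9 a :+ :quad 7 3 b)) refl x y
         ; 4F x y → solve 2 (λ a b → :quad 1 1 (con (+ 2) :* a :- b :+ con (+ 0)) :+ :quad 1 1 (a :+ con (+ 2) :* b :+ con -[1+ 0 ]) := con
             (+ 2) :+ (:quad 3 7 a :+ :quad 1 9 b)) refl x y })
      (λ _ _ _ → refl))
    (≈-trans (⊕-cong (≈-trans (·-cong mono-0 (·-cong d5 d5)) (·-identityˡ _))
        (⊕-cong ≈-refl (⊕-cong (·-cong ≈-refl (·-cong ≈-refl r37)) (⊕-cong (·-cong ≈-refl (·-cong r19 ≈-refl))
        (≈-trans (⊕-identityʳ _) (·-cong ≈-refl (·-cong r37 r19)))))))
      (S.solve 4 (λ p q x y → p S.:+ (q S.:* (x S.:* y) S.:+ (q S.:* (y S.:* x) S.:+ (q S.:* (y S.:* x) S.:+ q S.:* (x S.:* y)))) S.:= p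
          S.:+ S.con (+ 4) S.:* q S.:* (x S.:* y)) ≈-refl (dil 5 φ · dil 5 φ) (mono 1) β₁ β₂)))
    where
      open QuadPoly
      module S = SeriesSolver
      d5 = ≈-sym (th-dil 5 1 1 1≤ one-w)
      r37 = ϑ-reflect 3 7 1≤
      r19 = ϑ-reflect 1 9 1≤

  T₁ T₂ : PS
  T₁ = ϑ 1 4
  T₂ = ϑ 2 3

  -- In coordinates centred at (1/2, 1/2) the coset of (0, -1) consists of multiples of 2 + i and
  -- reproduces the square at q⁵, shifted by its least exponent 1. The corners of the unit square
  -- are rotated into each other.
  Ψ² : Ψ · Ψ ≈ mono 1 · (dil 5 Ψ · dil 5 Ψ) ⊕ κ (+ 4) · (T₁ · T₂)
  Ψ² = ≈-trans (th-· 0 1 0 1 1≤ 1≤ one-w one-w) (≈-trans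
    (ϑ₂-split G₂.g G₂.g-injective G₂.g-surjective 0 1 0 1 1≤ 1≤ (λ _ → + 1) (table5 0 0 0 0 1) (table5 1 2 3 4 0) (table5 4 3 2 1 5)
        (table5 2 4 1 3 0) (table5 3 1 4 2 5) (λ _ → one-w) (λ _ → one-w)
      (λ { 0F → 1≤ ; 1F → 1≤ ; 2F → 1≤ ; 3F → 1≤ ; 4F → 1≤ }) (λ { 0F → 1≤ ; 1F → 1≤ ; 2F → 1≤ ; 3F → 1≤ ; 4F → 1≤ })
      (λ { 0F x y → solve 2 (λ a b → :quad 0 1 (con (+ 2) :* a :- b :+ con (+ 0)) :+ :quad 0 1 (a :+ con (+ 2) :* b :+ con (+ 0)) := con
          (+ 0) :+ (:quad 1 4 a :+ :quad 2 3 b)) refl x y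
         ; 1F x y → solve 2 (λ a b → :quad 0 1 (con (+ 2) :* a :- b :+ con (+ 0)) :+ :quad 0 1 (a :+ con (+ 2) :* b :+ con (+ 1)) := con
             (+ 0) :+ (:quad 2 3 a :+ :quad 4 1 b)) refl x y
         ; 2F x y → solve 2 (λ a b → :quad 0 1 (con (+ 2) :* a :- b :+ con (+ 1)) :+ :quad 0 1 (a :+ con (+ 2) :* b :+ con (+ 0)) := con
             (+ 0) :+ (:quad 3 2 a :+ :quad 1 4 b)) refl x y
         ; 3F x y → solve 2 (λ a b → :quad 0 1 (con (+ 2) :* a :- b :+ con (+ 1)) :+ :quad 0 1 (a :+ con (+ 2) :* b :+ con (+ 1)) := con
             (+ 0) :+ (:quad 4 1 a :+ :quad 3 2 b)) refl x y
         ; 4F x y → solve 2 (λ a b → :quad 0 1 (con (+ 2) :* a :- b :+ con (+ 0)) :+ :quad 0 1 (a :+ con (+ 2) :* b :+ con -[1+ 0 ]) := con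
             (+ 2) :+ (:quad 0 5 a :+ :quad 0 5 b)) refl x y })
      (λ _ _ _ → refl))
    (≈-trans (⊕-cong m0 (⊕-cong (≈-trans m0 (·-cong ≈-refl r41)) (⊕-cong (≈-trans m0 (·-cong r32 ≈-refl))
        (⊕-cong (≈-trans m0 (·-cong r41 r32)) (≈-trans (⊕-identityʳ _) (·-cong ≈-refl (·-cong d5 d5)))))))
      (S.solve 3 (λ p x y → x S.:* y S.:+ (y S.:* x S.:+ (y S.:* x S.:+ (x S.:* y S.:+ p))) S.:= p S.:+ S.con (+ 4) S.:* (x S.:* y)) ≈-refl
          (mono 1 · (dil 5 Ψ · dil 5 Ψ)) T₁ T₂)))
    where
      open QuadPoly
      module S = SeriesSolver
      m0 : ∀ {f} → mono 0 · f ≈ f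
      m0 = ≈-trans (·-cong mono-0 ≈-refl) (·-identityˡ _)
      d5 = ≈-sym (th-dil 5 0 1 1≤ one-w)
      r41 = ϑ-reflect 4 1 1≤
      r32 = ϑ-reflect 3 2 1≤

open ResidueClasses

-- Sum and difference coordinates, and the Wronskian identity.

module TwoLattice where

  open import Data.Integer using (_+_; _*_; -_; _-_)

  module Parity where
    open +-*-Solver

    g : Fin 2 × (ℤ × ℤ) → ℤ × ℤ
    g (r , ρ , σ) = σ + ρ + + toℕ r , σ - ρ

    functional : ∀ r ρ σ → proj₁ (g (r , ρ , σ)) - proj₂ (g (r , ρ , σ)) ≡ + 2 * ρ + + toℕ r
    functional r ρ σ = solve 3 (λ r ρ σ → σ :+ ρ :+ r :- (σ :- ρ) := con (+ 2) :* ρ :+ r) refl (+ toℕ r) ρ σ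

    g-injective : ∀ {p p′} → g p ≡ g p′ → p ≡ p′
    g-injective {r , ρ , σ} {r′ , ρ′ , σ′} eq
      with quotRem-unique 2 ρ ρ′ r r′ (trans (sym (functional r ρ σ)) (trans (cong (λ p → proj₁ p - proj₂ p) eq) (functional r′ ρ′ σ′)))
    ... | refl , refl = cong (λ z → r , ρ , z) (+-cancelʳ (- ρ) {σ} {σ′} (cong proj₂ eq))

    g-surjective : ∀ z → ∃ λ p → z ≡ g p
    g-surjective (x , y) with quotRem 2 (x - y)
    ... | r , ρ , eq = (r , ρ , y + ρ) , cong₂ _,_
        (trans (solve 2 (λ x y → x := y :+ (x :- y)) refl x y) (trans (cong (λ z → y + z) eq)
            (solve 3 (λ y ρ r → y :+ (con (+ 2) :* ρ :+ r) := y :+ ρ :+ ρ :+ r) refl y ρ (+ toℕ r))))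
        (solve 2 (λ y ρ → y := y :+ ρ :- ρ) refl y ρ)

  sgnℤ-+ : ∀ a b → sgnℤ (a + b) ≡ sgnℤ a * sgnℤ b
  sgnℤ-+ a (+ zero)  = trans (cong sgnℤ (ℤₚ.+-identityʳ a)) (sym (ℤₚ.*-identityʳ (sgnℤ a)))
  sgnℤ-+ a (+ suc n) = begin
    sgnℤ (a + (+ 1 + + n))       ≡⟨ cong sgnℤ (solve 2 (λ a n → a :+ (con (+ 1) :+ n) := a :+ n :+ con (+ 1)) refl a (+ n)) ⟩
    sgnℤ (a + + n + + 1)         ≡⟨ sgnℤ-suc (a + + n) ⟩
    -[1+ 0 ] * sgnℤ (a + + n)    ≡⟨ cong (-[1+ 0 ] *_) (sgnℤ-+ a (+ n)) ⟩
    -[1+ 0 ] * (sgnℤ a * sgn n)  ≡⟨ solve 2 (λ a b → con -[1+ 0 ] :* (a :* b) := a :* (:- b)) refl (sgnℤ a) (sgn n) ⟩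
    sgnℤ a * - sgn n             ∎
    where
      open ≡-Reasoning
      open +-*-Solver
  sgnℤ-+ a -[1+ zero ] = trans (sgnℤ-pred a) (ℤₚ.*-comm -[1+ 0 ] (sgnℤ a))
  sgnℤ-+ a -[1+ suc n ] = begin
    sgnℤ (a + -[1+ suc n ])             ≡⟨ cong sgnℤ (solve 2 (λ a n → a :- (con (+ 1) :+ n) := a :- n :- con (+ 1)) refl a (+ suc n)) ⟩
    sgnℤ (a + -[1+ n ] - + 1)           ≡⟨ sgnℤ-pred (a + -[1+ n ]) ⟩
    -[1+ 0 ] * sgnℤ (a + -[1+ n ])      ≡⟨ cong (-[1+ 0 ] *_) (sgnℤ-+ a -[1+ n ]) ⟩
    -[1+ 0 ] * (sgnℤ a * sgn (suc n))   ≡⟨ solve 2 (λ a b → con -[1+ 0 ] :* (a :* b) := a :* (:- b)) refl (sgnℤ a) (sgn (suc n)) ⟩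
    sgnℤ a * - sgn (suc n)              ∎
    where
      open ≡-Reasoning
      open +-*-Solver

  sgn-even-pair : ∀ ρ σ → sgnℤ (σ + ρ + + 0) * sgnℤ (σ - ρ) ≡ + 1
  sgn-even-pair ρ σ = begin
    sgnℤ (σ + ρ + + 0) * sgnℤ (σ - ρ)             ≡⟨ cong₂ _*_ (trans (cong sgnℤ (ℤₚ.+-identityʳ (σ + ρ))) (sgnℤ-+ σ ρ))
        (trans (sgnℤ-+ σ (- ρ)) (cong (λ z → sgnℤ σ * sgn z) (ℤₚ.∣-i∣≡∣i∣ ρ))) ⟩
    sgnℤ σ * sgnℤ ρ * (sgnℤ σ * sgnℤ ρ)           ≡⟨ solve 2 (λ a b → a :* b :* (a :* b) := a :* a :* (b :* b)) refl (sgnℤ σ) (sgnℤ ρ) ⟩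
    sgnℤ σ * sgnℤ σ * (sgnℤ ρ * sgnℤ ρ)           ≡⟨ cong₂ _*_ (sgn² ℤ.∣ σ ∣) (sgn² ℤ.∣ ρ ∣) ⟩
    + 1                                           ∎
    where
      open ≡-Reasoning
      open +-*-Solver

  sgn-odd-pair : ∀ ρ σ → sgnℤ (σ + ρ + + 1) * sgnℤ (σ - ρ) ≡ -[1+ 0 ]
  sgn-odd-pair ρ σ = trans (cong (_* sgnℤ (σ - ρ)) (trans (sgnℤ-suc (σ + ρ))
      (cong (λ z → -[1+ 0 ] * sgnℤ z) (sym (ℤₚ.+-identityʳ (σ + ρ))))))
    (trans (ℤₚ.*-assoc -[1+ 0 ] (sgnℤ (σ + ρ + + 0)) (sgnℤ (σ - ρ))) (cong (-[1+ 0 ] *_) (sgn-even-pair ρ σ)))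

  table2 : {S : Set} → S → S → Fin 2 → S
  table2 a b 0F = a
  table2 a b 1F = b

  -- On each class of x - y modulo 2 the exponent separates in the difference coordinate ρ and the
  -- sum coordinate σ. The weight is required to depend on ρ alone, so the σ-factor is an unweighted
  -- theta series.
  parity-split : ∀ a b c d → 1 ℕ.≤ a ℕ.+ b → 1 ℕ.≤ c ℕ.+ d → (W : ℤ × ℤ → ℤ) (o A B C D A′ B′ C′ D′ : ℕ) (w w′ : ℤ → ℤ) →
    1 ℕ.≤ A ℕ.+ B → 1 ℕ.≤ C ℕ.+ D → 1 ℕ.≤ A′ ℕ.+ B′ → 1 ℕ.≤ C′ ℕ.+ D′ →
    (∀ ρ σ → quad a b (σ + ρ + + 0) + quad c d (σ - ρ) ≡ + 0 + (quad A B ρ + quad C D σ)) →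
    (∀ ρ σ → quad a b (σ + ρ + + 1) + quad c d (σ - ρ) ≡ + 2 * + o + (quad A′ B′ ρ + quad C′ D′ σ)) →
    (∀ ρ σ → W (σ + ρ + + 0 , σ - ρ) ≡ w ρ * + 1) → (∀ ρ σ → W (σ + ρ + + 1 , σ - ρ) ≡ w′ ρ * + 1) →
    Θ₂ (λ (x , y) → ex a b x ℕ.+ ex c d y) W ≈ th A B w · ϑ C D ⊕ mono o · (th A′ B′ w′ · ϑ C′ D′)
  parity-split a b c d 1≤ab 1≤cd W o A B C D A′ B′ C′ D′ w w′ p₁ p₂ p₃ p₄ e₀ e₁ W₀ W₁ = ≈-trans
    (ϑ₂-split Parity.g Parity.g-injective Parity.g-surjective a b c d 1≤ab 1≤cd W (table2 0 o) (table2 A A′) (table2 B B′) (table2 C C′)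
        (table2 D D′) (table2 w w′) (λ _ → one-w)
      (λ { 0F → p₁ ; 1F → p₃ }) (λ { 0F → p₂ ; 1F → p₄ }) (λ { 0F → e₀ ; 1F → e₁ }) (λ { 0F → W₀ ; 1F → W₁ }))
    (⊕-cong (≈-trans (·-cong mono-0 ≈-refl) (·-identityˡ _)) (⊕-identityʳ _))

  _^²_ : (ℤ → ℤ) → ℕ → ℤ → ℤ
  (u ^² zero)        j = u j
  (u ^² suc zero)    j = u j * j
  (u ^² suc (suc _)) j = u j * (j * j)

  -- Expanding (x - y)² turns M₂M₀ - M₁², the numerator of a second logarithmic derivative, into a
  -- single lattice sum whose weight depends only on x - y. That is what `parity-split` can
  -- separate.
  difference-squared : ∀ a b → 1 ℕ.≤ a ℕ.+ b → (u : ℤ → ℤ) →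
    Θ₂ (λ (x , y) → ex a b x ℕ.+ ex a b y) (λ (x , y) → u x * u y * ((x - y) * (x - y)))
      ≈ κ (+ 2) · (th a b (u ^² 2) · th a b u ⊖ th a b (u ^² 1) · th a b (u ^² 1))
  difference-squared a b 1≤ab u = ≈-trans
    (Θ₂-linear (+ 1) (+ 1) (λ (x , y) → (u ^² 2) x * u y) (λ (x , y) → + 1 * (u x * (u ^² 2) y) + -[1+ 1 ] * ((u ^² 1) x * (u ^² 1) y))
        expand)
    (≈-trans (⊕-cong (·-cong ≈-refl (≈-sym (th-· a b a b 1≤ab 1≤ab (u ^² 2) u)))
      (·-cong ≈-refl (≈-trans (Θ₂-linear (+ 1) -[1+ 1 ] (λ (x , y) → u x * (u ^² 2) y) (λ (x , y) → (u ^² 1) x * (u ^² 1) y) (λ _ → refl))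
        (⊕-cong (·-cong ≈-refl (≈-sym (th-· a b a b 1≤ab 1≤ab u (u ^² 2))))
            (·-cong ≈-refl (≈-sym (th-· a b a b 1≤ab 1≤ab (u ^² 1) (u ^² 1))))))))
    (S.solve 3 (λ x y z → S.con (+ 1) S.:* (z S.:* x) S.:+ S.con (+ 1) S.:*
        (S.con (+ 1) S.:* (x S.:* z) S.:+ S.con -[1+ 1 ] S.:* (y S.:* y)) S.:= S.con (+ 2) S.:* (z S.:* x S.:- y S.:* y)) ≈-refl (th a b u)
        (th a b (u ^² 1)) (th a b (u ^² 2))))
    where
      module S = SeriesSolver
      open +-*-Solver
      expand : ∀ p → u (proj₁ p) * u (proj₂ p) * ((proj₁ p - proj₂ p) * (proj₁ p - proj₂ p))
        ≡ + 1 * ((u ^² 2) (proj₁ p) * u (proj₂ p)) + + 1 * (+ 1 * (u (proj₁ p) * (u ^² 2) (proj₂ p)) + -[1+ 1 ] *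
            ((u ^² 1) (proj₁ p) * (u ^² 1) (proj₂ p)))
      expand (x , y) = solve 4 (λ x y a b → a :* b :* ((x :- y) :* (x :- y)) := con (+ 1) :* (a :* (x :* x) :* b) :+ con (+ 1) :*
          (con (+ 1) :* (a :* (b :* (y :* y))) :+ con -[1+ 1 ] :* (a :* x :* (b :* y)))) refl x y (u x) (u y)

  th-scale : ∀ a b c w → th a b (λ j → c * w j) ≈ κ c · th a b w
  th-scale a b c w = pointwise (λ k → trans (trans (Σ<-cong (suc (suc k ℕ.+ suc k))
      (λ i _ → ℤₚ.*-assoc c (w (+ i - + suc k)) (monoᶜ (ex a b (+ i - + suc k)) k)))
    (Σ<-*ˡ (suc (suc k ℕ.+ suc k)) c (λ i → w (+ i - + suc k) * monoᶜ (ex a b (+ i - + suc k)) k))) (sym (κ-·-at c (th a b w) k)))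

  even-w odd-w : ℤ → ℤ
  even-w ρ = (ρ + ρ) * (ρ + ρ)
  odd-w  ρ = (ρ + ρ + + 1) * (ρ + ρ + + 1)

  -- `α₁` = f(q², q⁸) and `α₂` = f(q⁴, q⁶). `Ψ₀` is `Ψ` at q¹⁰, while `Φ₂` and `Ψ₂` are φ(q⁵) and
  -- `Ψ₀` with the additional weight (x - y)².
  α₁ α₂ Φ₂ Ψ₀ Ψ₂ : PS
  α₁ = ϑ 2 8
  α₂ = ϑ 4 6
  Φ₂ = th 5 5 even-w
  Ψ₀ = ϑ 10 0
  Ψ₂ = th 10 0 odd-w

  module _ where
    open QuadPoly

    T₁-exponent₀ : ∀ ρ σ → quad 1 4 (σ + ρ + + 0) + quad 1 4 (σ - ρ) ≡ + 0 + (quad 5 5 ρ + quad 2 8 σ)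
    T₁-exponent₀ = solve 2 (λ ρ σ → :quad 1 4 (σ :+ ρ :+ con (+ 0)) :+ :quad 1 4 (σ :- ρ) := con (+ 0) :+ (:quad 5 5 ρ :+ :quad 2 8 σ)) refl

    T₁-exponent₁ : ∀ ρ σ → quad 1 4 (σ + ρ + + 1) + quad 1 4 (σ - ρ) ≡ + 2 * + 1 + (quad 10 0 ρ + quad 7 3 σ)
    T₁-exponent₁ = solve 2 (λ ρ σ → :quad 1 4 (σ :+ ρ :+ con (+ 1)) :+ :quad 1 4 (σ :- ρ) := con (+ 2) :+ (:quad 10 0 ρ :+ :quad 7 3 σ))
        refl

    T₂-exponent₀ : ∀ ρ σ → quad 2 3 (σ + ρ + + 0) + quad 2 3 (σ - ρ) ≡ + 0 + (quad 5 5 ρ + quad 4 6 σ)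
    T₂-exponent₀ = solve 2 (λ ρ σ → :quad 2 3 (σ :+ ρ :+ con (+ 0)) :+ :quad 2 3 (σ :- ρ) := con (+ 0) :+ (:quad 5 5 ρ :+ :quad 4 6 σ)) refl

    T₂-exponent₁ : ∀ ρ σ → quad 2 3 (σ + ρ + + 1) + quad 2 3 (σ - ρ) ≡ + 2 * + 2 + (quad 10 0 ρ + quad 9 1 σ)
    T₂-exponent₁ = solve 2 (λ ρ σ → :quad 2 3 (σ :+ ρ :+ con (+ 1)) :+ :quad 2 3 (σ :- ρ) := con (+ 4) :+ (:quad 10 0 ρ :+ :quad 9 1 σ))
        refl

    weight₀ : ∀ ρ σ → + 1 * + 1 * ((σ + ρ + + 0 - (σ - ρ)) * (σ + ρ + + 0 - (σ - ρ))) ≡ even-w ρ * + 1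
    weight₀ = solve 2 (λ ρ σ → con (+ 1) :* con (+ 1) :* ((σ :+ ρ :+ con (+ 0) :- (σ :- ρ)) :* (σ :+ ρ :+ con (+ 0) :- (σ :- ρ))) :=
        (ρ :+ ρ) :* (ρ :+ ρ) :* con (+ 1)) refl

    weight₁ : ∀ ρ σ → + 1 * + 1 * ((σ + ρ + + 1 - (σ - ρ)) * (σ + ρ + + 1 - (σ - ρ))) ≡ odd-w ρ * + 1
    weight₁ = solve 2 (λ ρ σ → con (+ 1) :* con (+ 1) :* ((σ :+ ρ :+ con (+ 1) :- (σ :- ρ)) :* (σ :+ ρ :+ con (+ 1) :- (σ :- ρ))) :=
        (ρ :+ ρ :+ con (+ 1)) :* (ρ :+ ρ :+ con (+ 1)) :* con (+ 1)) refl

  T₁² : T₁ · T₁ ≈ dil 5 φ · α₁ ⊕ mono 1 · (Ψ₀ · β₁)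
  T₁² = ≈-trans (th-· 1 4 1 4 1≤ 1≤ one-w one-w) (≈-trans
    (parity-split 1 4 1 4 1≤ 1≤ (λ _ → + 1) 1 5 5 2 8 10 0 7 3 one-w one-w 1≤ 1≤ 1≤ 1≤ T₁-exponent₀ T₁-exponent₁ (λ _ _ → refl)
        (λ _ _ → refl))
    (⊕-cong (·-cong (≈-sym (th-dil 5 1 1 1≤ one-w)) ≈-refl) ≈-refl))

  T₂² : T₂ · T₂ ≈ dil 5 φ · α₂ ⊕ mono 2 · (Ψ₀ · β₂)
  T₂² = ≈-trans (th-· 2 3 2 3 1≤ 1≤ one-w one-w) (≈-trans
    (parity-split 2 3 2 3 1≤ 1≤ (λ _ → + 1) 2 5 5 4 6 10 0 9 1 one-w one-w 1≤ 1≤ 1≤ 1≤ T₂-exponent₀ T₂-exponent₁ (λ _ _ → refl)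
        (λ _ _ → refl))
    (⊕-cong (·-cong (≈-sym (th-dil 5 1 1 1≤ one-w)) ≈-refl) ≈-refl))

  -- The numerator of the second logarithmic derivative of f(u q^a, u⁻¹ q^b) at u = 1.
  curv : ℕ → ℕ → PS
  curv a b = th a b (λ j → j * j) · ϑ a b ⊖ th a b id · th a b id

  curv-2 : ∀ a b → 1 ℕ.≤ a ℕ.+ b → Θ₂ (λ (x , y) → ex a b x ℕ.+ ex a b y) (λ (x , y) → + 1 * + 1 * ((x - y) * (x - y))) ≈ κ (+ 2) · curv a b
  curv-2 a b 1≤ab = ≈-trans (difference-squared a b 1≤ab one-w) (·-cong ≈-refl
      (⊖-cong (·-cong (th-cong a b (λ j → ℤₚ.*-identityˡ (j * j))) ≈-refl)
    (·-cong (th-cong a b ℤₚ.*-identityˡ) (th-cong a b ℤₚ.*-identityˡ))))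

  curv-T₁ : κ (+ 2) · curv 1 4 ≈ Φ₂ · α₁ ⊕ mono 1 · (Ψ₂ · β₁)
  curv-T₁ = ≈-trans (≈-sym (curv-2 1 4 1≤))
    (parity-split 1 4 1 4 1≤ 1≤ (λ (x , y) → + 1 * + 1 * ((x - y) * (x - y))) 1 5 5 2 8 10 0 7 3 even-w odd-w 1≤ 1≤ 1≤ 1≤ T₁-exponent₀
        T₁-exponent₁ weight₀ weight₁)

  curv-T₂ : κ (+ 2) · curv 2 3 ≈ Φ₂ · α₂ ⊕ mono 2 · (Ψ₂ · β₂)
  curv-T₂ = ≈-trans (≈-sym (curv-2 2 3 1≤))
    (parity-split 2 3 2 3 1≤ 1≤ (λ (x , y) → + 1 * + 1 * ((x - y) * (x - y))) 2 5 5 4 6 10 0 9 1 even-w odd-w 1≤ 1≤ 1≤ 1≤ T₂-exponent₀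
        T₂-exponent₁ weight₀ weight₁)

  -- The sign (-1)^(x + y) is constant on the two classes of x - y modulo 2, which produces a
  -- difference of unweighted products.
  signed-T₁T₂ : th 1 4 sgnℤ · th 2 3 sgnℤ ≈ α₂ · β₁ ⊖ mono 1 · (α₁ · β₂)
  signed-T₁T₂ = ≈-trans (th-· 1 4 2 3 1≤ 1≤ sgnℤ sgnℤ) (≈-trans
    (parity-split 1 4 2 3 1≤ 1≤ (λ (x , y) → sgnℤ x * sgnℤ y) 1 4 6 3 7 9 1 8 2 one-w (λ j → -[1+ 0 ] * one-w j) 1≤ 1≤ 1≤ 1≤
      (solve 2 (λ ρ σ → :quad 1 4 (σ :+ ρ :+ con (+ 0)) :+ :quad 2 3 (σ :- ρ) := con (+ 0) :+ (:quad 4 6 ρ :+ :quad 3 7 σ)) refl)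
      (solve 2 (λ ρ σ → :quad 1 4 (σ :+ ρ :+ con (+ 1)) :+ :quad 2 3 (σ :- ρ) := con (+ 2) :+ (:quad 9 1 ρ :+ :quad 8 2 σ)) refl)
      sgn-even-pair sgn-odd-pair)
    (≈-trans (⊕-cong (·-cong ≈-refl (ϑ-reflect 3 7 1≤)) (·-cong ≈-refl (·-cong (th-scale 9 1 -[1+ 0 ] one-w) (ϑ-reflect 8 2 1≤))))
      (S.solve 4 (λ x y q z → x S.:+ q S.:* (S.con -[1+ 0 ] S.:* z S.:* y) S.:= x S.:- q S.:* (y S.:* z)) ≈-refl (α₂ · β₁) α₁ (mono 1) β₂)))
    where
      open QuadPoly
      module S = SeriesSolver

  J₁ : PS
  J₁ = th 0 5 (λ j → sgnℤ j * j)

  -- `difference-squared` for the weight (-1)^j: the unweighted signed sum is zero, so M₂M₀ drops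
  -- out and only -J₁² remains, while `parity-split` evaluates the same sum.
  J₁² : κ (+ 2) · (J₁ · J₁) ≈ Ψ₂ · dil 5 φ ⊖ Φ₂ · Ψ₀
  J₁² = ≈-trans (S.solve 1 (λ j → S.con (+ 2) S.:* (j S.:* j) S.:= S.:- (S.con (+ 2) S.:* (S.con (+ 0) S.:- j S.:* j))) ≈-refl J₁)
      (≈-trans (~-cong (≈-trans (·-cong ≈-refl (⊖-cong (≈-sym κ0) ≈-refl)) (≈-sym squares)))
    (S.solve 2 (λ x y → S.:- (x S.:+ S.:- y) S.:= y S.:- x) ≈-refl (Φ₂ · Ψ₀) (Ψ₂ · dil 5 φ)))
    where
      module S = SeriesSolver
      open QuadPoly
      κ0 : th 0 5 (sgnℤ ^² 2) · th 0 5 sgnℤ ≈ κ (+ 0)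
      κ0 = ≈-trans (·-cong ≈-refl (ZeroJTP.signed-zero 5 1≤)) (≈-trans (·-zeroʳ _) (pointwise λ { zero → refl ; (suc k) → refl }))
      W : ℤ × ℤ → ℤ
      W (x , y) = sgnℤ x * sgnℤ y * ((x - y) * (x - y))
      split : Θ₂ (λ (x , y) → ex 0 5 x ℕ.+ ex 0 5 y) W ≈ Φ₂ · ϑ 0 10 ⊕ mono 0 · (th 10 0 (λ ρ → -[1+ 0 ] * odd-w ρ) · ϑ 5 5)
      split = parity-split 0 5 0 5 1≤ 1≤ W 0 5 5 0 10 10 0 5 5 even-w (λ ρ → -[1+ 0 ] * odd-w ρ) 1≤ 1≤ 1≤ 1≤
        (solve 2 (λ ρ σ → :quad 0 5 (σ :+ ρ :+ con (+ 0)) :+ :quad 0 5 (σ :- ρ) := con (+ 0) :+ (:quad 5 5 ρ :+ :quad 0 10 σ)) refl)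
        (solve 2 (λ ρ σ → :quad 0 5 (σ :+ ρ :+ con (+ 1)) :+ :quad 0 5 (σ :- ρ) := con (+ 0) :+ (:quad 10 0 ρ :+ :quad 5 5 σ)) refl)
        (λ ρ σ → trans (cong (_* ((σ + ρ + + 0 - (σ - ρ)) * (σ + ρ + + 0 - (σ - ρ)))) (sgn-even-pair ρ σ)) (weight₀ ρ σ))
        (λ ρ σ → trans (cong (_* ((σ + ρ + + 1 - (σ - ρ)) * (σ + ρ + + 1 - (σ - ρ)))) (sgn-odd-pair ρ σ))
          (trans (solve 1 (λ z → con -[1+ 0 ] :* z := con -[1+ 0 ] :* (con (+ 1) :* con (+ 1) :* z)) refl
              ((σ + ρ + + 1 - (σ - ρ)) * (σ + ρ + + 1 - (σ - ρ))))
          (trans (cong (-[1+ 0 ] *_) (weight₁ ρ σ)) (sym (ℤₚ.*-assoc -[1+ 0 ] (odd-w ρ) (+ 1))))))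
      squares : Φ₂ · Ψ₀ ⊕ ~ (Ψ₂ · dil 5 φ) ≈ κ (+ 2) · (th 0 5 (sgnℤ ^² 2) · th 0 5 sgnℤ ⊖ J₁ · J₁)
      squares = ≈-trans (≈-sym (≈-trans split (⊕-cong (·-cong ≈-refl (ϑ-reflect 0 10 1≤))
          (≈-trans (·-cong mono-0 (·-cong (th-scale 10 0 -[1+ 0 ] odd-w) (≈-sym (th-dil 5 1 1 1≤ one-w)))) (≈-trans (·-identityˡ _)
            (S.solve 2 (λ x y → S.con -[1+ 0 ] S.:* x S.:* y S.:= S.:- (x S.:* y)) ≈-refl Ψ₂ (dil 5 φ)))))))
                (difference-squared 0 5 1≤ sgnℤ)

  -- The rows (2 curv, T²) for `T₁` and `T₂` are the product of the matrix with rows (α₁, qβ₁), (α₂,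
  -- q²β₂) and the matrix with rows (Φ₂, φ(q⁵)), (Ψ₂, Ψ₀). The determinant therefore factors, and
  -- the two factors are `signed-T₁T₂` and `J₁²` up to sign and powers of q.
  wronskian : curv 1 4 · (T₂ · T₂) ⊖ curv 2 3 · (T₁ · T₁) ≈ mono 1 · (J₁ · J₁) · (th 1 4 sgnℤ · th 2 3 sgnℤ)
  wronskian = κ-cancelˡ (+ 2) (λ ()) (begin
    κ (+ 2) · (curv 1 4 · (T₂ · T₂) ⊖ curv 2 3 · (T₁ · T₁))
      ≈⟨ solve 4 (λ c t d u → con (+ 2) :* (c :* t :- d :* u) := con (+ 2) :* c :* t :- con (+ 2) :* d :* u) ≈-refl (curv 1 4) (T₂ · T₂)
          (curv 2 3) (T₁ · T₁) ⟩
    κ (+ 2) · curv 1 4 · (T₂ · T₂) ⊖ κ (+ 2) · curv 2 3 · (T₁ · T₁)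
      ≈⟨ ⊖-cong (·-cong curv-T₁ (≈-trans T₂² (⊕-cong ≈-refl (·-cong q² ≈-refl))))
          (·-cong (≈-trans curv-T₂ (⊕-cong ≈-refl (·-cong q² ≈-refl))) T₁²) ⟩
    (Φ₂ · α₁ ⊕ q · (Ψ₂ · β₁)) · (dil 5 φ · α₂ ⊕ q · q · (Ψ₀ · β₂)) ⊖ (Φ₂ · α₂ ⊕ q · q · (Ψ₂ · β₂)) · (dil 5 φ · α₁ ⊕ q · (Ψ₀ · β₁))
      ≈⟨ solve 9 (λ q f₂ p₀ p₂ f₀ a₁ a₂ b₁ b₂ →
           (f₂ :* a₁ :+ q :* (p₂ :* b₁)) :* (f₀ :* a₂ :+ q :* q :* (p₀ :* b₂)) :- (f₂ :* a₂ :+ q :* q :* (p₂ :* b₂)) :*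
               (f₀ :* a₁ :+ q :* (p₀ :* b₁))
           := q :* (p₂ :* f₀ :- f₂ :* p₀) :* (a₂ :* b₁ :- q :* (a₁ :* b₂))) ≈-refl q Φ₂ Ψ₀ Ψ₂ (dil 5 φ) α₁ α₂ β₁ β₂ ⟩
    q · (Ψ₂ · dil 5 φ ⊖ Φ₂ · Ψ₀) · (α₂ · β₁ ⊖ q · (α₁ · β₂))
      ≈⟨ ·-cong (·-cong ≈-refl (≈-sym J₁²)) (≈-sym signed-T₁T₂) ⟩
    q · (κ (+ 2) · (J₁ · J₁)) · (th 1 4 sgnℤ · th 2 3 sgnℤ)
      ≈⟨ solve 3 (λ q j t → q :* (con (+ 2) :* j) :* t := con (+ 2) :* (q :* j :* t)) ≈-refl q (J₁ · J₁) (th 1 4 sgnℤ · th 2 3 sgnℤ) ⟩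
    κ (+ 2) · (q · (J₁ · J₁) · (th 1 4 sgnℤ · th 2 3 sgnℤ)) ∎)
    where
      open ≈-Reasoning
      open SeriesSolver
      q = mono 1
      q² : mono 2 ≈ q · q
      q² = mono-+ 1 1

open TwoLattice

-- Pochhammer products and eta quotients with integer exponents.

module EtaQuotients where

  open import Data.Integer using (_+_; _*_; -_; _-_)
  open import Data.Vec using (zipWith; map)

  -- The Pochhammer product (-c q^a; q^d)_∞.
  Pc : ℤ → ℕ → ℕ → PS
  Pc c a d = ∏∞ (λ j → 1ₛ ⊕ κ c · mono (a ℕ.+ d ℕ.* j))

  module _ (c : ℤ) (a d : ℕ) (1≤a : 1 ℕ.≤ a) (1≤d : 1 ℕ.≤ d) where

    Pc-tame : Tame (λ j → 1ₛ ⊕ κ c · mono (a ℕ.+ d ℕ.* j))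
    Pc-tame k = ≈[]-trans (⊕-cong[] ≈[]-refl (≈[]-trans (·-cong[] ≈[]-refl
        (mono-small (ℕₚ.+-mono-≤ 1≤a (ℕₚ.m≤n*m k d {{ℕ.>-nonZero 1≤d}})))) (≈⇒≈[] (suc k) (·-zeroʳ _)))) (≈⇒≈[] (suc k) (⊕-identityʳ 1ₛ))

    Pc-split2 : Pc c a d ≈ Pc c a (d ℕ.* 2) · Pc c (a ℕ.+ d) (d ℕ.* 2)
    Pc-split2 = ≈-trans (∏∞-split2 Pc-tame) (·-cong (∏∞-cong (λ j → ⊕-cong ≈-refl
        (·-cong ≈-refl (mono-≡ (solve 3 (λ a d j → a :+ d :* (j :* con 2) := a :+ d :* con 2 :* j) refl a d j)))))
      (∏∞-cong (λ j → ⊕-cong ≈-refl (·-cong ≈-refl (mono-≡ (solve 3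
          (λ a d j → a :+ d :* (con 1 :+ j :* con 2) := a :+ d :+ d :* con 2 :* j) refl a d j))))))
      where open ℕ-Solver

    Pc-split5 : Pc c a d ≈ Pc c a (d ℕ.* 5) · Pc c (a ℕ.+ d ℕ.* 1) (d ℕ.* 5) · Pc c (a ℕ.+ d ℕ.* 2) (d ℕ.* 5) · Pc c (a ℕ.+ d ℕ.* 3)
        (d ℕ.* 5) · Pc c (a ℕ.+ d ℕ.* 4) (d ℕ.* 5)
    Pc-split5 = ≈-trans (∏∞-split5 Pc-tame) (·-cong (·-cong (·-cong (·-cong
        (∏∞-cong (λ j → ⊕-cong ≈-refl (·-cong ≈-refl (mono-≡ (solve 3 (λ a d j → a :+ d :* (j :* con 5) := a :+ d :* con 5 :* j) refl a d
            j)))))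
        (∏∞-cong (λ j → ⊕-cong ≈-refl (·-cong ≈-refl (mono-≡ (solve 3
            (λ a d j → a :+ d :* (con 1 :+ j :* con 5) := a :+ d :* con 1 :+ d :* con 5 :* j) refl a d j))))))
        (∏∞-cong (λ j → ⊕-cong ≈-refl (·-cong ≈-refl (mono-≡ (solve 3
            (λ a d j → a :+ d :* (con 2 :+ j :* con 5) := a :+ d :* con 2 :+ d :* con 5 :* j) refl a d j))))))
        (∏∞-cong (λ j → ⊕-cong ≈-refl (·-cong ≈-refl (mono-≡ (solve 3
            (λ a d j → a :+ d :* (con 3 :+ j :* con 5) := a :+ d :* con 3 :+ d :* con 5 :* j) refl a d j))))))
        (∏∞-cong (λ j → ⊕-cong ≈-refl (·-cong ≈-refl (mono-≡ (solve 3
            (λ a d j → a :+ d :* (con 4 :+ j :* con 5) := a :+ d :* con 4 :+ d :* con 5 :* j) refl a d j))))))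
      where open ℕ-Solver

    Pc-dil : ∀ k .{{_ : NonZero k}} → dil k (Pc c a d) ≈ Pc c (a ℕ.* k) (d ℕ.* k)
    Pc-dil k = ≈-trans (dil-∏∞ k Pc-tame) (∏∞-cong (λ j → ≈-trans (dil-⊕ k 1ₛ _) (⊕-cong (dil-1 k)
      (≈-trans (dil-κ-· k c _) (·-cong ≈-refl (≈-trans (dil-mono k _)
          (mono-≡ (solve 4 (λ a d j k → (a :+ d :* j) :* k := a :* k :+ d :* k :* j) refl a d j k))))))))
      where open ℕ-Solver

  Pc-± : ∀ a d → 1 ℕ.≤ a → 1 ℕ.≤ d → Pc (+ 1) a d · Pc -[1+ 0 ] a d ≈ Pc -[1+ 0 ] (a ℕ.* 2) (d ℕ.* 2)
  Pc-± a d 1≤a 1≤d = ≈-trans (≈-sym (∏∞-· (Pc-tame (+ 1) a d 1≤a 1≤d) (Pc-tame -[1+ 0 ] a d 1≤a 1≤d))) (∏∞-cong (λ j → let x = mono (a ℕ.+ d ℕ.* j) in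
    ≈-trans (·-cong (⊕-cong 1ₛ≈κ ≈-refl) (⊕-cong 1ₛ≈κ ≈-refl)) (≈-trans
      (solve 1 (λ x → (con (+ 1) :+ con (+ 1) :* x) :* (con (+ 1) :+ con -[1+ 0 ] :* x) := con (+ 1) :+ con -[1+ 0 ] :* (x :* x)) ≈-refl x)
      (⊕-cong (≈-sym 1ₛ≈κ) (·-cong ≈-refl (mono-·-mono (ℕ-Solver.solve 3
          (λ a d j → a ℕ-Solver.:+ d ℕ-Solver.:* j ℕ-Solver.:+ (a ℕ-Solver.:+ d ℕ-Solver.:* j) ℕ-Solver.:= a ℕ-Solver.:* ℕ-Solver.con 2
          ℕ-Solver.:+ d ℕ-Solver.:* ℕ-Solver.con 2 ℕ-Solver.:* j) refl a d j)))))))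
    where open SeriesSolver

  alt-Pc : alt (Pc -[1+ 0 ] 1 2) ≈ Pc (+ 1) 1 2
  alt-Pc = ≈-trans (alt-∏∞ _) (∏∞-cong (λ j → ≈-trans (alt-⊕ 1ₛ _) (⊕-cong alt-1 (≈-trans (alt-· (κ -[1+ 0 ]) _)
    (≈-trans (·-cong (alt-κ -[1+ 0 ]) (≈-trans (alt-mono _) (·-cong (κ-≡ (odd j)) ≈-refl)))
        (solve 1 (λ x → con -[1+ 0 ] :* (con -[1+ 0 ] :* x) := con (+ 1) :* x) ≈-refl _))))))
    where
      open SeriesSolver
      odd : ∀ j → sgn (1 ℕ.+ 2 ℕ.* j) ≡ -[1+ 0 ]
      odd j = cong -_ (trans (cong sgn (ℕₚ.*-comm 2 j)) (sgn-even j))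

  e₁ : PS
  e₁ = Pc -[1+ 0 ] 1 1

  ones : PS
  PS.coe ones _ = + 1

  -- The partition generating function, as a product of geometric series. An explicit inverse of
  -- `e₁` makes negative exponents available.
  i₁ : PS
  i₁ = ∏∞ (λ j → dil (suc j) ones)

  geometric₁ : (1ₛ ⊕ κ -[1+ 0 ] · mono 1) · ones ≈ 1ₛ
  geometric₁ = ≈-trans (≈-trans (·-cong (⊕-cong 1ₛ≈κ ≈-refl) ≈-refl)
      (solve 2 (λ x y → (con (+ 1) :+ con -[1+ 0 ] :* x) :* y := y :- x :* y) ≈-refl (mono 1) ones))
    (pointwise λ { zero → cong (λ z → + 1 - z) (mono-·-< 1 ones 0 (s≤s z≤n)) ; (suc n) → cong (λ z → + 1 - z) (mono-·-+ 1 ones n) })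
    where open SeriesSolver

  e₁·i₁ : e₁ · i₁ ≈ 1ₛ
  e₁·i₁ = ≈-trans (≈-sym (∏∞-· (Pc-tame -[1+ 0 ] 1 1 1≤ 1≤) tame)) (≈-trans (∏∞-cong factor≈1) ∏∞-1)
    where
      open SeriesSolver
      tame : Tame (λ j → dil (suc j) ones)
      tame j = modulo λ { zero _ → dil-at-0 (suc j) ones ; (suc n) n<j → dil-small (suc j) ones (suc n) (s≤s z≤n) n<j }
      factor≈1 : ∀ j → (1ₛ ⊕ κ -[1+ 0 ] · mono (1 ℕ.+ 1 ℕ.* j)) · dil (suc j) ones ≈ 1ₛ
      factor≈1 j = ≈-trans (·-cong (≈-sym (≈-trans (dil-⊕ (suc j) 1ₛ _)
          (⊕-cong (dil-1 (suc j)) (≈-trans (dil-κ-· (suc j) -[1+ 0 ] (mono 1)) (·-cong ≈-refl (dil-mono (suc j) 1)))))) ≈-refl)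
        (≈-trans (≈-sym (dil-· (suc j) (1ₛ ⊕ κ -[1+ 0 ] · mono 1) ones)) (≈-trans (dil-cong (suc j) geometric₁) (dil-1 (suc j))))
      ∏<-1 : ∀ n → ∏< n (λ _ → 1ₛ) ≈ 1ₛ
      ∏<-1 zero    = ≈-refl
      ∏<-1 (suc n) = ≈-trans (·-identityʳ _) (∏<-1 n)
      ∏∞-1 : ∏∞ (λ _ → 1ₛ) ≈ 1ₛ
      ∏∞-1 = pointwise (λ n → at (∏<-1 n) n)

  -- Total in k, so that powers of the eta factors can be indexed by plain numbers without `NonZero`
  -- evidence.
  dilN : ℕ → PS → PS
  dilN zero    f = f
  dilN (suc k) f = dil (suc k) f

  ee ii : ℕ → PS
  ee k = dilN k e₁
  ii k = dilN k i₁

  ee·ii : ∀ k → ee k · ii k ≈ 1ₛ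
  ee·ii zero    = e₁·i₁
  ee·ii (suc k) = ≈-trans (≈-sym (dil-· (suc k) e₁ i₁)) (≈-trans (dil-cong (suc k) e₁·i₁) (dil-1 (suc k)))

  pw : ℕ → ℤ → PS
  pw k (+ zero)      = 1ₛ
  pw k (+ suc n)     = ee k · pw k (+ n)
  pw k -[1+ zero ]   = ii k
  pw k -[1+ suc n ]  = ii k · pw k -[1+ n ]

  pw-suc : ∀ k z → pw k (+ 1 + z) ≈ ee k · pw k z
  pw-suc k (+ n)        = ≈-refl
  pw-suc k -[1+ zero ]  = ≈-sym (ee·ii k)
  pw-suc k -[1+ suc n ] = ≈-sym (≈-trans (solve 3 (λ e i p → e :* (i :* p) := e :* i :* p) ≈-refl (ee k) (ii k) (pw k -[1+ n ]))
      (≈-trans (·-cong (ee·ii k) ≈-refl) (·-identityˡ _)))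
    where open SeriesSolver

  pw-pred : ∀ k z → pw k (-[1+ 0 ] + z) ≈ ii k · pw k z
  pw-pred k (+ zero)   = ≈-sym (·-identityʳ _)
  pw-pred k (+ suc n)  = ≈-sym (≈-trans (solve 3 (λ e i p → i :* (e :* p) := e :* i :* p) ≈-refl (ee k) (ii k) (pw k (+ n)))
      (≈-trans (·-cong (ee·ii k) ≈-refl) (·-identityˡ _)))
    where open SeriesSolver
  pw-pred k -[1+ n ]   = ≈-refl

  pw-≡ : ∀ k {y z} → y ≡ z → pw k y ≈ pw k z
  pw-≡ k refl = ≈-refl

  pw-+ : ∀ k y z → pw k (y + z) ≈ pw k y · pw k z
  pw-+ k (+ zero)  z = ≈-trans (pw-≡ k (ℤₚ.+-identityˡ z)) (≈-sym (·-identityˡ _))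
  pw-+ k (+ suc n) z = ≈-trans (pw-≡ k (ℤₚ.+-assoc (+ 1) (+ n) z)) (≈-trans (pw-suc k (+ n + z)) (≈-trans (·-cong ≈-refl (pw-+ k (+ n) z))
    (solve 3 (λ a b c → a :* (b :* c) := a :* b :* c) ≈-refl (ee k) (pw k (+ n)) (pw k z))))
    where open SeriesSolver
  pw-+ k -[1+ zero ] z = pw-pred k z
  pw-+ k -[1+ suc n ] z = ≈-trans (pw-≡ k (ℤₚ.+-assoc -[1+ 0 ] -[1+ n ] z))
      (≈-trans (pw-pred k (-[1+ n ] + z)) (≈-trans (·-cong ≈-refl (pw-+ k -[1+ n ] z))
    (solve 3 (λ a b c → a :* (b :* c) := a :* b :* c) ≈-refl (ii k) (pw k -[1+ n ]) (pw k z))))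
    where open SeriesSolver

  dilN-dil : ∀ m k l .{{_ : NonZero m}} .{{_ : NonZero k}} → k ℕ.* m ≡ l → ∀ f → dil k (dilN m f) ≈ dilN l f
  dilN-dil (suc m) (suc k) l refl f = dil-dil (suc k) (suc m) (suc k ℕ.* suc m) refl f

  pw-dil : ∀ m k l .{{_ : NonZero m}} .{{_ : NonZero k}} → k ℕ.* m ≡ l → ∀ z → dil k (pw m z) ≈ pw l z
  pw-dil m k l eq (+ zero)     = dil-1 k
  pw-dil m k l eq (+ suc n)    = ≈-trans (dil-· k _ _) (·-cong (dilN-dil m k l eq e₁) (pw-dil m k l eq (+ n)))
  pw-dil m k l eq -[1+ zero ]  = dilN-dil m k l eq i₁
  pw-dil m k l eq -[1+ suc n ] = ≈-trans (dil-· k _ _) (·-cong (dilN-dil m k l eq i₁) (pw-dil m k l eq -[1+ n ]))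

  -- mon′ (a ∷ b ∷ …) = e₁^a e₂^b e₄^c e₈^d e₅^a′ e₁₀^b′ e₂₀^c′ e₄₀^d′, with negative exponents allowed.
  Exponents : Set
  Exponents = Vec ℤ 8

  mon′ : Exponents → PS
  mon′ (a ∷ b ∷ c ∷ d ∷ a′ ∷ b′ ∷ c′ ∷ d′ ∷ []) = pw 1 a · pw 2 b · pw 4 c · pw 8 d · (pw 5 a′ · pw 10 b′ · pw 20 c′ · pw 40 d′)

  infixl 6 _⊹_
  _⊹_ : Exponents → Exponents → Exponents
  _⊹_ = zipWith _+_

  mon-·′ : ∀ u v → mon′ u · mon′ v ≈ mon′ (u ⊹ v)
  mon-·′ (a ∷ b ∷ c ∷ d ∷ e ∷ f ∷ g ∷ h ∷ []) (a′ ∷ b′ ∷ c′ ∷ d′ ∷ e′ ∷ f′ ∷ g′ ∷ h′ ∷ []) = ≈-trans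
    (solve 16 (λ a b c d e f g h a′ b′ c′ d′ e′ f′ g′ h′ →
       a :* b :* c :* d :* (e :* f :* g :* h) :* (a′ :* b′ :* c′ :* d′ :* (e′ :* f′ :* g′ :* h′))
       := a :* a′ :* (b :* b′) :* (c :* c′) :* (d :* d′) :* (e :* e′ :* (f :* f′) :* (g :* g′) :* (h :* h′))) ≈-refl
       (pw 1 a) (pw 2 b) (pw 4 c) (pw 8 d) (pw 5 e) (pw 10 f) (pw 20 g) (pw 40 h) (pw 1 a′) (pw 2 b′) (pw 4 c′) (pw 8 d′) (pw 5 e′)
           (pw 10 f′) (pw 20 g′) (pw 40 h′))
    (≈-sym (·-cong (·-cong (·-cong (·-cong (pw-+ 1 a a′) (pw-+ 2 b b′)) (pw-+ 4 c c′)) (pw-+ 8 d d′))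
        (·-cong (·-cong (·-cong (pw-+ 5 e e′) (pw-+ 10 f f′)) (pw-+ 20 g g′)) (pw-+ 40 h h′))))
    where open SeriesSolver

  -- The exponents of e₈ and e₄₀ are zero because q ↦ q² would send these factors to e₁₆ and e₈₀,
  -- outside the eight slots.
  dil2-mon′ : ∀ a b c e f g → dil 2 (mon′ (a ∷ b ∷ c ∷ + 0 ∷ e ∷ f ∷ g ∷ + 0 ∷ [])) ≈ mon′ (+ 0 ∷ a ∷ b ∷ c ∷ + 0 ∷ e ∷ f ∷ g ∷ [])
  dil2-mon′ a b c e f g = ≈-trans (dil-cong 2 (≈-trans (·-cong (·-identityʳ _) (·-identityʳ _)) ≈-refl)) (≈-trans (dil-· 2 _ _)
    (·-cong (≈-trans (dil-· 2 _ _) (·-cong (≈-trans (dil-· 2 _ _) (·-cong (≈-trans (pw-dil 1 2 2 refl a) (≈-sym (·-identityˡ _)))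
        (pw-dil 2 2 4 refl b))) (pw-dil 4 2 8 refl c)))
            (≈-trans (dil-· 2 _ _) (·-cong (≈-trans (dil-· 2 _ _) (·-cong (≈-trans (pw-dil 5 2 10 refl e) (≈-sym (·-identityˡ _)))
                (pw-dil 10 2 20 refl f))) (pw-dil 20 2 40 refl g)))))

  dil5-mon′ : ∀ a b c d → dil 5 (mon′ (a ∷ b ∷ c ∷ d ∷ + 0 ∷ + 0 ∷ + 0 ∷ + 0 ∷ [])) ≈ mon′ (+ 0 ∷ + 0 ∷ + 0 ∷ + 0 ∷ a ∷ b ∷ c ∷ d ∷ [])
  dil5-mon′ a b c d = ≈-trans (dil-· 5 _ _) (≈-trans (·-cong
      (≈-trans (dil-· 5 _ _) (·-cong (≈-trans (dil-· 5 _ _) (·-cong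
          (≈-trans (dil-· 5 _ _) (·-cong (pw-dil 1 5 5 refl a) (pw-dil 2 5 10 refl b))) (pw-dil 4 5 20 refl c))) (pw-dil 8 5 40 refl d)))
      (≈-trans (dil-cong 5 1s) (≈-trans (dil-1 5) (≈-sym 1s)))) (·-comm _ _))
    where
      1s : 1ₛ · 1ₛ · 1ₛ · 1ₛ ≈ 1ₛ
      1s = ≈-trans (·-identityʳ _) (≈-trans (·-identityʳ _) (·-identityʳ _))

  mon-0′ : mon′ (+ 0 ∷ + 0 ∷ + 0 ∷ + 0 ∷ + 0 ∷ + 0 ∷ + 0 ∷ + 0 ∷ []) ≈ 1ₛ
  mon-0′ = ≈-trans (·-cong 1s 1s) (·-identityʳ _)
    where
      1s : 1ₛ · 1ₛ · 1ₛ · 1ₛ ≈ 1ₛ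
      1s = ≈-trans (·-identityʳ _) (≈-trans (·-identityʳ _) (·-identityʳ _))

  -- A copy of `mon′` that is blocked as an element of `PS`. Unification then compares exponent
  -- vectors and does not unfold the product.
  mon : Exponents → PS
  PS.coe (mon v) = PS.coe (mon′ v)

  mon-unfold : ∀ v → mon v ≈ mon′ v
  mon-unfold v = pointwise (λ _ → refl)

  mon-· : ∀ u v → mon u · mon v ≈ mon (u ⊹ v)
  mon-· u v = ≈-trans (·-cong (mon-unfold u) (mon-unfold v)) (≈-trans (mon-·′ u v) (≈-sym (mon-unfold (u ⊹ v))))

  dil2-mon : ∀ a b c e f g → dil 2 (mon (a ∷ b ∷ c ∷ + 0 ∷ e ∷ f ∷ g ∷ + 0 ∷ [])) ≈ mon (+ 0 ∷ a ∷ b ∷ c ∷ + 0 ∷ e ∷ f ∷ g ∷ [])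
  dil2-mon a b c e f g = ≈-trans (dil-cong 2 (mon-unfold _)) (≈-trans (dil2-mon′ a b c e f g) (≈-sym (mon-unfold _)))

  dil5-mon : ∀ a b c d → dil 5 (mon (a ∷ b ∷ c ∷ d ∷ + 0 ∷ + 0 ∷ + 0 ∷ + 0 ∷ [])) ≈ mon (+ 0 ∷ + 0 ∷ + 0 ∷ + 0 ∷ a ∷ b ∷ c ∷ d ∷ [])
  dil5-mon a b c d = ≈-trans (dil-cong 5 (mon-unfold _)) (≈-trans (dil5-mon′ a b c d) (≈-sym (mon-unfold _)))

  mon-0 : mon (+ 0 ∷ + 0 ∷ + 0 ∷ + 0 ∷ + 0 ∷ + 0 ∷ + 0 ∷ + 0 ∷ []) ≈ 1ₛ
  mon-0 = ≈-trans (mon-unfold _) mon-0′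

  neg-exps : Exponents → Exponents
  neg-exps = map (λ z → - z)

  mon-inverse : ∀ u → mon u · mon (neg-exps u) ≈ 1ₛ
  mon-inverse u@(a ∷ b ∷ c ∷ d ∷ e ∷ f ∷ g ∷ h ∷ []) = ≈-trans (mon-· u (neg-exps u)) (≈-trans (mon-unfold _) (≈-trans
    (·-cong (·-cong (·-cong (·-cong (pw-≡ 1 (ℤₚ.+-inverseʳ a)) (pw-≡ 2 (ℤₚ.+-inverseʳ b))) (pw-≡ 4 (ℤₚ.+-inverseʳ c)))
        (pw-≡ 8 (ℤₚ.+-inverseʳ d)))
            (·-cong (·-cong (·-cong (pw-≡ 5 (ℤₚ.+-inverseʳ e)) (pw-≡ 10 (ℤₚ.+-inverseʳ f))) (pw-≡ 20 (ℤₚ.+-inverseʳ g)))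
                (pw-≡ 40 (ℤₚ.+-inverseʳ h)))) mon-0′))

  mon-cancel[] : ∀ v {f g N} → f · mon v ≈[ N ] g · mon v → f ≈[ N ] g
  mon-cancel[] v {f} {g} p = ≈[]-trans (≈⇒≈[] _ (≈-sym (unit f))) (≈[]-trans (·-cong[] p ≈[]-refl) (≈⇒≈[] _ (unit g)))
    where
      open SeriesSolver
      unit : ∀ f → f · mon v · mon (neg-exps v) ≈ f
      unit f = ≈-trans (solve 3 (λ f x y → f :* x :* y := f :* (x :* y)) ≈-refl f (mon v) (mon (neg-exps v)))
          (≈-trans (·-cong ≈-refl (mon-inverse v)) (·-identityʳ f))

  -- An eta quotient is a unit: negating its exponents inverts it.
  mon-cancel : ∀ u {f g} → f · mon u ≈ g · mon u → f ≈ g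
  mon-cancel u p = ≈[]-all (λ M → mon-cancel[] u (≈⇒≈[] M p))

open EtaQuotients

-- Theta series as eta quotients, and q ↦ -q on exponent vectors.

module ThetaProducts where

  open import Data.Integer using (_+_; _*_; -_; _-_)

  dil-identity : ∀ f → dil 1 f ≈ f
  dil-identity f = pointwise (λ n → trans (cong (dil 1 f !_) (sym (ℕₚ.*-identityʳ n))) (dil-* 1 f n))

  r4 : ∀ {x} → x · 1ₛ · 1ₛ · 1ₛ ≈ x
  r4 = ≈-trans (·-identityʳ _) (≈-trans (·-identityʳ _) (·-identityʳ _))

  mon-e₁ : mon (+ 1 ∷ + 0 ∷ + 0 ∷ + 0 ∷ + 0 ∷ + 0 ∷ + 0 ∷ + 0 ∷ []) ≈ ee 1
  mon-e₁ = ≈-trans (mon-unfold _) (≈-trans (·-cong r4 r4) (≈-trans (·-identityʳ _) (·-identityʳ _)))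

  mon-e₂ : mon (+ 0 ∷ + 1 ∷ + 0 ∷ + 0 ∷ + 0 ∷ + 0 ∷ + 0 ∷ + 0 ∷ []) ≈ ee 2
  mon-e₂ = ≈-trans (mon-unfold _) (≈-trans (·-cong (≈-trans (·-identityʳ _) (≈-trans (·-identityʳ _) (·-identityˡ _))) r4)
      (≈-trans (·-identityʳ _) (·-identityʳ _)))

  mon-e₅ : mon (+ 0 ∷ + 0 ∷ + 0 ∷ + 0 ∷ + 1 ∷ + 0 ∷ + 0 ∷ + 0 ∷ []) ≈ ee 5
  mon-e₅ = ≈-trans (mon-unfold _) (≈-trans (·-cong r4 r4) (≈-trans (·-identityˡ _) (·-identityʳ _)))

  mon-e₁₀ : mon (+ 0 ∷ + 0 ∷ + 0 ∷ + 0 ∷ + 0 ∷ + 1 ∷ + 0 ∷ + 0 ∷ []) ≈ ee 10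
  mon-e₁₀ = ≈-trans (mon-unfold _) (≈-trans (·-cong r4 (≈-trans (·-identityʳ _) (≈-trans (·-identityʳ _) (·-identityˡ _))))
      (≈-trans (·-identityˡ _) (·-identityʳ _)))

  Pc≈ee : ∀ d .{{_ : NonZero d}} → Pc -[1+ 0 ] d d ≈ dil d e₁
  Pc≈ee d = ≈-sym (≈-trans (Pc-dil -[1+ 0 ] 1 1 1≤ 1≤ d) (∏∞-cong
      (λ j → ⊕-cong ≈-refl (·-cong ≈-refl (mono-≡ (cong₂ (λ a b → a ℕ.+ b ℕ.* j) (ℕₚ.*-identityˡ d) (ℕₚ.*-identityˡ d)))))))

  factor≈Pc : ∀ d → ∏∞ (Gauss.factor d) ≈ Pc -[1+ 0 ] d d
  factor≈Pc d = ∏∞-cong (λ k → ⊕-cong ≈-refl (≈-trans (~-cong (mono-≡ (ℕₚ.*-suc d k)))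
      (solve 1 (λ x → :- x := con -[1+ 0 ] :* x) ≈-refl _)))
    where open SeriesSolver

  O O⁺ : PS
  O  = Pc -[1+ 0 ] 1 2
  O⁺ = Pc (+ 1) 1 2

  O·e₂ : O · ee 2 ≈ ee 1
  O·e₂ = ≈-sym (≈-trans (dil-identity e₁) (≈-trans (Pc-split2 -[1+ 0 ] 1 1 1≤ 1≤) (·-cong ≈-refl (Pc≈ee 2))))

  mO mO⁺ : Exponents
  mO  = + 1 ∷ - + 1 ∷ + 0 ∷ + 0 ∷ + 0 ∷ + 0 ∷ + 0 ∷ + 0 ∷ []
  mO⁺ = - + 1 ∷ + 2 ∷ - + 1 ∷ + 0 ∷ + 0 ∷ + 0 ∷ + 0 ∷ + 0 ∷ []

  O-mon : O ≈ mon mO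
  O-mon = mon-cancel (+ 0 ∷ + 1 ∷ + 0 ∷ + 0 ∷ + 0 ∷ + 0 ∷ + 0 ∷ + 0 ∷ [])
      (≈-trans (·-cong ≈-refl mon-e₂) (≈-trans O·e₂ (≈-trans (≈-sym mon-e₁) (≈-sym (mon-· mO _)))))

  -- From (1 + x)(1 - x) = 1 - x² the product of `O⁺` and `O` is `O` at q², so the exponents come
  -- from one division.
  O⁺-mon : O⁺ ≈ mon mO⁺
  O⁺-mon = mon-cancel mO (≈-trans (·-cong ≈-refl (≈-sym O-mon)) (≈-trans (Pc-± 1 2 1≤ 1≤) (≈-trans (≈-sym (Pc-dil -[1+ 0 ] 1 2 1≤ 1≤ 2))
    (≈-trans (dil-cong 2 O-mon) (≈-trans (dil2-mon (+ 1) (- + 1) (+ 0) (+ 0) (+ 0) (+ 0)) (≈-sym (mon-· mO⁺ mO)))))))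

  -- Exponents of the z-th power of e₁(-q) = e₂³/(e₁e₄), and of its dilation by 5. The formula holds
  -- because q ↦ -q turns `O` into `O⁺` and fixes e₂.
  m1 m5 : ℤ → Exponents
  m1 z = - z ∷ + 3 * z ∷ - z ∷ + 0 ∷ + 0 ∷ + 0 ∷ + 0 ∷ + 0 ∷ []
  m5 z = + 0 ∷ + 0 ∷ + 0 ∷ + 0 ∷ - z ∷ + 3 * z ∷ - z ∷ + 0 ∷ []

  mon-≡ : ∀ {u v} → u ≡ v → mon u ≈ mon v
  mon-≡ refl = ≈-refl

  m1-+ : ∀ y z → m1 (y + z) ≡ m1 y ⊹ m1 z
  m1-+ y z = cong₂ (λ a b → a ∷ b ∷ a ∷ + 0 ∷ + 0 ∷ + 0 ∷ + 0 ∷ + 0 ∷ []) (ℤₚ.neg-distrib-+ y z) (ℤₚ.*-distribˡ-+ (+ 3) y z)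

  alt-ee₁ : alt (ee 1) ≈ mon (m1 (+ 1))
  alt-ee₁ = ≈-trans (alt-cong (≈-sym O·e₂)) (≈-trans (alt-· O (ee 2))
      (≈-trans (·-cong (≈-trans alt-Pc O⁺-mon) (≈-trans (alt-dil2 e₁) (≈-sym mon-e₂))) (mon-· mO⁺ _)))

  alt-ii₁ : alt (ii 1) ≈ mon (m1 -[1+ 0 ])
  alt-ii₁ = mon-cancel (m1 (+ 1)) (≈-trans (·-cong ≈-refl (≈-sym alt-ee₁))
      (≈-trans (≈-sym (alt-· (ii 1) (ee 1))) (≈-trans (alt-cong (≈-trans (·-comm _ _) (ee·ii 1)))
    (≈-trans alt-1 (≈-trans (≈-sym mon-0) (≈-sym (mon-· (m1 -[1+ 0 ]) (m1 (+ 1)))))))))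

  alt-pw₁ : ∀ z → alt (pw 1 z) ≈ mon (m1 z)
  alt-pw₁ (+ zero)     = ≈-trans alt-1 (≈-sym mon-0)
  alt-pw₁ (+ suc n)    = ≈-trans (alt-· _ _) (≈-trans (·-cong alt-ee₁ (alt-pw₁ (+ n)))
      (≈-trans (mon-· (m1 (+ 1)) (m1 (+ n))) (mon-≡ (sym (m1-+ (+ 1) (+ n))))))
  alt-pw₁ -[1+ zero ]  = alt-ii₁
  alt-pw₁ -[1+ suc n ] = ≈-trans (alt-· _ _) (≈-trans (·-cong alt-ii₁ (alt-pw₁ -[1+ n ]))
      (≈-trans (mon-· (m1 -[1+ 0 ]) (m1 -[1+ n ])) (mon-≡ (sym (m1-+ -[1+ 0 ] -[1+ n ])))))

  sgn-5 : ∀ n → sgn (n ℕ.* 5) ≡ sgn n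
  sgn-5 zero    = refl
  sgn-5 (suc n) = trans (solve 1 (λ s → :- (:- (:- (:- (:- s)))) := :- s) refl (sgn (n ℕ.* 5))) (cong -_ (sgn-5 n))
    where open +-*-Solver

  alt-dil5 : ∀ f → alt (dil 5 f) ≈ dil 5 (alt f)
  alt-dil5 f = pointwise λ n → ∣-cases 5 n
    (λ { (divides m refl) → trans (cong₂ _*_ (sgn-5 m) (dil-* 5 f m)) (sym (dil-* 5 (alt f) m)) })
    (λ 5∤n → trans (cong (sgn n *_) (dil-∤ 5 f 5∤n)) (trans (ℤₚ.*-zeroʳ (sgn n)) (sym (dil-∤ 5 (alt f) 5∤n))))

  alt-pw₅ : ∀ z → alt (pw 5 z) ≈ mon (m5 z)
  alt-pw₅ z = ≈-trans (alt-cong (≈-sym (pw-dil 1 5 5 refl z))) (≈-trans (alt-dil5 (pw 1 z))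
      (≈-trans (dil-cong 5 (alt-pw₁ z)) (dil5-mon (- z) (+ 3 * z) (- z) (+ 0))))

  alt-pw-even : ∀ m l .{{_ : NonZero m}} → 2 ℕ.* m ≡ l → ∀ z → alt (pw l z) ≈ pw l z
  alt-pw-even m l eq z = ≈-trans (alt-cong (≈-sym (pw-dil m 2 l eq z))) (≈-trans (alt-dil2 (pw m z)) (pw-dil m 2 l eq z))

  -- Of the eight eta factors only e₁ and e₅ are affected by q ↦ -q; the others are series in q².
  altE : Exponents → Exponents
  altE (a ∷ b ∷ c ∷ d ∷ a′ ∷ b′ ∷ c′ ∷ d′ ∷ []) = m1 a ⊹ m5 a′ ⊹ (+ 0 ∷ b ∷ c ∷ d ∷ + 0 ∷ b′ ∷ c′ ∷ d′ ∷ [])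

  alt-mon : ∀ u → alt (mon u) ≈ mon (altE u)
  alt-mon (a ∷ b ∷ c ∷ d ∷ a′ ∷ b′ ∷ c′ ∷ d′ ∷ []) = begin
    alt (mon (a ∷ b ∷ c ∷ d ∷ a′ ∷ b′ ∷ c′ ∷ d′ ∷ []))
      ≈⟨ alt-cong (mon-unfold _) ⟩
    alt (pw 1 a · pw 2 b · pw 4 c · pw 8 d · (pw 5 a′ · pw 10 b′ · pw 20 c′ · pw 40 d′))
      ≈⟨ ≈-trans (alt-· _ _) (·-cong (≈-trans (alt-· _ _) (·-cong (≈-trans (alt-· _ _) (·-cong (alt-· _ _) (alt-pw-even 2 4 refl c)))
          (alt-pw-even 4 8 refl d)))
                                    (≈-trans (alt-· _ _) (·-cong (≈-trans (alt-· _ _) (·-cong (alt-· _ _) (alt-pw-even 10 20 refl c′)))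
                                        (alt-pw-even 20 40 refl d′)))) ⟩
    alt (pw 1 a) · alt (pw 2 b) · pw 4 c · pw 8 d · (alt (pw 5 a′) · alt (pw 10 b′) · pw 20 c′ · pw 40 d′)
      ≈⟨ ·-cong (·-cong (·-cong (·-cong (alt-pw₁ a) (alt-pw-even 1 2 refl b)) ≈-refl) ≈-refl)
          (·-cong (·-cong (·-cong (alt-pw₅ a′) (alt-pw-even 5 10 refl b′)) ≈-refl) ≈-refl) ⟩
    mon (m1 a) · pw 2 b · pw 4 c · pw 8 d · (mon (m5 a′) · pw 10 b′ · pw 20 c′ · pw 40 d′)
      ≈⟨ solve 8 (λ x b c d y b′ c′ d′ → x :* b :* c :* d :* (y :* b′ :* c′ :* d′) := x :* y :*
          (con (+ 1) :* b :* c :* d :* (con (+ 1) :* b′ :* c′ :* d′))) ≈-refl (mon (m1 a)) (pw 2 b) (pw 4 c) (pw 8 d) (mon (m5 a′))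
          (pw 10 b′) (pw 20 c′) (pw 40 d′) ⟩
    mon (m1 a) · mon (m5 a′) · (κ (+ 1) · pw 2 b · pw 4 c · pw 8 d · (κ (+ 1) · pw 10 b′ · pw 20 c′ · pw 40 d′))
      ≈⟨ ·-cong (mon-· (m1 a) (m5 a′)) (·-cong (·-cong (·-cong (·-cong (≈-sym 1ₛ≈κ) ≈-refl) ≈-refl) ≈-refl)
          (·-cong (·-cong (·-cong (≈-sym 1ₛ≈κ) ≈-refl) ≈-refl) ≈-refl)) ⟩
    mon (m1 a ⊹ m5 a′) · mon′ (+ 0 ∷ b ∷ c ∷ d ∷ + 0 ∷ b′ ∷ c′ ∷ d′ ∷ [])
      ≈⟨ ·-cong ≈-refl (≈-sym (mon-unfold _)) ⟩
    mon (m1 a ⊹ m5 a′) · mon (+ 0 ∷ b ∷ c ∷ d ∷ + 0 ∷ b′ ∷ c′ ∷ d′ ∷ [])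
      ≈⟨ mon-· (m1 a ⊹ m5 a′) (+ 0 ∷ b ∷ c ∷ d ∷ + 0 ∷ b′ ∷ c′ ∷ d′ ∷ []) ⟩
    mon (m1 a ⊹ m5 a′ ⊹ (+ 0 ∷ b ∷ c ∷ d ∷ + 0 ∷ b′ ∷ c′ ∷ d′ ∷ [])) ∎
    where
      open ≈-Reasoning
      open SeriesSolver

  vφ vψ vP : Exponents
  vφ = - + 2 ∷ + 5 ∷ - + 2 ∷ + 0 ∷ + 0 ∷ + 0 ∷ + 0 ∷ + 0 ∷ []
  vψ = - + 1 ∷ + 2 ∷ + 0 ∷ + 0 ∷ + 0 ∷ + 0 ∷ + 0 ∷ + 0 ∷ []
  vP = - + 1 ∷ + 1 ∷ + 0 ∷ + 0 ∷ + 0 ∷ + 0 ∷ + 0 ∷ + 0 ∷ []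

  φ-mon : φ ≈ mon vφ
  φ-mon = ≈-trans (JTP.triple-product 1 1 1≤ (+ 1) one-w refl (λ _ → refl) (λ _ → refl) 1≤ 1≤)
    (≈-trans (·-cong (≈-trans (factor≈Pc 2) (≈-trans (Pc≈ee 2) (≈-sym mon-e₂))) (≈-trans (·-cong O⁺-mon O⁺-mon) (mon-· mO⁺ mO⁺)))
      (mon-· _ (mO⁺ ⊹ mO⁺)))

  P⁺ : PS
  P⁺ = Pc (+ 1) 1 1

  P⁺-mon : P⁺ ≈ mon vP
  P⁺-mon = mon-cancel (+ 1 ∷ + 0 ∷ + 0 ∷ + 0 ∷ + 0 ∷ + 0 ∷ + 0 ∷ + 0 ∷ []) (≈-trans (·-cong ≈-refl (≈-trans mon-e₁ (dil-identity e₁)))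
    (≈-trans (Pc-± 1 1 1≤ 1≤) (≈-trans (Pc≈ee 2) (≈-trans (≈-sym mon-e₂) (≈-sym (mon-· vP _))))))

  Ψ-mon : Ψ ≈ κ (+ 2) · mon vψ
  Ψ-mon = ≈-trans (ZeroJTP.triple-product-0 1 1≤) (·-cong ≈-refl (≈-trans
    (·-cong (≈-trans (factor≈Pc 1) (≈-trans (≈-sym (dil-identity e₁)) (≈-sym mon-e₁))) (≈-trans (·-cong P⁺-mon P⁺-mon) (mon-· vP vP)))
    (mon-· _ (vP ⊹ vP))))

  vY vZ v15 : Exponents
  vY  = - + 1 ∷ + 2 ∷ - + 1 ∷ + 0 ∷ + 1 ∷ + 0 ∷ + 1 ∷ + 0 ∷ []
  vZ  = - + 1 ∷ + 1 ∷ + 0 ∷ + 0 ∷ + 3 ∷ - + 1 ∷ + 0 ∷ + 0 ∷ []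
  v15 = + 1 ∷ + 0 ∷ + 0 ∷ + 0 ∷ + 1 ∷ + 0 ∷ + 0 ∷ + 0 ∷ []

  module _ where
    open SeriesSolver

    collect : ∀ e f a b c d m → e · (a · d) · (f · (b · c)) · m ≈ e · f · (a · b · c · d · m)
    collect = solve 7 (λ e f a b c d m → e :* (a :* d) :* (f :* (b :* c)) :* m := e :* f :* (a :* b :* c :* d :* m)) ≈-refl

    collect′ : ∀ e f a b c d m → e · (c · b) · (f · (d · a)) · m ≈ e · f · (a · b · m · c · d)
    collect′ = solve 7 (λ e f a b c d m → e :* (c :* b) :* (f :* (d :* a)) :* m := e :* f :* (a :* b :* m :* c :* d)) ≈-refl

  E₅ : ∏∞ (Gauss.factor 5) ≈ mon (+ 0 ∷ + 0 ∷ + 0 ∷ + 0 ∷ + 1 ∷ + 0 ∷ + 0 ∷ + 0 ∷ [])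
  E₅ = ≈-trans (factor≈Pc 5) (≈-trans (Pc≈ee 5) (≈-sym mon-e₅))

  -- The two triple products together run through the residues 1, 2, 3, 4 modulo 5. Multiplying by
  -- the missing class of multiples of 5 completes them to the full product `P⁺`.
  T₁T₂-mon : T₁ · T₂ ≈ mon vZ
  T₁T₂-mon = mon-cancel v (≈-trans (·-cong (·-cong (tp 1 4 1≤ 1≤) (tp 2 3 1≤ 1≤)) (≈-sym P₅)) (≈-trans
    (collect (∏∞ (Gauss.factor 5)) (∏∞ (Gauss.factor 5)) (Pc (+ 1) 1 5) (Pc (+ 1) 2 5) (Pc (+ 1) 3 5) (Pc (+ 1) 4 5) (Pc (+ 1) 5 5))
    (≈-trans (·-cong (≈-trans (·-cong E₅ E₅) (mon-· _ _)) (≈-trans (≈-sym (Pc-split5 (+ 1) 1 1 1≤ 1≤)) P⁺-mon))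
        (≈-trans (mon-· _ vP) (≈-sym (mon-· vZ v))))))
    where
      tp : ∀ a b → 1 ℕ.≤ a → 1 ℕ.≤ b → ϑ a b ≈ _
      tp a b 1≤a 1≤b = JTP.triple-product a b (ℕₚ.≤-trans 1≤a (ℕₚ.m≤m+n a b)) (+ 1) one-w refl (λ _ → refl) (λ _ → refl) 1≤a 1≤b
      v : Exponents
      v = + 0 ∷ + 0 ∷ + 0 ∷ + 0 ∷ - + 1 ∷ + 1 ∷ + 0 ∷ + 0 ∷ []
      P₅ : Pc (+ 1) 5 5 ≈ mon v
      P₅ = ≈-trans (≈-sym (Pc-dil (+ 1) 1 1 1≤ 1≤ 5)) (≈-trans (dil-cong 5 P⁺-mon) (dil5-mon (- + 1) (+ 1) (+ 0) (+ 0)))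

  signed-T₁T₂-mon : th 1 4 sgnℤ · th 2 3 sgnℤ ≈ mon v15
  signed-T₁T₂-mon = mon-cancel v (≈-trans (·-cong (·-cong (tp 1 4 1≤ 1≤) (tp 2 3 1≤ 1≤)) (≈-sym P₅)) (≈-trans
    (collect (∏∞ (Gauss.factor 5)) (∏∞ (Gauss.factor 5)) (Pc -[1+ 0 ] 1 5) (Pc -[1+ 0 ] 2 5) (Pc -[1+ 0 ] 3 5) (Pc -[1+ 0 ] 4 5)
        (Pc -[1+ 0 ] 5 5))
    (≈-trans (·-cong (≈-trans (·-cong E₅ E₅) (mon-· v v)) (≈-trans (≈-sym (Pc-split5 -[1+ 0 ] 1 1 1≤ 1≤))
        (≈-trans (≈-sym (dil-identity e₁)) (≈-sym mon-e₁)))) (≈-trans (mon-· (v ⊹ v) _) (≈-sym (mon-· v15 v))))))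
    where
      tp : ∀ a b → 1 ℕ.≤ a → 1 ℕ.≤ b → th a b sgnℤ ≈ _
      tp a b 1≤a 1≤b = JTP.triple-product a b (ℕₚ.≤-trans 1≤a (ℕₚ.m≤m+n a b)) -[1+ 0 ] sgnℤ refl sgnℤ-suc sgnℤ-pred 1≤a 1≤b
      v : Exponents
      v = + 0 ∷ + 0 ∷ + 0 ∷ + 0 ∷ + 1 ∷ + 0 ∷ + 0 ∷ + 0 ∷ []
      P₅ : Pc -[1+ 0 ] 5 5 ≈ mon v
      P₅ = ≈-trans (Pc≈ee 5) (≈-sym mon-e₅)

  -- The residues 1, 3, 7, 9 modulo 10 are the odd ones apart from 5. Supplying the class of 5
  -- completes them to `O⁺`.
  β₁β₂-mon : β₁ · β₂ ≈ mon vY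
  β₁β₂-mon = mon-cancel v (≈-trans (·-cong (·-cong (tp 7 3 1≤ 1≤) (tp 9 1 1≤ 1≤)) (≈-sym P₅)) (≈-trans
    (collect′ (∏∞ (Gauss.factor 10)) (∏∞ (Gauss.factor 10)) (Pc (+ 1) 1 10) (Pc (+ 1) 3 10) (Pc (+ 1) 7 10) (Pc (+ 1) 9 10) (Pc (+ 1) 5 10))
    (≈-trans (·-cong (≈-trans (·-cong E₁₀ E₁₀) (mon-· _ _)) (≈-trans (≈-sym (Pc-split5 (+ 1) 1 2 1≤ 1≤)) O⁺-mon))
        (≈-trans (mon-· _ mO⁺) (≈-sym (mon-· vY v))))))
    where
      tp : ∀ a b → 1 ℕ.≤ a → 1 ℕ.≤ b → ϑ a b ≈ _
      tp a b 1≤a 1≤b = JTP.triple-product a b (ℕₚ.≤-trans 1≤a (ℕₚ.m≤m+n a b)) (+ 1) one-w refl (λ _ → refl) (λ _ → refl) 1≤a 1≤b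
      E₁₀ = ≈-trans (factor≈Pc 10) (≈-trans (Pc≈ee 10) (≈-sym mon-e₁₀))
      v : Exponents
      v = + 0 ∷ + 0 ∷ + 0 ∷ + 0 ∷ - + 1 ∷ + 2 ∷ - + 1 ∷ + 0 ∷ []
      P₅ : Pc (+ 1) 5 10 ≈ mon v
      P₅ = ≈-trans (≈-sym (Pc-dil (+ 1) 1 2 1≤ 1≤ 5)) (≈-trans (dil-cong 5 O⁺-mon) (dil5-mon (- + 1) (+ 2) (- + 1) (+ 0)))

  J₁²-mon : J₁ · J₁ ≈ mon (+ 0 ∷ + 0 ∷ + 0 ∷ + 0 ∷ + 6 ∷ + 0 ∷ + 0 ∷ + 0 ∷ [])
  J₁²-mon = ≈-trans (·-cong J≈ J≈) (≈-trans (S.solve 1 (λ x → S.:- x S.:* S.:- x S.:= x S.:* x) ≈-refl (mon (v ⊹ (v ⊹ v))))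
      (mon-· (v ⊹ (v ⊹ v)) (v ⊹ (v ⊹ v))))
    where
      module S = SeriesSolver
      v : Exponents
      v = + 0 ∷ + 0 ∷ + 0 ∷ + 0 ∷ + 1 ∷ + 0 ∷ + 0 ∷ + 0 ∷ []
      P₅ : Pc -[1+ 0 ] 5 5 ≈ mon v
      P₅ = ≈-trans (Pc≈ee 5) (≈-sym mon-e₅)
      J≈ : J₁ ≈ ~ mon (v ⊹ (v ⊹ v))
      J≈ = ≈-trans (ZeroJTP.jacobi-cube 5 1≤) (~-cong (≈-trans (·-cong E₅ (≈-trans (·-cong P₅ P₅) (mon-· v v))) (mon-· v (v ⊹ v))))

open ThetaProducts

-- Theta identities in both signs of q, and certificates for polynomial consequences.

module LevelTwenty where

  open import Data.Integer using (-_)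
  open import Relation.Binary.PropositionalEquality using (_≡_)

  record Hyp : Set where
    constructor hyp
    field
      coefficient {lhs rhs} : PS
      equation : lhs ≈ rhs

  excess : List Hyp → PS
  excess []               = κ (+ 0)
  excess (hyp c {a} {b} _ ∷ hs) = c · (a ⊖ b) ⊕ excess hs

  -- A certificate checker: f - g is exhibited as a combination of the differences of known
  -- equations. The multipliers are left as `_` in the list of hypotheses and are read off by
  -- unification from the right side of the solver equation.
  combine : ∀ hs {f g} → f ⊖ g ≈ excess hs → f ≈ g
  combine hs p = ⊖≈0⇒≈ (≈-trans p (vanish hs))
    where
      vanish : ∀ hs → excess hs ≈ 0ₛ
      vanish []                 = pointwise λ { zero → refl ; (suc k) → refl }
      vanish (hyp c {a} {b} p ∷ hs) = ≈-trans (⊕-cong (≈-trans (·-cong (≈-refl {c}) (≈⇒⊖≈0 p)) (·-zeroʳ c)) (vanish hs)) (⊕-identityʳ 0ₛ)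

  q : PS
  q = mono 1

  q^2 : mono 2 ≈ q · q
  q^2 = mono-+ 1 1

  q^3 : mono 3 ≈ q · q · q
  q^3 = ≈-trans (mono-+ 2 1) (·-cong q^2 ≈-refl)

  q^4 : mono 4 ≈ q · q · (q · q)
  q^4 = ≈-trans (mono-+ 2 2) (·-cong q^2 q^2)

  q^5 : mono 5 ≈ q · q · (q · q) · q
  q^5 = ≈-trans (mono-+ 4 1) (·-cong q^4 ≈-refl)

  alt-q : alt q ≈ ~ q
  alt-q = ≈-trans (alt-mono 1) (solve 1 (λ x → con -[1+ 0 ] :* x := :- x) ≈-refl q)
    where open SeriesSolver

  alt-κ· : ∀ c f → alt (κ c · f) ≈ κ c · alt f
  alt-κ· c f = ≈-trans (alt-· (κ c) f) (·-cong (alt-κ c) ≈-refl)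

  alt-q· : ∀ f → alt (q · f) ≈ ~ (q · alt f)
  alt-q· f = ≈-trans (alt-· q f) (≈-trans (·-cong alt-q ≈-refl) (solve 2 (λ x y → :- x :* y := :- (x :* y)) ≈-refl q (alt f)))
    where open SeriesSolver

  alt-dil-even : ∀ k l .{{_ : NonZero k}} .{{_ : NonZero l}} → 2 ℕ.* k ≡ l → ∀ f → alt (dil l f) ≈ dil l f
  alt-dil-even k l eq f = ≈-trans (alt-cong (≈-sym (dil-dil 2 k l eq f))) (≈-trans (alt-dil2 (dil k f)) (dil-dil 2 k l eq f))

  φ̄ φ₂ φ₅ φ₁₀ φ̄₅ Ψ₄ Ψ₁₀ Ψ₂₀ Ψ₍₂₎ Ψ₅ : PS
  φ̄   = alt φ
  φ₂  = dil 2 φ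
  φ₅  = dil 5 φ
  φ₁₀ = dil 10 φ
  φ̄₅  = dil 5 φ̄
  Ψ₍₂₎ = dil 2 Ψ
  Ψ₄  = dil 4 Ψ
  Ψ₅  = dil 5 Ψ
  Ψ₁₀ = dil 10 Ψ
  Ψ₂₀ = dil 20 Ψ

  Y Ȳ Z : PS
  Y = mon vY
  Ȳ = mon (altE vY)
  Z = mon vZ

  vφ̄ : Exponents
  vφ̄ = altE vφ

  φ̄-mon : φ̄ ≈ mon vφ̄
  φ̄-mon = ≈-trans (alt-cong φ-mon) (alt-mon vφ)

  φ₂-mon : φ₂ ≈ mon (+ 0 ∷ - + 2 ∷ + 5 ∷ - + 2 ∷ + 0 ∷ + 0 ∷ + 0 ∷ + 0 ∷ [])
  φ₂-mon = ≈-trans (dil-cong 2 φ-mon) (dil2-mon (- + 2) (+ 5) (- + 2) (+ 0) (+ 0) (+ 0))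

  φ₅-mon : φ₅ ≈ mon (+ 0 ∷ + 0 ∷ + 0 ∷ + 0 ∷ - + 2 ∷ + 5 ∷ - + 2 ∷ + 0 ∷ [])
  φ₅-mon = ≈-trans (dil-cong 5 φ-mon) (dil5-mon (- + 2) (+ 5) (- + 2) (+ 0))

  φ₁₀-mon : φ₁₀ ≈ mon (+ 0 ∷ + 0 ∷ + 0 ∷ + 0 ∷ + 0 ∷ - + 2 ∷ + 5 ∷ - + 2 ∷ [])
  φ₁₀-mon = ≈-trans (≈-sym (dil-dil 2 5 10 refl φ)) (≈-trans (dil-cong 2 φ₅-mon) (dil2-mon (+ 0) (+ 0) (+ 0) (- + 2) (+ 5) (- + 2)))

  φ̄₅-mon : φ̄₅ ≈ mon (+ 0 ∷ + 0 ∷ + 0 ∷ + 0 ∷ + 2 ∷ - + 1 ∷ + 0 ∷ + 0 ∷ [])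
  φ̄₅-mon = ≈-trans (dil-cong 5 φ̄-mon) (dil5-mon (+ 2) (- + 1) (+ 0) (+ 0))

  κ-mon : ∀ k .{{_ : NonZero k}} c {f v w} → f ≈ κ c · mon v → dil k (mon v) ≈ mon w → dil k f ≈ κ c · mon w
  κ-mon k c {f} {v} p r = ≈-trans (dil-cong k p) (≈-trans (dil-κ-· k c (mon v)) (·-cong ≈-refl r))

  Ψ₍₂₎-mon : Ψ₍₂₎ ≈ κ (+ 2) · mon (+ 0 ∷ - + 1 ∷ + 2 ∷ + 0 ∷ + 0 ∷ + 0 ∷ + 0 ∷ + 0 ∷ [])
  Ψ₍₂₎-mon = κ-mon 2 (+ 2) Ψ-mon (dil2-mon (- + 1) (+ 2) (+ 0) (+ 0) (+ 0) (+ 0))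

  Ψ₄-mon : Ψ₄ ≈ κ (+ 2) · mon (+ 0 ∷ + 0 ∷ - + 1 ∷ + 2 ∷ + 0 ∷ + 0 ∷ + 0 ∷ + 0 ∷ [])
  Ψ₄-mon = ≈-trans (≈-sym (dil-dil 2 2 4 refl Ψ)) (κ-mon 2 (+ 2) Ψ₍₂₎-mon (dil2-mon (+ 0) (- + 1) (+ 2) (+ 0) (+ 0) (+ 0)))

  Ψ₅-mon : Ψ₅ ≈ κ (+ 2) · mon (+ 0 ∷ + 0 ∷ + 0 ∷ + 0 ∷ - + 1 ∷ + 2 ∷ + 0 ∷ + 0 ∷ [])
  Ψ₅-mon = κ-mon 5 (+ 2) Ψ-mon (dil5-mon (- + 1) (+ 2) (+ 0) (+ 0))

  Ψ₁₀-mon : Ψ₁₀ ≈ κ (+ 2) · mon (+ 0 ∷ + 0 ∷ + 0 ∷ + 0 ∷ + 0 ∷ - + 1 ∷ + 2 ∷ + 0 ∷ [])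
  Ψ₁₀-mon = ≈-trans (≈-sym (dil-dil 2 5 10 refl Ψ)) (κ-mon 2 (+ 2) Ψ₅-mon (dil2-mon (+ 0) (+ 0) (+ 0) (- + 1) (+ 2) (+ 0)))

  Ψ₂₀-mon : Ψ₂₀ ≈ κ (+ 2) · mon (+ 0 ∷ + 0 ∷ + 0 ∷ + 0 ∷ + 0 ∷ + 0 ∷ - + 1 ∷ + 2 ∷ [])
  Ψ₂₀-mon = ≈-trans (≈-sym (dil-dil 2 10 20 refl Ψ)) (κ-mon 2 (+ 2) Ψ₁₀-mon (dil2-mon (+ 0) (+ 0) (+ 0) (+ 0) (- + 1) (+ 2)))

  alt-φ₅ : alt φ₅ ≈ φ̄₅
  alt-φ₅ = alt-dil5 φ

  alt-φ̄₅ : alt φ̄₅ ≈ φ₅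
  alt-φ̄₅ = ≈-trans (alt-cong (≈-sym alt-φ₅)) (alt-alt φ₅)

  Y-identity : φ · φ ≈ φ₅ · φ₅ ⊕ κ (+ 4) · q · Y
  Y-identity = ≈-trans φ² (⊕-cong ≈-refl (·-cong ≈-refl β₁β₂-mon))

  Ȳ-identity : φ̄ · φ̄ ≈ φ̄₅ · φ̄₅ ⊖ κ (+ 4) · q · Ȳ
  Ȳ-identity = ≈-trans (≈-sym (alt-· φ φ)) (≈-trans (alt-cong Y-identity)
      (≈-trans (alt-⊕ _ _) (⊕-cong (≈-trans (alt-· φ₅ φ₅) (·-cong alt-φ₅ alt-φ₅))
    (≈-trans (alt-· (κ (+ 4) · q) Y) (≈-trans (·-cong (≈-trans (alt-κ· (+ 4) q) (·-cong ≈-refl alt-q)) (alt-mon vY))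
        (solve 2 (λ q y → con (+ 4) :* :- q :* y := :- (con (+ 4) :* q :* y)) ≈-refl q Ȳ))))))
    where open SeriesSolver

  Z-identity : Ψ · Ψ ≈ q · (Ψ₅ · Ψ₅) ⊕ κ (+ 4) · Z
  Z-identity = ≈-trans Ψ² (⊕-cong ≈-refl (·-cong ≈-refl T₁T₂-mon))

  alt-φ₄ : alt (dil 4 φ) ≈ dil 4 φ
  alt-φ₄ = alt-dil-even 2 4 refl φ

  φ̄-dissection : φ̄ ≈ dil 4 φ ⊖ q · dil 8 Ψ
  φ̄-dissection = ≈-trans (alt-cong φ-dissection₂) (≈-trans (alt-⊕ _ _)
      (⊕-cong alt-φ₄ (≈-trans (alt-q· (dil 8 Ψ)) (~-cong (·-cong ≈-refl (alt-dil-even 4 8 refl Ψ))))))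

  φφ̄ : φ · φ̄ ≈ dil 2 (φ̄ · φ̄)
  φφ̄ = ≈-trans (·-cong φ-mon φ̄-mon) (≈-trans (mon-· vφ vφ̄) (≈-sym
      (≈-trans (dil-cong 2 (≈-trans (·-cong φ̄-mon φ̄-mon) (mon-· vφ̄ vφ̄))) (dil2-mon (+ 4) (- + 2) (+ 0) (+ 0) (+ 0) (+ 0)))))

  dil-q : ∀ k .{{_ : NonZero k}} → dil k q ≈ mono (1 ℕ.* k)
  dil-q k = dil-mono k 1

  -- The classical φ(q) φ(-q) = φ(-q²)². Inserting the dissections of both factors makes the left
  -- side a difference of squares in q², and the dilation by 2 is then removed.
  φ̄²-dissection : φ̄ · φ̄ ≈ φ₂ · φ₂ ⊖ q · (Ψ₄ · Ψ₄)
  φ̄²-dissection = dil-injective 2 (≈-trans (≈-sym φφ̄) (≈-trans (·-cong φ-dissection₂ φ̄-dissection) (≈-trans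
    (solve 3 (λ q a b → (a :+ q :* b) :* (a :- q :* b) := a :* a :- q :* q :* (b :* b)) ≈-refl q (dil 4 φ) (dil 8 Ψ))
    (≈-sym (≈-trans (dil-⊖ 2 _ _) (⊖-cong (≈-trans (dil-· 2 φ₂ φ₂) (·-cong d₂ d₂))
        (≈-trans (dil-· 2 q _) (·-cong (≈-trans (dil-q 2) q^2) (≈-trans (dil-· 2 Ψ₄ Ψ₄) (·-cong d₄ d₄))))))))))
    where
      open SeriesSolver
      d₂ = dil-dil 2 2 4 refl φ
      d₄ = dil-dil 2 4 8 refl Ψ

  alt-φ₂ : alt φ₂ ≈ φ₂
  alt-φ₂ = alt-dil2 φ

  alt-Ψ₄ : alt Ψ₄ ≈ Ψ₄
  alt-Ψ₄ = alt-dil-even 2 4 refl Ψ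

  alt-φ₁₀ : alt φ₁₀ ≈ φ₁₀
  alt-φ₁₀ = alt-dil-even 5 10 refl φ

  alt-Ψ₂₀ : alt Ψ₂₀ ≈ Ψ₂₀
  alt-Ψ₂₀ = alt-dil-even 10 20 refl Ψ

  φ²-dissection : φ · φ ≈ φ₂ · φ₂ ⊕ q · (Ψ₄ · Ψ₄)
  φ²-dissection = ≈-trans (≈-sym (alt-alt (φ · φ))) (≈-trans (alt-cong (≈-trans (alt-· φ φ) φ̄²-dissection)) (≈-trans (alt-⊖ _ _)
    (≈-trans (⊖-cong (≈-trans (alt-· φ₂ φ₂) (·-cong alt-φ₂ alt-φ₂))
        (≈-trans (alt-q· _) (~-cong (·-cong ≈-refl (≈-trans (alt-· Ψ₄ Ψ₄) (·-cong alt-Ψ₄ alt-Ψ₄))))))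
      (solve 2 (λ x y → x :- :- y := x :+ y) ≈-refl _ _))))
    where open SeriesSolver

  dil5-φ₂ : dil 5 φ₂ ≈ φ₁₀
  dil5-φ₂ = dil-dil 5 2 10 refl φ

  dil5-Ψ₄ : dil 5 Ψ₄ ≈ Ψ₂₀
  dil5-Ψ₄ = dil-dil 5 4 20 refl Ψ

  φ₅²-dissection : φ₅ · φ₅ ≈ φ₁₀ · φ₁₀ ⊕ mono 5 · (Ψ₂₀ · Ψ₂₀)
  φ₅²-dissection = ≈-trans (≈-sym (dil-· 5 φ φ)) (≈-trans (dil-cong 5 φ²-dissection)
      (≈-trans (dil-⊕ 5 _ _) (⊕-cong (≈-trans (dil-· 5 φ₂ φ₂) (·-cong dil5-φ₂ dil5-φ₂))
    (≈-trans (dil-· 5 q _) (·-cong (dil-q 5) (≈-trans (dil-· 5 Ψ₄ Ψ₄) (·-cong dil5-Ψ₄ dil5-Ψ₄)))))))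

  φ̄₅²-dissection : φ̄₅ · φ̄₅ ≈ φ₁₀ · φ₁₀ ⊖ mono 5 · (Ψ₂₀ · Ψ₂₀)
  φ̄₅²-dissection = ≈-trans (≈-sym (dil-· 5 φ̄ φ̄)) (≈-trans (dil-cong 5 φ̄²-dissection)
      (≈-trans (dil-⊖ 5 _ _) (⊖-cong (≈-trans (dil-· 5 φ₂ φ₂) (·-cong dil5-φ₂ dil5-φ₂))
    (≈-trans (dil-· 5 q _) (·-cong (dil-q 5) (≈-trans (dil-· 5 Ψ₄ Ψ₄) (·-cong dil5-Ψ₄ dil5-Ψ₄)))))))

  Y₂ Z₄ : PS
  Y₂ = mon (+ 0 ∷ - + 1 ∷ + 2 ∷ - + 1 ∷ + 0 ∷ + 1 ∷ + 0 ∷ + 1 ∷ [])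
  Z₄ = mon (+ 0 ∷ + 0 ∷ - + 1 ∷ + 1 ∷ + 0 ∷ + 0 ∷ + 3 ∷ - + 1 ∷ [])

  Z₂ : PS
  Z₂ = mon (+ 0 ∷ - + 1 ∷ + 1 ∷ + 0 ∷ + 0 ∷ + 3 ∷ - + 1 ∷ + 0 ∷ [])

  Y-identity₂ : φ₂ · φ₂ ≈ φ₁₀ · φ₁₀ ⊕ κ (+ 4) · (q · q) · Y₂
  Y-identity₂ = ≈-trans (≈-sym (dil-· 2 φ φ)) (≈-trans (dil-cong 2 Y-identity)
      (≈-trans (dil-⊕ 2 _ _) (⊕-cong (≈-trans (dil-· 2 φ₅ φ₅) (·-cong d d))
    (≈-trans (dil-· 2 (κ (+ 4) · q) Y) (·-cong (≈-trans (dil-κ-· 2 (+ 4) q) (·-cong ≈-refl (≈-trans (dil-q 2) q^2)))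
        (dil2-mon (- + 1) (+ 2) (- + 1) (+ 1) (+ 0) (+ 1)))))))
    where d = dil-dil 2 5 10 refl φ

  Z-identity₂ : Ψ₍₂₎ · Ψ₍₂₎ ≈ q · q · (Ψ₁₀ · Ψ₁₀) ⊕ κ (+ 4) · Z₂
  Z-identity₂ = ≈-trans (≈-sym (dil-· 2 Ψ Ψ)) (≈-trans (dil-cong 2 Z-identity) (≈-trans (dil-⊕ 2 _ _) (⊕-cong
    (≈-trans (dil-· 2 q _) (·-cong (≈-trans (dil-q 2) q^2) (≈-trans (dil-· 2 Ψ₅ Ψ₅) (·-cong d d))))
    (≈-trans (dil-κ-· 2 (+ 4) Z) (·-cong ≈-refl (dil2-mon (- + 1) (+ 1) (+ 0) (+ 3) (- + 1) (+ 0)))))))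
    where d = dil-dil 2 5 10 refl Ψ

  Z-identity₄ : Ψ₄ · Ψ₄ ≈ q · q · (q · q) · (Ψ₂₀ · Ψ₂₀) ⊕ κ (+ 4) · Z₄
  Z-identity₄ = ≈-trans (·-cong (≈-sym d₂) (≈-sym d₂)) (≈-trans (≈-sym (dil-· 2 Ψ₍₂₎ Ψ₍₂₎))
      (≈-trans (dil-cong 2 Z-identity₂) (≈-trans (dil-⊕ 2 _ _) (⊕-cong
    (≈-trans (dil-· 2 (q · q) _) (·-cong (≈-trans (dil-· 2 q q) (·-cong (≈-trans (dil-q 2) q^2) (≈-trans (dil-q 2) q^2)))
        (≈-trans (dil-· 2 Ψ₁₀ Ψ₁₀) (·-cong d d))))
    (≈-trans (dil-κ-· 2 (+ 4) Z₂) (·-cong ≈-refl (dil2-mon (+ 0) (- + 1) (+ 1) (+ 0) (+ 3) (- + 1))))))))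
    where
      d = dil-dil 2 10 20 refl Ψ
      d₂ = dil-dil 2 2 4 refl Ψ

open LevelTwenty

-- Eta quotient identities behind the form G and the two cusp forms.

module EtaIdentities where

  open import Data.Integer using (-_)

  open SeriesSolver

  lift : ∀ {f v} → f ≈ mon v → f ≈ κ (+ 1) · mon v
  lift p = ≈-trans p (≈-sym (≈-trans (·-cong (≈-sym 1ₛ≈κ) ≈-refl) (·-identityˡ _)))

  self : ∀ {v} → mon v ≈ κ (+ 1) · mon v
  self = lift ≈-refl

  infixl 7 _⊗_
  -- Multiplies normal forms, an integer times an eta quotient. Two products whose normal forms
  -- compute to the same constant and exponent vector are thereby equal; this settles all the purely
  -- multiplicative identities below.
  _⊗_ : ∀ {f g c d u v} → f ≈ κ c · mon u → g ≈ κ d · mon v → f · g ≈ κ (c ℤ.* d) · mon (u ⊹ v)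
  _⊗_ {f} {g} {c} {d} {u} {v} p r = ≈-trans (·-cong p r) (≈-trans
      (solve 4 (λ c u d v → c :* u :* (d :* v) := c :* d :* (u :* v)) ≈-refl (κ c) (mon u) (κ d) (mon v))
    (·-cong (≈-sym (κκ c d)) (mon-· u v)))

  scaled : ∀ c {f d v} → f ≈ κ d · mon v → κ c · f ≈ κ (c ℤ.* d) · mon v
  scaled c {f} {d} {v} p = ≈-trans (·-cong ≈-refl p) (≈-trans (solve 3 (λ c d v → c :* (d :* v) := c :* d :* v) ≈-refl (κ c) (κ d) (mon v))
      (·-cong (≈-sym (κκ c d)) ≈-refl))

  μ : PS
  μ = mon (+ 0 ∷ - + 1 ∷ + 0 ∷ + 0 ∷ + 0 ∷ + 1 ∷ + 2 ∷ + 0 ∷ [])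

  m₄₂₀ : PS
  m₄₂₀ = mon (+ 0 ∷ + 0 ∷ + 1 ∷ + 0 ∷ + 0 ∷ + 0 ∷ + 1 ∷ + 0 ∷ [])

  m₁₅ : PS
  m₁₅ = mon (+ 1 ∷ + 0 ∷ + 0 ∷ + 0 ∷ + 1 ∷ + 0 ∷ + 0 ∷ + 0 ∷ [])

  m̄₁₅ : PS
  m̄₁₅ = mon (- + 1 ∷ + 3 ∷ - + 1 ∷ + 0 ∷ - + 1 ∷ + 3 ∷ - + 1 ∷ + 0 ∷ [])

  m₂₁₀ : PS
  m₂₁₀ = mon (+ 0 ∷ + 1 ∷ + 0 ∷ + 0 ∷ + 0 ∷ + 1 ∷ + 0 ∷ + 0 ∷ [])

  c : PS
  c = mon (- + 1 ∷ + 2 ∷ - + 1 ∷ + 0 ∷ - + 1 ∷ + 2 ∷ - + 1 ∷ + 0 ∷ [])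

  c̄ : PS
  c̄ = mon (+ 1 ∷ - + 1 ∷ + 0 ∷ + 0 ∷ + 1 ∷ - + 1 ∷ + 0 ∷ + 0 ∷ [])

  -- With `Dη`, the eta quotients for which φ φ₅ = `Sη` + q `Dη` and `G` = `Sη` - q `Dη`. The two
  -- theta series belong to the two forms x² + 5y² and 2x² + 2xy + 3y² of discriminant -20.
  Sη : PS
  Sη = mon (- + 1 ∷ + 1 ∷ + 1 ∷ + 0 ∷ + 1 ∷ + 1 ∷ - + 1 ∷ + 0 ∷ [])

  Dη : PS
  Dη = mon (+ 1 ∷ + 1 ∷ - + 1 ∷ + 0 ∷ - + 1 ∷ + 1 ∷ + 1 ∷ + 0 ∷ [])

  V̄ : PS
  V̄ = mon (- + 1 ∷ + 3 ∷ + 0 ∷ + 0 ∷ + 1 ∷ - + 1 ∷ + 0 ∷ + 0 ∷ [])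

  V : PS
  V = mon (+ 1 ∷ + 0 ∷ + 1 ∷ + 0 ∷ - + 1 ∷ + 2 ∷ - + 1 ∷ + 0 ∷ [])

  ν : PS
  ν = mon (+ 1 ∷ - + 1 ∷ + 0 ∷ + 0 ∷ + 1 ∷ - + 1 ∷ + 0 ∷ + 0 ∷ [])

  πm : PS
  πm = mon (+ 0 ∷ + 0 ∷ + 0 ∷ + 0 ∷ + 4 ∷ - + 2 ∷ + 0 ∷ + 0 ∷ [])

  W : PS
  W = mon (+ 3 ∷ - + 1 ∷ + 0 ∷ + 0 ∷ - + 1 ∷ + 1 ∷ + 0 ∷ + 0 ∷ [])

  W₂ : PS
  W₂ = mon (+ 0 ∷ + 3 ∷ - + 1 ∷ + 0 ∷ + 0 ∷ - + 1 ∷ + 1 ∷ + 0 ∷ [])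

  ω : PS
  ω = mon (+ 0 ∷ + 1 ∷ - + 1 ∷ + 0 ∷ + 0 ∷ + 1 ∷ - + 1 ∷ + 0 ∷ [])

  -- η(2z) η⁴(20z)/η(10z) without its leading q³. Likewise `B₂` is η⁴(4z) η(10z)/η(2z) without its
  -- leading q.
  B₁ : PS
  B₁ = mon (+ 0 ∷ + 1 ∷ + 0 ∷ + 0 ∷ + 0 ∷ - + 1 ∷ + 4 ∷ + 0 ∷ [])

  B₂ : PS
  B₂ = mon (+ 0 ∷ - + 1 ∷ + 4 ∷ + 0 ∷ + 0 ∷ + 1 ∷ + 0 ∷ + 0 ∷ [])

  φ₅²-dissection′ : φ₅ · φ₅ ≈ φ₁₀ · φ₁₀ ⊕ q · q · (q · q) · q · (Ψ₂₀ · Ψ₂₀)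
  φ₅²-dissection′ = ≈-trans φ₅²-dissection (⊕-cong ≈-refl (·-cong q^5 ≈-refl))

  φ̄₅²-dissection′ : φ̄₅ · φ̄₅ ≈ φ₁₀ · φ₁₀ ⊖ q · q · (q · q) · q · (Ψ₂₀ · Ψ₂₀)
  φ̄₅²-dissection′ = ≈-trans φ̄₅²-dissection (⊖-cong ≈-refl (·-cong q^5 ≈-refl))

  φ₅-dissection : φ₅ ≈ dil 20 φ ⊕ q · q · (q · q) · q · dil 40 Ψ
  φ₅-dissection = ≈-trans (dil-cong 5 φ-dissection₂) (≈-trans (dil-⊕ 5 _ _)
      (⊕-cong (dil-dil 5 4 20 refl φ) (≈-trans (dil-· 5 q _) (·-cong (≈-trans (dil-q 5) q^5) (dil-dil 5 8 40 refl Ψ)))))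

  φ̄₅-dissection : φ̄₅ ≈ dil 20 φ ⊖ q · q · (q · q) · q · dil 40 Ψ
  φ̄₅-dissection = ≈-trans (dil-cong 5 φ̄-dissection) (≈-trans (dil-⊖ 5 _ _)
      (⊖-cong (dil-dil 5 4 20 refl φ) (≈-trans (dil-· 5 q _) (·-cong (≈-trans (dil-q 5) q^5) (dil-dil 5 8 40 refl Ψ)))))

  -- 4qY is φ² - φ₅², whose odd part is q(Ψ₄² - q⁴Ψ₂₀²), an instance of the `Z` identity at q⁴. The
  -- even part, φ₂² - φ₁₀², is the `Y` identity at q² and gives `Y-Ȳ`.
  Y+Ȳ : Y ⊕ Ȳ ≈ κ (+ 2) · Z₄
  Y+Ȳ = mono-cancelˡ 1 (κ-cancelˡ (+ 4) (λ ()) (combine (hyp _ Y-identity ∷ hyp _ φ²-dissection ∷ hyp _ φ₅²-dissection′ ∷ hyp _ Ȳ-identity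
      ∷ hyp _ φ̄²-dissection ∷ hyp _ φ̄₅²-dissection′ ∷ hyp _ Z-identity₄ ∷ [])
        (solve 12 (λ q Y Yb Z4 p p5 p2 s4 p10 s20 pb pb5 → con (+ 4) :* (q :* (Y :+ Yb)) :- con (+ 4) :* (q :* (con (+ 2) :* Z4)) := con
            -[1+ 0 ] :* (p :* p :- (p5 :* p5 :+ con (+ 4) :* q :* Y)) :+
            (con (+ 1) :* (p :* p :- (p2 :* p2 :+ q :* (s4 :* s4))) :+
            (con -[1+ 0 ] :* (p5 :* p5 :- (p10 :* p10 :+ q :* q :* (q :* q) :* q :* (s20 :* s20))) :+
            (con (+ 1) :* (pb :* pb :- (pb5 :* pb5 :- con (+ 4) :* q :* Yb)) :+
            (con -[1+ 0 ] :* (pb :* pb :- (p2 :* p2 :- q :* (s4 :* s4))) :+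
            (con (+ 1) :* (pb5 :* pb5 :- (p10 :* p10 :- q :* q :* (q :* q) :* q :* (s20 :* s20))) :+
            (con (+ 2) :* q :* (s4 :* s4 :- (q :* q :* (q :* q) :* (s20 :* s20) :+ con (+ 4) :* Z4)) :+ con (+ 0)))))))) ≈-refl q Y Ȳ Z₄ φ
            φ₅ φ₂ Ψ₄ φ₁₀ Ψ₂₀ φ̄ φ̄₅)))

  Y-Ȳ : Y ⊖ Ȳ ≈ κ (+ 2) · q · Y₂
  Y-Ȳ = mono-cancelˡ 1 (κ-cancelˡ (+ 4) (λ ()) (combine (hyp _ Y-identity ∷ hyp _ φ²-dissection ∷ hyp _ φ₅²-dissection′ ∷ hyp _ Ȳ-identity
      ∷ hyp _ φ̄²-dissection ∷ hyp _ φ̄₅²-dissection′ ∷ hyp _ Y-identity₂ ∷ [])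
        (solve 12 (λ q Y Yb Y2 p p5 p2 s4 p10 s20 pb pb5 → con (+ 4) :* (q :* (Y :- Yb)) :- con (+ 4) :* (q :* (con (+ 2) :* q :* Y2)) :=
            con -[1+ 0 ] :* (p :* p :- (p5 :* p5 :+ con (+ 4) :* q :* Y)) :+
            (con (+ 1) :* (p :* p :- (p2 :* p2 :+ q :* (s4 :* s4))) :+
            (con -[1+ 0 ] :* (p5 :* p5 :- (p10 :* p10 :+ q :* q :* (q :* q) :* q :* (s20 :* s20))) :+
            (con -[1+ 0 ] :* (pb :* pb :- (pb5 :* pb5 :- con (+ 4) :* q :* Yb)) :+
            (con (+ 1) :* (pb :* pb :- (p2 :* p2 :- q :* (s4 :* s4))) :+
            (con -[1+ 0 ] :* (pb5 :* pb5 :- (p10 :* p10 :- q :* q :* (q :* q) :* q :* (s20 :* s20))) :+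
            (con (+ 2) :* (p2 :* p2 :- (p10 :* p10 :+ con (+ 4) :* (q :* q) :* Y2)) :+ con (+ 0)))))))) ≈-refl q Y Ȳ Y₂ φ φ₅ φ₂ Ψ₄ φ₁₀ Ψ₂₀
            φ̄ φ̄₅)))

  φ·φ̄₅·μ : φ · φ̄₅ · μ ≈ Y · Y
  φ·φ̄₅·μ = ≈-trans (((lift φ-mon) ⊗ (lift φ̄₅-mon)) ⊗ self) (≈-sym (self ⊗ self))

  φ̄·φ₅·μ : φ̄ · φ₅ · μ ≈ Ȳ · Ȳ
  φ̄·φ₅·μ = ≈-trans (((lift φ̄-mon) ⊗ (lift φ₅-mon)) ⊗ self) (≈-sym (self ⊗ self))

  Y₂·Z₄ : Y₂ · Z₄ ≈ m₄₂₀ · μ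
  Y₂·Z₄ = ≈-trans (self ⊗ self) (≈-sym (self ⊗ self))

  -- After multiplication by `μ` the left side is the difference of squares Y² - Ȳ², and its two
  -- factors are the odd and even parts just found.
  L₂ : φ · φ̄₅ ⊖ φ̄ · φ₅ ≈ κ (+ 4) · q · m₄₂₀
  L₂ = mon-cancel (+ 0 ∷ - + 1 ∷ + 0 ∷ + 0 ∷ + 0 ∷ + 1 ∷ + 2 ∷ + 0 ∷ [])
      (combine (hyp _ φ·φ̄₅·μ ∷ hyp _ φ̄·φ₅·μ ∷ hyp _ Y-Ȳ ∷ hyp _ Y+Ȳ ∷ hyp _ Y₂·Z₄ ∷ [])
        (solve 11 (λ mu p pb5 pb p5 m420 q Y Yb Y2 Z4 → (p :* pb5 :- pb :* p5) :* mu :- con (+ 4) :* q :* m420 :* mu := con (+ 1) :*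
            (p :* pb5 :* mu :- Y :* Y) :+ (con -[1+ 0 ] :* (pb :* p5 :* mu :- Yb :* Yb) :+
            ((Y :+ Yb) :* (Y :- Yb :- con (+ 2) :* q :* Y2) :+ (con (+ 2) :* q :* Y2 :* (Y :+ Yb :- con (+ 2) :* Z4) :+
            (con (+ 4) :* q :* (Y2 :* Z4 :- m420 :* mu) :+ con (+ 0)))))) ≈-refl μ φ φ̄₅ φ̄ φ₅ m₄₂₀ q Y Ȳ Y₂ Z₄))

  dil4-q : dil 4 q ≈ q · q · (q · q)
  dil4-q = ≈-trans (dil-q 4) q^4

  m₄₂₀-dil : dil 4 m₁₅ ≈ m₄₂₀
  m₄₂₀-dil = ≈-trans (≈-sym (dil-dil 2 2 4 refl m₁₅)) (≈-trans (dil-cong 2 (dil2-mon (+ 1) (+ 0) (+ 0) (+ 1) (+ 0) (+ 0)))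
      (dil2-mon (+ 0) (+ 1) (+ 0) (+ 0) (+ 1) (+ 0)))

  -- This is `L₂` read at q⁴: inserting the dissections of φ and φ₅ in both signs, the even terms
  -- cancel and the odd ones double.
  K-identity : Ψ₍₂₎ · φ₅ ⊖ q · (φ · Ψ₁₀) ≈ κ (+ 2) · m₁₅
  K-identity = dil-injective 4 (≈-trans (dil-⊖ 4 _ _) (≈-trans (⊖-cong
      (≈-trans (dil-· 4 _ _) (·-cong (dil-dil 4 2 8 refl Ψ) (dil-dil 4 5 20 refl φ)))
      (≈-trans (dil-· 4 _ _) (·-cong dil4-q (≈-trans (dil-· 4 _ _) (·-cong ≈-refl (dil-dil 4 10 40 refl Ψ))))))
    (≈-trans (mono-cancelˡ 1 (κ-cancelˡ (+ 2) (λ ()) (combine (hyp _ L₂ ∷ hyp _ φ-dissection₂ ∷ hyp _ φ̄₅-dissection ∷ hyp _ φ̄-dissection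
        ∷ hyp _ φ₅-dissection ∷ [])
        (solve 10 (λ q s8 p20 p4 s40 m420 p pb5 pb p5 → con (+ 2) :* (q :* (s8 :* p20 :- q :* q :* (q :* q) :* (p4 :* s40))) :- con (+ 2)
            :* (q :* (con (+ 2) :* m420)) := con (+ 1) :* (p :* pb5 :- pb :* p5 :- con (+ 4) :* q :* m420) :+
            (:- pb5 :* (p :- (p4 :+ q :* s8)) :+ (:- (p4 :+ q :* s8) :* (pb5 :- (p20 :- q :* q :* (q :* q) :* q :* s40)) :+
            (p5 :* (pb :- (p4 :- q :* s8)) :+ ((p4 :- q :* s8) :* (p5 :- (p20 :+ q :* q :* (q :* q) :* q :* s40)) :+ con (+ 0)))))) ≈-refl
            q (dil 8 Ψ) (dil 20 φ) (dil 4 φ) (dil 40 Ψ) m₄₂₀ φ φ̄₅ φ̄ φ₅))))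
            (≈-sym (≈-trans (dil-κ-· 4 (+ 2) m₁₅) (·-cong ≈-refl m₄₂₀-dil))))))

  alt-Ψ₍₂₎ : alt Ψ₍₂₎ ≈ Ψ₍₂₎
  alt-Ψ₍₂₎ = alt-dil2 Ψ

  alt-Ψ₁₀ : alt Ψ₁₀ ≈ Ψ₁₀
  alt-Ψ₁₀ = alt-dil-even 5 10 refl Ψ

  K̄-identity : Ψ₍₂₎ · φ̄₅ ⊕ q · (φ̄ · Ψ₁₀) ≈ κ (+ 2) · m̄₁₅
  K̄-identity = ≈-trans (solve 2 (λ x y → x :+ y := x :- :- y) ≈-refl _ _)
      (≈-trans (≈-sym (≈-trans (alt-⊖ _ _) (⊖-cong (≈-trans (alt-· _ _) (·-cong alt-Ψ₍₂₎ alt-φ₅))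
      (≈-trans (alt-q· _) (~-cong (·-cong ≈-refl (≈-trans (alt-· _ _) (·-cong ≈-refl alt-Ψ₁₀))))))))
    (≈-trans (alt-cong K-identity) (≈-trans (alt-κ· (+ 2) m₁₅) (·-cong ≈-refl (alt-mon v15)))))

  K₂-identity : Ψ₄ · φ₁₀ ⊖ q · q · (φ₂ · Ψ₂₀) ≈ κ (+ 2) · m₂₁₀
  K₂-identity = ≈-trans (≈-sym (≈-trans (dil-⊖ 2 _ _) (⊖-cong (≈-trans (dil-· 2 _ _)
      (·-cong (dil-dil 2 2 4 refl Ψ) (dil-dil 2 5 10 refl φ)))
      (≈-trans (dil-· 2 _ _) (·-cong (≈-trans (dil-q 2) q^2) (≈-trans (dil-· 2 _ _) (·-cong ≈-refl (dil-dil 2 10 20 refl Ψ))))))))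
    (≈-trans (dil-cong 2 K-identity) (≈-trans (dil-κ-· 2 (+ 2) m₁₅) (·-cong ≈-refl (dil2-mon (+ 1) (+ 0) (+ 0) (+ 1) (+ 0) (+ 0)))))

  φ·φ₅ : φ · φ₅ ≈ m̄₁₅ · c
  φ·φ₅ = ≈-trans ((lift φ-mon) ⊗ (lift φ₅-mon)) (≈-sym (self ⊗ self))

  Ψ₍₂₎·φ̄₅·c : Ψ₍₂₎ · φ̄₅ · c ≈ κ (+ 2) · Sη
  Ψ₍₂₎·φ̄₅·c = ≈-trans ((Ψ₍₂₎-mon ⊗ (lift φ̄₅-mon)) ⊗ self) (≈-sym (scaled (+ 2) (self)))

  φ̄·Ψ₁₀·c : φ̄ · Ψ₁₀ · c ≈ κ (+ 2) · Dη
  φ̄·Ψ₁₀·c = ≈-trans (((lift φ̄-mon) ⊗ Ψ₁₀-mon) ⊗ self) (≈-sym (scaled (+ 2) (self)))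

  -- φφ₅ is `m̄₁₅` times `c`, and `K̄-identity` splits 2 `m̄₁₅` into two products, each of which
  -- becomes an eta quotient when multiplied by `c`.
  φφ₅ : φ · φ₅ ≈ Sη ⊕ q · Dη
  φφ₅ = κ-cancelˡ (+ 2) (λ ()) (combine (hyp _ φ·φ₅ ∷ hyp _ K̄-identity ∷ hyp _ Ψ₍₂₎·φ̄₅·c ∷ hyp _ φ̄·Ψ₁₀·c ∷ [])
        (solve 11 (λ p p5 S q D0 mb15 c s2 pb5 pb s10 → con (+ 2) :* (p :* p5) :- con (+ 2) :* (S :+ q :* D0) := con (+ 2) :*
            (p :* p5 :- mb15 :* c) :+ (:- c :* (s2 :* pb5 :+ q :* (pb :* s10) :- con (+ 2) :* mb15) :+
            (con (+ 1) :* (s2 :* pb5 :* c :- con (+ 2) :* S) :+ (q :* (pb :* s10 :* c :- con (+ 2) :* D0) :+ con (+ 0))))) ≈-refl φ φ₅ Sη q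
            Dη m̄₁₅ c Ψ₍₂₎ φ̄₅ φ̄ Ψ₁₀))

  -- The theta series of 2x² + 2xy + 3y².
  G : PS
  G = φ₂ · φ₁₀ ⊕ q · q · q · (Ψ₄ · Ψ₂₀)

  Ψ₍₂₎·Ψ₍₂₎ : Ψ₍₂₎ · Ψ₍₂₎ ≈ κ (+ 2) · (φ₂ · Ψ₄)
  Ψ₍₂₎·Ψ₍₂₎ = ≈-trans (Ψ₍₂₎-mon ⊗ Ψ₍₂₎-mon) (≈-sym (scaled (+ 2) ((lift φ₂-mon) ⊗ Ψ₄-mon)))

  Ψ₁₀·Ψ₁₀ : Ψ₁₀ · Ψ₁₀ ≈ κ (+ 2) · (φ₁₀ · Ψ₂₀)
  Ψ₁₀·Ψ₁₀ = ≈-trans (Ψ₁₀-mon ⊗ Ψ₁₀-mon) (≈-sym (scaled (+ 2) ((lift φ₁₀-mon) ⊗ Ψ₂₀-mon)))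

  -- A second factorization of a difference of squares. Writing Ψ₍₂₎², Ψ₁₀², φ̄² and φ̄₅² in terms
  -- of φ₂, φ₁₀, Ψ₄, Ψ₂₀ makes it factor again, now with `G` as one factor.
  HK : (Ψ₍₂₎ · φ̄₅ ⊖ q · (φ̄ · Ψ₁₀)) · (Ψ₍₂₎ · φ̄₅ ⊕ q · (φ̄ · Ψ₁₀)) ≈ κ (+ 2) · (Ψ₄ · φ₁₀ ⊖ q · q · (φ₂ · Ψ₂₀)) ·
      (φ₂ · φ₁₀ ⊕ q · q · q · (Ψ₄ · Ψ₂₀))
  HK = combine (hyp _ Ψ₍₂₎·Ψ₍₂₎ ∷ hyp _ φ̄₅²-dissection′ ∷ hyp _ φ̄²-dissection ∷ hyp _ Ψ₁₀·Ψ₁₀ ∷ [])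
      (solve 9 (λ s2 pb5 q pb s10 p2 p10 s4 s20 → (s2 :* pb5 :- q :* (pb :* s10)) :* (s2 :* pb5 :+ q :* (pb :* s10)) :- con (+ 2) :*
          (s4 :* p10 :- q :* q :* (p2 :* s20)) :* (p2 :* p10 :+ q :* q :* q :* (s4 :* s20)) := pb5 :* pb5 :*
          (s2 :* s2 :- con (+ 2) :* (p2 :* s4)) :+ (con (+ 2) :* (p2 :* s4) :*
          (pb5 :* pb5 :- (p10 :* p10 :- q :* q :* (q :* q) :* q :* (s20 :* s20))) :+
          (:- (q :* q :* (s10 :* s10)) :* (pb :* pb :- (p2 :* p2 :- q :* (s4 :* s4))) :+
          (:- (q :* q :* (p2 :* p2 :- q :* (s4 :* s4))) :* (s10 :* s10 :- con (+ 2) :* (p10 :* s20)) :+ con (+ 0))))) ≈-refl Ψ₍₂₎ φ̄₅ q φ̄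
          Ψ₁₀ φ₂ φ₁₀ Ψ₄ Ψ₂₀)

  c·m₂₁₀ : c · m₂₁₀ ≈ m̄₁₅
  c·m₂₁₀ = ≈-trans (self ⊗ self) (≈-sym (self))

  -- Divides `HK` by `K̄-identity`; the quotient of its value by that of `K₂-identity` is the eta
  -- quotient `c`, by `c·m₂₁₀`.
  HcG : (Ψ₍₂₎ · φ̄₅ ⊖ q · (φ̄ · Ψ₁₀)) · c ≈ κ (+ 2) · G
  HcG = mon-cancel (+ 0 ∷ + 1 ∷ + 0 ∷ + 0 ∷ + 0 ∷ + 1 ∷ + 0 ∷ + 0 ∷ [])
      (κ-cancelˡ (+ 2) (λ ()) (combine (hyp _ c·m₂₁₀ ∷ hyp _ K̄-identity ∷ hyp _ HK ∷ hyp _ K₂-identity ∷ [])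
        (solve 12 (λ m210 c s2 pb5 q pb s10 p2 p10 s4 s20 mb15 → con (+ 2) :* ((s2 :* pb5 :- q :* (pb :* s10)) :* c :* m210) :- con (+ 2)
            :* (con (+ 2) :* (p2 :* p10 :+ q :* q :* q :* (s4 :* s20)) :* m210) := con (+ 2) :* (s2 :* pb5 :- q :* (pb :* s10)) :*
            (c :* m210 :- mb15) :+ (:- (s2 :* pb5 :- q :* (pb :* s10)) :* (s2 :* pb5 :+ q :* (pb :* s10) :- con (+ 2) :* mb15) :+
            (con (+ 1) :* ((s2 :* pb5 :- q :* (pb :* s10)) :* (s2 :* pb5 :+ q :* (pb :* s10)) :- con (+ 2) :*
            (s4 :* p10 :- q :* q :* (p2 :* s20)) :* (p2 :* p10 :+ q :* q :* q :* (s4 :* s20))) :+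
            (con (+ 2) :* (p2 :* p10 :+ q :* q :* q :* (s4 :* s20)) :* (s4 :* p10 :- q :* q :* (p2 :* s20) :- con (+ 2) :* m210) :+ con
            (+ 0))))) ≈-refl m₂₁₀ c Ψ₍₂₎ φ̄₅ q φ̄ Ψ₁₀ φ₂ φ₁₀ Ψ₄ Ψ₂₀ m̄₁₅)))

  G-eta : G ≈ Sη ⊖ q · Dη
  G-eta = κ-cancelˡ (+ 2) (λ ()) (combine (hyp _ HcG ∷ hyp _ Ψ₍₂₎·φ̄₅·c ∷ hyp _ φ̄·Ψ₁₀·c ∷ [])
        (solve 9 (λ G S q D0 c s2 pb5 pb s10 → con (+ 2) :* G :- con (+ 2) :* (S :- q :* D0) := con -[1+ 0 ] :*
            ((s2 :* pb5 :- q :* (pb :* s10)) :* c :- con (+ 2) :* G) :+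
            (con (+ 1) :* (s2 :* pb5 :* c :- con (+ 2) :* S) :+ (:- q :* (pb :* s10 :* c :- con (+ 2) :* D0) :+ con (+ 0)))) ≈-refl G Sη q
            Dη c Ψ₍₂₎ φ̄₅ φ̄ Ψ₁₀))

  Ψ·Ψ·ν : Ψ · Ψ · ν ≈ κ (+ 4) · V̄
  Ψ·Ψ·ν = ≈-trans ((Ψ-mon ⊗ Ψ-mon) ⊗ self) (≈-sym (scaled (+ 4) (self)))

  Ψ₅·Ψ₅·ν : Ψ₅ · Ψ₅ · ν ≈ κ (+ 4) · Ȳ
  Ψ₅·Ψ₅·ν = ≈-trans ((Ψ₅-mon ⊗ Ψ₅-mon) ⊗ self) (≈-sym (scaled (+ 4) (self)))

  Z·ν : Z · ν ≈ φ̄₅ · φ̄₅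
  Z·ν = ≈-trans (self ⊗ self) (≈-sym ((lift φ̄₅-mon) ⊗ (lift φ̄₅-mon)))

  -- `ν` turns all three terms of `Z-identity` into multiples of the eta quotients `V̄`, `Ȳ` and
  -- φ̄₅². Combined with `Ȳ-identity` it makes 5φ̄₅² - φ̄² a single eta quotient.
  V̄-Ȳ : φ̄₅ · φ̄₅ ≈ V̄ ⊖ q · Ȳ
  V̄-Ȳ = κ-cancelˡ (+ 4) (λ ()) (combine (hyp _ Z-identity ∷ hyp _ Ψ·Ψ·ν ∷ hyp _ Ψ₅·Ψ₅·ν ∷ hyp _ Z·ν ∷ [])
        (solve 8 (λ pb5 Vb q Yb n s Z s5 → con (+ 4) :* (pb5 :* pb5) :- con (+ 4) :* (Vb :- q :* Yb) := :- n :*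
            (s :* s :- (q :* (s5 :* s5) :+ con (+ 4) :* Z)) :+ (con (+ 1) :* (s :* s :* n :- con (+ 4) :* Vb) :+
            (:- q :* (s5 :* s5 :* n :- con (+ 4) :* Yb) :+ (con -[1+ 3 ] :* (Z :* n :- pb5 :* pb5) :+ con (+ 0))))) ≈-refl φ̄₅ V̄ q Ȳ ν Ψ Z
            Ψ₅))

  V̄-identity : κ (+ 5) · (φ̄₅ · φ̄₅) ⊖ φ̄ · φ̄ ≈ κ (+ 4) · V̄
  V̄-identity = combine (hyp _ Ȳ-identity ∷ hyp _ V̄-Ȳ ∷ [])
      (solve 5 (λ pb pb5 Vb Yb q → con (+ 5) :* (pb5 :* pb5) :- pb :* pb :- con (+ 4) :* Vb := con -[1+ 0 ] :*
          (pb :* pb :- (pb5 :* pb5 :- con (+ 4) :* q :* Yb)) :+ (con (+ 4) :* (pb5 :* pb5 :- (Vb :- q :* Yb)) :+ con (+ 0))) ≈-refl φ̄ φ̄₅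
          V̄ Ȳ q)

  V-identity : κ (+ 5) · (φ₅ · φ₅) ⊖ φ · φ ≈ κ (+ 4) · V
  V-identity = ≈-trans (≈-sym (≈-trans (alt-⊖ _ _) (⊖-cong (≈-trans (alt-κ· (+ 5) _)
      (·-cong ≈-refl (≈-trans (alt-· _ _) (·-cong alt-φ̄₅ alt-φ̄₅)))) (≈-trans (alt-· _ _) (·-cong (alt-alt φ) (alt-alt φ))))))
    (≈-trans (alt-cong V̄-identity) (≈-trans (alt-κ· (+ 4) V̄) (·-cong ≈-refl
        (alt-mon (- + 1 ∷ + 3 ∷ + 0 ∷ + 0 ∷ + 1 ∷ - + 1 ∷ + 0 ∷ + 0 ∷ [])))))

  Ψ₅·Ψ₅·πm : Ψ₅ · Ψ₅ · πm ≈ κ (+ 4) · (Ȳ · Z)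
  Ψ₅·Ψ₅·πm = ≈-trans ((Ψ₅-mon ⊗ Ψ₅-mon) ⊗ self) (≈-sym (scaled (+ 4) (self ⊗ self)))

  Z·φ̄·φ̄ : Z · (φ̄ · φ̄) ≈ W · πm
  Z·φ̄·φ̄ = ≈-trans (self ⊗ ((lift φ̄-mon) ⊗ (lift φ̄-mon))) (≈-sym (self ⊗ self))

  φ̄₅·φ̄₅ : φ̄₅ · φ̄₅ ≈ πm
  φ̄₅·φ̄₅ = ≈-trans ((lift φ̄₅-mon) ⊗ (lift φ̄₅-mon)) (≈-sym (self))

  -- By `Z-identity` the left side is 4(Z - qΨ₅²). Multiplied by `πm`, which equals φ̄₅², it becomes
  -- 4Z(φ̄₅² - 4qȲ) = 4Zφ̄², a single eta quotient.
  W-identity : Ψ · Ψ ⊖ κ (+ 5) · (q · (Ψ₅ · Ψ₅)) ≈ κ (+ 4) · W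
  W-identity = mon-cancel (+ 0 ∷ + 0 ∷ + 0 ∷ + 0 ∷ + 4 ∷ - + 2 ∷ + 0 ∷ + 0 ∷ [])
      (combine (hyp _ Z-identity ∷ hyp _ Ψ₅·Ψ₅·πm ∷ hyp _ Ȳ-identity ∷ hyp _ Z·φ̄·φ̄ ∷ hyp _ φ̄₅·φ̄₅ ∷ [])
        (solve 9 (λ pm s q s5 Wm Z Yb pb pb5 → (s :* s :- con (+ 5) :* (q :* (s5 :* s5))) :* pm :- con (+ 4) :* Wm :* pm := pm :*
            (s :* s :- (q :* (s5 :* s5) :+ con (+ 4) :* Z)) :+ (con -[1+ 3 ] :* q :* (s5 :* s5 :* pm :- con (+ 4) :* (Yb :* Z)) :+
            (con -[1+ 3 ] :* Z :* (pb :* pb :- (pb5 :* pb5 :- con (+ 4) :* q :* Yb)) :+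
            (con (+ 4) :* (Z :* (pb :* pb) :- Wm :* pm) :+ (con -[1+ 3 ] :* Z :* (pb5 :* pb5 :- pm) :+ con (+ 0)))))) ≈-refl πm Ψ q Ψ₅ W Z
            Ȳ φ̄ φ̄₅))

  W-identity₂ : Ψ₍₂₎ · Ψ₍₂₎ ⊖ κ (+ 5) · (q · q · (Ψ₁₀ · Ψ₁₀)) ≈ κ (+ 4) · W₂
  W-identity₂ = ≈-trans (≈-sym (≈-trans (dil-⊖ 2 _ _) (⊖-cong (dil-· 2 _ _)
      (≈-trans (dil-κ-· 2 (+ 5) _) (·-cong ≈-refl (≈-trans (dil-· 2 _ _)
      (·-cong (≈-trans (dil-q 2) q^2) (≈-trans (dil-· 2 _ _) (·-cong d d)))))))))
    (≈-trans (dil-cong 2 W-identity) (≈-trans (dil-κ-· 2 (+ 4) W) (·-cong ≈-refl (dil2-mon (+ 3) (- + 1) (+ 0) (- + 1) (+ 1) (+ 0)))))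
    where d = dil-dil 2 5 10 refl Ψ

  -- The left side of `K-identity` with the opposite sign. At q⁴ it is the odd part of φφ₅, up to a
  -- factor q.
  Hh Hh₂ Hh₄ : PS
  Hh  = Ψ₍₂₎ · φ₅ ⊕ q · (φ · Ψ₁₀)
  Hh₂ = dil 2 Hh
  Hh₄ = dil 4 Hh

  alt-G : alt G ≈ φ₂ · φ₁₀ ⊖ q · q · q · (Ψ₄ · Ψ₂₀)
  alt-G = ≈-trans (alt-⊕ _ _) (≈-trans (⊕-cong (≈-trans (alt-· _ _) (·-cong alt-φ₂ alt-φ₁₀))
      (≈-trans (alt-· _ _) (·-cong (≈-trans (alt-· _ _) (·-cong (≈-trans (alt-· _ _) (·-cong alt-q alt-q)) alt-q))
      (≈-trans (alt-· _ _) (·-cong alt-Ψ₄ alt-Ψ₂₀)))))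
    (solve 3 (λ a q b → a :+ :- q :* :- q :* :- q :* b := a :- q :* q :* q :* b) ≈-refl _ q _))

  Hh-c̄ : Hh · c̄ ≈ κ (+ 2) · (φ₂ · φ₁₀ ⊖ q · q · q · (Ψ₄ · Ψ₂₀))
  Hh-c̄ = ≈-trans (≈-sym (≈-trans (alt-· _ _) (·-cong (≈-trans (alt-⊖ _ _)
      (≈-trans (⊖-cong (≈-trans (alt-· _ _) (·-cong alt-Ψ₍₂₎ alt-φ̄₅))
      (≈-trans (alt-q· _) (~-cong (·-cong ≈-refl (≈-trans (alt-· _ _) (·-cong (alt-alt φ) alt-Ψ₁₀))))))
      (solve 2 (λ x y → x :- :- y := x :+ y) ≈-refl _ _))) (alt-mon (- + 1 ∷ + 2 ∷ - + 1 ∷ + 0 ∷ - + 1 ∷ + 2 ∷ - + 1 ∷ + 0 ∷ [])))))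
    (≈-trans (alt-cong HcG) (≈-trans (alt-κ· (+ 2) G) (·-cong ≈-refl alt-G)))

  Hh₂-ω : Hh₂ · ω ≈ κ (+ 2) · (dil 4 φ · dil 20 φ ⊖ q · q · (q · q) · (q · q) · (dil 8 Ψ · dil 40 Ψ))
  Hh₂-ω = ≈-trans (·-cong ≈-refl (≈-sym (dil2-mon (+ 1) (- + 1) (+ 0) (+ 1) (- + 1) (+ 0))))
      (≈-trans (≈-sym (dil-· 2 Hh c̄)) (≈-trans (dil-cong 2 Hh-c̄) (≈-trans (dil-κ-· 2 (+ 2) _)
    (·-cong ≈-refl (≈-trans (dil-⊖ 2 _ _) (⊖-cong (≈-trans (dil-· 2 _ _) (·-cong (dil-dil 2 2 4 refl φ) (dil-dil 2 10 20 refl φ)))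
      (≈-trans (dil-· 2 _ _) (·-cong (≈-trans (dil-· 2 _ _) (·-cong (≈-trans (dil-· 2 _ _) (·-cong q₂ q₂)) q₂))
          (≈-trans (dil-· 2 _ _) (·-cong (dil-dil 2 4 8 refl Ψ) (dil-dil 2 20 40 refl Ψ)))))))))))
    where q₂ = ≈-trans (dil-q 2) q^2

  Ψ₍₂₎·Ψ₁₀·ω : Ψ₍₂₎ · Ψ₁₀ · ω ≈ κ (+ 4) · m₄₂₀
  Ψ₍₂₎·Ψ₁₀·ω = ≈-trans ((Ψ₍₂₎-mon ⊗ Ψ₁₀-mon) ⊗ self) (≈-sym (scaled (+ 4) (self)))

  -- Multiplied by `ω`, the term `Hh₂` is φφ̄₅ + φ̄φ₅ and the other term is φφ̄₅ - φ̄φ₅, by `L₂`.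
  -- Their sum is one product, and `Hh₂-minus` takes the difference.
  Hh₂-plus : (Hh₂ ⊕ q · (Ψ₍₂₎ · Ψ₁₀)) · ω ≈ κ (+ 2) · (φ · φ̄₅)
  Hh₂-plus = combine (hyp _ Hh₂-ω ∷ hyp _ Ψ₍₂₎·Ψ₁₀·ω ∷ hyp _ L₂ ∷ hyp _ φ-dissection₂ ∷ hyp _ φ̄₅-dissection ∷ hyp _ φ̄-dissection ∷ hyp _
      φ₅-dissection ∷ [])
      (solve 14 (λ m H2 q s2 s10 p pb5 p4 p20 s8 s40 m420 pb p5 → (H2 :+ q :* (s2 :* s10)) :* m :- con (+ 2) :* (p :* pb5) := con (+ 1) :*
          (H2 :* m :- con (+ 2) :* (p4 :* p20 :- q :* q :* (q :* q) :* (q :* q) :* (s8 :* s40))) :+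
          (q :* (s2 :* s10 :* m :- con (+ 4) :* m420) :+ (con -[1+ 0 ] :* (p :* pb5 :- pb :* p5 :- con (+ 4) :* q :* m420) :+
          (:- pb5 :* (p :- (p4 :+ q :* s8)) :+ (:- (p4 :+ q :* s8) :* (pb5 :- (p20 :- q :* q :* (q :* q) :* q :* s40)) :+
          (:- p5 :* (pb :- (p4 :- q :* s8)) :+ (:- (p4 :- q :* s8) :* (p5 :- (p20 :+ q :* q :* (q :* q) :* q :* s40)) :+ con (+ 0))))))))
          ≈-refl ω Hh₂ q Ψ₍₂₎ Ψ₁₀ φ φ̄₅ (dil 4 φ) (dil 20 φ) (dil 8 Ψ) (dil 40 Ψ) m₄₂₀ φ̄ φ₅)

  Hh₂-minus : (Hh₂ ⊖ q · (Ψ₍₂₎ · Ψ₁₀)) · ω ≈ κ (+ 2) · (φ̄ · φ₅)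
  Hh₂-minus = combine (hyp _ Hh₂-ω ∷ hyp _ Ψ₍₂₎·Ψ₁₀·ω ∷ hyp _ L₂ ∷ hyp _ φ-dissection₂ ∷ hyp _ φ̄₅-dissection ∷ hyp _ φ̄-dissection ∷ hyp _
      φ₅-dissection ∷ [])
      (solve 14 (λ m H2 q s2 s10 pb p5 p4 p20 s8 s40 m420 p pb5 → (H2 :- q :* (s2 :* s10)) :* m :- con (+ 2) :* (pb :* p5) := con (+ 1) :*
          (H2 :* m :- con (+ 2) :* (p4 :* p20 :- q :* q :* (q :* q) :* (q :* q) :* (s8 :* s40))) :+
          (:- q :* (s2 :* s10 :* m :- con (+ 4) :* m420) :+ (con (+ 1) :* (p :* pb5 :- pb :* p5 :- con (+ 4) :* q :* m420) :+
          (:- pb5 :* (p :- (p4 :+ q :* s8)) :+ (:- (p4 :+ q :* s8) :* (pb5 :- (p20 :- q :* q :* (q :* q) :* q :* s40)) :+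
          (:- p5 :* (pb :- (p4 :- q :* s8)) :+ (:- (p4 :- q :* s8) :* (p5 :- (p20 :+ q :* q :* (q :* q) :* q :* s40)) :+ con (+ 0))))))))
          ≈-refl ω Hh₂ q Ψ₍₂₎ Ψ₁₀ φ̄ φ₅ (dil 4 φ) (dil 20 φ) (dil 8 Ψ) (dil 40 Ψ) m₄₂₀ φ φ̄₅)

  φ̄₅·φ₅ : φ̄₅ · φ₅ ≈ Z₂ · ω
  φ̄₅·φ₅ = ≈-trans ((lift φ̄₅-mon) ⊗ (lift φ₅-mon)) (≈-sym (self ⊗ self))

  φ̄·φ : φ̄ · φ ≈ W₂ · ω
  φ̄·φ = ≈-trans ((lift φ̄-mon) ⊗ (lift φ-mon)) (≈-sym (self ⊗ self))

  -- Multiplied by `ω`, both sides equal 4φφ₅φ̄₅: the left by `Hh₂-plus`, the right because the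
  -- bracket is 4 `Z₂`. `U₂` is the same argument with `Hh₂-minus` and `W₂`.
  U₁ : κ (+ 2) · ((Hh₂ ⊕ q · (Ψ₍₂₎ · Ψ₁₀)) · φ₅) ≈ φ · (Ψ₍₂₎ · Ψ₍₂₎ ⊖ q · q · (Ψ₁₀ · Ψ₁₀))
  U₁ = mon-cancel (+ 0 ∷ + 1 ∷ - + 1 ∷ + 0 ∷ + 0 ∷ + 1 ∷ - + 1 ∷ + 0 ∷ []) (combine (hyp _ Hh₂-plus ∷ hyp _ Z-identity₂ ∷ hyp _ φ̄₅·φ₅ ∷ [])
        (solve 9 (λ m p5 H2 q s2 s10 p pb5 Z2 → con (+ 2) :* ((H2 :+ q :* (s2 :* s10)) :* p5) :* m :- p :*
            (s2 :* s2 :- q :* q :* (s10 :* s10)) :* m := con (+ 2) :* p5 :* ((H2 :+ q :* (s2 :* s10)) :* m :- con (+ 2) :* (p :* pb5)) :+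
            (:- p :* m :* (s2 :* s2 :- (q :* q :* (s10 :* s10) :+ con (+ 4) :* Z2)) :+
            (con (+ 4) :* p :* (pb5 :* p5 :- Z2 :* m) :+ con (+ 0)))) ≈-refl ω φ₅ Hh₂ q Ψ₍₂₎ Ψ₁₀ φ φ̄₅ Z₂))

  U₂ : κ (+ 2) · ((Hh₂ ⊖ q · (Ψ₍₂₎ · Ψ₁₀)) · φ) ≈ φ₅ · (Ψ₍₂₎ · Ψ₍₂₎ ⊖ κ (+ 5) · (q · q · (Ψ₁₀ · Ψ₁₀)))
  U₂ = mon-cancel (+ 0 ∷ + 1 ∷ - + 1 ∷ + 0 ∷ + 0 ∷ + 1 ∷ - + 1 ∷ + 0 ∷ []) (combine (hyp _ Hh₂-minus ∷ hyp _ W-identity₂ ∷ hyp _ φ̄·φ ∷ [])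
        (solve 9 (λ m p H2 q s2 s10 p5 pb W2 → con (+ 2) :* ((H2 :- q :* (s2 :* s10)) :* p) :* m :- p5 :*
            (s2 :* s2 :- con (+ 5) :* (q :* q :* (s10 :* s10))) :* m := con (+ 2) :* p :*
            ((H2 :- q :* (s2 :* s10)) :* m :- con (+ 2) :* (pb :* p5)) :+
            (:- p5 :* m :* (s2 :* s2 :- con (+ 5) :* (q :* q :* (s10 :* s10)) :- con (+ 4) :* W2) :+
            (con (+ 4) :* p5 :* (pb :* p :- W2 :* m) :+ con (+ 0)))) ≈-refl ω φ Hh₂ q Ψ₍₂₎ Ψ₁₀ φ₅ φ̄ W₂))

  module _ where
    private
      q₂ = ≈-trans (dil-q 2) q^2
      q₄ = ≈-trans (dil-· 2 q q) (·-cong q₂ q₂)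
      h  = dil-dil 2 2 4 refl Hh
      s₂ = dil-dil 2 2 4 refl Ψ
      s₁₀ = dil-dil 2 10 20 refl Ψ
      p₅ = dil-dil 2 5 10 refl φ
      qs = ≈-trans (dil-· 2 _ _) (·-cong q₂ (≈-trans (dil-· 2 _ _) (·-cong s₂ s₁₀)))
      ss = ≈-trans (dil-· 2 _ _) (·-cong s₂ s₂)
      qt = ≈-trans (dil-· 2 _ _) (·-cong q₄ (≈-trans (dil-· 2 _ _) (·-cong s₁₀ s₁₀)))

    U₁-dil : κ (+ 2) · ((Hh₄ ⊕ q · q · (Ψ₄ · Ψ₂₀)) · φ₁₀) ≈ φ₂ · (Ψ₄ · Ψ₄ ⊖ q · q · (q · q) · (Ψ₂₀ · Ψ₂₀))
    U₁-dil = ≈-trans (≈-sym (≈-trans (dil-κ-· 2 (+ 2) _) (·-cong ≈-refl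
        (≈-trans (dil-· 2 _ _) (·-cong (≈-trans (dil-⊕ 2 _ _) (⊕-cong h qs)) p₅)))))
      (≈-trans (dil-cong 2 U₁) (≈-trans (dil-· 2 _ _) (·-cong ≈-refl (≈-trans (dil-⊖ 2 _ _) (⊖-cong ss qt)))))

    U₂-dil : κ (+ 2) · ((Hh₄ ⊖ q · q · (Ψ₄ · Ψ₂₀)) · φ₂) ≈ φ₁₀ · (Ψ₄ · Ψ₄ ⊖ κ (+ 5) · (q · q · (q · q) · (Ψ₂₀ · Ψ₂₀)))
    U₂-dil = ≈-trans (≈-sym (≈-trans (dil-κ-· 2 (+ 2) _) (·-cong ≈-refl
        (≈-trans (dil-· 2 _ _) (·-cong (≈-trans (dil-⊖ 2 _ _) (⊖-cong h qs)) ≈-refl)))))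
      (≈-trans (dil-cong 2 U₂) (≈-trans (dil-· 2 _ _) (·-cong p₅ (≈-trans (dil-⊖ 2 _ _)
          (⊖-cong ss (≈-trans (dil-κ-· 2 (+ 5) _) (·-cong ≈-refl qt)))))))

  Ψ₄·φ₂·m₂₁₀ : Ψ₄ · φ₂ · m₂₁₀ ≈ κ (+ 2) · B₂
  Ψ₄·φ₂·m₂₁₀ = ≈-trans ((Ψ₄-mon ⊗ (lift φ₂-mon)) ⊗ self) (≈-sym (scaled (+ 2) (self)))

  Ψ₂₀·φ₁₀·m₂₁₀ : Ψ₂₀ · φ₁₀ · m₂₁₀ ≈ κ (+ 2) · B₁
  Ψ₂₀·φ₁₀·m₂₁₀ = ≈-trans ((Ψ₂₀-mon ⊗ (lift φ₁₀-mon)) ⊗ self) (≈-sym (scaled (+ 2) (self)))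

  -- `K₂-identity` multiplied by qΨ₄φ₂. With the multiplier q³Ψ₂₀φ₁₀ it yields `B₁-identity`; in
  -- this way the two cusp forms arise from one relation.
  B₂-identity : q · (Ψ₄ · Ψ₄ · (φ₂ · φ₁₀)) ⊖ q · q · q · (Ψ₄ · Ψ₂₀ · (φ₂ · φ₂)) ≈ κ (+ 4) · (q · B₂)
  B₂-identity = combine (hyp _ K₂-identity ∷ hyp _ Ψ₄·φ₂·m₂₁₀ ∷ [])
      (solve 7 (λ q s4 p2 p10 s20 B2 m210 → q :* (s4 :* s4 :* (p2 :* p10)) :- q :* q :* q :* (s4 :* s20 :* (p2 :* p2)) :- con (+ 4) :*
          (q :* B2) := q :* (s4 :* p2) :* (s4 :* p10 :- q :* q :* (p2 :* s20) :- con (+ 2) :* m210) :+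
          (con (+ 2) :* q :* (s4 :* p2 :* m210 :- con (+ 2) :* B2) :+ con (+ 0))) ≈-refl q Ψ₄ φ₂ φ₁₀ Ψ₂₀ B₂ m₂₁₀)

  B₁-identity : q · q · q · (Ψ₄ · Ψ₂₀ · (φ₁₀ · φ₁₀)) ⊖ q · q · (q · q) · q · (Ψ₂₀ · Ψ₂₀ · (φ₂ · φ₁₀)) ≈ κ (+ 4) · (q · q · q · B₁)
  B₁-identity = combine (hyp _ K₂-identity ∷ hyp _ Ψ₂₀·φ₁₀·m₂₁₀ ∷ [])
      (solve 7 (λ q s4 s20 p10 p2 B1 m210 → q :* q :* q :* (s4 :* s20 :* (p10 :* p10)) :- q :* q :* (q :* q) :* q :*
          (s20 :* s20 :* (p2 :* p10)) :- con (+ 4) :* (q :* q :* q :* B1) := q :* q :* q :* (s20 :* p10) :*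
          (s4 :* p10 :- q :* q :* (p2 :* s20) :- con (+ 2) :* m210) :+
          (con (+ 2) :* (q :* q :* q) :* (s20 :* p10 :* m210 :- con (+ 2) :* B1) :+ con (+ 0))) ≈-refl q Ψ₄ Ψ₂₀ φ₁₀ φ₂ B₁ m₂₁₀)

open EtaIdentities

-- Lambert series over divisor pairs, character twists and the two Eisenstein series.

module Eisenstein where

  open import Data.Integer using (_+_; _*_; -_; _-_)
  open import Function using (flip)
  open import Data.Nat.Divisibility using (∣m⇒∣m*n; ∣n⇒∣m*n)
  open import Data.Nat.DivMod using (_/_; %-distribˡ-*; [m+kn]%n≡m%n)
  open import Data.Sum using (_⊎_)
  open import Relation.Nullary.Decidable using (_⊎-dec_)
  open import Data.Fin.Properties using (toℕ-fromℕ<; all?)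
  open import Data.Empty using (⊥)

  factorˡ : ∀ {k} d m → k ∣ d → k ∣ d ℕ.* m
  factorˡ d m p = ∣m⇒∣m*n m p

  Σ<-single : ∀ n {f : ℕ → ℤ} k → k ℕ.< n → (∀ i → ¬ i ≡ k → f i ≡ + 0) → Σ< n f ≡ f k
  Σ<-single (suc n) {f} zero    _         h = trans (cong (λ z → f 0 + z) (Σ<-0 n (λ i _ → h (suc i) (λ ())))) (ℤₚ.+-identityʳ (f 0))
  Σ<-single (suc n) {f} (suc k) (s≤s k<n) h = trans (cong₂ _+_ (h 0 (λ ()))
      (Σ<-single n {f ∘ suc} k k<n (λ i i≢k → h (suc i) (i≢k ∘ ℕₚ.suc-injective)))) (ℤₚ.+-identityˡ (f (suc k)))

  Σ<-split : ∀ m n (f : ℕ → ℤ) → Σ< (m ℕ.+ n) f ≡ Σ< m f + Σ< n (λ i → f (m ℕ.+ i))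
  Σ<-split zero    n f = sym (ℤₚ.+-identityˡ _)
  Σ<-split (suc m) n f = trans (cong (λ z → f 0 + z) (Σ<-split m n (f ∘ suc))) (sym (ℤₚ.+-assoc (f 0) _ _))

  -- The coefficient of q^n is the sum of h d m over d m = n.
  Λ : (ℕ → ℕ → ℤ) → PS
  PS.coe (Λ h) n = Σ< n (λ i → Σ< n (λ j → monoᶜ (suc i ℕ.* suc j) n * h (suc i) (suc j)))

  private
    term-zero : ∀ {a n} c → ¬ n ≡ a → monoᶜ a n * c ≡ + 0
    term-zero {a} {n} c n≢a = trans (cong (_* c) (mono-other a n n≢a)) (ℤₚ.*-zeroˡ c)

    large-left : ∀ n i j → n ℕ.≤ i → ¬ n ≡ suc i ℕ.* suc j
    large-left n i j n≤i eq = ℕₚ.<⇒≱ (s≤s n≤i) (subst (suc i ℕ.≤_) (sym eq) (ℕₚ.m≤m*n (suc i) (suc j)))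

    large-right : ∀ n i j → n ℕ.≤ j → ¬ n ≡ suc i ℕ.* suc j
    large-right n i j n≤j eq = ℕₚ.<⇒≱ (s≤s n≤j) (subst (suc j ℕ.≤_) (sym eq) (ℕₚ.m≤n*m (suc j) (suc i)))

  Λ-at : ∀ h {n B C} → n ℕ.≤ B → n ℕ.≤ C → Λ h ! n ≡ Σ< B (λ i → Σ< C (λ j → monoᶜ (suc i ℕ.* suc j) n * h (suc i) (suc j)))
  Λ-at h {n} {B} {C} n≤B n≤C = sym (trans
    (Σ<-extend n B n≤B (λ i n≤i → Σ<-0 C (λ j _ → term-zero (h (suc i) (suc j)) (large-left n i j n≤i))))
    (Σ<-cong n (λ i _ → Σ<-extend n C n≤C (λ j n≤j → term-zero (h (suc i) (suc j)) (large-right n i j n≤j)))))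

  -- Lets a weight depend on n through the relation n = d m, as needed for signs and characters of
  -- n.
  Λ-local : ∀ n {h g : ℕ → ℕ → ℤ} → (∀ d m → n ≡ d ℕ.* m → h d m ≡ g d m) → Λ h ! n ≡ Λ g ! n
  Λ-local n {h} {g} p = Σ<-cong n (λ i _ → Σ<-cong n (λ j _ → go i j))
    where
      go : ∀ i j → monoᶜ (suc i ℕ.* suc j) n * h (suc i) (suc j) ≡ monoᶜ (suc i ℕ.* suc j) n * g (suc i) (suc j)
      go i j with n ℕ.≟ suc i ℕ.* suc j
      ... | yes eq = cong (monoᶜ (suc i ℕ.* suc j) n *_) (p (suc i) (suc j) eq)
      ... | no  n≢ = trans (term-zero (h (suc i) (suc j)) n≢) (sym (term-zero (g (suc i) (suc j)) n≢))

  Λ-cong : {h g : ℕ → ℕ → ℤ} → (∀ d m → h d m ≡ g d m) → Λ h ≈ Λ g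
  Λ-cong p = pointwise (λ n → Λ-local n (λ d m _ → p d m))

  Λ-flip : ∀ h → Λ h ≈ Λ (flip h)
  Λ-flip h = pointwise (λ n → trans (Σ<-swap n n (λ i j → monoᶜ (suc i ℕ.* suc j) n * h (suc i) (suc j)))
    (Σ<-cong n (λ j _ → Σ<-cong n (λ i _ → cong (λ z → monoᶜ z n * h (suc i) (suc j)) (ℕₚ.*-comm (suc i) (suc j))))))

  Λ-linear : ∀ x y (h g : ℕ → ℕ → ℤ) → Λ (λ d m → x * h d m + y * g d m) ≈ κ x · Λ h ⊕ κ y · Λ g
  Λ-linear x y h g = pointwise (λ n → trans (trans (Σ<-cong n (λ i _ → row n i))
      (double n x y (λ i → Σ< n (λ j → t h n i j)) (λ i → Σ< n (λ j → t g n i j))))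
      (sym (cong₂ _+_ (κ-·-at x (Λ h) n) (κ-·-at y (Λ g) n))))
    where
      open +-*-Solver
      t : (ℕ → ℕ → ℤ) → ℕ → ℕ → ℕ → ℤ
      t h n i j = monoᶜ (suc i ℕ.* suc j) n * h (suc i) (suc j)
      double : ∀ n x y (F G : ℕ → ℤ) → Σ< n (λ i → x * F i + y * G i) ≡ x * Σ< n F + y * Σ< n G
      double n x y F G = trans (Σ<-+ n (λ i → x * F i) (λ i → y * G i)) (cong₂ _+_ (Σ<-*ˡ n x F) (Σ<-*ˡ n y G))
      row : ∀ n i → Σ< n (λ j → monoᶜ (suc i ℕ.* suc j) n * (x * h (suc i) (suc j) + y * g (suc i) (suc j))) ≡ x * Σ< n (t h n i) + y * Σ<
          n (t g n i)
      row n i = trans (Σ<-cong n (λ j _ → solve 5 (λ m x y a b → m :* (x :* a :+ y :* b) := x :* (m :* a) :+ y :* (m :* b)) refl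
          (monoᶜ (suc i ℕ.* suc j) n) x y (h (suc i) (suc j)) (g (suc i) (suc j))))
        (double n x y (t h n i) (t g n i))

  Λ-scale : ∀ c (h : ℕ → ℕ → ℤ) → Λ (λ d m → c * h d m) ≈ κ c · Λ h
  Λ-scale c h = ≈-trans (Λ-cong (λ d m → sym (trans (cong (λ z → c * h d m + z) (ℤₚ.*-zeroˡ (h d m))) (ℤₚ.+-identityʳ _))))
      (≈-trans (Λ-linear c (+ 0) h h)
    (solve 2 (λ x y → x :* y :+ con (+ 0) :* y := x :* y) ≈-refl (κ c) (Λ h)))
    where open SeriesSolver

  δ : ℕ → ℕ → ℤ
  δ k n = if ⌊ k ∣? n ⌋ then + 1 else + 0

  δ-yes : ∀ {k n} → k ∣ n → δ k n ≡ + 1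
  δ-yes {k} {n} k∣n with k ∣? n
  ... | yes _   = refl
  ... | no  k∤n = contradiction k∣n k∤n

  δ-no : ∀ {k n} → ¬ k ∣ n → δ k n ≡ + 0
  δ-no {k} {n} k∤n with k ∣? n
  ... | yes k∣n = contradiction k∣n k∤n
  ... | no  _   = refl

  Σ<-multiples : ∀ k .{{_ : NonZero k}} t (G : ℕ → ℤ) → Σ< (t ℕ.* k) (λ i → δ k (suc i) * G (suc i)) ≡ Σ< t (λ i → G (suc i ℕ.* k))
  Σ<-multiples k zero    G = refl
  Σ<-multiples k@(suc k′) (suc t) G = trans (Σ<-split k (t ℕ.* k) (λ i → δ k (suc i) * G (suc i))) (cong₂ _+_ block rest)
    where
      block : Σ< k (λ i → δ k (suc i) * G (suc i)) ≡ G (1 ℕ.* k)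
      block = trans (trans (Σ<-cong k (λ i i<k → only i i<k)) (Σ<-single k {λ i → monoᶜ k′ i * G (suc i)} k′ ℕₚ.≤-refl
          (λ i i≢ → term-zero (G (suc i)) i≢)))
        (trans (cong (_* G k) (mono-self k′)) (trans (ℤₚ.*-identityˡ (G k)) (cong G (sym (ℕₚ.*-identityˡ k)))))
        where
          only : ∀ i → i ℕ.< k → δ k (suc i) * G (suc i) ≡ monoᶜ k′ i * G (suc i)
          only i (s≤s i≤k′) with i ℕ.≟ k′
          ... | yes refl = cong (_* G (suc i)) (trans (δ-yes {suc i} {suc i} ∣-refl) (sym (mono-self i)))
          ... | no  i≢   = cong (_* G (suc i)) (trans (δ-no {suc k′} {suc i} (>⇒∤ (s≤s (ℕₚ.≤∧≢⇒< i≤k′ i≢)))) (sym (mono-other k′ i i≢)))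
      δ-shift : ∀ i → δ k (suc (k ℕ.+ i)) ≡ δ k (suc i)
      δ-shift i with k ∣? suc i
      ... | yes k∣ = δ-yes (subst (k ∣_) (ℕₚ.+-suc k i) (∣m∣n⇒∣m+n ∣-refl k∣))
      ... | no  k∤ = δ-no (λ k∣ → k∤ (∣m+n∣m⇒∣n (subst (k ∣_) (sym (ℕₚ.+-suc k i)) k∣) ∣-refl))
      rest : Σ< (t ℕ.* k) (λ i → δ k (suc (k ℕ.+ i)) * G (suc (k ℕ.+ i))) ≡ Σ< t (λ i → G (suc (suc i) ℕ.* k))
      rest = trans (Σ<-cong (t ℕ.* k) (λ i _ → cong₂ _*_ (δ-shift i) (cong G (sym (ℕₚ.+-suc k i))))) (Σ<-multiples k t (λ m → G (k ℕ.+ m)))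

  -- Restricting to d divisible by k and writing d = k d′ turns n = d m into n/k = d′ m, which is
  -- the substitution q ↦ q^k.
  Λ-δ : ∀ k .{{_ : NonZero k}} (h : ℕ → ℕ → ℤ) → Λ (λ d m → δ k d * h d m) ≈ dil k (Λ (λ d m → h (d ℕ.* k) m))
  Λ-δ k h = pointwise (λ n → ∣-cases k n
    (λ { (divides t refl) → sym (trans (dil-* k (Λ (λ d m → h (d ℕ.* k) m)) t) (sym (begin
      Λ (λ d m → δ k d * h d m) ! (t ℕ.* k)
        ≡⟨ Σ<-cong (t ℕ.* k) (λ i _ → trans (Σ<-cong (t ℕ.* k) (λ j _ → solve 3 (λ m d h → m :* (d :* h) := d :* (m :* h)) refl
            (monoᶜ (suc i ℕ.* suc j) (t ℕ.* k)) (δ k (suc i)) (h (suc i) (suc j))))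
             (Σ<-*ˡ (t ℕ.* k) (δ k (suc i)) (λ j → monoᶜ (suc i ℕ.* suc j) (t ℕ.* k) * h (suc i) (suc j)))) ⟩
      Σ< (t ℕ.* k) (λ i → δ k (suc i) * R t (suc i))
        ≡⟨ Σ<-multiples k t (R t) ⟩
      Σ< t (λ i → R t (suc i ℕ.* k))
        ≡⟨ Σ<-cong t (λ i _ → Σ<-cong (t ℕ.* k) (λ j _ → cong (_* h (suc i ℕ.* k) (suc j)) (scale t i j))) ⟩
      Σ< t (λ i → Σ< (t ℕ.* k) (λ j → monoᶜ (suc i ℕ.* suc j) t * h (suc i ℕ.* k) (suc j)))
        ≡⟨ Λ-at (λ d m → h (d ℕ.* k) m) ℕₚ.≤-refl (ℕₚ.m≤m*n t k) ⟨
      Λ (λ d m → h (d ℕ.* k) m) ! t ∎))) })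
    (λ k∤n → trans (Λ-local n {g = λ _ _ → + 0} (λ d m n≡ → trans (cong (_* h d m)
        (δ-no (λ k∣d → k∤n (subst (k ∣_) (sym n≡) (factorˡ d m k∣d))))) (ℤₚ.*-zeroˡ (h d m))))
      (trans (Σ<-0 n (λ i _ → Σ<-0 n (λ j _ → ℤₚ.*-zeroʳ (monoᶜ (suc i ℕ.* suc j) n)))) (sym (dil-∤ k (Λ (λ d m → h (d ℕ.* k) m)) k∤n)))))
    where
      open ≡-Reasoning
      open +-*-Solver
      R : ℕ → ℕ → ℤ
      R t d = Σ< (t ℕ.* k) (λ j → monoᶜ (d ℕ.* suc j) (t ℕ.* k) * h d (suc j))
      scale : ∀ t i j → monoᶜ (suc i ℕ.* k ℕ.* suc j) (t ℕ.* k) ≡ monoᶜ (suc i ℕ.* suc j) t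
      scale t i j = trans (cong (λ z → monoᶜ z (t ℕ.* k)) (trans (ℕₚ.*-assoc (suc i) k (suc j))
          (trans (cong (suc i ℕ.*_) (ℕₚ.*-comm k (suc j))) (sym (ℕₚ.*-assoc (suc i) (suc j) k)))))
        (trans (sym (at (dil-mono k (suc i ℕ.* suc j)) (t ℕ.* k))) (dil-* k (mono (suc i ℕ.* suc j)) t))

  Λ-δʳ : ∀ k .{{_ : NonZero k}} (h : ℕ → ℕ → ℤ) → Λ (λ d m → δ k m * h d m) ≈ dil k (Λ (λ d m → h d (m ℕ.* k)))
  Λ-δʳ k h = ≈-trans (Λ-flip _) (≈-trans (Λ-δ k (flip h)) (dil-cong k (Λ-flip _)))

  -- For a fixed divisor the complementary one is determined, so the double sum defining `Λ`
  -- collapses to a divisor sum.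
  inner-sum : ∀ n j (g : ℕ → ℤ) → 1 ℕ.≤ n → Σ< n (λ i → monoᶜ (suc i ℕ.* suc j) n * g (suc i)) ≡
      (if ⌊ suc j ∣? n ⌋ then g (n / suc j) else + 0)
  inner-sum n j g 1≤n with suc j ∣? n
  ... | no  j∤n = Σ<-0 n (λ i _ → term-zero (g (suc i)) (λ n≡ → j∤n (divides (suc i) n≡)))
  ... | yes (divides zero refl) = contradiction 1≤n (λ ())
  ... | yes (divides (suc t) refl) = trans
    (Σ<-single _ {λ i → monoᶜ (suc i ℕ.* suc j) n * g (suc i)} t (ℕₚ.m≤m*n (suc t) (suc j))
        (λ i i≢t → term-zero (g (suc i)) (λ n≡ → i≢t (sym (ℕₚ.suc-injective (ℕₚ.*-cancelʳ-≡ (suc t) (suc i) (suc j) n≡))))))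
    (trans (cong (_* g (suc t)) (mono-self (suc t ℕ.* suc j))) (trans (ℤₚ.*-identityˡ (g (suc t)))
        (cong g (sym (m*n/n≡m (suc t) (suc j))))))

  σ-series : (ℕ → ℤ) → (ℕ → ℤ) → PS
  PS.coe (σ-series χ ψ) = σ χ ψ

  σ-Λ : ∀ χ ψ → σ-series χ ψ ≈ Λ (λ d m → ψ m * χ d * + m)
  σ-Λ χ ψ = pointwise λ { zero → refl ; n@(suc n′) → sym (begin
    Λ (λ d m → ψ m * χ d * + m) ! n
      ≡⟨ Σ<-swap n n (λ i j → monoᶜ (suc i ℕ.* suc j) n * (ψ (suc j) * χ (suc i) * + suc j)) ⟩
    Σ< n (λ j → Σ< n (λ i → monoᶜ (suc i ℕ.* suc j) n * (ψ (suc j) * χ (suc i) * + suc j)))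
      ≡⟨ Σ<-cong n (λ j _ → inner-sum n j (λ d → ψ (suc j) * χ d * + suc j) (s≤s z≤n)) ⟩
    Σ< n (λ j → if ⌊ suc j ∣? n ⌋ then ψ (suc j) * χ (n / suc j) * + suc j else + 0)
      ≡⟨ sumℤ-applyUpTo (λ j → if ⌊ suc j ∣? n ⌋ then ψ (suc j) * χ (n / suc j) * + suc j else + 0) id n ⟨
    σ χ ψ n ∎) }
    where open ≡-Reasoning

  χt : ℕ → ℤ
  χt 0 = + 0
  χt 1 = + 1
  χt 4 = + 1
  χt _ = -[1+ 0 ]

  χ₁-residue : ∀ m → χ₁ m ≡ χt (m % 5)
  χ₁-residue m with m % 5
  ... | 0 = refl
  ... | 1 = refl
  ... | 2 = refl
  ... | 3 = refl
  ... | 4 = refl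
  ... | suc (suc (suc (suc (suc _)))) = refl

  χt-* : ∀ (r s : Fin 5) → χt ((toℕ r ℕ.* toℕ s) % 5) ≡ χt (toℕ r) * χt (toℕ s)
  χt-* = from-yes (all? (λ (r : Fin 5) → all? (λ (s : Fin 5) → χt ((toℕ r ℕ.* toℕ s) % 5) ℤ.≟ χt (toℕ r) * χt (toℕ s))))

  χ₁-* : ∀ d m → χ₁ (d ℕ.* m) ≡ χ₁ d * χ₁ m
  χ₁-* d m = begin
    χ₁ (d ℕ.* m)                     ≡⟨ χ₁-residue (d ℕ.* m) ⟩
    χt ((d ℕ.* m) % 5)               ≡⟨ cong χt (%-distribˡ-* d m 5) ⟩
    χt ((d % 5 ℕ.* (m % 5)) % 5)     ≡⟨ cong₂ (λ x y → χt ((x ℕ.* y) % 5)) (sym (toℕ-fromℕ< d<)) (sym (toℕ-fromℕ< m<)) ⟩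
    χt ((toℕ r ℕ.* toℕ r′) % 5)       ≡⟨ χt-* r r′ ⟩
    χt (toℕ r) * χt (toℕ r′)          ≡⟨ cong₂ (λ x y → χt x * χt y) (toℕ-fromℕ< d<) (toℕ-fromℕ< m<) ⟩
    χt (d % 5) * χt (m % 5)          ≡⟨ cong₂ _*_ (χ₁-residue d) (χ₁-residue m) ⟨
    χ₁ d * χ₁ m                      ∎
    where
      open ≡-Reasoning
      d< = m%n<n d 5
      m< = m%n<n m 5
      r = fromℕ< d<
      r′ = fromℕ< m<

  χ₁-∣ : ∀ {m} → 5 ∣ m → χ₁ m ≡ + 0
  χ₁-∣ {m} 5∣m = trans (χ₁-residue m) (cong χt (n∣m⇒m%n≡0 m 5 5∣m))

  χ₁-unit : ∀ {m} → ¬ 5 ∣ m → χ₁ m * χ₁ m ≡ + 1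
  χ₁-unit {m} 5∤m with table (fromℕ< (m%n<n m 5))
    where
      table : ∀ (r : Fin 5) → toℕ r ≡ 0 ⊎ χt (toℕ r) * χt (toℕ r) ≡ + 1
      table = from-yes (all? (λ (r : Fin 5) → (toℕ r ℕ.≟ 0) ⊎-dec (χt (toℕ r) * χt (toℕ r) ℤ.≟ + 1)))
  ... | inj₁ r≡0 = contradiction (m%n≡0⇒n∣m m 5 (trans (sym (toℕ-fromℕ< (m%n<n m 5))) r≡0)) 5∤m
  ... | inj₂ eq  = trans (cong₂ _*_ (χ₁-residue m) (χ₁-residue m)) (subst (λ z → χt z * χt z ≡ + 1) (toℕ-fromℕ< (m%n<n m 5)) eq)

  χ₁-2 : ∀ d → χ₁ (d ℕ.* 2) ≡ -[1+ 0 ] * χ₁ d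
  χ₁-2 d = trans (χ₁-* d 2) (ℤₚ.*-comm (χ₁ d) -[1+ 0 ])

  -- In `F` the character sits on the cofactor n/m, in `E` on the divisor m. The Eisenstein series
  -- belonging to `E` has a nonzero constant term, omitted here; it accounts for the explicit
  -- `κ (+ 1)` in the identities for `E`.
  F E : PS
  F = σ-series χ₁ χ₀
  E = σ-series χ₀ χ₁

  hF hE : ℕ → ℕ → ℤ
  hF d m = χ₁ d * + m
  hE d m = χ₁ m * + m

  F-Λ : F ≈ Λ hF
  F-Λ = ≈-trans (σ-Λ χ₁ χ₀) (Λ-cong (λ d m → cong (_* + m) (ℤₚ.*-identityˡ (χ₁ d))))

  E-Λ : E ≈ Λ hE
  E-Λ = ≈-trans (σ-Λ χ₀ χ₁) (Λ-cong (λ d m → cong (_* + m) (ℤₚ.*-identityʳ (χ₁ m))))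

  sgn-δ : ∀ n → sgn n ≡ + 2 * δ 2 n - + 1
  sgn-δ zero          = refl
  sgn-δ (suc zero)    = refl
  sgn-δ (suc (suc n)) = trans (ℤₚ.neg-involutive (sgn n)) (trans (sgn-δ n) (cong (λ z → + 2 * z - + 1) (sym step)))
    where
      step : δ 2 (2 ℕ.+ n) ≡ δ 2 n
      step with 2 ∣? n
      ... | yes 2∣n = δ-yes (∣m∣n⇒∣m+n ∣-refl 2∣n)
      ... | no  2∤n = δ-no (λ 2∣ → 2∤n (∣m+n∣m⇒∣n 2∣ ∣-refl))

  δ-* : ∀ d m → δ 2 (d ℕ.* m) ≡ δ 2 d + δ 2 m - δ 2 d * δ 2 m
  δ-* d m with 2 ∣? d | 2 ∣? m
  ... | yes 2∣d | yes _   = δ-yes (factorˡ d m 2∣d)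
  ... | yes 2∣d | no  _   = δ-yes (factorˡ d m 2∣d)
  ... | no  _   | yes 2∣m = δ-yes (∣n⇒∣m*n d 2∣m)
  ... | no  2∤d | no  2∤m = δ-no (λ 2∣dm → case (euclidsLemma d m (from-yes (prime? 2)) 2∣dm))
    where
      case : 2 ∣ d ⊎ 2 ∣ m → ⊥
      case (inj₁ p) = 2∤d p
      case (inj₂ p) = 2∤m p

  -- (-1)^(d m) is 2[2 ∣ d m] - 1, and the indicator expands by inclusion and exclusion over 2 ∣ d
  -- and 2 ∣ m.
  alt-Λ : ∀ (h : ℕ → ℕ → ℤ) → alt (Λ h) ≈ κ (+ 2) · dil 2 (Λ (λ d m → h (d ℕ.* 2) m)) ⊕ κ (+ 2) · dil 2 (Λ (λ d m → h d (m ℕ.* 2)))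
                          ⊖ κ (+ 2) · dil 4 (Λ (λ d m → h (d ℕ.* 2) (m ℕ.* 2))) ⊖ Λ h
  alt-Λ h = ≈-trans twisted (≈-trans (Λ-linear (+ 2) (+ 1) (λ d m → δ 2 d * h d m) _) (≈-trans
    (⊕-cong (·-cong ≈-refl (Λ-δ 2 h)) (·-cong ≈-refl (≈-trans (Λ-linear (+ 2) (+ 1) (λ d m → δ 2 m * h d m) _)
      (⊕-cong (·-cong ≈-refl (Λ-δʳ 2 h)) (·-cong ≈-refl (≈-trans (Λ-linear -[1+ 1 ] -[1+ 0 ] (λ d m → δ 2 d * (δ 2 m * h d m)) h)
        (⊕-cong (·-cong ≈-refl (≈-trans (Λ-δ 2 (λ d m → δ 2 m * h d m))
            (≈-trans (dil-cong 2 (Λ-δʳ 2 (λ d m → h (d ℕ.* 2) m))) (dil-dil 2 2 4 refl _)))) ≈-refl)))))))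
    (solve 4 (λ a b c f → con (+ 2) :* a :+ con (+ 1) :* (con (+ 2) :* b :+ con (+ 1) :* (con -[1+ 1 ] :* c :+ con -[1+ 0 ] :* f)) := con
        (+ 2) :* a :+ con (+ 2) :* b :- con (+ 2) :* c :- f) ≈-refl _ _ _ (Λ h))))
    where
      open SeriesSolver
      twisted : alt (Λ h) ≈ Λ (λ d m → + 2 * (δ 2 d * h d m) + + 1 *
          (+ 2 * (δ 2 m * h d m) + + 1 * (-[1+ 1 ] * (δ 2 d * (δ 2 m * h d m)) + -[1+ 0 ] * h d m)))
      twisted = pointwise (λ n → trans (sym (trans (at (Λ-scale (sgn n) h) n) (κ-·-at (sgn n) (Λ h) n)))
        (Λ-local n (λ d m n≡ → trans (cong (_* h d m) (trans (cong sgn n≡)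
            (trans (sgn-δ (d ℕ.* m)) (cong (λ z → + 2 * z - + 1) (δ-* d m)))))
          (Z.solve 3 (λ a b h → (Z.con (+ 2) Z.:* (a Z.:+ b Z.:- a Z.:* b) Z.:- Z.con (+ 1)) Z.:* h Z.:= Z.con (+ 2) Z.:* (a Z.:* h) Z.:+
              Z.con (+ 1) Z.:* (Z.con (+ 2) Z.:* (b Z.:* h) Z.:+ Z.con (+ 1) Z.:*
              (Z.con -[1+ 1 ] Z.:* (a Z.:* (b Z.:* h)) Z.:+ Z.con -[1+ 0 ] Z.:* h))) refl (δ 2 d) (δ 2 m) (h d m)))))
        where module Z = +-*-Solver

  module _ where
    open +-*-Solver

    hF-2ˡ : ∀ d m → hF (d ℕ.* 2) m ≡ -[1+ 0 ] * hF d m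
    hF-2ˡ d m = trans (cong (_* + m) (χ₁-2 d)) (ℤₚ.*-assoc -[1+ 0 ] (χ₁ d) (+ m))

    hF-2ʳ : ∀ d m → hF d (m ℕ.* 2) ≡ + 2 * hF d m
    hF-2ʳ d m = trans (cong (χ₁ d *_) (ℤₚ.pos-* m 2)) (solve 2 (λ a m → a :* (m :* con (+ 2)) := con (+ 2) :* (a :* m)) refl (χ₁ d) (+ m))

    hE-2ʳ : ∀ d m → hE d (m ℕ.* 2) ≡ -[1+ 1 ] * hE d m
    hE-2ʳ d m = trans (cong₂ _*_ (χ₁-2 m) (ℤₚ.pos-* m 2)) (solve 2
        (λ a m → con -[1+ 0 ] :* a :* (m :* con (+ 2)) := con -[1+ 1 ] :* (a :* m)) refl (χ₁ m) (+ m))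

  scaled-Λ : ∀ c {h g : ℕ → ℕ → ℤ} → (∀ d m → g d m ≡ c * h d m) → Λ g ≈ κ c · Λ h
  scaled-Λ c {h} p = ≈-trans (Λ-cong p) (Λ-scale c h)

  alt-F : alt F ≈ κ (+ 2) · dil 2 F ⊕ κ (+ 4) · dil 4 F ⊖ F
  alt-F = ≈-trans (alt-cong F-Λ) (≈-trans (alt-Λ hF) (≈-trans (⊖-cong
      (⊖-cong (⊕-cong (·-cong ≈-refl (d 2 -[1+ 0 ] hF-2ˡ)) (·-cong ≈-refl (d 2 (+ 2) hF-2ʳ)))
      (·-cong ≈-refl (d 4 -[1+ 1 ] (λ d m → trans (hF-2ˡ d (m ℕ.* 2))
          (trans (cong (-[1+ 0 ] *_) (hF-2ʳ d m)) (sym (ℤₚ.*-assoc -[1+ 0 ] (+ 2) (hF d m)))))))) (≈-sym F-Λ))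
    (solve 3 (λ a b f → con (+ 2) :* (con -[1+ 0 ] :* a) :+ con (+ 2) :* (con (+ 2) :* a) :- con (+ 2) :* (con -[1+ 1 ] :* b) :- f := con
        (+ 2) :* a :+ con (+ 4) :* b :- f) ≈-refl (dil 2 F) (dil 4 F) F)))
    where
      open SeriesSolver
      d : ∀ k .{{_ : NonZero k}} c {g : ℕ → ℕ → ℤ} → (∀ d m → g d m ≡ c * hF d m) → dil k (Λ g) ≈ κ c · dil k F
      d k c p = ≈-trans (dil-cong k (≈-trans (scaled-Λ c p) (·-cong ≈-refl (≈-sym F-Λ)))) (dil-κ-· k c F)

  alt-E : alt E ≈ κ (+ 4) · dil 4 E ⊖ κ (+ 2) · dil 2 E ⊖ E
  alt-E = ≈-trans (alt-cong E-Λ) (≈-trans (alt-Λ hE) (≈-trans (⊖-cong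
      (⊖-cong (⊕-cong (·-cong ≈-refl (d 2 (+ 1) (λ d m → sym (ℤₚ.*-identityˡ (hE d m))))) (·-cong ≈-refl (d 2 -[1+ 1 ] hE-2ʳ)))
      (·-cong ≈-refl (d 4 -[1+ 1 ] (λ d m → hE-2ʳ d m)))) (≈-sym E-Λ))
    (solve 3 (λ a b f → con (+ 2) :* (con (+ 1) :* a) :+ con (+ 2) :* (con -[1+ 1 ] :* a) :- con (+ 2) :* (con -[1+ 1 ] :* b) :- f := con
        (+ 4) :* b :- con (+ 2) :* a :- f) ≈-refl (dil 2 E) (dil 4 E) E)))
    where
      open SeriesSolver
      d : ∀ k .{{_ : NonZero k}} c {g : ℕ → ℕ → ℤ} → (∀ d m → g d m ≡ c * hE d m) → dil k (Λ g) ≈ κ c · dil k E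
      d k c p = ≈-trans (dil-cong k (≈-trans (scaled-Λ c p) (·-cong ≈-refl (≈-sym E-Λ)))) (dil-κ-· k c E)

  -- The weight -(-1)^m m is the m-th coefficient of q/(1 + q)², so the left side is the sum of
  -- χ₁(d) `s d`. It equals m for odd m and -m for even m, which costs twice the terms with m even.
  F-4F₂ : Λ (λ d m → χ₁ d * (- sgn m * + m)) ≈ F ⊖ κ (+ 4) · dil 2 F
  F-4F₂ = ≈-trans (Λ-cong (λ d m → trans (cong (λ z → χ₁ d * (- z * + m)) (sgn-δ m))
      (Z.solve 3 (λ a b m → a Z.:* (Z.:- (Z.con (+ 2) Z.:* b Z.:- Z.con (+ 1)) Z.:* m) Z.:= Z.con -[1+ 1 ] Z.:* (b Z.:* (a Z.:* m)) Z.:+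
      Z.con (+ 1) Z.:* (a Z.:* m)) refl (χ₁ d) (δ 2 m) (+ m))))
    (≈-trans (Λ-linear -[1+ 1 ] (+ 1) (λ d m → δ 2 m * hF d m) hF)
        (≈-trans (⊕-cong (·-cong ≈-refl (≈-trans (Λ-δʳ 2 hF) (≈-trans
        (dil-cong 2 (≈-trans (scaled-Λ (+ 2) hF-2ʳ) (·-cong ≈-refl (≈-sym F-Λ)))) (dil-κ-· 2 (+ 2) F)))) (·-cong ≈-refl (≈-sym F-Λ)))
    (solve 2 (λ a f → con -[1+ 1 ] :* (con (+ 2) :* a) :+ con (+ 1) :* f := f :- con (+ 4) :* a) ≈-refl (dil 2 F) F)))
    where
      open SeriesSolver
      module Z = +-*-Solver

  -- χ₁(n) χ₁(d) = χ₁(d)² χ₁(m), and the square is 1 when 5 does not divide n.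
  E-twist : ∀ n → ¬ 5 ∣ n → E ! n ≡ χ₁ n * F ! n
  E-twist n 5∤n = trans (at E-Λ n) (trans (Λ-local n (λ d m n≡ → sym (begin
      χ₁ n * hF d m                       ≡⟨ cong (_* hF d m) (trans (cong χ₁ n≡) (χ₁-* d m)) ⟩
      χ₁ d * χ₁ m * (χ₁ d * + m)          ≡⟨ solve 3 (λ a b m → a :* b :* (a :* m) := a :* a :* (b :* m)) refl (χ₁ d) (χ₁ m) (+ m) ⟩
      χ₁ d * χ₁ d * hE d m                ≡⟨ cong (_* hE d m) (χ₁-unit {d} (λ 5∣d → 5∤n (subst (5 ∣_) (sym n≡) (factorˡ d m 5∣d)))) ⟩
      + 1 * hE d m                        ≡⟨ ℤₚ.*-identityˡ (hE d m) ⟩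
      hE d m                              ∎)))
    (trans (at (Λ-scale (χ₁ n) hF) n) (trans (κ-·-at (χ₁ n) (Λ hF) n) (cong (χ₁ n *_) (sym (at F-Λ n))))))
    where
      open ≡-Reasoning
      open +-*-Solver

  -- A divisor m prime to 5 leaves the factor 5 in the cofactor, and the other divisors are killed
  -- by χ₁.
  E-5 : ∀ n → E ! (n ℕ.* 5) ≡ E ! n
  E-5 n = trans (at E-Λ (n ℕ.* 5)) (trans (Λ-local (n ℕ.* 5) local)
      (trans (at (Λ-δ 5 hE) (n ℕ.* 5)) (trans (dil-* 5 (Λ hE) n) (sym (at E-Λ n)))))
    where
      local : ∀ d m → n ℕ.* 5 ≡ d ℕ.* m → hE d m ≡ δ 5 d * hE d m
      local d m eq with 5 ∣? d
      ... | yes 5∣d = sym (ℤₚ.*-identityˡ (hE d m))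
      ... | no  5∤d with euclidsLemma d m (from-yes (prime? 5)) (divides n (sym eq))
      ...   | inj₁ 5∣d = contradiction 5∣d 5∤d
      ...   | inj₂ 5∣m = trans (cong (_* + m) (χ₁-∣ 5∣m)) (trans (ℤₚ.*-zeroˡ (+ m)) (sym (ℤₚ.*-zeroˡ (hE d m))))

  -- χ₁ is 1 on the residues 1, 4 and -1 on 2, 3 modulo 5. These are exactly the exponents in the
  -- triple products for `T₁` and `T₂`.
  s-sum : ∀ n → Λ (λ d m → χ₁ d * (- sgn m * + m)) ≈[ n ] Moments.S 1 4 1≤ 1≤ n n ⊖ Moments.S 2 3 1≤ 1≤ n n
  s-sum n = modulo (λ k k<n → begin
    Λ (λ d m → χ₁ d * (- sgn m * + m)) ! k
      ≡⟨ by-divisors k ⟩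
    Σ< k (λ i → χ₁ (suc i) * s (suc i) ! k)
      ≡⟨ Σ<-extend k (n ℕ.* 5) (ℕₚ.≤-trans (ℕₚ.<⇒≤ k<n) (ℕₚ.m≤m*n n 5))
          (λ i k≤i → trans (cong (χ₁ (suc i) *_) (s-large k i k≤i)) (ℤₚ.*-zeroʳ (χ₁ (suc i)))) ⟨
    Σ< (n ℕ.* 5) (λ i → χ₁ (suc i) * s (suc i) ! k)
      ≡⟨ blocks n k ⟩
    Σ< n (λ t → s (1 ℕ.+ 5 ℕ.* t) ! k) + Σ< n (λ t → s (4 ℕ.+ 5 ℕ.* t) ! k) -
        (Σ< n (λ t → s (2 ℕ.+ 5 ℕ.* t) ! k) + Σ< n (λ t → s (3 ℕ.+ 5 ℕ.* t) ! k))
      ≡⟨ cong₂ _-_ (cong₂ _+_ (ΣS-at n (λ t → s (1 ℕ.+ 5 ℕ.* t)) k) (ΣS-at n (λ t → s (4 ℕ.+ 5 ℕ.* t)) k))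
          (cong₂ _+_ (ΣS-at n (λ t → s (2 ℕ.+ 5 ℕ.* t)) k) (ΣS-at n (λ t → s (3 ℕ.+ 5 ℕ.* t)) k)) ⟨
    (Moments.S 1 4 1≤ 1≤ n n ⊖ Moments.S 2 3 1≤ 1≤ n n) ! k ∎)
    where
      open ≡-Reasoning
      by-divisors : ∀ k → Λ (λ d m → χ₁ d * (- sgn m * + m)) ! k ≡ Σ< k (λ i → χ₁ (suc i) * s (suc i) ! k)
      by-divisors zero = refl
      by-divisors k@(suc k′) = Σ<-cong k (λ i _ → begin
        Σ< k (λ j → monoᶜ (suc i ℕ.* suc j) k * (χ₁ (suc i) * (- sgn (suc j) * + suc j)))
          ≡⟨ Σ<-cong k (λ j _ → trans (cong (λ z → monoᶜ z k * (χ₁ (suc i) * (- sgn (suc j) * + suc j))) (ℕₚ.*-comm (suc i) (suc j)))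
               (solve 3 (λ m a u → m :* (a :* u) := a :* (m :* u)) refl (monoᶜ (suc j ℕ.* suc i) k) (χ₁ (suc i))
                   (- sgn (suc j) * + suc j))) ⟩
        Σ< k (λ j → χ₁ (suc i) * (monoᶜ (suc j ℕ.* suc i) k * (- sgn (suc j) * + suc j)))
          ≡⟨ Σ<-*ˡ k (χ₁ (suc i)) (λ j → monoᶜ (suc j ℕ.* suc i) k * (- sgn (suc j) * + suc j)) ⟩
        χ₁ (suc i) * Σ< k (λ j → monoᶜ (suc j ℕ.* suc i) k * (- sgn (suc j) * + suc j))
          ≡⟨ cong (χ₁ (suc i) *_) (inner-sum k i (λ m → - sgn m * + m) (s≤s z≤n)) ⟩
        χ₁ (suc i) * s (suc i) ! k ∎)
        where open +-*-Solver
      s-large : ∀ k i → k ℕ.≤ i → s (suc i) ! k ≡ + 0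
      s-large zero    i _   = trans (dil-at-0 (suc i) s₁) refl
      s-large (suc k) i k<i = dil-small (suc i) s₁ (suc k) (s≤s z≤n) (s≤s k<i)
      χ-at : ∀ i t → χ₁ (i ℕ.+ t ℕ.* 5) ≡ χt (i % 5)
      χ-at i t = trans (χ₁-residue (i ℕ.+ t ℕ.* 5)) (cong χt ([m+kn]%n≡m%n i t 5))
      swap5 : ∀ i t → i ℕ.+ t ℕ.* 5 ≡ i ℕ.+ 5 ℕ.* t
      swap5 i t = cong (i ℕ.+_) (ℕₚ.*-comm t 5)
      Σ<-last5 : ∀ n (f : ℕ → ℤ) → Σ< (suc n ℕ.* 5) f ≡ Σ< (n ℕ.* 5) f + f (n ℕ.* 5) + f (1 ℕ.+ n ℕ.* 5) + f (2 ℕ.+ n ℕ.* 5) + f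
          (3 ℕ.+ n ℕ.* 5) + f (4 ℕ.+ n ℕ.* 5)
      Σ<-last5 n f = trans (Σ<-last (4 ℕ.+ n ℕ.* 5) f) (cong (λ z → z + f (4 ℕ.+ n ℕ.* 5))
          (trans (Σ<-last (3 ℕ.+ n ℕ.* 5) f) (cong (λ z → z + f (3 ℕ.+ n ℕ.* 5))
        (trans (Σ<-last (2 ℕ.+ n ℕ.* 5) f) (cong (λ z → z + f (2 ℕ.+ n ℕ.* 5))
            (trans (Σ<-last (1 ℕ.+ n ℕ.* 5) f) (cong (λ z → z + f (1 ℕ.+ n ℕ.* 5)) (Σ<-last (n ℕ.* 5) f))))))))
      blocks : ∀ n k → Σ< (n ℕ.* 5) (λ i → χ₁ (suc i) * s (suc i) ! k) ≡
        Σ< n (λ t → s (1 ℕ.+ 5 ℕ.* t) ! k) + Σ< n (λ t → s (4 ℕ.+ 5 ℕ.* t) ! k) -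
            (Σ< n (λ t → s (2 ℕ.+ 5 ℕ.* t) ! k) + Σ< n (λ t → s (3 ℕ.+ 5 ℕ.* t) ! k))
      blocks zero    k = refl
      blocks (suc n) k = trans (Σ<-last5 n (λ i → χ₁ (suc i) * s (suc i) ! k)) (trans
        (cong₂ _+_ (cong₂ _+_ (cong₂ _+_ (cong₂ _+_ (cong₂ _+_ (blocks n k) (term 1)) (term 2)) (term 3)) (term 4)) (term 5)) (trans
        (solve 9 (λ A B C D a b c d e → A :+ B :- (C :+ D) :+ con (+ 1) :* a :+ con -[1+ 0 ] :* b :+ con -[1+ 0 ] :* c :+ con (+ 1) :* d :+
            con (+ 0) :* e := A :+ a :+ (B :+ d) :- (C :+ b :+ (D :+ c))) refl
          (Σ< n (λ t → s (1 ℕ.+ 5 ℕ.* t) ! k)) (Σ< n (λ t → s (4 ℕ.+ 5 ℕ.* t) ! k)) (Σ< n (λ t → s (2 ℕ.+ 5 ℕ.* t) ! k))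
              (Σ< n (λ t → s (3 ℕ.+ 5 ℕ.* t) ! k))
          (s (1 ℕ.+ 5 ℕ.* n) ! k) (s (2 ℕ.+ 5 ℕ.* n) ! k) (s (3 ℕ.+ 5 ℕ.* n) ! k) (s (4 ℕ.+ 5 ℕ.* n) ! k) (s (5 ℕ.+ 5 ℕ.* n) ! k))
        (sym (cong₂ _-_ (cong₂ _+_ (Σ<-last n (λ t → s (1 ℕ.+ 5 ℕ.* t) ! k)) (Σ<-last n (λ t → s (4 ℕ.+ 5 ℕ.* t) ! k)))
            (cong₂ _+_ (Σ<-last n (λ t → s (2 ℕ.+ 5 ℕ.* t) ! k)) (Σ<-last n (λ t → s (3 ℕ.+ 5 ℕ.* t) ! k)))))))
        where
          open +-*-Solver
          term : ∀ i → χ₁ (i ℕ.+ n ℕ.* 5) * s (i ℕ.+ n ℕ.* 5) ! k ≡ χt (i % 5) * s (i ℕ.+ 5 ℕ.* n) ! k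
          term i = cong₂ _*_ (χ-at i n) (cong (λ z → s z ! k) (swap5 i n))

open Eisenstein

-- The theta product formulas for F and E.

module FiveDissection where

  open import Data.Integer using (_+_; _*_; -_; _-_)
  open import Data.Nat.DivMod using (%-distribˡ-+)
  open import Data.Nat.Induction using (<-rec)

  open SeriesSolver

  w₀ : PS
  w₀ = mon (+ 3 ∷ - + 2 ∷ + 0 ∷ + 0 ∷ + 1 ∷ + 2 ∷ + 0 ∷ + 0 ∷ [])

  -- The difference of second logarithmic derivatives is cleared of its denominator (T₁T₂)². The
  -- result is the left side of `wronskian`, and everything on its right is an eta quotient.
  F-4F₂-product : F ⊖ κ (+ 4) · dil 2 F ≈ q · w₀
  F-4F₂-product = mon-cancel (vZ ⊹ vZ) (begin
    (F ⊖ κ (+ 4) · dil 2 F) · mon (vZ ⊹ vZ)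
      ≈⟨ ·-cong (≈-sym F-4F₂) (≈-trans (≈-sym (mon-· vZ vZ)) (·-cong (≈-sym T₁T₂-mon) (≈-sym T₁T₂-mon))) ⟩
    L · (T₁ · T₂ · (T₁ · T₂))
      ≈⟨ ≈[]-all limit ⟩
    curv 1 4 · (T₂ · T₂) ⊖ curv 2 3 · (T₁ · T₁)
      ≈⟨ wronskian ⟩
    q · (J₁ · J₁) · (th 1 4 sgnℤ · th 2 3 sgnℤ)
      ≈⟨ ·-cong (·-cong ≈-refl J₁²-mon) signed-T₁T₂-mon ⟩
    q · mon _ · mon v15
      ≈⟨ ≈-trans (solve 3 (λ q a b → q :* a :* b := q :* (a :* b)) ≈-refl q _ (mon v15)) (·-cong ≈-refl (mon-· _ v15)) ⟩
    q · mon ((+ 0 ∷ + 0 ∷ + 0 ∷ + 0 ∷ + 6 ∷ + 0 ∷ + 0 ∷ + 0 ∷ []) ⊹ v15)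
      ≈⟨ ·-cong ≈-refl (≈-sym (mon-· _ (vZ ⊹ vZ))) ⟩
    q · (w₀ · mon (vZ ⊹ vZ))
      ≈⟨ solve 3 (λ q a b → q :* (a :* b) := q :* a :* b) ≈-refl q w₀ (mon (vZ ⊹ vZ)) ⟩
    q · w₀ · mon (vZ ⊹ vZ) ∎)
    where
      open ≈-Reasoning
      L : PS
      L = Λ (λ d m → χ₁ d * (- sgn m * + m))
      limit : ∀ n → L · (T₁ · T₂ · (T₁ · T₂)) ≈[ n ] curv 1 4 · (T₂ · T₂) ⊖ curv 2 3 · (T₁ · T₁)
      limit n = ≈[]-trans (·-cong[] (s-sum n) ≈[]-refl) (≈[]-trans (≈⇒≈[] n
          (solve 4 (λ a b x y → (a :- b) :* (x :* y :* (x :* y)) := a :* (x :* x) :* (y :* y) :- b :* (y :* y) :* (x :* x)) ≈-refl S₁ S₂ T₁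
          T₂))
        (⊕-cong[] (·-cong[] (≈[]-sym (Moments.th-curvature 1 4 1≤ 1≤ n)) ≈[]-refl)
            (~-cong[] (·-cong[] (≈[]-sym (Moments.th-curvature 2 3 1≤ 1≤ n)) ≈[]-refl))))
        where
          S₁ = Moments.S 1 4 1≤ 1≤ n n
          S₂ = Moments.S 2 3 1≤ 1≤ n n

  w₀-mon : φ̄ · φ̄₅ · Ȳ ≈ w₀
  w₀-mon = ≈-trans (lift φ̄-mon ⊗ lift φ̄₅-mon ⊗ self) (≈-sym self)

  F-theta-bar : φ̄ · φ̄₅ · (φ̄₅ · φ̄₅ ⊖ φ̄ · φ̄) ≈ κ (+ 4) · (F ⊖ κ (+ 4) · (dil 2 F))
  F-theta-bar = combine (hyp _ Ȳ-identity ∷ hyp _ w₀-mon ∷ hyp _ F-4F₂-product ∷ [])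
      (solve 7 (λ pb pb5 F F2 Yb q w → pb :* pb5 :* (pb5 :* pb5 :- pb :* pb) :- con (+ 4) :* (F :- con (+ 4) :* F2) := :- (pb :* pb5) :*
          (pb :* pb :- (pb5 :* pb5 :- con (+ 4) :* q :* Yb)) :+ (con (+ 4) :* q :* (pb :* pb5 :* Yb :- w) :+
          (con -[1+ 3 ] :* (F :- con (+ 4) :* F2 :- q :* w) :+ con (+ 0)))) ≈-refl φ̄ φ̄₅ F (dil 2 F) Ȳ q w₀)

  -- The substitution q ↦ -q in `F-theta-bar`. The coefficients in `alt-F` come from χ₁(2) = -1.
  F-theta : φ · φ₅ · (φ · φ ⊖ φ₅ · φ₅) ≈ κ (+ 4) · (F ⊕ κ (+ 2) · dil 2 F ⊖ κ (+ 4) · dil 4 F)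
  F-theta = ≈-trans (solve 2 (λ p r → p :* r :* (p :* p :- r :* r) := :- (p :* r :* (r :* r :- p :* p))) ≈-refl φ φ₅) (≈-trans
    (~-cong (≈-trans (≈-sym (≈-trans (alt-· _ _) (·-cong (≈-trans (alt-· _ _) (·-cong (alt-alt φ) alt-φ̄₅))
        (≈-trans (alt-⊖ _ _) (⊖-cong (≈-trans (alt-· _ _) (·-cong alt-φ̄₅ alt-φ̄₅))
        (≈-trans (alt-· _ _) (·-cong (alt-alt φ) (alt-alt φ))))))))
      (≈-trans (alt-cong F-theta-bar) (≈-trans (alt-κ· (+ 4) _) (·-cong ≈-refl
          (≈-trans (alt-⊖ _ _) (⊖-cong alt-F (≈-trans (alt-κ· (+ 4) _) (·-cong ≈-refl (alt-dil2 F))))))))))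
    (solve 3 (λ f f₂ f₄ → :- (con (+ 4) :* (con (+ 2) :* f₂ :+ con (+ 4) :* f₄ :- f :- con (+ 4) :* f₂)) := con (+ 4) :*
        (f :+ con (+ 2) :* f₂ :- con (+ 4) :* f₄)) ≈-refl F (dil 2 F) (dil 4 F)))

  record Supp (r : ℕ) (f : PS) : Set where
    constructor supported
    field off : ∀ n → ¬ n % 5 ≡ r % 5 → f ! n ≡ + 0
  open Supp

  Supp-· : ∀ r t {f g} → Supp r f → Supp t g → Supp (r ℕ.+ t) (f · g)
  Supp-· r t {f} {g} sf sg = supported (λ n n≢ → trans (⊛-sum (PS.coe f) (PS.coe g) n) (Σ<-0 (suc n) (λ { i (s≤s i≤n) → go n n≢ i i≤n })))
    where
      go : ∀ n → ¬ n % 5 ≡ (r ℕ.+ t) % 5 → ∀ i → i ℕ.≤ n → f ! i * g ! (n ℕ.∸ i) ≡ + 0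
      go n n≢ i i≤n with i % 5 ℕ.≟ r % 5
      ... | no  i≢ = trans (cong (_* g ! (n ℕ.∸ i)) (off sf i i≢)) (ℤₚ.*-zeroˡ (g ! (n ℕ.∸ i)))
      ... | yes i≡ with (n ℕ.∸ i) % 5 ℕ.≟ t % 5
      ...   | no  j≢ = trans (cong (f ! i *_) (off sg (n ℕ.∸ i) j≢)) (ℤₚ.*-zeroʳ (f ! i))
      ...   | yes j≡ = contradiction (begin
          n % 5                              ≡⟨ cong (_% 5) (ℕₚ.m+[n∸m]≡n i≤n) ⟨
          (i ℕ.+ (n ℕ.∸ i)) % 5              ≡⟨ %-distribˡ-+ i (n ℕ.∸ i) 5 ⟩
          (i % 5 ℕ.+ (n ℕ.∸ i) % 5) % 5      ≡⟨ cong₂ (λ x y → (x ℕ.+ y) % 5) i≡ j≡ ⟩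
          (r % 5 ℕ.+ t % 5) % 5              ≡⟨ %-distribˡ-+ r t 5 ⟨
          (r ℕ.+ t) % 5                      ∎) n≢
        where open ≡-Reasoning

  Supp-dil : ∀ f → Supp 0 (dil 5 f)
  Supp-dil f = supported (λ n n≢ → dil-∤ 5 f (λ 5∣n → n≢ (n∣m⇒m%n≡0 n 5 5∣n)))

  Supp-mono : ∀ k → Supp k (mono k)
  Supp-mono k = supported (λ n n≢ → mono-other k n (λ { refl → n≢ refl }))

  Supp-κ : ∀ c → Supp 0 (κ c)
  Supp-κ c = supported λ { zero n≢ → contradiction refl n≢ ; (suc n) n≢ → refl }

  Supp-≈ : ∀ {r f g} → f ≈ g → Supp r g → Supp r f
  Supp-≈ p sg = supported (λ n n≢ → trans (at p n) (off sg n n≢))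

  -- The parts of φ in the exponent classes 0, 1 and 4 modulo 5.
  A C D : PS
  A = dil 25 φ
  C = κ (+ 2) · mono 1 · dil 5 β₁
  D = κ (+ 2) · mono 4 · dil 5 β₂

  φ-ACD : φ ≈ A ⊕ C ⊕ D
  φ-ACD = φ-dissection₅

  dil5-φ₅ : dil 5 φ₅ ≈ A
  dil5-φ₅ = dil-dil 5 5 25 refl φ

  -- The identity `φ²` at q⁵: its cross term 4q⁵β₁(q⁵)β₂(q⁵) is exactly C times D, by the splitting
  -- q⁵ = q q⁴.
  φ₅²-ACD : φ₅ · φ₅ ≈ A · A ⊕ C · D
  φ₅²-ACD = ≈-trans (≈-sym (dil-· 5 φ φ)) (≈-trans (dil-cong 5 φ²)
      (≈-trans (dil-⊕ 5 _ _) (⊕-cong (≈-trans (dil-· 5 φ₅ φ₅) (·-cong dil5-φ₅ dil5-φ₅))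
    (≈-trans (dil-· 5 _ _) (≈-trans (·-cong (≈-trans (dil-κ-· 5 (+ 4) q) (·-cong ≈-refl (≈-trans (dil-q 5) (mono-+ 1 4)))) (dil-· 5 β₁ β₂))
      (solve 4 (λ q r x y → con (+ 4) :* (q :* r) :* (x :* y) := con (+ 2) :* q :* x :* (con (+ 2) :* r :* y)) ≈-refl (mono 1) (mono 4)
          (dil 5 β₁) (dil 5 β₂)))))))

  -- Sorted by exponents modulo 5: `U₅` and `V₅` live on the class 0, `P₅` on ±1 and `X₅` on ±2.
  U₅ P₅ X₅ V₅ : PS
  U₅ = κ (+ 5) · (φ₅ · φ₅ · φ₅ · A) ⊖ κ (+ 5) · (φ₅ · (A · A · A))
  P₅ = κ (+ 2) · (φ₅ · φ₅ · φ₅ · (C ⊕ D))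
  X₅ = φ₅ · (κ (+ 3) · (A · C · C) ⊕ D · D · D) ⊕ φ₅ · (κ (+ 3) · (A · D · D) ⊕ C · C · C)
  V₅ = φ₅ · A · (κ (+ 5) · (A · A) ⊖ φ₅ · φ₅)

  u v : PS
  u = φ · φ₅ · (φ · φ ⊖ φ₅ · φ₅)
  v = φ · φ₅ · (κ (+ 5) · (φ₅ · φ₅) ⊖ φ · φ)

  -- In φ³ each occurrence of CD is replaced by φ₅² - A². The classes ±1 then combine to 3φ₅²(C +
  -- D); subtracting φ₅²(C + D) here, or subtracting from 5φ₅²(C + D) in `v-dissection`, leaves the
  -- same multiple 2, while the classes ±2 enter with opposite signs.
  u-dissection : φ · φ₅ · (φ · φ ⊖ φ₅ · φ₅) ≈ κ (+ 5) · (φ₅ · φ₅ · φ₅ · A) ⊖ κ (+ 5) · (φ₅ · (A · A · A)) ⊕ κ (+ 2) ·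
      (φ₅ · φ₅ · φ₅ · (C ⊕ D)) ⊕ (φ₅ · (κ (+ 3) · (A · C · C) ⊕ D · D · D) ⊕ φ₅ · (κ (+ 3) · (A · D · D) ⊕ C · C · C))
  u-dissection = combine (hyp _ φ-ACD ∷ hyp _ φ₅²-ACD ∷ [])
      (solve 5 (λ p p5 A C D → p :* p5 :* (p :* p :- p5 :* p5) :- (con (+ 5) :* (p5 :* p5 :* p5 :* A) :- con (+ 5) :* (p5 :* (A :* A :* A))
          :+ con (+ 2) :* (p5 :* p5 :* p5 :* (C :+ D)) :+ (p5 :* (con (+ 3) :* (A :* C :* C) :+ D :* D :* D) :+ p5 :*
          (con (+ 3) :* (A :* D :* D) :+ C :* C :* C))) := p5 :* (p :* p :+ p :* (A :+ C :+ D) :+ (A :+ C :+ D) :* (A :+ C :+ D) :- p5 :*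
          p5) :* (p :- (A :+ C :+ D)) :+ (:- (p5 :* (con (+ 6) :* A :+ con (+ 3) :* C :+ con (+ 3) :* D)) :*
          (p5 :* p5 :- (A :* A :+ C :* D)) :+ con (+ 0))) ≈-refl φ φ₅ A C D)

  v-dissection : φ · φ₅ · (κ (+ 5) · (φ₅ · φ₅) ⊖ φ · φ) ≈ φ₅ · A · (κ (+ 5) · (A · A) ⊖ φ₅ · φ₅) ⊕ κ (+ 2) · (φ₅ · φ₅ · φ₅ · (C ⊕ D)) ⊖
      (φ₅ · (κ (+ 3) · (A · C · C) ⊕ D · D · D) ⊕ φ₅ · (κ (+ 3) · (A · D · D) ⊕ C · C · C))
  v-dissection = combine (hyp _ φ-ACD ∷ hyp _ φ₅²-ACD ∷ [])
      (solve 5 (λ p p5 A C D → p :* p5 :* (con (+ 5) :* (p5 :* p5) :- p :* p) :-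
          (p5 :* A :* (con (+ 5) :* (A :* A) :- p5 :* p5) :+ con (+ 2) :* (p5 :* p5 :* p5 :* (C :+ D)) :-
          (p5 :* (con (+ 3) :* (A :* C :* C) :+ D :* D :* D) :+ p5 :* (con (+ 3) :* (A :* D :* D) :+ C :* C :* C))) := p5 :*
          (con (+ 5) :* (p5 :* p5) :- (p :* p :+ p :* (A :+ C :+ D) :+ (A :+ C :+ D) :* (A :+ C :+ D))) :* (p :- (A :+ C :+ D)) :+
          (p5 :* (con (+ 6) :* A :+ con (+ 3) :* C :+ con (+ 3) :* D) :* (p5 :* p5 :- (A :* A :+ C :* D)) :+ con (+ 0))) ≈-refl φ φ₅ A C D)

  module _ where
    private
      sφ : Supp 0 φ₅
      sφ = Supp-dil φ
      sA : Supp 0 A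
      sA = Supp-≈ (≈-sym dil5-φ₅) (Supp-dil φ₅)
      sC : Supp 1 C
      sC = Supp-· 1 0 (Supp-· 0 1 (Supp-κ (+ 2)) (Supp-mono 1)) (Supp-dil β₁)
      sD : Supp 4 D
      sD = Supp-· 4 0 (Supp-· 0 4 (Supp-κ (+ 2)) (Supp-mono 4)) (Supp-dil β₂)

      sum-zero : ∀ {a b} → a ≡ + 0 → b ≡ + 0 → a + b ≡ + 0
      sum-zero refl refl = refl

      neg-zero : ∀ {a} → a ≡ + 0 → - a ≡ + 0
      neg-zero refl = refl

    U₅-vanishes : ∀ n → ¬ n % 5 ≡ 0 → U₅ ! n ≡ + 0
    U₅-vanishes n n≢ = sum-zero (off (Supp-· 0 0 (Supp-κ (+ 5)) (Supp-· 0 0 (Supp-· 0 0 (Supp-· 0 0 sφ sφ) sφ) sA)) n n≢)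
      (neg-zero (off (Supp-· 0 0 (Supp-κ (+ 5)) (Supp-· 0 0 sφ (Supp-· 0 0 (Supp-· 0 0 sA sA) sA))) n n≢))

    -- Under q ↦ q⁵ the pair φ, φ₅ becomes φ₅, A, so the class 0 part of v is v itself at q⁵. This
    -- self-similarity is what makes the combination with the coefficient 5 the right companion of
    -- u.
    V₅-dil : V₅ ≈ dil 5 v
    V₅-dil = ≈-sym (≈-trans (dil-· 5 _ _) (·-cong (≈-trans (dil-· 5 _ _) (·-cong ≈-refl dil5-φ₅))
        (≈-trans (dil-⊖ 5 _ _) (⊖-cong (≈-trans (dil-κ-· 5 (+ 5) _) (·-cong ≈-refl (≈-trans (dil-· 5 _ _) (·-cong dil5-φ₅ dil5-φ₅))))
        (dil-· 5 _ _)))))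

    P₅-vanishes : ∀ n → ¬ n % 5 ≡ 1 → ¬ n % 5 ≡ 4 → P₅ ! n ≡ + 0
    P₅-vanishes n n≢1 n≢4 = trans (at (solve 3 (λ f c d → con (+ 2) :* (f :* f :* f :* (c :+ d)) := con (+ 2) :* (f :* f :* f :* c) :+ con
        (+ 2) :* (f :* f :* f :* d)) ≈-refl φ₅ C D) n)
      (sum-zero (off (Supp-· 0 1 (Supp-κ (+ 2)) (Supp-· 0 1 (Supp-· 0 0 (Supp-· 0 0 sφ sφ) sφ) sC)) n n≢1)
                (off (Supp-· 0 4 (Supp-κ (+ 2)) (Supp-· 0 4 (Supp-· 0 0 (Supp-· 0 0 sφ sφ) sφ) sD)) n n≢4))

    X₅-vanishes : ∀ n → ¬ n % 5 ≡ 2 → ¬ n % 5 ≡ 3 → X₅ ! n ≡ + 0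
    X₅-vanishes n n≢2 n≢3 = trans (at (solve 4 (λ f a c d → f :* (con (+ 3) :* (a :* c :* c) :+ d :* d :* d) :+ f :*
        (con (+ 3) :* (a :* d :* d) :+ c :* c :* c) := f :* (con (+ 3) :* (a :* c :* c)) :+ f :* (d :* d :* d) :+
        (f :* (con (+ 3) :* (a :* d :* d)) :+ f :* (c :* c :* c))) ≈-refl φ₅ A C D) n)
      (sum-zero (sum-zero (off (Supp-· 0 2 sφ (Supp-· 0 2 (Supp-κ (+ 3)) (Supp-· 1 1 (Supp-· 0 1 sA sC) sC))) n n≢2)
          (off (Supp-· 0 12 sφ (Supp-· 8 4 (Supp-· 4 4 sD sD) sD)) n n≢2))
                (sum-zero (off (Supp-· 0 8 sφ (Supp-· 0 8 (Supp-κ (+ 3)) (Supp-· 4 4 (Supp-· 0 4 sA sD) sD))) n n≢3)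
                    (off (Supp-· 0 3 sφ (Supp-· 2 1 (Supp-· 1 1 sC sC) sC)) n n≢3)))

    u-at : ∀ n → u ! n ≡ U₅ ! n + P₅ ! n + X₅ ! n
    u-at n = at u-dissection n

    v-at : ∀ n → v ! n ≡ V₅ ! n + P₅ ! n - X₅ ! n
    v-at n = at v-dissection n

    v-5 : ∀ n → v ! (n ℕ.* 5) ≡ v ! n
    v-5 n = trans (v-at (n ℕ.* 5)) (trans (cong₂ _-_ (cong₂ _+_ (trans (at V₅-dil (n ℕ.* 5)) (dil-* 5 v n))
        (P₅-vanishes (n ℕ.* 5) (0≢ 1) (0≢ 4))) (X₅-vanishes (n ℕ.* 5) (0≢ 2) (0≢ 3)))
      (trans (ℤₚ.+-identityʳ _) (ℤₚ.+-identityʳ _)))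
      where
        0≢ : ∀ k .{{_ : NonZero k}} → ¬ (n ℕ.* 5) % 5 ≡ k
        0≢ (suc k) eq = contradiction (trans (sym (n∣m⇒m%n≡0 (n ℕ.* 5) 5 (divides n refl))) eq) (λ ())

    -- P₅ lives on the residues ±1, where χ₁ = 1, and X₅ on the residues ±2, where χ₁ = -1.
    v-twist : ∀ n → ¬ 5 ∣ n → v ! n ≡ χ₁ n * u ! n
    v-twist n 5∤n = go (n % 5) refl (m%n<n n 5)
      where
        n≢0 : ¬ n % 5 ≡ 0
        n≢0 = 5∤n ∘ m%n≡0⇒n∣m n 5
        U0 = U₅-vanishes n n≢0
        V0 = trans (at V₅-dil n) (dil-∤ 5 v 5∤n)
        other : ∀ {r k} → n % 5 ≡ r → ¬ r ≡ k → ¬ n % 5 ≡ k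
        other p r≢k eq = r≢k (trans (sym p) eq)
        plus : X₅ ! n ≡ + 0 → χ₁ n ≡ + 1 → v ! n ≡ χ₁ n * u ! n
        plus X0 χ≡ = trans (v-at n) (trans (cong₂ (λ a b → a + P₅ ! n - b) V0 X0)
            (trans (solve′ (P₅ ! n)) (sym (cong₂ _*_ χ≡ (trans (u-at n) (cong₂ (λ a b → a + P₅ ! n + b) U0 X0))))))
          where
            module Z = +-*-Solver
            solve′ : ∀ p → + 0 + p - + 0 ≡ + 1 * (+ 0 + p + + 0)
            solve′ = Z.solve 1 (λ p → Z.con (+ 0) Z.:+ p Z.:- Z.con (+ 0) Z.:= Z.con (+ 1) Z.:* (Z.con (+ 0) Z.:+ p Z.:+ Z.con (+ 0))) refl
        minus : P₅ ! n ≡ + 0 → χ₁ n ≡ -[1+ 0 ] → v ! n ≡ χ₁ n * u ! n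
        minus P0 χ≡ = trans (v-at n) (trans (cong₂ (λ a b → a + b - X₅ ! n) V0 P0)
            (trans (solve′ (X₅ ! n)) (sym (cong₂ _*_ χ≡ (trans (u-at n) (cong₂ (λ a b → a + b + X₅ ! n) U0 P0))))))
          where
            module Z = +-*-Solver
            solve′ : ∀ x → + 0 + + 0 - x ≡ -[1+ 0 ] * (+ 0 + + 0 + x)
            solve′ = Z.solve 1 (λ x → Z.con (+ 0) Z.:+ Z.con (+ 0) Z.:- x Z.:= Z.con -[1+ 0 ] Z.:* (Z.con (+ 0) Z.:+ Z.con (+ 0) Z.:+ x))
                refl
        χ≡ : ∀ {r} → n % 5 ≡ r → χ₁ n ≡ χt r
        χ≡ p = trans (χ₁-residue n) (cong χt p)
        go : ∀ r → n % 5 ≡ r → r ℕ.< 5 → v ! n ≡ χ₁ n * u ! n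
        go 0 p _ = contradiction p n≢0
        go 1 p _ = plus (X₅-vanishes n (other p (λ ())) (other p (λ ()))) (χ≡ p)
        go 2 p _ = minus (P₅-vanishes n (other p (λ ())) (other p (λ ()))) (χ≡ p)
        go 3 p _ = minus (P₅-vanishes n (other p (λ ())) (other p (λ ()))) (χ≡ p)
        go 4 p _ = plus (X₅-vanishes n (other p (λ ())) (other p (λ ()))) (χ≡ p)
        go (suc (suc (suc (suc (suc r))))) p (s≤s (s≤s (s≤s (s≤s (s≤s ())))))

  RE : PS
  RE = κ (+ 4) · (κ (+ 1) ⊕ E ⊖ κ (+ 2) · dil 2 E ⊖ κ (+ 4) · dil 4 E)

  RE-at : ∀ n → RE ! n ≡ + 4 * (κ (+ 1) ! n + E ! n - + 2 * dil 2 E ! n - + 4 * dil 4 E ! n)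
  RE-at n = trans (κ-·-at (+ 4) (κ (+ 1) ⊕ E ⊖ κ (+ 2) · dil 2 E ⊖ κ (+ 4) · dil 4 E) n)
      (cong (+ 4 *_) (cong₂ _-_ (cong (λ z → κ (+ 1) ! n + E ! n - z) (κ-·-at (+ 2) (dil 2 E) n)) (κ-·-at (+ 4) (dil 4 E) n)))

  dil-E-5 : ∀ k .{{_ : NonZero k}} → (∀ m → k ∣ m ℕ.* 5 → k ∣ m) → ∀ m → dil k E ! (m ℕ.* 5) ≡ dil k E ! m
  dil-E-5 k coprime m = ∣-cases k m
    (λ { (divides t refl) → trans (cong (dil k E !_) (trans (ℕₚ.*-assoc t k 5)
        (trans (cong (t ℕ.*_) (ℕₚ.*-comm k 5)) (sym (ℕₚ.*-assoc t 5 k)))))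
        (trans (dil-* k E (t ℕ.* 5)) (trans (E-5 t) (sym (dil-* k E t)))) })
    (λ k∤m → trans (dil-∤ k E (k∤m ∘ coprime m)) (sym (dil-∤ k E k∤m)))

  coprime-2 : ∀ m → 2 ∣ m ℕ.* 5 → 2 ∣ m
  coprime-2 m 2∣ with euclidsLemma m 5 (from-yes (prime? 2)) 2∣
  ... | inj₁ 2∣m = 2∣m
  ... | inj₂ 2∣5 = contradiction (n∣m⇒m%n≡0 5 2 2∣5) (λ ())

  coprime-4 : ∀ m → 4 ∣ m ℕ.* 5 → 4 ∣ m
  coprime-4 m 4∣ = ∣m+n∣m⇒∣n (subst (4 ∣_) (solveℕ m) 4∣) (divides m refl)
    where
      solveℕ : ∀ m → m ℕ.* 5 ≡ m ℕ.* 4 ℕ.+ m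
      solveℕ = ℕ-Solver.solve 1 (λ m → m ℕ-Solver.:* ℕ-Solver.con 5 ℕ-Solver.:= m ℕ-Solver.:* ℕ-Solver.con 4 ℕ-Solver.:+ m) refl

  -- With n = t k the character splits as χ₁(t) χ₁(k), and χ₁(t) turns F into E. The values χ₁(2) =
  -- -1 and χ₁(4) = 1 explain the different signs in the formulas for F and E.
  dil-F-twist : ∀ k .{{_ : NonZero k}} n → ¬ 5 ∣ n → χ₁ n * dil k F ! n ≡ χ₁ k * dil k E ! n
  dil-F-twist k n 5∤n = ∣-cases k n
    (λ { (divides t refl) → let 5∤t = λ 5∣t → 5∤n (factorˡ t k 5∣t) in begin
      χ₁ (t ℕ.* k) * dil k F ! (t ℕ.* k)   ≡⟨ cong₂ _*_ (χ₁-* t k) (dil-* k F t) ⟩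
      χ₁ t * χ₁ k * F ! t                  ≡⟨ Z.solve 3 (λ a b c → a Z.:* b Z.:* c Z.:= b Z.:* (a Z.:* c)) refl (χ₁ t) (χ₁ k) (F ! t) ⟩
      χ₁ k * (χ₁ t * F ! t)                ≡⟨ cong (χ₁ k *_) (E-twist t 5∤t) ⟨
      χ₁ k * E ! t                         ≡⟨ cong (χ₁ k *_) (dil-* k E t) ⟨
      χ₁ k * dil k E ! (t ℕ.* k)           ∎ })
    (λ k∤n → trans (trans (cong (χ₁ n *_) (dil-∤ k F k∤n)) (ℤₚ.*-zeroʳ (χ₁ n)))
        (sym (trans (cong (χ₁ k *_) (dil-∤ k E k∤n)) (ℤₚ.*-zeroʳ (χ₁ k)))))
    where
      open ≡-Reasoning
      module Z = +-*-Solver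

  -- Strong induction on n. At a multiple of 5 both sides repeat their value at n/5, by `v-5` and
  -- `E-5`; elsewhere both are the χ₁-twist of `F-theta`.
  E-theta-at : ∀ n → v ! n ≡ RE ! n
  E-theta-at = <-rec (λ n → v ! n ≡ RE ! n) step
    where
      κ-pos : ∀ {n} → ¬ 5 ∣ n → κ (+ 1) ! n ≡ + 0
      κ-pos {zero}  5∤0 = contradiction (divides 0 refl) 5∤0
      κ-pos {suc n} _   = refl
      multiple : ∀ n → (∀ {m} → m ℕ.< n → v ! m ≡ RE ! m) → 5 ∣ n → v ! n ≡ RE ! n
      -- The base n = 0: both constant terms compute to 4.
      multiple _ ih (divides zero refl) = refl
      multiple _ ih (divides (suc m) refl) = trans (v-5 (suc m)) (trans (ih (ℕₚ.m<m*n (suc m) 5 (s≤s (s≤s z≤n))))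
          (trans (RE-at (suc m)) (sym (trans (RE-at (suc m ℕ.* 5))
          (cong (+ 4 *_) (cong₂ _-_ (cong₂ (λ a b → κ (+ 1) ! suc m + a - + 2 * b) (E-5 (suc m)) (dil-E-5 2 coprime-2 (suc m)))
              (cong (+ 4 *_) (dil-E-5 4 coprime-4 (suc m)))))))))
      step : ∀ n → (∀ {m} → m ℕ.< n → v ! m ≡ RE ! m) → v ! n ≡ RE ! n
      unit : ∀ n → ¬ 5 ∣ n → v ! n ≡ RE ! n
      step n ih = ∣-cases 5 n (multiple n ih) (unit n)
      unit n 5∤n = begin
        v ! n
          ≡⟨ v-twist n 5∤n ⟩
        χ₁ n * u ! n
          ≡⟨ cong (χ₁ n *_) (trans (at F-theta n) (trans (κ-·-at (+ 4) (F ⊕ κ (+ 2) · dil 2 F ⊖ κ (+ 4) · dil 4 F) n)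
              (cong (+ 4 *_) (cong₂ _-_ (cong (λ z → F ! n + z) (κ-·-at (+ 2) (dil 2 F) n)) (κ-·-at (+ 4) (dil 4 F) n))))) ⟩
        χ₁ n * (+ 4 * (F ! n + + 2 * dil 2 F ! n - + 4 * dil 4 F ! n))
          ≡⟨ Z.solve 4 (λ x f g h → x Z.:* (Z.con (+ 4) Z.:* (f Z.:+ Z.con (+ 2) Z.:* g Z.:- Z.con (+ 4) Z.:* h)) Z.:= Z.con (+ 4) Z.:*
              (x Z.:* f Z.:+ Z.con (+ 2) Z.:* (x Z.:* g) Z.:- Z.con (+ 4) Z.:* (x Z.:* h))) refl (χ₁ n) (F ! n) (dil 2 F ! n) (dil 4 F ! n)
              ⟩
        + 4 * (χ₁ n * F ! n + + 2 * (χ₁ n * dil 2 F ! n) - + 4 * (χ₁ n * dil 4 F ! n))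
          ≡⟨ cong (+ 4 *_) (cong₂ _-_ (cong₂ (λ a b → a + + 2 * b) (sym (E-twist n 5∤n)) (dil-F-twist 2 n 5∤n))
              (cong (+ 4 *_) (dil-F-twist 4 n 5∤n))) ⟩
        + 4 * (E ! n + + 2 * (-[1+ 0 ] * dil 2 E ! n) - + 4 * (+ 1 * dil 4 E ! n))
          ≡⟨ Z.solve 3 (λ f g h → Z.con (+ 4) Z.:* (f Z.:+ Z.con (+ 2) Z.:* (Z.con -[1+ 0 ] Z.:* g) Z.:- Z.con (+ 4) Z.:*
              (Z.con (+ 1) Z.:* h)) Z.:= Z.con (+ 4) Z.:* (Z.con (+ 0) Z.:+ f Z.:- Z.con (+ 2) Z.:* g Z.:- Z.con (+ 4) Z.:* h)) refl
              (E ! n) (dil 2 E ! n) (dil 4 E ! n) ⟩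
        + 4 * (+ 0 + E ! n - + 2 * dil 2 E ! n - + 4 * dil 4 E ! n)
          ≡⟨ cong (λ z → + 4 * (z + E ! n - + 2 * dil 2 E ! n - + 4 * dil 4 E ! n)) (κ-pos 5∤n) ⟨
        + 4 * (κ (+ 1) ! n + E ! n - + 2 * dil 2 E ! n - + 4 * dil 4 E ! n)
          ≡⟨ RE-at n ⟨
        RE ! n ∎
        where
          open ≡-Reasoning
          module Z = +-*-Solver

  E-theta : φ · φ₅ · (κ (+ 5) · (φ₅ · φ₅) ⊖ φ · φ) ≈ κ (+ 4) · (κ (+ 1) ⊕ E ⊖ κ (+ 2) · dil 2 E ⊖ κ (+ 4) · dil 4 E)
  E-theta = pointwise E-theta-at

open FiveDissection

-- The six products of theta series in terms of E, F and the cusp forms.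

module RepresentationSeries where

  open import Data.Integer using (-_)

  open SeriesSolver

  w₂ z₀ z₂ : PS
  w₂ = mon (+ 0 ∷ + 3 ∷ - + 2 ∷ + 0 ∷ + 0 ∷ + 1 ∷ + 2 ∷ + 0 ∷ [])
  z₀ = mon (+ 1 ∷ + 2 ∷ + 0 ∷ + 0 ∷ + 3 ∷ - + 2 ∷ + 0 ∷ + 0 ∷ [])
  z₂ = mon (+ 0 ∷ + 1 ∷ + 2 ∷ + 0 ∷ + 0 ∷ + 3 ∷ - + 2 ∷ + 0 ∷ [])

  D·Y : Dη · Y ≈ w₂
  D·Y = ≈-trans (self ⊗ self) (≈-sym self)

  S·V : Sη · V ≈ z₂
  S·V = ≈-trans (self ⊗ self) (≈-sym self)

  z₀-mon : φ̄ · φ̄₅ · V̄ ≈ z₀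
  z₀-mon = ≈-trans (lift φ̄-mon ⊗ lift φ̄₅-mon ⊗ self) (≈-sym self)

  F₂-4F₄ : dil 2 F ⊖ κ (+ 4) · dil 4 F ≈ q · q · w₂
  F₂-4F₄ = ≈-trans (≈-sym (≈-trans (dil-⊖ 2 _ _) (⊖-cong ≈-refl (≈-trans (dil-κ-· 2 (+ 4) _) (·-cong ≈-refl (dil-dil 2 2 4 refl F))))))
    (≈-trans (dil-cong 2 F-4F₂-product) (≈-trans (dil-· 2 _ _) (·-cong (≈-trans (dil-q 2) q^2)
        (dil2-mon (+ 3) (- + 2) (+ 0) (+ 1) (+ 2) (+ 0)))))

  alt-5φ₅² : alt (κ (+ 5) · (φ₅ · φ₅) ⊖ φ · φ) ≈ κ (+ 5) · (φ̄₅ · φ̄₅) ⊖ φ̄ · φ̄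
  alt-5φ₅² = ≈-trans (alt-⊖ _ _) (⊖-cong (≈-trans (alt-κ· (+ 5) _) (·-cong ≈-refl (≈-trans (alt-· _ _) (·-cong alt-φ₅ alt-φ₅))))
      (alt-· _ _))

  alt-dil4 : ∀ f → alt (dil 4 f) ≈ dil 4 f
  alt-dil4 = alt-dil-even 2 4 refl

  E-theta-bar : φ̄ · φ̄₅ · (κ (+ 5) · (φ̄₅ · φ̄₅) ⊖ φ̄ · φ̄) ≈ κ (+ 4) · (κ (+ 1) ⊖ E ⊖ κ (+ 4) · dil 2 E)
  E-theta-bar = ≈-trans (≈-sym (≈-trans (alt-· _ _) (·-cong (≈-trans (alt-· _ _) (·-cong ≈-refl alt-φ₅)) alt-5φ₅²)))
      (≈-trans (alt-cong E-theta) (≈-trans (alt-κ· (+ 4) _) (≈-trans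
    (·-cong ≈-refl (≈-trans (alt-⊖ _ _) (⊖-cong (≈-trans (alt-⊖ _ _)
        (⊖-cong (≈-trans (alt-⊕ _ _) (⊕-cong (alt-κ (+ 1)) alt-E)) (≈-trans (alt-κ· (+ 2) _) (·-cong ≈-refl (alt-dil2 E)))))
        (≈-trans (alt-κ· (+ 4) _) (·-cong ≈-refl (alt-dil4 E))))))
    (solve 3 (λ e f g → con (+ 4) :* (con (+ 1) :+ (con (+ 4) :* g :- con (+ 2) :* f :- e) :- con (+ 2) :* f :- con (+ 4) :* g) := con
        (+ 4) :* (con (+ 1) :- e :- con (+ 4) :* f)) ≈-refl E (dil 2 E) (dil 4 E)))))

  -- By `V̄-identity` the left side of `E-theta-bar` is 4 times the eta quotient `z₀`; the
  -- substitution q ↦ q² gives `z₂`.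
  E₂-product : κ (+ 1) ⊖ dil 2 E ⊖ κ (+ 4) · dil 4 E ≈ z₂
  E₂-product = ≈-trans (≈-sym (≈-trans (dil-⊖ 2 _ _) (⊖-cong (≈-trans (dil-⊖ 2 _ _) (⊖-cong (dil-κ 2 (+ 1)) ≈-refl))
      (≈-trans (dil-κ-· 2 (+ 4) _) (·-cong ≈-refl (dil-dil 2 2 4 refl E))))))
    (≈-trans (dil-cong 2 (κ-cancelˡ (+ 4) (λ ()) (combine (hyp _ E-theta-bar ∷ hyp _ V̄-identity ∷ hyp _ z₀-mon ∷ [])
        (solve 6 (λ E E2 z pb pb5 Vb → con (+ 4) :* (con (+ 1) :- E :- con (+ 4) :* E2) :- con (+ 4) :* z := con -[1+ 0 ] :*
            (pb :* pb5 :* (con (+ 5) :* (pb5 :* pb5) :- pb :* pb) :- con (+ 4) :* (con (+ 1) :- E :- con (+ 4) :* E2)) :+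
            (pb :* pb5 :* (con (+ 5) :* (pb5 :* pb5) :- pb :* pb :- con (+ 4) :* Vb) :+
            (con (+ 4) :* (pb :* pb5 :* Vb :- z) :+ con (+ 0)))) ≈-refl E (dil 2 E) z₀ φ̄ φ̄₅ V̄))))
            (dil2-mon (+ 1) (+ 2) (+ 0) (+ 3) (- + 2) (+ 0)))

  -- `G` is φφ₅ - 2q `Dη`. The first part is `F-theta`, and q `Dη` times φ² - φ₅² is the single eta
  -- quotient 4q² `w₂`, already known as 4(F(q²) - 4F(q⁴)).
  F-theta-G : G · (φ · φ ⊖ φ₅ · φ₅) ≈ κ (+ 4) · (F ⊕ κ (+ 4) · (dil 4 F))
  F-theta-G = combine (hyp _ G-eta ∷ hyp _ φφ₅ ∷ hyp _ F-theta ∷ hyp _ Y-identity ∷ hyp _ D·Y ∷ hyp _ F₂-4F₄ ∷ [])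
      (solve 11 (λ G p p5 F F4 S q D0 F2 Y w2 → G :* (p :* p :- p5 :* p5) :- con (+ 4) :* (F :+ con (+ 4) :* F4) := (p :* p :- p5 :* p5) :*
          (G :- (S :- q :* D0)) :+ (:- (p :* p :- p5 :* p5) :* (p :* p5 :- (S :+ q :* D0)) :+
          (con (+ 1) :* (p :* p5 :* (p :* p :- p5 :* p5) :- con (+ 4) :* (F :+ con (+ 2) :* F2 :- con (+ 4) :* F4)) :+
          (:- (con (+ 2) :* q :* D0) :* (p :* p :- (p5 :* p5 :+ con (+ 4) :* q :* Y)) :+
          (:- (con (+ 8) :* q :* q) :* (D0 :* Y :- w2) :+ (con (+ 8) :* (F2 :- con (+ 4) :* F4 :- q :* q :* w2) :+ con (+ 0))))))) ≈-refl G
          φ φ₅ F (dil 4 F) Sη q Dη (dil 2 F) Y w₂)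

  -- Here `G` is written as 2 `Sη` - φφ₅, since `Sη` times `V` is the eta quotient `z₂` evaluated by
  -- `E₂-product`.
  E-theta-G : G · (κ (+ 5) · (φ₅ · φ₅) ⊖ φ · φ) ≈ κ (+ 4) · (κ (+ 1) ⊖ E ⊖ κ (+ 4) · (dil 4 E))
  E-theta-G = combine (hyp _ G-eta ∷ hyp _ φφ₅ ∷ hyp _ E-theta ∷ hyp _ V-identity ∷ hyp _ S·V ∷ hyp _ E₂-product ∷ [])
      (solve 11 (λ G p p5 E E4 S q D0 E2 V z2 → G :* (con (+ 5) :* (p5 :* p5) :- p :* p) :- con (+ 4) :*
          (con (+ 1) :- E :- con (+ 4) :* E4) := (con (+ 5) :* (p5 :* p5) :- p :* p) :* (G :- (S :- q :* D0)) :+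
          ((con (+ 5) :* (p5 :* p5) :- p :* p) :* (p :* p5 :- (S :+ q :* D0)) :+
          (con -[1+ 0 ] :* (p :* p5 :* (con (+ 5) :* (p5 :* p5) :- p :* p) :- con (+ 4) :*
          (con (+ 1) :+ E :- con (+ 2) :* E2 :- con (+ 4) :* E4)) :+ (con (+ 2) :* S :*
          (con (+ 5) :* (p5 :* p5) :- p :* p :- con (+ 4) :* V) :+ (con (+ 8) :* (S :* V :- z2) :+
          (con -[1+ 7 ] :* (con (+ 1) :- E2 :- con (+ 4) :* E4 :- z2) :+ con (+ 0))))))) ≈-refl G φ φ₅ E (dil 4 E) Sη q Dη (dil 2 E) V z₂)

  alt-φ²-φ₅² : alt (φ · φ ⊖ φ₅ · φ₅) ≈ φ̄ · φ̄ ⊖ φ̄₅ · φ̄₅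
  alt-φ²-φ₅² = ≈-trans (alt-⊖ _ _) (⊖-cong (alt-· _ _) (≈-trans (alt-· _ _) (·-cong alt-φ₅ alt-φ₅)))

  F-theta-G-bar : (φ₂ · φ₁₀ ⊖ q · q · q · (Ψ₄ · Ψ₂₀)) · (φ̄ · φ̄ ⊖ φ̄₅ · φ̄₅) ≈ κ (+ 4) ·
      (κ (+ 2) · dil 2 F ⊕ κ (+ 4) · dil 4 F ⊖ F ⊕ κ (+ 4) · dil 4 F)
  F-theta-G-bar = ≈-trans (≈-sym (≈-trans (alt-· _ _) (·-cong alt-G alt-φ²-φ₅²))) (≈-trans (alt-cong F-theta-G) (≈-trans (alt-κ· (+ 4) _)
    (·-cong ≈-refl (≈-trans (alt-⊕ _ _) (⊕-cong alt-F (≈-trans (alt-κ· (+ 4) _) (·-cong ≈-refl (alt-dil4 F))))))))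

  E-theta-G-bar : (φ₂ · φ₁₀ ⊖ q · q · q · (Ψ₄ · Ψ₂₀)) · (κ (+ 5) · (φ̄₅ · φ̄₅) ⊖ φ̄ · φ̄) ≈ κ (+ 4) ·
      (κ (+ 1) ⊖ (κ (+ 4) · dil 4 E ⊖ κ (+ 2) · dil 2 E ⊖ E) ⊖ κ (+ 4) · dil 4 E)
  E-theta-G-bar = ≈-trans (≈-sym (≈-trans (alt-· _ _) (·-cong alt-G alt-5φ₅²))) (≈-trans (alt-cong E-theta-G) (≈-trans (alt-κ· (+ 4) _)
    (·-cong ≈-refl (≈-trans (alt-⊖ _ _) (⊖-cong (≈-trans (alt-⊖ _ _) (⊖-cong (alt-κ (+ 1)) alt-E))
        (≈-trans (alt-κ· (+ 4) _) (·-cong ≈-refl (alt-dil4 E))))))))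

  X₁ X₂ R : PS
  X₁ = q · (Ψ₄ · Ψ₄ · (φ₂ · φ₁₀))
  X₂ = q · q · (q · q) · q · (Ψ₂₀ · Ψ₂₀ · (φ₂ · φ₁₀))
  R  = q · q · q · (Ψ₄ · Ψ₂₀)

  -- Half the difference of `F-theta-G` and its image under q ↦ -q. The surviving terms pair the odd
  -- part of φ² or φ₅² with the even part of `G`, or conversely.
  F-odd : κ (+ 4) · (F ⊖ dil 2 F ⊖ κ (+ 2) · dil 4 F) ≈ X₁ ⊖ X₂ ⊕ R · (φ₂ · φ₂ ⊖ φ₁₀ · φ₁₀)
  F-odd = κ-cancelˡ (+ 2) (λ ()) (combine (hyp _ F-theta-G ∷ hyp _ F-theta-G-bar ∷ hyp _ φ²-dissection ∷ hyp _ φ₅²-dissection′ ∷ hyp _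
      φ̄²-dissection ∷ hyp _ φ̄₅²-dissection′ ∷ [])
        (solve 12 (λ F F2 F4 q s4 s20 p2 p10 p p5 pb pb5 → con (+ 2) :* (con (+ 4) :* (F :- F2 :- con (+ 2) :* F4)) :- con (+ 2) :*
            (q :* (s4 :* s4 :* (p2 :* p10)) :- q :* q :* (q :* q) :* q :* (s20 :* s20 :* (p2 :* p10)) :+ q :* q :* q :* (s4 :* s20) :*
            (p2 :* p2 :- p10 :* p10)) := con -[1+ 0 ] :* ((p2 :* p10 :+ q :* q :* q :* (s4 :* s20)) :* (p :* p :- p5 :* p5) :- con (+ 4) :*
            (F :+ con (+ 4) :* F4)) :+ (con (+ 1) :* ((p2 :* p10 :- q :* q :* q :* (s4 :* s20)) :* (pb :* pb :- pb5 :* pb5) :- con (+ 4) :*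
            (con (+ 2) :* F2 :+ con (+ 4) :* F4 :- F :+ con (+ 4) :* F4)) :+
            ((p2 :* p10 :+ q :* q :* q :* (s4 :* s20)) :* (p :* p :- (p2 :* p2 :+ q :* (s4 :* s4))) :+
            (:- (p2 :* p10 :+ q :* q :* q :* (s4 :* s20)) :* (p5 :* p5 :- (p10 :* p10 :+ q :* q :* (q :* q) :* q :* (s20 :* s20))) :+
            (:- (p2 :* p10 :- q :* q :* q :* (s4 :* s20)) :* (pb :* pb :- (p2 :* p2 :- q :* (s4 :* s4))) :+
            ((p2 :* p10 :- q :* q :* q :* (s4 :* s20)) :* (pb5 :* pb5 :- (p10 :* p10 :- q :* q :* (q :* q) :* q :* (s20 :* s20))) :+ con
            (+ 0))))))) ≈-refl F (dil 2 F) (dil 4 F) q Ψ₄ Ψ₂₀ φ₂ φ₁₀ φ φ₅ φ̄ φ̄₅))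

  E-odd : κ (+ 4) · (E ⊕ dil 2 E ⊖ κ (+ 2) · dil 4 E) ≈ X₁ ⊖ κ (+ 5) · X₂ ⊖ R · (κ (+ 5) · (φ₁₀ · φ₁₀) ⊖ φ₂ · φ₂)
  E-odd = κ-cancelˡ (+ 2) (λ ()) (combine (hyp _ E-theta-G ∷ hyp _ E-theta-G-bar ∷ hyp _ φ²-dissection ∷ hyp _ φ₅²-dissection′ ∷ hyp _
      φ̄²-dissection ∷ hyp _ φ̄₅²-dissection′ ∷ [])
        (solve 12 (λ E E2 E4 q s4 s20 p2 p10 p p5 pb pb5 → con (+ 2) :* (con (+ 4) :* (E :+ E2 :- con (+ 2) :* E4)) :- con (+ 2) :*
            (q :* (s4 :* s4 :* (p2 :* p10)) :- con (+ 5) :* (q :* q :* (q :* q) :* q :* (s20 :* s20 :* (p2 :* p10))) :- q :* q :* q :*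
            (s4 :* s20) :* (con (+ 5) :* (p10 :* p10) :- p2 :* p2)) := con (+ 1) :*
            ((p2 :* p10 :+ q :* q :* q :* (s4 :* s20)) :* (con (+ 5) :* (p5 :* p5) :- p :* p) :- con (+ 4) :*
            (con (+ 1) :- E :- con (+ 4) :* E4)) :+ (con -[1+ 0 ] :* ((p2 :* p10 :- q :* q :* q :* (s4 :* s20)) :*
            (con (+ 5) :* (pb5 :* pb5) :- pb :* pb) :- con (+ 4) :* (con (+ 1) :- (con (+ 4) :* E4 :- con (+ 2) :* E2 :- E) :- con (+ 4) :*
            E4)) :+ ((p2 :* p10 :+ q :* q :* q :* (s4 :* s20)) :* (p :* p :- (p2 :* p2 :+ q :* (s4 :* s4))) :+
            (:- (con (+ 5) :* (p2 :* p10 :+ q :* q :* q :* (s4 :* s20))) :*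
            (p5 :* p5 :- (p10 :* p10 :+ q :* q :* (q :* q) :* q :* (s20 :* s20))) :+
            (:- (p2 :* p10 :- q :* q :* q :* (s4 :* s20)) :* (pb :* pb :- (p2 :* p2 :- q :* (s4 :* s4))) :+
            (con (+ 5) :* (p2 :* p10 :- q :* q :* q :* (s4 :* s20)) :*
            (pb5 :* pb5 :- (p10 :* p10 :- q :* q :* (q :* q) :* q :* (s20 :* s20))) :+ con (+ 0))))))) ≈-refl E (dil 2 E) (dil 4 E) q Ψ₄
            Ψ₂₀ φ₂ φ₁₀ φ φ₅ φ̄ φ̄₅))

  -- 5(φ² - φ₅²) + (5φ₅² - φ²) = 4φ². Without the factor 5 the same sum is 4φ₅², which is the case
  -- of `N₁₅₅₅`.
  N₁₁₁₅ : φ · (φ · (φ · φ₅)) ≈ κ (+ 1) ⊕ E ⊖ κ (+ 2) · dil 2 E ⊖ κ (+ 4) · dil 4 E ⊕ κ (+ 5) · F ⊕ κ (+ 10) · dil 2 F ⊖ κ (+ 20) · dil 4 F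
  N₁₁₁₅ = κ-cancelˡ (+ 4) (λ ()) (combine (hyp _ F-theta ∷ hyp _ E-theta ∷ [])
        (solve 8 (λ p p5 F4 F2 F E4 E E2 → con (+ 4) :* (p :* (p :* (p :* p5))) :- con (+ 4) :*
            (con (+ 1) :+ E :- con (+ 2) :* E2 :- con (+ 4) :* E4 :+ con (+ 5) :* F :+ con (+ 10) :* F2 :- con (+ 20) :* F4) := con (+ 5)
            :* (p :* p5 :* (p :* p :- p5 :* p5) :- con (+ 4) :* (F :+ con (+ 2) :* F2 :- con (+ 4) :* F4)) :+
            (con (+ 1) :* (p :* p5 :* (con (+ 5) :* (p5 :* p5) :- p :* p) :- con (+ 4) :*
            (con (+ 1) :+ E :- con (+ 2) :* E2 :- con (+ 4) :* E4)) :+ con (+ 0))) ≈-refl φ φ₅ (dil 4 F) (dil 2 F) F (dil 4 E) E (dil 2 E)))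

  N₁₅₅₅ : φ · (φ₅ · (φ₅ · φ₅)) ≈ κ (+ 1) ⊕ E ⊖ κ (+ 2) · dil 2 E ⊖ κ (+ 4) · dil 4 E ⊕ F ⊕ κ (+ 2) · dil 2 F ⊖ κ (+ 4) · dil 4 F
  N₁₅₅₅ = κ-cancelˡ (+ 4) (λ ()) (combine (hyp _ F-theta ∷ hyp _ E-theta ∷ [])
        (solve 8 (λ p p5 F4 F F2 E4 E E2 → con (+ 4) :* (p :* (p5 :* (p5 :* p5))) :- con (+ 4) :*
            (con (+ 1) :+ E :- con (+ 2) :* E2 :- con (+ 4) :* E4 :+ F :+ con (+ 2) :* F2 :- con (+ 4) :* F4) := con (+ 1) :*
            (p :* p5 :* (p :* p :- p5 :* p5) :- con (+ 4) :* (F :+ con (+ 2) :* F2 :- con (+ 4) :* F4)) :+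
            (con (+ 1) :* (p :* p5 :* (con (+ 5) :* (p5 :* p5) :- p :* p) :- con (+ 4) :*
            (con (+ 1) :+ E :- con (+ 2) :* E2 :- con (+ 4) :* E4)) :+ con (+ 0))) ≈-refl φ φ₅ (dil 4 F) F (dil 2 F) (dil 4 E) E (dil 2 E)))

  module _ where
    private
      k₂ : ∀ c f {g} → dil 2 f ≈ g → dil 2 (κ c · f) ≈ κ c · g
      k₂ c f p = ≈-trans (dil-κ-· 2 c f) (·-cong ≈-refl p)
      infixl 6 _⊕₂_ _⊖₂_
      _⊕₂_ : ∀ {f g f′ g′} → dil 2 f ≈ f′ → dil 2 g ≈ g′ → dil 2 (f ⊕ g) ≈ f′ ⊕ g′
      p ⊕₂ r = ≈-trans (dil-⊕ 2 _ _) (⊕-cong p r)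
      _⊖₂_ : ∀ {f g f′ g′} → dil 2 f ≈ f′ → dil 2 g ≈ g′ → dil 2 (f ⊖ g) ≈ f′ ⊖ g′
      p ⊖₂ r = ≈-trans (dil-⊖ 2 _ _) (⊖-cong p r)
      infixr 7 _·₂_
      _·₂_ : ∀ {f g f′ g′} → dil 2 f ≈ f′ → dil 2 g ≈ g′ → dil 2 (f · g) ≈ f′ · g′
      p ·₂ r = ≈-trans (dil-· 2 _ _) (·-cong p r)
      d₂ : ∀ f → dil 2 (dil 2 f) ≈ dil 4 f
      d₂ = dil-dil 2 2 4 refl
      d₄ : ∀ f → dil 2 (dil 4 f) ≈ dil 8 f
      d₄ = dil-dil 2 4 8 refl
      p₅ : dil 2 φ₅ ≈ φ₁₀
      p₅ = dil-dil 2 5 10 refl φ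

    N₁₁₁₅-dil : φ₂ · (φ₂ · (φ₂ · φ₁₀)) ≈ κ (+ 1) ⊕ dil 2 E ⊖ κ (+ 2) · dil 4 E ⊖ κ (+ 4) · dil 8 E ⊕ κ (+ 5) · dil 2 F ⊕ κ (+ 10) · dil 4 F
        ⊖ κ (+ 20) · dil 8 F
    N₁₁₁₅-dil = ≈-trans (≈-sym (≈-refl ·₂ ≈-refl ·₂ ≈-refl ·₂ p₅)) (≈-trans (dil-cong 2 N₁₁₁₅)
      (dil-κ 2 (+ 1) ⊕₂ ≈-refl ⊖₂ k₂ (+ 2) _ (d₂ E) ⊖₂ k₂ (+ 4) _ (d₄ E) ⊕₂ k₂ (+ 5) _ ≈-refl ⊕₂ k₂ (+ 10) _ (d₂ F) ⊖₂ k₂ (+ 20) _ (d₄ F)))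

    N₁₅₅₅-dil : φ₂ · (φ₁₀ · (φ₁₀ · φ₁₀)) ≈ κ (+ 1) ⊕ dil 2 E ⊖ κ (+ 2) · dil 4 E ⊖ κ (+ 4) · dil 8 E ⊕ dil 2 F ⊕ κ (+ 2) · dil 4 F ⊖ κ
        (+ 4) · dil 8 F
    N₁₅₅₅-dil = ≈-trans (≈-sym (≈-refl ·₂ p₅ ·₂ p₅ ·₂ p₅)) (≈-trans (dil-cong 2 N₁₅₅₅)
      (dil-κ 2 (+ 1) ⊕₂ ≈-refl ⊖₂ k₂ (+ 2) _ (d₂ E) ⊖₂ k₂ (+ 4) _ (d₄ E) ⊕₂ ≈-refl ⊕₂ k₂ (+ 2) _ (d₂ F) ⊖₂ k₂ (+ 4) _ (d₄ F)))

    -- The combination used for `N₁₁₁₅` with `G` in place of φφ₅, moved to q² because `G` enters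
    -- through the even part of φφ₅.
    Gφ²-dil : dil 2 G · (φ₂ · φ₂) ≈ κ (+ 1) ⊖ dil 2 E ⊖ κ (+ 4) · dil 8 E ⊕ κ (+ 5) · dil 2 F ⊕ κ (+ 20) · dil 8 F
    Gφ²-dil = ≈-trans (≈-sym (≈-refl ·₂ ≈-refl ·₂ ≈-refl)) (≈-trans
        (dil-cong 2 (κ-cancelˡ (+ 4) (λ ()) (combine (hyp _ F-theta-G ∷ hyp _ E-theta-G ∷ [])
        (solve 7 (λ G p F4 F E E4 p5 → con (+ 4) :* (G :* (p :* p)) :- con (+ 4) :*
            (con (+ 1) :- E :- con (+ 4) :* E4 :+ con (+ 5) :* F :+ con (+ 20) :* F4) := con (+ 5) :*
            (G :* (p :* p :- p5 :* p5) :- con (+ 4) :* (F :+ con (+ 4) :* F4)) :+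
            (con (+ 1) :* (G :* (con (+ 5) :* (p5 :* p5) :- p :* p) :- con (+ 4) :* (con (+ 1) :- E :- con (+ 4) :* E4)) :+ con (+ 0)))
            ≈-refl G φ (dil 4 F) F E (dil 4 E) φ₅))))
      (dil-κ 2 (+ 1) ⊖₂ ≈-refl ⊖₂ k₂ (+ 4) _ (d₄ E) ⊕₂ k₂ (+ 5) _ ≈-refl ⊕₂ k₂ (+ 20) _ (d₄ F)))

    Gφ₅²-dil : dil 2 G · (φ₁₀ · φ₁₀) ≈ κ (+ 1) ⊖ dil 2 E ⊖ κ (+ 4) · dil 8 E ⊕ dil 2 F ⊕ κ (+ 4) · dil 8 F
    Gφ₅²-dil = ≈-trans (≈-sym (≈-refl ·₂ p₅ ·₂ p₅)) (≈-trans (dil-cong 2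
        (κ-cancelˡ (+ 4) (λ ()) (combine (hyp _ F-theta-G ∷ hyp _ E-theta-G ∷ [])
        (solve 7 (λ G p5 F F4 E E4 p → con (+ 4) :* (G :* (p5 :* p5)) :- con (+ 4) :*
            (con (+ 1) :- E :- con (+ 4) :* E4 :+ F :+ con (+ 4) :* F4) := con (+ 1) :*
            (G :* (p :* p :- p5 :* p5) :- con (+ 4) :* (F :+ con (+ 4) :* F4)) :+
            (con (+ 1) :* (G :* (con (+ 5) :* (p5 :* p5) :- p :* p) :- con (+ 4) :* (con (+ 1) :- E :- con (+ 4) :* E4)) :+ con (+ 0)))
            ≈-refl G φ₅ F (dil 4 F) E (dil 4 E) φ))))
      (dil-κ 2 (+ 1) ⊖₂ ≈-refl ⊖₂ k₂ (+ 4) _ (d₄ E) ⊕₂ ≈-refl ⊕₂ k₂ (+ 4) _ (d₄ F)))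

    G-dil : dil 2 G ≈ dil 4 φ · dil 20 φ ⊕ q · q · (q · q) · (q · q) · (dil 8 Ψ · dil 40 Ψ)
    G-dil = (d₂ φ ·₂ dil-dil 2 10 20 refl φ) ⊕₂ (((q₂ ·₂ q₂) ·₂ q₂) ·₂ (d₄ Ψ ·₂ dil-dil 2 20 40 refl Ψ))
      where
        q₂ : dil 2 q ≈ q · q
        q₂ = ≈-trans (dil-q 2) q^2

    Hh-dil : Hh₄ ≈ dil 8 Ψ · dil 20 φ ⊕ q · q · (q · q) · (dil 4 φ · dil 40 Ψ)
    Hh-dil = ≈-trans (dil-⊕ 4 _ _) (⊕-cong (≈-trans (dil-· 4 _ _) (·-cong (dil-dil 4 2 8 refl Ψ) (dil-dil 4 5 20 refl φ)))
        (≈-trans (dil-· 4 _ _) (·-cong dil4-q (≈-trans (dil-· 4 _ _) (·-cong ≈-refl (dil-dil 4 10 40 refl Ψ))))))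

  -- x² + 5y² is even exactly when x ≡ y modulo 2, and on that sublattice it is twice the form 2x² +
  -- 2xy + 3y².
  φφ₅-dissection : φ · φ₅ ≈ (dil 2 G) ⊕ q · Hh₄
  φφ₅-dissection = combine (hyp _ φ-dissection₂ ∷ hyp _ φ₅-dissection ∷ hyp _ G-dil ∷ hyp _ Hh-dil ∷ [])
      (solve 9 (λ p p5 G2 q H4 p4 s8 p20 s40 → p :* p5 :- (G2 :+ q :* H4) := p5 :* (p :- (p4 :+ q :* s8)) :+
          ((p4 :+ q :* s8) :* (p5 :- (p20 :+ q :* q :* (q :* q) :* q :* s40)) :+
          (con -[1+ 0 ] :* (G2 :- (p4 :* p20 :+ q :* q :* (q :* q) :* (q :* q) :* (s8 :* s40))) :+
          (:- q :* (H4 :- (s8 :* p20 :+ q :* q :* (q :* q) :* (p4 :* s40))) :+ con (+ 0))))) ≈-refl φ φ₅ (dil 2 G) q Hh₄ (dil 4 φ)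
          (dil 8 Ψ) (dil 20 φ) (dil 40 Ψ))

  -- φ² = φ₂² + qΨ₄² splits the product into `N₁₁₁₅` at q² and `X₁`. Now 5 `F-odd` - `E-odd`
  -- evaluates 4X₁ + 4Rφ₂², and `B₂-identity` evaluates X₁ - Rφ₂², so 8X₁ is determined.
  N₁₁₂₁₀ : κ (+ 2) · (φ · (φ · (φ₂ · φ₁₀))) ≈ κ (+ 2) ⊖ E ⊕ (dil 2 E) ⊖ κ (+ 2) · (dil 4 E) ⊖ κ (+ 8) · (dil 8 E) ⊕ κ (+ 5) · F ⊕ κ (+ 5) ·
      (dil 2 F) ⊕ κ (+ 10) · (dil 4 F) ⊖ κ (+ 40) · (dil 8 F) ⊕ κ (+ 4) · (q · B₂)
  N₁₁₂₁₀ = κ-cancelˡ (+ 4) (λ ()) (combine (hyp _ φ²-dissection ∷ hyp _ N₁₁₁₅-dil ∷ hyp _ F-odd ∷ hyp _ E-odd ∷ hyp _ B₂-identity ∷ [])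
        (solve 15 (λ p p2 p10 F8 q B2 F4 F2 F E8 E2 E4 E s4 s20 → con (+ 4) :* (con (+ 2) :* (p :* (p :* (p2 :* p10)))) :- con (+ 4) :*
            (con (+ 2) :- E :+ E2 :- con (+ 2) :* E4 :- con (+ 8) :* E8 :+ con (+ 5) :* F :+ con (+ 5) :* F2 :+ con (+ 10) :* F4 :- con
            (+ 40) :* F8 :+ con (+ 4) :* (q :* B2)) := con (+ 8) :* (p2 :* p10) :* (p :* p :- (p2 :* p2 :+ q :* (s4 :* s4))) :+
            (con (+ 8) :* (p2 :* (p2 :* (p2 :* p10)) :- (con (+ 1) :+ E2 :- con (+ 2) :* E4 :- con (+ 4) :* E8 :+ con (+ 5) :* F2 :+ con
            (+ 10) :* F4 :- con (+ 20) :* F8)) :+ (con -[1+ 4 ] :* (con (+ 4) :* (F :- F2 :- con (+ 2) :* F4) :-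
            (q :* (s4 :* s4 :* (p2 :* p10)) :- q :* q :* (q :* q) :* q :* (s20 :* s20 :* (p2 :* p10)) :+ q :* q :* q :* (s4 :* s20) :*
            (p2 :* p2 :- p10 :* p10))) :+ (con (+ 1) :* (con (+ 4) :* (E :+ E2 :- con (+ 2) :* E4) :-
            (q :* (s4 :* s4 :* (p2 :* p10)) :- con (+ 5) :* (q :* q :* (q :* q) :* q :* (s20 :* s20 :* (p2 :* p10))) :- q :* q :* q :*
            (s4 :* s20) :* (con (+ 5) :* (p10 :* p10) :- p2 :* p2))) :+
            (con (+ 4) :* (q :* (s4 :* s4 :* (p2 :* p10)) :- q :* q :* q :* (s4 :* s20 :* (p2 :* p2)) :- con (+ 4) :* (q :* B2)) :+ con
            (+ 0)))))) ≈-refl φ φ₂ φ₁₀ (dil 8 F) q B₂ (dil 4 F) (dil 2 F) F (dil 8 E) (dil 2 E) (dil 4 E) E Ψ₄ Ψ₂₀))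

  -- The odd part of φ₅² leaves `X₂`. It is found from `F-odd` - `E-odd`, which evaluates 4X₂ +
  -- 4Rφ₁₀², and `B₁-identity`, which evaluates Rφ₁₀² - X₂.
  N₂₅₅₁₀ : κ (+ 2) · (φ₂ · (φ₅ · (φ₅ · φ₁₀))) ≈ κ (+ 2) ⊖ E ⊕ (dil 2 E) ⊖ κ (+ 2) · (dil 4 E) ⊖ κ (+ 8) · (dil 8 E) ⊕ F ⊕ (dil 2 F) ⊕ κ
      (+ 2) · (dil 4 F) ⊖ κ (+ 8) · (dil 8 F) ⊖ κ (+ 4) · (q · q · q · B₁)
  N₂₅₅₁₀ = κ-cancelˡ (+ 4) (λ ()) (combine (hyp _ φ₅²-dissection′ ∷ hyp _ N₁₅₅₅-dil ∷ hyp _ F-odd ∷ hyp _ E-odd ∷ hyp _ B₁-identity ∷ [])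
        (solve 15 (λ p2 p5 p10 F8 B1 F2 F4 q F E8 E2 E4 E s20 s4 → con (+ 4) :* (con (+ 2) :* (p2 :* (p5 :* (p5 :* p10)))) :- con (+ 4) :*
            (con (+ 2) :- E :+ E2 :- con (+ 2) :* E4 :- con (+ 8) :* E8 :+ F :+ F2 :+ con (+ 2) :* F4 :- con (+ 8) :* F8 :- con (+ 4) :*
            (q :* q :* q :* B1)) := con (+ 8) :* (p2 :* p10) :* (p5 :* p5 :- (p10 :* p10 :+ q :* q :* (q :* q) :* q :* (s20 :* s20))) :+
            (con (+ 8) :* (p2 :* (p10 :* (p10 :* p10)) :- (con (+ 1) :+ E2 :- con (+ 2) :* E4 :- con (+ 4) :* E8 :+ F2 :+ con (+ 2) :* F4
            :- con (+ 4) :* F8)) :+ (con -[1+ 0 ] :* (con (+ 4) :* (F :- F2 :- con (+ 2) :* F4) :-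
            (q :* (s4 :* s4 :* (p2 :* p10)) :- q :* q :* (q :* q) :* q :* (s20 :* s20 :* (p2 :* p10)) :+ q :* q :* q :* (s4 :* s20) :*
            (p2 :* p2 :- p10 :* p10))) :+ (con (+ 1) :* (con (+ 4) :* (E :+ E2 :- con (+ 2) :* E4) :-
            (q :* (s4 :* s4 :* (p2 :* p10)) :- con (+ 5) :* (q :* q :* (q :* q) :* q :* (s20 :* s20 :* (p2 :* p10))) :- q :* q :* q :*
            (s4 :* s20) :* (con (+ 5) :* (p10 :* p10) :- p2 :* p2))) :+
            (con -[1+ 3 ] :* (q :* q :* q :* (s4 :* s20 :* (p10 :* p10)) :- q :* q :* (q :* q) :* q :* (s20 :* s20 :* (p2 :* p10)) :- con
            (+ 4) :* (q :* q :* q :* B1)) :+ con (+ 0)))))) ≈-refl φ₂ φ₅ φ₁₀ (dil 8 F) B₁ (dil 2 F) (dil 4 F) q F (dil 8 E) (dil 2 E)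
            (dil 4 E) E Ψ₂₀ Ψ₄))

  -- Here φφ₅ is dissected. Its even part is `Gφ²-dil`; for the odd part `U₂-dil` gives 2q `Hh₄` φ₂²
  -- = X₁ - 5X₂ + 2Rφ₂², which is a combination of `E-odd`, `F-odd` and both cusp form identities.
  N₁₂₂₅ : κ (+ 2) · (φ · (φ₂ · (φ₂ · φ₅))) ≈ κ (+ 2) ⊕ E ⊖ (dil 2 E) ⊖ κ (+ 2) · (dil 4 E) ⊖ κ (+ 8) · (dil 8 E) ⊕ κ (+ 5) · F ⊕ κ (+ 5) ·
      (dil 2 F) ⊖ κ (+ 10) · (dil 4 F) ⊕ κ (+ 40) · (dil 8 F) ⊕ κ (+ 10) · (q · q · q · B₁) ⊖ κ (+ 2) · (q · B₂)
  N₁₂₂₅ = κ-cancelˡ (+ 4) (λ ()) (combine (hyp _ φφ₅-dissection ∷ hyp _ Gφ²-dil ∷ hyp _ U₂-dil ∷ hyp _ E-odd ∷ hyp _ F-odd ∷ hyp _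
      B₁-identity ∷ hyp _ B₂-identity ∷ [])
        (solve 19 (λ p p2 p5 q B2 F8 B1 F4 F2 F E8 E2 E4 E G2 H4 s4 s20 p10 → con (+ 4) :* (con (+ 2) :* (p :* (p2 :* (p2 :* p5)))) :- con
            (+ 4) :* (con (+ 2) :+ E :- E2 :- con (+ 2) :* E4 :- con (+ 8) :* E8 :+ con (+ 5) :* F :+ con (+ 5) :* F2 :- con (+ 10) :* F4
            :+ con (+ 40) :* F8 :+ con (+ 10) :* (q :* q :* q :* B1) :- con (+ 2) :* (q :* B2)) := con (+ 8) :* (p2 :* p2) :*
            (p :* p5 :- (G2 :+ q :* H4)) :+ (con (+ 8) :* (G2 :* (p2 :* p2) :-
            (con (+ 1) :- E2 :- con (+ 4) :* E8 :+ con (+ 5) :* F2 :+ con (+ 20) :* F8)) :+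
            (con (+ 4) :* q :* p2 :* (con (+ 2) :* ((H4 :- q :* q :* (s4 :* s20)) :* p2) :- p10 :*
            (s4 :* s4 :- con (+ 5) :* (q :* q :* (q :* q) :* (s20 :* s20)))) :+
            (con -[1+ 0 ] :* (con (+ 4) :* (E :+ E2 :- con (+ 2) :* E4) :-
            (q :* (s4 :* s4 :* (p2 :* p10)) :- con (+ 5) :* (q :* q :* (q :* q) :* q :* (s20 :* s20 :* (p2 :* p10))) :- q :* q :* q :*
            (s4 :* s20) :* (con (+ 5) :* (p10 :* p10) :- p2 :* p2))) :+
            (con -[1+ 4 ] :* (con (+ 4) :* (F :- F2 :- con (+ 2) :* F4) :-
            (q :* (s4 :* s4 :* (p2 :* p10)) :- q :* q :* (q :* q) :* q :* (s20 :* s20 :* (p2 :* p10)) :+ q :* q :* q :* (s4 :* s20) :*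
            (p2 :* p2 :- p10 :* p10))) :+ (con (+ 10) :* (q :* q :* q :* (s4 :* s20 :* (p10 :* p10)) :- q :* q :* (q :* q) :* q :*
            (s20 :* s20 :* (p2 :* p10)) :- con (+ 4) :* (q :* q :* q :* B1)) :+
            (con -[1+ 1 ] :* (q :* (s4 :* s4 :* (p2 :* p10)) :- q :* q :* q :* (s4 :* s20 :* (p2 :* p2)) :- con (+ 4) :* (q :* B2)) :+ con
            (+ 0)))))))) ≈-refl φ φ₂ φ₅ q B₂ (dil 8 F) B₁ (dil 4 F) (dil 2 F) F (dil 8 E) (dil 2 E) (dil 4 E) E (dil 2 G) Hh₄ Ψ₄ Ψ₂₀ φ₁₀))

  -- As for `N₁₂₂₅`, with `U₁-dil` giving 2q `Hh₄` φ₁₀² = X₁ - X₂ - 2Rφ₁₀² for the odd part.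
  N₁₅₁₀₁₀ : κ (+ 2) · (φ · (φ₅ · (φ₁₀ · φ₁₀))) ≈ κ (+ 2) ⊕ E ⊖ (dil 2 E) ⊖ κ (+ 2) · (dil 4 E) ⊖ κ (+ 8) · (dil 8 E) ⊕ F ⊕ (dil 2 F) ⊖ κ
      (+ 2) · (dil 4 F) ⊕ κ (+ 8) · (dil 8 F) ⊖ κ (+ 2) · (q · q · q · B₁) ⊕ κ (+ 2) · (q · B₂)
  N₁₅₁₀₁₀ = κ-cancelˡ (+ 4) (λ ()) (combine (hyp _ φφ₅-dissection ∷ hyp _ Gφ₅²-dil ∷ hyp _ U₁-dil ∷ hyp _ E-odd ∷ hyp _ F-odd ∷ hyp _
      B₁-identity ∷ hyp _ B₂-identity ∷ [])
        (solve 19 (λ p p5 p10 q B2 F8 B1 F2 F4 F E8 E2 E4 E G2 H4 s4 s20 p2 → con (+ 4) :* (con (+ 2) :* (p :* (p5 :* (p10 :* p10)))) :-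
            con (+ 4) :* (con (+ 2) :+ E :- E2 :- con (+ 2) :* E4 :- con (+ 8) :* E8 :+ F :+ F2 :- con (+ 2) :* F4 :+ con (+ 8) :* F8 :-
            con (+ 2) :* (q :* q :* q :* B1) :+ con (+ 2) :* (q :* B2)) := con (+ 8) :* (p10 :* p10) :* (p :* p5 :- (G2 :+ q :* H4)) :+
            (con (+ 8) :* (G2 :* (p10 :* p10) :- (con (+ 1) :- E2 :- con (+ 4) :* E8 :+ F2 :+ con (+ 4) :* F8)) :+
            (con (+ 4) :* q :* p10 :* (con (+ 2) :* ((H4 :+ q :* q :* (s4 :* s20)) :* p10) :- p2 :*
            (s4 :* s4 :- q :* q :* (q :* q) :* (s20 :* s20))) :+ (con -[1+ 0 ] :*
            (con (+ 4) :* (E :+ E2 :- con (+ 2) :* E4) :- (q :* (s4 :* s4 :* (p2 :* p10)) :- con (+ 5) :*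
            (q :* q :* (q :* q) :* q :* (s20 :* s20 :* (p2 :* p10))) :- q :* q :* q :* (s4 :* s20) :*
            (con (+ 5) :* (p10 :* p10) :- p2 :* p2))) :+ (con -[1+ 0 ] :*
            (con (+ 4) :* (F :- F2 :- con (+ 2) :* F4) :- (q :* (s4 :* s4 :* (p2 :* p10)) :- q :* q :* (q :* q) :* q :*
            (s20 :* s20 :* (p2 :* p10)) :+ q :* q :* q :* (s4 :* s20) :* (p2 :* p2 :- p10 :* p10))) :+
            (con -[1+ 1 ] :* (q :* q :* q :* (s4 :* s20 :* (p10 :* p10)) :- q :* q :* (q :* q) :* q :* (s20 :* s20 :* (p2 :* p10)) :- con
            (+ 4) :* (q :* q :* q :* B1)) :+ (con (+ 2) :* (q :* (s4 :* s4 :* (p2 :* p10)) :- q :* q :* q :* (s4 :* s20 :* (p2 :* p2)) :-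
            con (+ 4) :* (q :* B2)) :+ con (+ 0)))))))) ≈-refl φ φ₅ φ₁₀ q B₂ (dil 8 F) B₁ (dil 2 F) (dil 4 F) F (dil 8 E) (dil 2 E)
            (dil 4 E) E (dil 2 G) Hh₄ Ψ₄ Ψ₂₀ φ₂))

open RepresentationSeries

-- The eta products b₁ and b₂ and the counting function N as coefficients of series.

module Coefficients where

  open import Data.Integer using (_+_; _*_)
  open import Data.List using (map)

  geometric : ∀ a .{{_ : NonZero a}} → (1ₛ ⊕ κ -[1+ 0 ] · mono a) · ⟪ 1/1-q^ a ⟫ ≈ 1ₛ
  geometric a = ≈-trans (·-cong (≈-sym (≈-trans (dil-⊕ a 1ₛ _) (⊕-cong (dil-1 a)
      (≈-trans (dil-κ-· a -[1+ 0 ] (mono 1)) (·-cong ≈-refl (≈-trans (dil-mono a 1) (mono-≡ (ℕₚ.*-identityˡ a))))))))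
      (pointwise (λ _ → refl)))
    (≈-trans (≈-sym (dil-· a (1ₛ ⊕ κ -[1+ 0 ] · mono 1) ones)) (≈-trans (dil-cong a geometric₁) (dil-1 a)))

  1-q^≈ : ∀ a .{{_ : NonZero a}} → ⟪ 1-q^ a ⟫ ≈ 1ₛ ⊕ κ -[1+ 0 ] · mono a
  1-q^≈ a = pointwise λ k → trans (coefficient k) (cong (λ z → 1ₛ ! k + z) (sym (κ-·-at -[1+ 0 ] (mono a) k)))
    where
      coefficient : ∀ k → 1-q^ a k ≡ 1ₛ ! k + -[1+ 0 ] * monoᶜ a k
      coefficient zero = sym (cong (λ z → + 1 + -[1+ 0 ] * z) (mono-other a 0 (λ 0≡a → ℕ.≢-nonZero⁻¹ a (sym 0≡a))))
      coefficient (suc k) with suc k ℕ.≟ a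
      ... | yes refl = sym (cong (λ z → + 0 + -[1+ 0 ] * z) (mono-self (suc k)))
      ... | no  k≢a  = sym (cong (λ z → + 0 + -[1+ 0 ] * z) (mono-other a (suc k) k≢a))

  fin : ℕ → ℕ → PS
  fin k M = ∏< M (λ j → 1ₛ ⊕ κ -[1+ 0 ] · mono (k ℕ.+ k ℕ.* j))

  fin-limit : ∀ k .{{_ : NonZero k}} M → fin k M ≈[ suc M ] dil k e₁
  fin-limit k M = ≈[]-trans (≈[]-sym (∏∞-trunc (Pc-tame -[1+ 0 ] k k (ℕ.>-nonZero⁻¹ k) (ℕ.>-nonZero⁻¹ k)) M)) (≈⇒≈[] (suc M) (Pc≈ee k))

  wrap : ∀ f g → ⟪ f ⊛ g ⟫ ≈ ⟪ f ⟫ · ⟪ g ⟫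
  wrap f g = pointwise (λ _ → refl)

  -- The shape to which a fourth power by `_^S_` unfolds, including the final unit factor.
  quartic : PS → PS
  quartic x = x · (x · (x · (x · 1ₛ)))

  fourth : ∀ f → ⟪ f ^S 4 ⟫ ≈ quartic ⟪ f ⟫
  fourth f = pointwise (λ _ → refl)

  module EtaProduct (a b c : ℕ) .{{_ : NonZero a}} .{{_ : NonZero b}} .{{_ : NonZero c}} (Fac : ℕ → Series)
    (Fac-suc : ∀ j → ⟪ Fac (suc j) ⟫ ≈
      quartic (1ₛ ⊕ κ -[1+ 0 ] · mono (a ℕ.* suc j)) · (1ₛ ⊕ κ -[1+ 0 ] · mono (b ℕ.* suc j)) · ⟪ 1/1-q^ (c ℕ.* suc j) {{ℕₚ.m*n≢0 c (suc j)}} ⟫) where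

    open SeriesSolver

    -- The denominator is carried to the left side, so each geometric series cancels against its own
    -- factor and the induction involves only finite products.
    finite : ∀ M → ⟪ prodS Fac M ⟫ · fin c M ≈ fin a M · (fin a M · (fin a M · fin a M)) · fin b M
    finite zero = ·-cong (≈-trans (pointwise (λ _ → refl)) (≈-sym (≈-trans (·-identityˡ _) (≈-trans (·-identityˡ _) (·-identityˡ 1ₛ)))))
        ≈-refl
    finite (suc M) = begin
      ⟪ prodS Fac (suc M) ⟫ · (fin c M · z′)
        ≈⟨ ·-cong (≈-trans (wrap (Fac (suc M)) (prodS Fac M)) (·-cong (Fac-suc M) ≈-refl)) ≈-refl ⟩
      x · (x · (x · (x · 1ₛ))) · y · g · ⟪ prodS Fac M ⟫ · (fin c M · z′)
        ≈⟨ ·-cong (·-cong (·-cong (·-cong (·-cong ≈-refl (·-cong ≈-refl (·-cong ≈-refl (·-identityʳ x)))) ≈-refl) ≈-refl) ≈-refl)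
            (·-cong ≈-refl z≈) ⟩
      x · (x · (x · x)) · y · g · ⟪ prodS Fac M ⟫ · (fin c M · z)
        ≈⟨ solve 6 (λ x y g P C z → x :* (x :* (x :* x)) :* y :* g :* P :* (C :* z) := x :* (x :* (x :* x)) :* y :* (P :* C) :* (z :* g))
            ≈-refl x y g ⟪ prodS Fac M ⟫ (fin c M) z ⟩
      x · (x · (x · x)) · y · (⟪ prodS Fac M ⟫ · fin c M) · (z · g)
        ≈⟨ ·-cong (·-cong ≈-refl (finite M)) (geometric (c ℕ.* suc M) {{ℕₚ.m*n≢0 c (suc M)}}) ⟩
      x · (x · (x · x)) · y · (fa · (fa · (fa · fa)) · fb) · 1ₛ
        ≈⟨ ≈-trans (·-identityʳ _) (solve 4 (λ x y fa fb → x :* (x :* (x :* x)) :* y :* (fa :* (fa :* (fa :* fa)) :* fb) := fa :* x :*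
            (fa :* x :* (fa :* x :* (fa :* x))) :* (fb :* y)) ≈-refl x y fa fb) ⟩
      fa · x · (fa · x · (fa · x · (fa · x))) · (fb · y)
        ≈⟨ ·-cong (·-cong Ax (·-cong Ax (·-cong Ax Ax))) (·-cong ≈-refl (⊕-cong ≈-refl (·-cong ≈-refl (mono-≡ (ℕₚ.*-suc b M))))) ⟩
      fin a (suc M) · (fin a (suc M) · (fin a (suc M) · fin a (suc M))) · fin b (suc M) ∎
      where
        open ≈-Reasoning
        fa = fin a M
        fb = fin b M
        x = 1ₛ ⊕ κ -[1+ 0 ] · mono (a ℕ.* suc M)
        y = 1ₛ ⊕ κ -[1+ 0 ] · mono (b ℕ.* suc M)
        z = 1ₛ ⊕ κ -[1+ 0 ] · mono (c ℕ.* suc M)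
        z′ = 1ₛ ⊕ κ -[1+ 0 ] · mono (c ℕ.+ c ℕ.* M)
        g = ⟪ 1/1-q^ (c ℕ.* suc M) {{ℕₚ.m*n≢0 c (suc M)}} ⟫
        z≈ : z′ ≈ z
        z≈ = ⊕-cong ≈-refl (·-cong ≈-refl (mono-≡ (sym (ℕₚ.*-suc c M))))
        Ax : fa · x ≈ fin a (suc M)
        Ax = ·-cong ≈-refl (⊕-cong ≈-refl (·-cong ≈-refl (mono-≡ (ℕₚ.*-suc a M))))

    infinite : ∀ M → ⟪ prodS Fac M ⟫ · dil c e₁ ≈[ suc M ] dil a e₁ · (dil a e₁ · (dil a e₁ · dil a e₁)) · dil b e₁
    infinite M = ≈[]-trans (·-cong[] ≈[]-refl (≈[]-sym (fin-limit c M))) (≈[]-trans (≈⇒≈[] (suc M) (finite M))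
      (·-cong[] (·-cong[] (fin-limit a M) (·-cong[] (fin-limit a M) (·-cong[] (fin-limit a M) (fin-limit a M)))) (fin-limit b M)))

  mon-e₄ : mon (+ 0 ∷ + 0 ∷ + 1 ∷ + 0 ∷ + 0 ∷ + 0 ∷ + 0 ∷ + 0 ∷ []) ≈ dil 4 e₁
  mon-e₄ = ≈-trans (≈-sym (dil2-mon (+ 0) (+ 1) (+ 0) (+ 0) (+ 0) (+ 0))) (≈-trans (dil-cong 2 mon-e₂) (dil-dil 2 2 4 refl e₁))

  mon-e₂₀ : mon (+ 0 ∷ + 0 ∷ + 0 ∷ + 0 ∷ + 0 ∷ + 0 ∷ + 1 ∷ + 0 ∷ []) ≈ dil 20 e₁
  mon-e₂₀ = ≈-trans (≈-sym (dil2-mon (+ 0) (+ 0) (+ 0) (+ 0) (+ 1) (+ 0))) (≈-trans (dil-cong 2 mon-e₁₀) (dil-dil 2 10 20 refl e₁))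

  B₂-product : ∀ M → ⟪ prodS F₂ M ⟫ ≈[ suc M ] B₂
  B₂-product M = mon-cancel[] (+ 0 ∷ + 1 ∷ + 0 ∷ + 0 ∷ + 0 ∷ + 0 ∷ + 0 ∷ + 0 ∷ [])
      (≈[]-trans (≈⇒≈[] _ (·-cong ≈-refl mon-e₂)) (≈[]-trans (EtaProduct.infinite 4 10 2 F₂ F₂-suc M)
    (≈⇒≈[] _ (≈-trans (·-cong (·-cong m4 (·-cong m4 (·-cong m4 m4))) (≈-sym mon-e₁₀))
        (≈-trans (self ⊗ (self ⊗ (self ⊗ self)) ⊗ self) (≈-sym (self ⊗ self)))))))
    where
      m4 = ≈-sym mon-e₄
      F₂-suc : ∀ j → _
      F₂-suc j = ≈-trans (wrap (1-q^ (4 ℕ.* suc j) ^S 4 ⊛ 1-q^ (10 ℕ.* suc j)) (1/1-q^ (2 ℕ.* suc j)))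
          (·-cong (≈-trans (wrap (1-q^ (4 ℕ.* suc j) ^S 4) (1-q^ (10 ℕ.* suc j)))
          (·-cong (≈-trans (fourth (1-q^ (4 ℕ.* suc j))) (·-cong x (·-cong x (·-cong x (·-cong x ≈-refl))))) (1-q^≈ (10 ℕ.* suc j))))
          ≈-refl)
        where x = 1-q^≈ (4 ℕ.* suc j)

  B₁-product : ∀ M → ⟪ prodS F₁ M ⟫ ≈[ suc M ] B₁
  B₁-product M = mon-cancel[] (+ 0 ∷ + 0 ∷ + 0 ∷ + 0 ∷ + 0 ∷ + 1 ∷ + 0 ∷ + 0 ∷ [])
      (≈[]-trans (≈⇒≈[] _ (·-cong ≈-refl mon-e₁₀)) (≈[]-trans (EtaProduct.infinite 20 2 10 F₁ F₁-suc M)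
    (≈⇒≈[] _ (≈-trans (·-cong (·-cong m20 (·-cong m20 (·-cong m20 m20))) (≈-sym mon-e₂))
        (≈-trans (self ⊗ (self ⊗ (self ⊗ self)) ⊗ self) (≈-sym (self ⊗ self)))))))
    where
      m20 = ≈-sym mon-e₂₀
      F₁-suc : ∀ j → _
      F₁-suc j = ≈-trans (wrap (1-q^ (2 ℕ.* suc j) ⊛ (1-q^ (20 ℕ.* suc j) ^S 4)) (1/1-q^ (10 ℕ.* suc j)))
          (·-cong (≈-trans (wrap (1-q^ (2 ℕ.* suc j)) (1-q^ (20 ℕ.* suc j) ^S 4))
          (≈-trans (·-comm ⟪ 1-q^ (2 ℕ.* suc j) ⟫ ⟪ 1-q^ (20 ℕ.* suc j) ^S 4 ⟫)
          (·-cong (≈-trans (fourth (1-q^ (20 ℕ.* suc j))) (·-cong x (·-cong x (·-cong x (·-cong x ≈-refl))))) (1-q^≈ (2 ℕ.* suc j)))))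
          ≈-refl)
        where x = 1-q^≈ (20 ℕ.* suc j)

  b₂-series : ∀ n → (q · B₂) ! n ≡ b₂ n
  b₂-series zero    = mono-·-< 1 B₂ 0 (s≤s z≤n)
  b₂-series (suc n) = trans (mono-·-+ 1 B₂ n) (sym (at< (B₂-product (suc n)) n (s≤s (ℕₚ.n≤1+n n))))

  b₁-series : ∀ n → (q · q · q · B₁) ! n ≡ b₁ n
  b₁-series n = trans (sym (at (·-cong q^3 (≈-refl {B₁})) n)) (go n)
    where
      go : ∀ n → (mono 3 · B₁) ! n ≡ b₁ n
      go 0 = mono-·-< 3 B₁ 0 (s≤s z≤n)
      go 1 = mono-·-< 3 B₁ 1 (s≤s (s≤s z≤n))
      go 2 = mono-·-< 3 B₁ 2 (s≤s (s≤s (s≤s z≤n)))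
      go (suc (suc (suc n))) = trans (mono-·-+ 3 B₁ n) (sym (at< (B₁-product (3 ℕ.+ n)) n (s≤s (ℕₚ.m≤n+m n 3))))

  ex-square : ∀ a x → + ex a a x ≡ + a * (x * x)
  ex-square a x = ℤₚ.*-cancelˡ-≡ (+ 2) (+ ex a a x) (+ a * (x * x)) (trans (ex-spec a a x)
    (solve 2 (λ a x → (a :+ a) :* (x :* (x :- con (+ 1))) :+ con (+ 2) :* (a :* x) := con (+ 2) :* (a :* (x :* x))) refl (+ a) x))
    where open +-*-Solver

  n≤n² : ∀ n → n ℕ.≤ n ℕ.* n
  n≤n² zero    = z≤n
  n≤n² (suc n) = ℕₚ.m≤m*n (suc n) (suc n)

  ex-square-bound : ∀ a .{{_ : NonZero a}} x → ℤ.∣ x ∣ ℕ.≤ ex a a x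
  ex-square-bound a x = ℕₚ.≤-trans (n≤n² ℤ.∣ x ∣) (ℕₚ.≤-trans (ℕₚ.m≤n*m (ℤ.∣ x ∣ ℕ.* ℤ.∣ x ∣) a)
    (ℕₚ.≤-reflexive (sym (trans (cong ℤ.∣_∣ (ex-square a x)) (trans (ℤₚ.abs-* (+ a) (x * x)) (cong (a ℕ.*_) (ℤₚ.abs-* x x)))))))

  square-poly : ℕ → ℕ → PS
  square-poly a n = ΣL (box n) (λ x → mono (ex a a x))

  -- For squares |x| ≤ a x² improves `ex-proper` by one, so the box from -n to n used in `N` already
  -- suffices for all coefficients up to q^n.
  φ-poly : ∀ a .{{_ : NonZero a}} n → dil a φ ≈[ suc n ] square-poly a n
  φ-poly a n = ≈[]-trans (≈⇒≈[] (suc n) (≈-trans (th-dil a 1 1 1≤ one-w)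
      (≈-trans (th≈Θ₁ (1 ℕ.* a) (1 ℕ.* a) one-w) (Θ₁-cong (λ x → cong₂ (λ c d → ex c d x) (ℕₚ.*-identityˡ a) (ℕₚ.*-identityˡ a))
      (λ _ → refl)))))
    (modulo (λ { k (s≤s k≤n) → trans (reindex (box n) (box (suc k)) id (summand k) (Index.boxes-unique line n)
        (Index.boxes-unique line (suc k)) id
        (λ x ≢0 → Index.∈-boxes line (suc k) x (ℕₚ.m≤n⇒m≤1+n (bound k x ≢0)))
        (λ x ≢0 → x , Index.∈-boxes line n x (ℕₚ.≤-trans (bound k x ≢0) k≤n) , refl))
      (trans (sumL-cong (box n) (λ x → ℤₚ.*-identityˡ (monoᶜ (ex a a x) k))) (sym (ΣL-at (box n) (λ x → mono (ex a a x)) k))) }))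
    where
      summand : ℕ → ℤ → ℤ
      summand k x = one-w x * monoᶜ (ex a a x) k
      bound : ∀ k x → ¬ summand k x ≡ + 0 → ℤ.∣ x ∣ ℕ.≤ k
      bound k x ≢0 = subst (ℤ.∣ x ∣ ℕ.≤_) (sym (Theta.support line (ex a a) one-w k x ≢0)) (ex-square-bound a x)

  sumℕ-pos : {I : Set} (xs : List I) (f : I → ℕ) → + sumℕ (map f xs) ≡ sumL xs (λ x → + f x)
  sumℕ-pos []       f = refl
  sumℕ-pos (x ∷ xs) f = cong (λ z → + f x + z) (sumℕ-pos xs f)

  -- One layer of the fourfold sum; k accumulates the exponents of the variables already fixed.
  peel : ∀ k a n g m → (mono k · (square-poly a n · g)) ! m ≡ sumL (box n) (λ x → (mono (k ℕ.+ ex a a x) · g) ! m)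
  peel k a n g m = begin
    (mono k · (square-poly a n · g)) ! m
      ≡⟨ at (≈-trans (·-cong ≈-refl (ΣL-·ʳ (box n) (λ x → mono (ex a a x)) g)) (ΣL-·ˡ (box n) (mono k) (λ x → mono (ex a a x) · g))) m ⟩
    ΣL (box n) (λ x → mono k · (mono (ex a a x) · g)) ! m
      ≡⟨ ΣL-at (box n) (λ x → mono k · (mono (ex a a x) · g)) m ⟩
    sumL (box n) (λ x → (mono k · (mono (ex a a x) · g)) ! m)
      ≡⟨ sumL-cong (box n) (λ x → at (≈-trans (solve 3 (λ a b c → a :* (b :* c) := a :* b :* c) ≈-refl (mono k) (mono (ex a a x)) g)
          (·-cong (≈-sym (mono-+ k (ex a a x))) ≈-refl)) m) ⟩
    sumL (box n) (λ x → (mono (k ℕ.+ ex a a x) · g) ! m) ∎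
    where
      open ≡-Reasoning
      open SeriesSolver

  N-series : ∀ a b c d .{{_ : NonZero a}} .{{_ : NonZero b}} .{{_ : NonZero c}} .{{_ : NonZero d}} n →
    + N a b c d n ≡ (dil a φ · (dil b φ · (dil c φ · dil d φ))) ! n
  N-series a b c d n = begin
    + N a b c d n
      ≡⟨ trans (sumℕ-pos (box n) _) (sumL-cong (box n) (λ x → trans (sumℕ-pos (box n) _)
          (sumL-cong (box n) (λ y → trans (sumℕ-pos (box n) _) (sumL-cong (box n) (λ z →
           trans (sumℕ-pos (box n) (isSol a b c d n x y z)) (sumL-cong (box n) (λ w → solution x y z w)))))))) ⟩
    sumL (box n) (λ x → sumL (box n) (λ y → sumL (box n) (λ z → sumL (box n)
        (λ w → (mono (0 ℕ.+ ex a a x ℕ.+ ex b b y ℕ.+ ex c c z ℕ.+ ex d d w) · 1ₛ) ! n))))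
      ≡⟨ sumL-cong (box n) (λ x → sumL-cong (box n) (λ y → sumL-cong (box n)
          (λ z → peel (0 ℕ.+ ex a a x ℕ.+ ex b b y ℕ.+ ex c c z) d n 1ₛ n))) ⟨
    sumL (box n) (λ x → sumL (box n) (λ y → sumL (box n) (λ z → (mono (0 ℕ.+ ex a a x ℕ.+ ex b b y ℕ.+ ex c c z) · (square-poly d n · 1ₛ))
        ! n)))
      ≡⟨ sumL-cong (box n) (λ x → sumL-cong (box n) (λ y → peel (0 ℕ.+ ex a a x ℕ.+ ex b b y) c n (square-poly d n · 1ₛ) n)) ⟨
    sumL (box n) (λ x → sumL (box n) (λ y → (mono (0 ℕ.+ ex a a x ℕ.+ ex b b y) · (square-poly c n · (square-poly d n · 1ₛ))) ! n))
      ≡⟨ sumL-cong (box n) (λ x → peel (0 ℕ.+ ex a a x) b n (square-poly c n · (square-poly d n · 1ₛ)) n) ⟨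
    sumL (box n) (λ x → (mono (0 ℕ.+ ex a a x) · (square-poly b n · (square-poly c n · (square-poly d n · 1ₛ)))) ! n)
      ≡⟨ peel 0 a n (square-poly b n · (square-poly c n · (square-poly d n · 1ₛ))) n ⟨
    (mono 0 · (square-poly a n · (square-poly b n · (square-poly c n · (square-poly d n · 1ₛ))))) ! n
      ≡⟨ at (strip (square-poly a n) (square-poly b n) (square-poly c n) (square-poly d n)) n ⟩
    (square-poly a n · (square-poly b n · (square-poly c n · square-poly d n))) ! n
      ≡⟨ at< (·-cong[] (φ-poly a n) (·-cong[] (φ-poly b n) (·-cong[] (φ-poly c n) (φ-poly d n)))) n ℕₚ.≤-refl ⟨
    (dil a φ · (dil b φ · (dil c φ · dil d φ))) ! n ∎
    where
      open ≡-Reasoning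
      strip : ∀ f g h k → mono 0 · (f · (g · (h · (k · 1ₛ)))) ≈ f · (g · (h · k))
      strip f g h k = ≈-trans (·-cong mono-0 (·-cong ≈-refl (·-cong ≈-refl (·-cong ≈-refl (·-identityʳ k))))) (·-identityˡ _)
      solution : ∀ x y z w → + isSol a b c d n x y z w ≡ (mono (0 ℕ.+ ex a a x ℕ.+ ex b b y ℕ.+ ex c c z ℕ.+ ex d d w) · 1ₛ) ! n
      solution x y z w = trans value (sym (at (·-identityʳ (mono e)) n))
        where
          e = ex a a x ℕ.+ ex b b y ℕ.+ ex c c z ℕ.+ ex d d w
          form : ℤ
          form = + a * (x * x) + + b * (y * y) + + c * (z * z) + + d * (w * w)
          e≡ : + e ≡ form
          e≡ = cong₂ _+_ (cong₂ _+_ (cong₂ _+_ (ex-square a x) (ex-square b y)) (ex-square c z)) (ex-square d w)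
          value : + (if ⌊ form ℤ.≟ + n ⌋ then 1 else 0) ≡ monoᶜ e n
          value with form ℤ.≟ + n
          ... | yes p = sym (subst (λ m → monoᶜ e m ≡ + 1) (ℤₚ.+-injective (trans e≡ p)) (mono-self e))
          ... | no  p = sym (mono-other e n (λ n≡e → p (trans (sym e≡) (cong +_ (sym n≡e)))))

open Coefficients

-- Passage from integer series to the rational formulas.

import Data.Integer.Solver as ℤ-Solver
import Data.Rational.Properties as ℚₚ
import Data.Rational.Solver as ℚ-Solver
import Data.Rational.Unnormalised.Properties as ℚᵘₚ
open import Data.Nat using (_≤_)
open import Data.Fin.Patterns
open import Data.Vec using (lookup)
open import Data.Rational as ℚ using (ℚ; _+_; _-_; _*_; _/_; toℚᵘ)
open import Data.Rational.Unnormalised as ℚᵘ using (mkℚᵘ; *≡*)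

-- Syntax for linear combinations, interpreted in series, integers and rationals. One induction then
-- carries a series identity to its coefficients and on to ℚ; each term must mirror the shape of the
-- identity it interprets.
data Lin (m : ℕ) : Set where
  var     : Fin m → Lin m
  _⊞_ _⊟_ : Lin m → Lin m → Lin m
  _⊡_     : ℤ → Lin m → Lin m

infixl 6 _⊞_ _⊟_
infixr 7 _⊡_

⟦_⟧ₛ : ∀ {m} → Lin m → (Fin m → PS) → PS
⟦ var i ⟧ₛ ρ = ρ i
⟦ a ⊞ b ⟧ₛ ρ = ⟦ a ⟧ₛ ρ ⊕ ⟦ b ⟧ₛ ρ
⟦ a ⊟ b ⟧ₛ ρ = ⟦ a ⟧ₛ ρ ⊖ ⟦ b ⟧ₛ ρ
⟦ c ⊡ a ⟧ₛ ρ = κ c · ⟦ a ⟧ₛ ρ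

⟦_⟧ᵢ : ∀ {m} → Lin m → (Fin m → ℤ) → ℤ
⟦ var i ⟧ᵢ ρ = ρ i
⟦ a ⊞ b ⟧ᵢ ρ = ⟦ a ⟧ᵢ ρ ℤ.+ ⟦ b ⟧ᵢ ρ
⟦ a ⊟ b ⟧ᵢ ρ = ⟦ a ⟧ᵢ ρ ℤ.- ⟦ b ⟧ᵢ ρ
⟦ c ⊡ a ⟧ᵢ ρ = c ℤ.* ⟦ a ⟧ᵢ ρ

⟦_⟧ᵣ : ∀ {m} → Lin m → (Fin m → ℚ) → ℚ
⟦ var i ⟧ᵣ ρ = ρ i
⟦ a ⊞ b ⟧ᵣ ρ = ⟦ a ⟧ᵣ ρ ℚ.+ ⟦ b ⟧ᵣ ρ
⟦ a ⊟ b ⟧ᵣ ρ = ⟦ a ⟧ᵣ ρ ℚ.- ⟦ b ⟧ᵣ ρ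
⟦ c ⊡ a ⟧ᵣ ρ = ⟦ c ⟧ ℚ.* ⟦ a ⟧ᵣ ρ

Lin-at : ∀ {m} (a : Lin m) (ρ : Fin m → PS) n → ⟦ a ⟧ₛ ρ ! n ≡ ⟦ a ⟧ᵢ (λ i → ρ i ! n)
Lin-at (var i) ρ n = refl
Lin-at (a ⊞ b) ρ n = cong₂ ℤ._+_ (Lin-at a ρ n) (Lin-at b ρ n)
Lin-at (a ⊟ b) ρ n = cong₂ ℤ._-_ (Lin-at a ρ n) (Lin-at b ρ n)
Lin-at (c ⊡ a) ρ n = trans (κ-·-at c (⟦ a ⟧ₛ ρ) n) (cong (c ℤ.*_) (Lin-at a ρ n))

-- `⟦ z ⟧` is normalized through a gcd and does not compute for a variable z, so the homomorphism
-- laws are proved on unnormalised fractions.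
toℚᵘ-⟦⟧ : ∀ z → toℚᵘ ⟦ z ⟧ ℚᵘ.≃ mkℚᵘ z 0
toℚᵘ-⟦⟧ z = ℚₚ.toℚᵘ-fromℚᵘ (mkℚᵘ z 0)

⟦⟧-+ : ∀ a b → ⟦ a ℤ.+ b ⟧ ≡ ⟦ a ⟧ ℚ.+ ⟦ b ⟧
⟦⟧-+ a b = ℚₚ.toℚᵘ-injective (ℚᵘₚ.≃-trans (toℚᵘ-⟦⟧ (a ℤ.+ b)) (ℚᵘₚ.≃-trans
    (*≡* (solve 2 (λ a b → (a :+ b) :* con (+ 1) := (a :* con (+ 1) :+ b :* con (+ 1)) :* con (+ 1)) refl a b))
  (ℚᵘₚ.≃-sym (ℚᵘₚ.≃-trans (ℚₚ.toℚᵘ-homo-+ ⟦ a ⟧ ⟦ b ⟧) (ℚᵘₚ.+-cong (toℚᵘ-⟦⟧ a) (toℚᵘ-⟦⟧ b))))))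
  where open ℤ-Solver.+-*-Solver using (solve; _:=_; _:+_; _:*_; con)

⟦⟧-* : ∀ a b → ⟦ a ℤ.* b ⟧ ≡ ⟦ a ⟧ ℚ.* ⟦ b ⟧
⟦⟧-* a b = ℚₚ.toℚᵘ-injective (ℚᵘₚ.≃-trans (toℚᵘ-⟦⟧ (a ℤ.* b)) (ℚᵘₚ.≃-sym
    (ℚᵘₚ.≃-trans (ℚₚ.toℚᵘ-homo-* ⟦ a ⟧ ⟦ b ⟧) (ℚᵘₚ.*-cong (toℚᵘ-⟦⟧ a) (toℚᵘ-⟦⟧ b)))))

⟦⟧-neg : ∀ a → ⟦ ℤ.- a ⟧ ≡ ℚ.- ⟦ a ⟧
⟦⟧-neg a = ℚₚ.toℚᵘ-injective (ℚᵘₚ.≃-trans (toℚᵘ-⟦⟧ (ℤ.- a)) (ℚᵘₚ.≃-sym (ℚᵘₚ.≃-trans (ℚₚ.toℚᵘ-homo‿- ⟦ a ⟧) (ℚᵘₚ.-‿cong (toℚᵘ-⟦⟧ a)))))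

Lin-ℚ : ∀ {m} (a : Lin m) (ρ : Fin m → ℤ) → ⟦ ⟦ a ⟧ᵢ ρ ⟧ ≡ ⟦ a ⟧ᵣ (⟦_⟧ ∘ ρ)
Lin-ℚ (var i) ρ = refl
Lin-ℚ (a ⊞ b) ρ = trans (⟦⟧-+ (⟦ a ⟧ᵢ ρ) (⟦ b ⟧ᵢ ρ)) (cong₂ ℚ._+_ (Lin-ℚ a ρ) (Lin-ℚ b ρ))
Lin-ℚ (a ⊟ b) ρ = trans (⟦⟧-+ (⟦ a ⟧ᵢ ρ) (ℤ.- ⟦ b ⟧ᵢ ρ)) (cong₂ ℚ._+_ (Lin-ℚ a ρ) (trans (⟦⟧-neg (⟦ b ⟧ᵢ ρ)) (cong ℚ.-_ (Lin-ℚ b ρ))))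
Lin-ℚ (c ⊡ a) ρ = trans (⟦⟧-* c (⟦ a ⟧ᵢ ρ)) (cong (⟦ c ⟧ ℚ.*_) (Lin-ℚ a ρ))

N-ℚ : ∀ {m} (a : Lin m) (ρ : Fin m → PS) n {x : ℕ} {f : PS} → + x ≡ f ! n → f ≈ ⟦ a ⟧ₛ ρ → ⟦ x ⟧ₙ ≡ ⟦ a ⟧ᵣ (λ i → ⟦ ρ i ! n ⟧)
N-ℚ a ρ n x≡ f≈ = trans (cong ⟦_⟧ (trans x≡ (trans (at f≈ n) (Lin-at a ρ n)))) (Lin-ℚ a (λ i → ρ i ! n))

-- Four of the formulas have half-integral coefficients; their series identities are stated after
-- doubling, and the factor 1/2 is restored here.
N-ℚ-half : ∀ {m} (a : Lin m) (ρ : Fin m → PS) n {x : ℕ} {f : PS} → + x ≡ f ! n → κ (+ 2) · f ≈ ⟦ a ⟧ₛ ρ → ⟦ x ⟧ₙ ≡ (+ 1 / 2) ℚ.* ⟦ a ⟧ᵣ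
    (λ i → ⟦ ρ i ! n ⟧)
N-ℚ-half a ρ n {x} {f} x≡ f≈ = trans (solve 1 (λ x → x := con (+ 1 / 2) :* (con (+ 2 / 1) :* x)) refl ⟦ x ⟧ₙ)
  (cong ((+ 1 / 2) ℚ.*_) (trans (sym (⟦⟧-* (+ 2) (+ x))) (trans (cong ⟦_⟧
      (trans (cong (+ 2 ℤ.*_) x≡) (trans (sym (κ-·-at (+ 2) f n)) (trans (at f≈ n) (Lin-at a ρ n))))) (Lin-ℚ a (λ i → ρ i ! n)))))
  where open ℚ-Solver.+-*-Solver using (solve; _:=_; _:*_; con)

𝔟₁ 𝔟₂ : PS
PS.coe 𝔟₁ = b₁
PS.coe 𝔟₂ = b₂

B₁≈𝔟₁ : q · q · q · B₁ ≈ 𝔟₁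
B₁≈𝔟₁ = pointwise b₁-series

B₂≈𝔟₂ : q · B₂ ≈ 𝔟₂
B₂≈𝔟₂ = pointwise b₂-series

-- The constant c is 1 for the undoubled identities and 2 for the doubled ones.
atoms : ℤ → Vec PS 11
atoms c = κ c ∷ E ∷ dil 2 E ∷ dil 4 E ∷ dil 8 E ∷ F ∷ dil 2 F ∷ dil 4 F ∷ dil 8 F ∷ 𝔟₁ ∷ 𝔟₂ ∷ []

c₀ e₁′ e₂′ e₄′ e₈′ f₁′ f₂′ f₄′ f₈′ b₁′ b₂′ : Lin 11
c₀  = var 0F
e₁′ = var 1F
e₂′ = var 2F
e₄′ = var 3F
e₈′ = var 4F
f₁′ = var 5F
f₂′ = var 6F
f₄′ = var 7F
f₈′ = var 8F
b₁′ = var 9F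
b₂′ = var (Fin.suc 9F)

d₁ : dil 1 φ ≈ φ
d₁ = dil-identity φ

theorem3p2 : (n : ℕ) → 1 ≤ n →
      (⟦ N 1 1 1 5 n ⟧ₙ ≡
         ⟦ σ χ₀ χ₁ n ⟧ - (+ 2 / 1) * ⟦ σ/ χ₀ χ₁ n 2 ⟧ - (+ 4 / 1) * ⟦ σ/ χ₀ χ₁ n 4 ⟧
         + (+ 5 / 1) * ⟦ σ χ₁ χ₀ n ⟧ + (+ 10 / 1) * ⟦ σ/ χ₁ χ₀ n 2 ⟧ - (+ 20 / 1) * ⟦ σ/ χ₁ χ₀ n 4 ⟧)
    × (⟦ N 1 1 2 10 n ⟧ₙ ≡
         (-[1+ 0 ] / 2) * ⟦ σ χ₀ χ₁ n ⟧ + (+ 1 / 2) * ⟦ σ/ χ₀ χ₁ n 2 ⟧ - ⟦ σ/ χ₀ χ₁ n 4 ⟧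
         - (+ 4 / 1) * ⟦ σ/ χ₀ χ₁ n 8 ⟧
         + (+ 5 / 2) * ⟦ σ χ₁ χ₀ n ⟧ + (+ 5 / 2) * ⟦ σ/ χ₁ χ₀ n 2 ⟧ + (+ 5 / 1) * ⟦ σ/ χ₁ χ₀ n 4 ⟧
         - (+ 20 / 1) * ⟦ σ/ χ₁ χ₀ n 8 ⟧ + (+ 2 / 1) * ⟦ b₂ n ⟧)
    × (⟦ N 1 2 2 5 n ⟧ₙ ≡
         (+ 1 / 2) * ⟦ σ χ₀ χ₁ n ⟧ - (+ 1 / 2) * ⟦ σ/ χ₀ χ₁ n 2 ⟧ - ⟦ σ/ χ₀ χ₁ n 4 ⟧
         - (+ 4 / 1) * ⟦ σ/ χ₀ χ₁ n 8 ⟧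
         + (+ 5 / 2) * ⟦ σ χ₁ χ₀ n ⟧ + (+ 5 / 2) * ⟦ σ/ χ₁ χ₀ n 2 ⟧ - (+ 5 / 1) * ⟦ σ/ χ₁ χ₀ n 4 ⟧
         + (+ 20 / 1) * ⟦ σ/ χ₁ χ₀ n 8 ⟧ + (+ 5 / 1) * ⟦ b₁ n ⟧ - ⟦ b₂ n ⟧)
    × (⟦ N 1 5 5 5 n ⟧ₙ ≡
         ⟦ σ χ₀ χ₁ n ⟧ - (+ 2 / 1) * ⟦ σ/ χ₀ χ₁ n 2 ⟧ - (+ 4 / 1) * ⟦ σ/ χ₀ χ₁ n 4 ⟧
         + ⟦ σ χ₁ χ₀ n ⟧ + (+ 2 / 1) * ⟦ σ/ χ₁ χ₀ n 2 ⟧ - (+ 4 / 1) * ⟦ σ/ χ₁ χ₀ n 4 ⟧)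
    × (⟦ N 1 5 10 10 n ⟧ₙ ≡
         (+ 1 / 2) * ⟦ σ χ₀ χ₁ n ⟧ - (+ 1 / 2) * ⟦ σ/ χ₀ χ₁ n 2 ⟧ - ⟦ σ/ χ₀ χ₁ n 4 ⟧
         - (+ 4 / 1) * ⟦ σ/ χ₀ χ₁ n 8 ⟧
         + (+ 1 / 2) * ⟦ σ χ₁ χ₀ n ⟧ + (+ 1 / 2) * ⟦ σ/ χ₁ χ₀ n 2 ⟧ - ⟦ σ/ χ₁ χ₀ n 4 ⟧
         + (+ 4 / 1) * ⟦ σ/ χ₁ χ₀ n 8 ⟧ - ⟦ b₁ n ⟧ + ⟦ b₂ n ⟧)
    × (⟦ N 2 5 5 10 n ⟧ₙ ≡
         (-[1+ 0 ] / 2) * ⟦ σ χ₀ χ₁ n ⟧ + (+ 1 / 2) * ⟦ σ/ χ₀ χ₁ n 2 ⟧ - ⟦ σ/ χ₀ χ₁ n 4 ⟧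
         - (+ 4 / 1) * ⟦ σ/ χ₀ χ₁ n 8 ⟧
         + (+ 1 / 2) * ⟦ σ χ₁ χ₀ n ⟧ + (+ 1 / 2) * ⟦ σ/ χ₁ χ₀ n 2 ⟧ + ⟦ σ/ χ₁ χ₀ n 4 ⟧
         - (+ 4 / 1) * ⟦ σ/ χ₁ χ₀ n 8 ⟧ - (+ 2 / 1) * ⟦ b₁ n ⟧)
-- Matching on `suc` makes the coefficient of `κ c` compute to 0, which is the summand
-- `con (+ 0 / 1)` below. At n = 0 the constant term would count the zero vector.
theorem3p2 n@(suc _) _ = N₁₁₁₅-ℚ , N₁₁₂₁₀-ℚ , N₁₂₂₅-ℚ , N₁₅₅₅-ℚ , N₁₅₁₀₁₀-ℚ , N₂₅₅₁₀-ℚ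
  where
    open ℚ-Solver.+-*-Solver using (solve; _:=_; _:+_; _:-_; _:*_; con)
    N₁₁₁₅-ℚ = trans (N-ℚ (c₀ ⊞ e₁′ ⊟ (+ 2) ⊡ e₂′ ⊟ (+ 4) ⊡ e₄′ ⊞ (+ 5) ⊡ f₁′ ⊞ (+ 10) ⊡ f₂′ ⊟ (+ 20) ⊡ f₄′) (lookup (atoms (+ 1))) n
        (N-series 1 1 1 5 n)
        (≈-trans (·-cong d₁ (·-cong d₁ (·-cong d₁ ≈-refl))) N₁₁₁₅))
      (solve 6 (λ e1 e2 e4 f1 f2 f4 → con (+ 0 / 1) :+ e1 :- con (+ 2 / 1) :* e2 :- con (+ 4 / 1) :* e4 :+ con (+ 5 / 1) :* f1 :+ con
          (+ 10 / 1) :* f2 :- con (+ 20 / 1) :* f4 := e1 :- con (+ 2 / 1) :* e2 :- con (+ 4 / 1) :* e4 :+ con (+ 5 / 1) :* f1 :+ con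
          (+ 10 / 1) :* f2 :- con (+ 20 / 1) :* f4) refl ⟦ σ χ₀ χ₁ n ⟧ ⟦ σ/ χ₀ χ₁ n 2 ⟧ ⟦ σ/ χ₀ χ₁ n 4 ⟧ ⟦ σ χ₁ χ₀ n ⟧ ⟦ σ/ χ₁ χ₀ n 2 ⟧ ⟦
          σ/ χ₁ χ₀ n 4 ⟧)
    N₁₁₂₁₀-ℚ = trans (N-ℚ-half (c₀ ⊟ e₁′ ⊞ e₂′ ⊟ (+ 2) ⊡ e₄′ ⊟ (+ 8) ⊡ e₈′ ⊞ (+ 5) ⊡ f₁′ ⊞ (+ 5) ⊡ f₂′ ⊞ (+ 10) ⊡ f₄′ ⊟ (+ 40) ⊡ f₈′ ⊞
        (+ 4) ⊡ b₂′) (lookup (atoms (+ 2))) n (N-series 1 1 2 10 n)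
        (≈-trans (·-cong ≈-refl (·-cong d₁ (·-cong d₁ ≈-refl))) (≈-trans N₁₁₂₁₀ (⊕-cong ≈-refl (·-cong ≈-refl B₂≈𝔟₂)))))
      (solve 9 (λ e1 e2 e4 e8 f1 f2 f4 f8 b2 → con (+ 1 / 2) :* (con (+ 0 / 1) :- e1 :+ e2 :- con (+ 2 / 1) :* e4 :- con (+ 8 / 1) :* e8 :+
          con (+ 5 / 1) :* f1 :+ con (+ 5 / 1) :* f2 :+ con (+ 10 / 1) :* f4 :- con (+ 40 / 1) :* f8 :+ con (+ 4 / 1) :* b2) := con
          (-[1+ 0 ] / 2) :* e1 :+ con (+ 1 / 2) :* e2 :- e4 :- con (+ 4 / 1) :* e8 :+ con (+ 5 / 2) :* f1 :+ con (+ 5 / 2) :* f2 :+ con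
          (+ 5 / 1) :* f4 :- con (+ 20 / 1) :* f8 :+ con (+ 2 / 1) :* b2) refl ⟦ σ χ₀ χ₁ n ⟧ ⟦ σ/ χ₀ χ₁ n 2 ⟧ ⟦ σ/ χ₀ χ₁ n 4 ⟧ ⟦ σ/ χ₀ χ₁ n
          8 ⟧ ⟦ σ χ₁ χ₀ n ⟧ ⟦ σ/ χ₁ χ₀ n 2 ⟧ ⟦ σ/ χ₁ χ₀ n 4 ⟧ ⟦ σ/ χ₁ χ₀ n 8 ⟧ ⟦ b₂ n ⟧)
    N₁₂₂₅-ℚ = trans (N-ℚ-half (c₀ ⊞ e₁′ ⊟ e₂′ ⊟ (+ 2) ⊡ e₄′ ⊟ (+ 8) ⊡ e₈′ ⊞ (+ 5) ⊡ f₁′ ⊞ (+ 5) ⊡ f₂′ ⊟ (+ 10) ⊡ f₄′ ⊞ (+ 40) ⊡ f₈′ ⊞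
        (+ 10) ⊡ b₁′ ⊟ (+ 2) ⊡ b₂′) (lookup (atoms (+ 2))) n (N-series 1 2 2 5 n)
        (≈-trans (·-cong ≈-refl (·-cong d₁ ≈-refl)) (≈-trans N₁₂₂₅ (⊖-cong (⊕-cong ≈-refl (·-cong ≈-refl B₁≈𝔟₁)) (·-cong ≈-refl B₂≈𝔟₂)))))
      (solve 10 (λ e1 e2 e4 e8 f1 f2 f4 f8 b1 b2 → con (+ 1 / 2) :*
          (con (+ 0 / 1) :+ e1 :- e2 :- con (+ 2 / 1) :* e4 :- con (+ 8 / 1) :* e8 :+ con (+ 5 / 1) :* f1 :+ con (+ 5 / 1) :* f2 :- con
          (+ 10 / 1) :* f4 :+ con (+ 40 / 1) :* f8 :+ con (+ 10 / 1) :* b1 :- con (+ 2 / 1) :* b2) := con (+ 1 / 2) :* e1 :- con (+ 1 / 2)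
          :* e2 :- e4 :- con (+ 4 / 1) :* e8 :+ con (+ 5 / 2) :* f1 :+ con (+ 5 / 2) :* f2 :- con (+ 5 / 1) :* f4 :+ con (+ 20 / 1) :* f8
          :+ con (+ 5 / 1) :* b1 :- b2) refl ⟦ σ χ₀ χ₁ n ⟧ ⟦ σ/ χ₀ χ₁ n 2 ⟧ ⟦ σ/ χ₀ χ₁ n 4 ⟧ ⟦ σ/ χ₀ χ₁ n 8 ⟧ ⟦ σ χ₁ χ₀ n ⟧ ⟦ σ/ χ₁ χ₀ n 2
          ⟧ ⟦ σ/ χ₁ χ₀ n 4 ⟧ ⟦ σ/ χ₁ χ₀ n 8 ⟧ ⟦ b₁ n ⟧ ⟦ b₂ n ⟧)
    N₁₅₅₅-ℚ = trans (N-ℚ (c₀ ⊞ e₁′ ⊟ (+ 2) ⊡ e₂′ ⊟ (+ 4) ⊡ e₄′ ⊞ f₁′ ⊞ (+ 2) ⊡ f₂′ ⊟ (+ 4) ⊡ f₄′) (lookup (atoms (+ 1))) n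
        (N-series 1 5 5 5 n)
        (≈-trans (·-cong d₁ ≈-refl) N₁₅₅₅))
      (solve 6 (λ e1 e2 e4 f1 f2 f4 → con (+ 0 / 1) :+ e1 :- con (+ 2 / 1) :* e2 :- con (+ 4 / 1) :* e4 :+ f1 :+ con (+ 2 / 1) :* f2 :- con
          (+ 4 / 1) :* f4 := e1 :- con (+ 2 / 1) :* e2 :- con (+ 4 / 1) :* e4 :+ f1 :+ con (+ 2 / 1) :* f2 :- con (+ 4 / 1) :* f4) refl ⟦ σ
          χ₀ χ₁ n ⟧ ⟦ σ/ χ₀ χ₁ n 2 ⟧ ⟦ σ/ χ₀ χ₁ n 4 ⟧ ⟦ σ χ₁ χ₀ n ⟧ ⟦ σ/ χ₁ χ₀ n 2 ⟧ ⟦ σ/ χ₁ χ₀ n 4 ⟧)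
    N₁₅₁₀₁₀-ℚ = trans (N-ℚ-half (c₀ ⊞ e₁′ ⊟ e₂′ ⊟ (+ 2) ⊡ e₄′ ⊟ (+ 8) ⊡ e₈′ ⊞ f₁′ ⊞ f₂′ ⊟ (+ 2) ⊡ f₄′ ⊞ (+ 8) ⊡ f₈′ ⊟ (+ 2) ⊡ b₁′ ⊞ (+ 2) ⊡
        b₂′) (lookup (atoms (+ 2))) n (N-series 1 5 10 10 n)
        (≈-trans (·-cong ≈-refl (·-cong d₁ ≈-refl)) (≈-trans N₁₅₁₀₁₀ (⊕-cong (⊖-cong ≈-refl (·-cong ≈-refl B₁≈𝔟₁)) (·-cong ≈-refl B₂≈𝔟₂)))))
      (solve 10 (λ e1 e2 e4 e8 f1 f2 f4 f8 b1 b2 → con (+ 1 / 2) :*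
          (con (+ 0 / 1) :+ e1 :- e2 :- con (+ 2 / 1) :* e4 :- con (+ 8 / 1) :* e8 :+ f1 :+ f2 :- con (+ 2 / 1) :* f4 :+ con (+ 8 / 1) :*
          f8 :- con (+ 2 / 1) :* b1 :+ con (+ 2 / 1) :* b2) := con (+ 1 / 2) :* e1 :- con (+ 1 / 2) :* e2 :- e4 :- con (+ 4 / 1) :* e8 :+
          con (+ 1 / 2) :* f1 :+ con (+ 1 / 2) :* f2 :- f4 :+ con (+ 4 / 1) :* f8 :- b1 :+ b2) refl ⟦ σ χ₀ χ₁ n ⟧ ⟦ σ/ χ₀ χ₁ n 2 ⟧ ⟦ σ/ χ₀
          χ₁ n 4 ⟧ ⟦ σ/ χ₀ χ₁ n 8 ⟧ ⟦ σ χ₁ χ₀ n ⟧ ⟦ σ/ χ₁ χ₀ n 2 ⟧ ⟦ σ/ χ₁ χ₀ n 4 ⟧ ⟦ σ/ χ₁ χ₀ n 8 ⟧ ⟦ b₁ n ⟧ ⟦ b₂ n ⟧)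
    N₂₅₅₁₀-ℚ = trans (N-ℚ-half (c₀ ⊟ e₁′ ⊞ e₂′ ⊟ (+ 2) ⊡ e₄′ ⊟ (+ 8) ⊡ e₈′ ⊞ f₁′ ⊞ f₂′ ⊞ (+ 2) ⊡ f₄′ ⊟ (+ 8) ⊡ f₈′ ⊟ (+ 4) ⊡ b₁′)
        (lookup (atoms (+ 2))) n (N-series 2 5 5 10 n)
        (≈-trans (·-cong ≈-refl (≈-refl)) (≈-trans N₂₅₅₁₀ (⊖-cong ≈-refl (·-cong ≈-refl B₁≈𝔟₁)))))
      (solve 9 (λ e1 e2 e4 e8 f1 f2 f4 f8 b1 → con (+ 1 / 2) :* (con (+ 0 / 1) :- e1 :+ e2 :- con (+ 2 / 1) :* e4 :- con (+ 8 / 1) :* e8 :+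
          f1 :+ f2 :+ con (+ 2 / 1) :* f4 :- con (+ 8 / 1) :* f8 :- con (+ 4 / 1) :* b1) := con (-[1+ 0 ] / 2) :* e1 :+ con (+ 1 / 2) :* e2
          :- e4 :- con (+ 4 / 1) :* e8 :+ con (+ 1 / 2) :* f1 :+ con (+ 1 / 2) :* f2 :+ f4 :- con (+ 4 / 1) :* f8 :- con (+ 2 / 1) :* b1)
          refl ⟦ σ χ₀ χ₁ n ⟧ ⟦ σ/ χ₀ χ₁ n 2 ⟧ ⟦ σ/ χ₀ χ₁ n 4 ⟧ ⟦ σ/ χ₀ χ₁ n 8 ⟧ ⟦ σ χ₁ χ₀ n ⟧ ⟦ σ/ χ₁ χ₀ n 2 ⟧ ⟦ σ/ χ₁ χ₀ n 4 ⟧ ⟦ σ/ χ₁ χ₀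
          n 8 ⟧ ⟦ b₁ n ⟧)
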